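{- The decision problems $\mathsf{TRANS\text{ - }ST}$ and $\mathsf{GEN\text{ - }ST}$ are both $\mathsf{NP}$-complete.
   Context: A polyomino is a region of $\mathbb{R}^2$ made of unit squares joined along coincident edges, considered up to translation. $R_{n\times m}$ denotes the rectangular region of height $n$ ($n$ rows) and width $m$ ($m$ columns). A tiling of $R_{n\times m}$ by a multiset $T$ of polyominoes is a placement of translates of all elements of $T$ in $R_{n\times m}$ covering every point of $R_{n\times m}$, with no two different elements having two-dimensional overlap. A rearrangement of a tiling by $T$ is any tiling of $R_{n\times m}$ by the same multiset $T$. A rearrangement with rotations is any tiling of $R_{n\times m}$ by a multiset $T'$ obtained from $T$ by replacing any of its elements by rotated copies (each copy rotated independently). A tiling of $R_{n\times m}$ admits a subtiling (respectively, a subtiling allowing rotations) if it has a rearrangement (respectively, a rearrangement with rotations) which is the side-by-side juxtaposition of a tiling of $R_{n\times m'}$ and a tiling of $R_{n\times m''}$ with $m=m'+m''$ and $m',m''\neq 0$. Input for both problems: a tiling of a rectangle $R_{n\times m}$, for some $n$ and $m$, by rectangular polyominoes. Each polyomino in the tiling is given as an ordered pair of binary numbers $(h,w)$ (height and width), together with an ordered pair of binary numbers specifying the unit square of $R_{n\times m}$ occupied by its bottom-left corner, where $(0,0)$ is the bottom-left unit square of $R_{n\times m}$. $\mathsf{TRANS\text{ - }ST}$: decide whether the given tiling admits a subtiling (only translations of the tiles allowed). $\mathsf{GEN\text{ - }ST}$: decide whether the given tiling admits a subtiling allowing rotations. -}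

module Defs where

open import Data.Bool using (Bool; true; false)
open import Data.Digit using (Bit; 0b; 1b)
open import Data.Fin using (Fin; zero; suc; inject₁; inject≤; fromℕ; _↑ˡ_; _↑ʳ_)
open import Data.List using (List; []; _∷_; _++_; map; length; concatMap)
open import Data.List.Relation.Binary.Permutation.Propositional using (_↭_)
open import Data.List.Relation.Binary.Pointwise using (Pointwise)
open import Data.List.Relation.Unary.All using (All)
open import Data.List.Relation.Unary.AllPairs using (AllPairs)
open import Data.List.Relation.Unary.Any using (Any)
open import Data.Maybe using (Maybe; just; nothing)
open import Data.Nat using (ℕ; zero; suc; _+_; _*_; _≤_; _<_)
open import Data.Nat.GeneralisedArithmetic using (iterate)
open import Data.Product using (Σ; ∃; ∃-syntax; _×_; _,_)
open import Data.Sum using (_⊎_)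
open import Data.Vec as Vec using (Vec)
open import Function using (_⇔_)
open import Relation.Binary.PropositionalEquality using (_≡_)
open import Relation.Nullary using (¬_)

------------------------------------------------------------------------
-- Languages and polynomials

-- The alphabet with a letters is Fin a.

Word : ℕ → Set
Word a = List (Fin a)

Language : ℕ → Set₁
Language a = Word a → Set

-- Coefficient list, constant term first.

Polynomial : Set
Polynomial = List ℕ

eval : Polynomial → ℕ → ℕ
eval []      n = 0
eval (c ∷ p) n = c + n * eval p n

------------------------------------------------------------------------
-- Deterministic multi-tape Turing machines

-- A tape cell; nothing is the blank.

Cell : ℕ → Set
Cell γ = Maybe (Fin γ)

-- A two-way infinite tape: all cells beyond the two lists are blank, and both
-- lists start with the cell nearest to the head.

record Tape (γ : ℕ) : Set where
  constructor tape
  field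
    before : List (Cell γ)
    focus  : Cell γ
    after  : List (Cell γ)

data Move : Set where
  left stay right : Move

blankTape : ∀ {γ} → Tape γ
blankTape = tape [] nothing []

-- The head is on the first letter of the word.

loadTape : ∀ {γ} → Word γ → Tape γ
loadTape []      = blankTape
loadTape (s ∷ w) = tape [] (just s) (map just w)

move : ∀ {γ} → Move → Tape γ → Tape γ
move left  (tape []      c r)       = tape [] nothing (c ∷ r)
move left  (tape (b ∷ l) c r)       = tape l b (c ∷ r)
move stay  t                        = t
move right (tape l       c [])      = tape (c ∷ l) nothing []
move right (tape l       c (b ∷ r)) = tape (c ∷ l) b r

writeMove : ∀ {γ} → Cell γ × Move → Tape γ → Tape γ
writeMove (c , d) t = move d (record t { focus = c })

untilBlank : ∀ {γ} → List (Cell γ) → Word γ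
untilBlank []             = []
untilBlank (nothing ∷ cs) = []
untilBlank (just s ∷ cs)  = s ∷ untilBlank cs

-- The word from the head rightwards up to the first blank.

readTape : ∀ {γ} → Tape γ → Word γ
readTape (tape _ c r) = untilBlank (c ∷ r)

-- The Boolean is the verdict on halting: true is acceptance.

data Control (q : ℕ) : Set where
  running : Fin q → Control q
  halted  : Bool → Control q

record Config (q γ tapeCount : ℕ) : Set where
  constructor config
  field
    control : Control q
    tapes   : Vec (Tape γ) tapeCount

-- A machine reading words over Fin a and writing words over Fin b. Both
-- alphabets are initial segments of its tape alphabet Fin γ (plus blank).
-- There are suc k tapes.

record TM (a b : ℕ) : Set where
  field
    k γ q : ℕ
    a≤γ   : a ≤ γ
    b≤γ   : b ≤ γ
    start : Fin q
    δ     : Fin q → Vec (Cell γ) (suc k) →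
            Control q × Vec (Cell γ × Move) (suc k)

  step : Config q γ (suc k) → Config q γ (suc k)
  step (config (halted v)  ts) = config (halted v) ts
  step (config (running s) ts) with δ s (Vec.map Tape.focus ts)
  ... | c , acts = config c (Vec.zipWith writeMove acts ts)

  -- The input is on the first tape; the other tapes are blank.

  initial : Word a → Config q γ (suc k)
  initial x = config (running start)
    (loadTape (map (λ s → inject≤ s a≤γ) x) Vec.∷ Vec.replicate k blankTape)

  -- Halted configurations are fixed by step, so "halted after t steps" means
  -- "halts within t steps".

  runFor : ℕ → Word a → Config q γ (suc k)
  runFor t x = iterate step (initial x) t

  HaltsWith : Bool → Config q γ (suc k) → Set
  HaltsWith v c = Config.control c ≡ halted v

  -- The output is on the last tape.

  Outputs : Word b → Config q γ (suc k) → Set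
  Outputs y c =
    readTape (Vec.last (Config.tapes c)) ≡ map (λ s → inject≤ s b≤γ) y

------------------------------------------------------------------------
-- Polynomial time, NP, NP-completeness

PolyTimeComputable : ∀ {a b} → (Word a → Word b) → Set
PolyTimeComputable {a} {b} f =
  Σ (TM a b) λ M → let open TM M in
  ∃[ p ] (∀ x → let c = runFor (eval p (length x)) x in
                (∃[ v ] HaltsWith v c) × Outputs (f x) c)

-- A decider's output tape is irrelevant, hence the empty output alphabet.

P : ∀ {a} → Language a → Set
P {a} L =
  Σ (TM a 0) λ M → let open TM M in
  ∃[ p ] (∀ x → let c = runFor (eval p (length x)) x in
                (HaltsWith true c × L x) ⊎ (HaltsWith false c × ¬ L x))

-- The word x # y, with separate copies of the alphabets of x and y.

pair : ∀ {a c} → Word a → Word c → Word (suc (a + c))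
pair {a} {c} x y =
  map (λ s → suc (s ↑ˡ c)) x ++ zero ∷ map (λ s → suc (a ↑ʳ s)) y

-- Polynomial-time verifiable membership with polynomially bounded
-- certificates, over any finite certificate alphabet.

NP : ∀ {a} → Language a → Set₁
NP {a} L =
  ∃[ c ] Σ (Language (suc (a + c))) λ V → P V × ∃[ p ] (∀ x →
    L x ⇔ (∃[ y ] length y ≤ eval p (length x) × V (pair {a} {c} x y)))

_≤ₚ_ : ∀ {a b} → Language a → Language b → Set
L ≤ₚ L′ = ∃[ f ] PolyTimeComputable f × (∀ x → L x ⇔ L′ (f x))

NPHard : ∀ {a} → Language a → Set₁
NPHard L = ∀ {a} (L′ : Language a) → NP L′ → L′ ≤ₚ L

NPComplete : ∀ {a} → Language a → Set₁
NPComplete L = NP L × NPHard L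

------------------------------------------------------------------------
-- Tilings of rectangles by rectangular polyominoes

-- A rectangular polyomino up to translation.

record Shape : Set where
  constructor _by_
  field
    height width : ℕ

-- A placed polyomino; (row , col) is its bottom-left unit square, with rows
-- counted from the bottom and columns from the left, both from 0.

record Tile : Set where
  constructor _at_,_
  field
    shape   : Shape
    row col : ℕ
  open Shape shape public

Covers : ℕ → ℕ → Tile → Set
Covers r c t = (row ≤ r × r < row + height) × (col ≤ c × c < col + width)
  where open Tile t

Disjoint : Tile → Tile → Set
Disjoint s t = ∀ r c → ¬ (Covers r c s × Covers r c t)

record InRectangle (n m : ℕ) (t : Tile) : Set where
  open Tile t
  field
    height>0 : 0 < height
    width>0  : 0 < width
    top      : row + height ≤ n
    side     : col + width ≤ m

record IsTiling (n m : ℕ) (ts : List Tile) : Set where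
  field
    inside   : All (InRectangle n m) ts
    covering : ∀ r c → r < n → c < m → Any (Covers r c) ts
    disjoint : AllPairs Disjoint ts

shapes : List Tile → List Shape
shapes = map Tile.shape

Rearrangement : ℕ → ℕ → List Tile → List Tile → Set
Rearrangement n m ts ss = IsTiling n m ss × shapes ss ↭ shapes ts

-- Rotations of a rectangle by a multiple of 90° either keep its shape or
-- exchange height and width.

data RotatedCopy : Shape → Shape → Set where
  unturned : ∀ {h w} → RotatedCopy (h by w) (h by w)
  turned   : ∀ {h w} → RotatedCopy (h by w) (w by h)

RearrangementWithRotations : ℕ → ℕ → List Tile → List Tile → Set
RearrangementWithRotations n m ts ss =
  IsTiling n m ss ×
  ∃[ T′ ] Pointwise RotatedCopy (shapes ts) T′ × shapes ss ↭ T′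

shiftRight : ℕ → Tile → Tile
shiftRight d (s at r , c) = s at r , (d + c)

-- A tiling is a set of placed tiles, so the order of the list is immaterial.

IsJuxtaposition : ℕ → ℕ → List Tile → Set
IsJuxtaposition n m ss =
  ∃[ m′ ] ∃[ m″ ] m ≡ m′ + m″ × 0 < m′ × 0 < m″ ×
  (∃[ as ] ∃[ bs ] IsTiling n m′ as × IsTiling n m″ bs ×
                   ss ↭ as ++ map (shiftRight m′) bs)

AdmitsSubtiling : ℕ → ℕ → List Tile → Set
AdmitsSubtiling n m ts =
  ∃[ ss ] Rearrangement n m ts ss × IsJuxtaposition n m ss

AdmitsSubtilingWithRotations : ℕ → ℕ → List Tile → Set
AdmitsSubtilingWithRotations n m ts =
  ∃[ ss ] RearrangementWithRotations n m ts ss × IsJuxtaposition n m ss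

------------------------------------------------------------------------
-- The decision problems

increment : List Bit → List Bit
increment []           = 1b ∷ []
increment (zero  ∷ ds) = 1b ∷ ds
increment (suc _ ∷ ds) = 0b ∷ increment ds

-- Least significant bit first, no superfluous zeros; 0 is the empty string.

binary : ℕ → List Bit
binary zero    = []
binary (suc n) = increment (binary n)

-- The letters are the two bits and a terminator ending each number.

encodeNumber : ℕ → Word 3
encodeNumber n = map inject₁ (binary n) ++ fromℕ 2 ∷ []

encodeTile : Tile → Word 3
encodeTile ((h by w) at r , c) = concatMap encodeNumber (h ∷ w ∷ r ∷ c ∷ [])

encode : List Tile → Word 3
encode = concatMap encodeTile

-- The yes-instances. Words that do not encode a tiling of some (nonempty)
-- rectangle are no-instances.

Problem : (ℕ → ℕ → List Tile → Set) → Language 3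
Problem Q x =
  ∃[ ts ] ∃[ n ] ∃[ m ]
    x ≡ encode ts × 0 < n × 0 < m × IsTiling n m ts × Q n m ts

TRANS-ST : Language 3
TRANS-ST = Problem AdmitsSubtiling

GEN-ST : Language 3
GEN-ST = Problem AdmitsSubtilingWithRotations

-- Membership in NP. A certificate lists the tiles with their places in the
-- given tiling and in the rearrangement, together with the dimensions of the
-- rectangle and the place of the cut. All numbers have polynomially many bits,
-- and a covering needs to be checked only at the cells whose row is the top,
-- and whose column is the side, of some tile.
--
-- Hardness. A machine that guesses a certificate and runs a verifier on it is
-- read as a queue automaton whose transitions are Wang tiles. A run with given
-- queues at both ends is a choice of numbers with a prescribed sum: suitable
-- digits of the sum make the colours of adjacent tiles agree. Finally, numbers
-- with sum A have a subset with sum T if and only if the following tiling of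
-- width 2 S, where S = A + T, admits a subtiling: two tiles of width S and of
-- height H > 2 S stand on a row of tiles of height 1 and widths A, 2 T and the
-- given numbers. The tall tiles cannot be turned; a side of a subtiling has
-- room for one of them and not enough area without them, so both sides have
-- width S; and the low tiles on the side of A are A and a subset with sum T.
-- So the same instances serve with and without rotations.
--
-- Both the reduction and the verifier are written in a language of safe
-- recursion and compiled to Turing machines.

{-# OPTIONS --safe #-}
module Submission where

open import Defs
open import Data.Bool using (Bool; true; false; if_then_else_; not)
open import Data.Digit using (Bit; 0b; 1b)
open import Data.Empty using (⊥; ⊥-elim)
open import Data.Fin as Fin using (Fin; zero; suc; toℕ; inject≤; inject₁; fromℕ; fromℕ<; _↑ˡ_; _↑ʳ_)
open import Data.Fin.Patterns using (0F; 1F; 2F; 3F; 4F; 5F; 6F; 7F; 8F)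
open import Data.List using (List; []; _∷_; _++_; map; length; concatMap; lookup; allFin; replicate;
  _ʳ++_; reverse; _∷ʳ_; foldl; foldr)
open import Data.Nat.ListAction using (sum)
open import Data.Nat.ListAction.Properties using (sum-++; sum-↭)
open import Data.List.Membership.Propositional using (_∈_; lose; find)
open import Data.List.Relation.Binary.Permutation.Propositional using (_↭_)
open import Data.List.Relation.Binary.Pointwise using (Pointwise; []; _∷_)
open import Data.List.Relation.Unary.All using (All; []; _∷_)
open import Data.List.Relation.Unary.AllPairs using (AllPairs; []; _∷_)
open import Data.List.Relation.Unary.Any using (Any; here; there)
open import Data.Maybe using (Maybe; just; nothing; maybe)
open import Data.Nat using (ℕ; zero; suc; _+_; _*_; _∸_; _^_; _≤_; _<_; z≤n; s≤s; s≤s⁻¹; _≟_; _≤?_;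
  _<?_; _⊔_; >-nonZero)
open import Data.Nat.GeneralisedArithmetic using (iterate)
open import Relation.Nullary.Decidable using (_×-dec_)
open import Data.Nat.Properties using (+-comm; +-assoc; +-identityʳ; +-suc; *-comm; *-assoc;
  *-zeroʳ; *-identityʳ; *-identityˡ; *-distribˡ-+; *-suc; ≤-refl; ≤-trans; ≤-reflexive; ≤-antisym;
  <-trans; <-≤-trans; ≤-<-trans; <-irrefl; <⇒≤; <⇒≢; <⇒≱; ≰⇒>; ≮⇒≥; n≤1+n; n<1+n; m≤m+n; m≤n+m;
  m<m+n; +-mono-≤; +-monoˡ-≤; +-monoʳ-≤; +-mono-<; +-monoˡ-<; +-monoʳ-<; *-mono-≤; *-monoˡ-≤;
  *-monoʳ-≤; +-cancelˡ-≡; +-cancelʳ-≡; +-cancelˡ-≤; +-cancelʳ-≤; *-cancelˡ-≡; m+[n∸m]≡n; m≤n⊔m;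
  m≤m⊔n; suc-injective; m≤n⇒∃[o]m+o≡n; ^-distribˡ-+-*; m^n>0; ≤∧≢⇒<; +-cancelˡ-<; m≤n⇒m≤1+n;
  *-monoʳ-<; *-cancelˡ-<; ⊔-lub)
open import Data.Nat.Tactic.RingSolver using (solve-∀)
open import Data.Product using (Σ; ∃-syntax; _×_; _,_; proj₁; proj₂; map₁)
open import Data.Sum using (_⊎_; inj₁; inj₂; [_,_]′)
open import Data.Unit using (⊤; tt)
open import Data.Vec as Vec using (Vec; []; _∷_; _[_]≔_)
open import Function using (_∘_; id; _⇔_; mk⇔; case_of_; Equivalence)
open import Relation.Binary.PropositionalEquality using (_≡_; _≢_; refl; sym; trans; cong; cong₂;
  subst; subst₂; module ≡-Reasoning; _≗_)
open import Relation.Nullary using (¬_; Dec; yes; no; contradiction)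
import Data.Fin.Properties as Finₚ
import Data.List.Properties as Listₚ
import Data.List.Membership.Propositional.Properties as ∈ₚ
import Data.List.Relation.Unary.Any as Any
import Data.List.Relation.Unary.All as All
import Data.List.Relation.Unary.All.Properties as Allₚ
import Data.List.Relation.Unary.Any.Properties as Anyₚ
import Data.List.Relation.Unary.AllPairs as AllPairs
import Data.List.Relation.Unary.AllPairs.Properties as AllPairsₚ
import Data.List.Relation.Binary.Permutation.Propositional as Perm
import Data.List.Relation.Binary.Permutation.Propositional.Properties as Permₚ
import Data.Vec.Properties as Vecₚ
import Data.Nat.Properties as ℕₚ
import Data.Nat.DivMod as DivMod

-- Hardness starts from the bare definition of NP, with no complete problem at hand. Coding a
-- computation directly into subset sums avoids the detour over satisfiability: in a tableau read
-- row by row, every colour is consumed 1 or N steps after its production, where N is the width. If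
-- the producer contributes the complement of the colour to the digit to which the consumer
-- contributes the colour, that digit sums to a constant exactly if they agree. The target has to be
-- computed from the input alone, although certificate and computation are unknown. So the unknown
-- is hidden between a first and a last row that are known: certificates are guessed within the
-- rows, idling fixes the number of rows, and everything is erased at the end. The other obstacle is
-- that reduction and verifier have to be actual Turing machines with a polynomial clock. In the
-- language used for both, the polynomial is read off the syntax. The price is that words built up
-- by a loop cannot be looped over inside it; programs consume them under a loop over some other
-- word that is long enough.

record Enum (A : Set) : Set where
  constructor enum
  field
    elems : List A
    mem   : ∀ x → x ∈ elems

  -- Repetitions in `elems` do no harm: `code` only has to be a section of `decode`.
  code : A → Fin (length elems)
  code x = Any.index (mem x)

  decode : Fin (length elems) → A
  decode = lookup elems

  decode-code : ∀ x → decode (code x) ≡ x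
  decode-code x = sym (Anyₚ.lookup-index (mem x))

  code-injective : ∀ {x y} → toℕ (code x) ≡ toℕ (code y) → x ≡ y
  code-injective {x} {y} eq = trans (sym (decode-code x))
    (trans (cong decode (Finₚ.toℕ-injective eq)) (decode-code y))

open Enum using (elems; mem) public

enum-⊤ : Enum ⊤
enum-⊤ = enum (tt ∷ []) (λ _ → here refl)

enum-Bool : Enum Bool
enum-Bool = enum (true ∷ false ∷ []) λ { true → here refl ; false → there (here refl) }

enum-Fin : ∀ n → Enum (Fin n)
enum-Fin n = enum (allFin n) ∈ₚ.∈-allFin

enum-Maybe : ∀ {A} → Enum A → Enum (Maybe A)
enum-Maybe (enum xs m) = enum (nothing ∷ map just xs)
  λ { nothing → here refl ; (just x) → there (∈ₚ.∈-map⁺ just (m x)) }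

enum-⊎ : ∀ {A B} → Enum A → Enum B → Enum (A ⊎ B)
enum-⊎ (enum xs m) (enum ys n) = enum (map inj₁ xs ++ map inj₂ ys) λ
  { (inj₁ x) → ∈ₚ.∈-++⁺ˡ (∈ₚ.∈-map⁺ inj₁ (m x))
  ; (inj₂ y) → ∈ₚ.∈-++⁺ʳ (map inj₁ xs) (∈ₚ.∈-map⁺ inj₂ (n y)) }

enum-Σ : ∀ {A} {B : A → Set} → Enum A → (∀ x → Enum (B x)) → Enum (Σ A B)
enum-Σ (enum xs m) e = enum (concatMap (λ x → map (x ,_) (elems (e x))) xs)
  λ { (x , y) → ∈ₚ.∈-concatMap⁺ (λ x → map (x ,_) (elems (e x)))
        (lose (m x) (∈ₚ.∈-map⁺ (x ,_) (mem (e x) y))) }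

enum-Vec : ∀ {A} n → Enum A → Enum (Vec A n)
enum-Vec zero    e = enum ([] ∷ []) λ { [] → here refl }
enum-Vec (suc n) e = enum (map (λ (x , v) → x ∷ v) (elems p))
  λ { (x ∷ v) → ∈ₚ.∈-map⁺ (λ (x , v) → x ∷ v) (mem p (x , v)) }
  where p = enum-Σ e (λ _ → enum-Vec n e)

-- Structured programs on stacks

-- The content of stack n when the stacks are listed with the highest index
-- first; stacks beyond the list are empty.

look : ∀ {γ} → List (Word γ) → ℕ → Word γ
look []      n = []
look (w ∷ L) n with n ≟ length L
... | yes _ = w
... | no _  = look L n

look-out : ∀ {γ} (L : List (Word γ)) {n} → length L ≤ n → look L n ≡ []
look-out []      le = refl
look-out (w ∷ L) {n} le with n ≟ length L
... | yes eq = ⊥-elim (<-irrefl (sym eq) le)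
... | no  _  = look-out L (<⇒≤ le)

-- This is how scratch stacks come and go: as long as they are empty, they may be listed or left out
-- of the description of a memory.
look-[] : ∀ {γ} (L : List (Word γ)) n → look ([] ∷ L) n ≡ look L n
look-[] L n with n ≟ length L
... | yes refl = sym (look-out L ≤-refl)
... | no _     = refl

length-mid : ∀ {A : Set} (xs : List A) {v w} L → length (xs ++ v ∷ L) ≡ length (xs ++ w ∷ L)
length-mid []       L = refl
length-mid (x ∷ xs) L = cong suc (length-mid xs L)

length-mid< : ∀ {A : Set} (xs : List A) {v} L → length L < length (xs ++ v ∷ L)
length-mid< []       L = ≤-refl
length-mid< (x ∷ xs) L = m≤n⇒m≤1+n (length-mid< xs L)

look-at : ∀ {γ} (xs : List (Word γ)) {w} L → look (xs ++ w ∷ L) (length L) ≡ w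
look-at [] L with length L ≟ length L
... | yes _ = refl
... | no ne = contradiction refl ne
look-at (x ∷ xs) {w} L with length L ≟ length (xs ++ w ∷ L)
... | yes eq = ⊥-elim (<-irrefl eq (length-mid< xs L))
... | no _   = look-at xs L

look-off : ∀ {γ} (xs : List (Word γ)) {v w} L {n} → n ≢ length L →
           look (xs ++ v ∷ L) n ≡ look (xs ++ w ∷ L) n
look-off [] L {n} ne with n ≟ length L
... | yes eq = contradiction eq ne
... | no _   = refl
look-off (x ∷ xs) {v} {w} L {n} ne
  with n ≟ length (xs ++ v ∷ L) | n ≟ length (xs ++ w ∷ L)
... | yes _ | yes _  = refl
... | no _  | no _   = look-off xs L ne
... | yes e | no ne′ = contradiction (trans e (length-mid xs L)) ne′
... | no ne′ | yes e = contradiction (trans e (length-mid xs L)) ne′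

look-split : ∀ {γ} (L : List (Word γ)) {n} → n < length L →
             ∃[ xs ] ∃[ L′ ] L ≡ xs ++ look L n ∷ L′ × n ≡ length L′
look-split (w ∷ L) {n} lt with n ≟ length L
... | yes eq = [] , L , refl , eq
... | no ne  with look-split L (≤∧≢⇒< (s≤s⁻¹ lt) ne)
...   | xs , L′ , eq , le = w ∷ xs , L′ , cong (w ∷_) eq , le

module StackMachine (γ k : ℕ) where

  K = suc k
  Letter = Fin γ
  Words = List (Word γ)
  Tapes = Vec (Tape γ) K
  Acts = Vec (Cell γ × Move) K

  -- branch and while pop the letter on which they continue.

  data Prog : Set where
    skip   : Prog
    push   : Fin K → Letter → Prog
    _⨾_    : Prog → Prog → Prog
    branch : Fin K → Prog → (Letter → Prog) → Prog
    while  : Fin K → (Letter → Prog) → Prog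

  infixr 5 _⨾_

  -- A push takes two machine steps, moving left and then writing, hence `Bool`. In `branch` and
  -- `while` the state `nothing` is the one that tests the stack.
  St : Prog → Set
  St skip           = ⊤
  St (push j c)     = Bool
  St (P ⨾ Q)        = St P ⊎ St Q
  St (branch j P f) = Maybe (St P ⊎ Σ Letter λ c → St (f c))
  St (while j f)    = Maybe (Σ Letter λ c → St (f c))

  enum-St : ∀ P → Enum (St P)
  enum-St skip           = enum-⊤
  enum-St (push j c)     = enum-Bool
  enum-St (P ⨾ Q)        = enum-⊎ (enum-St P) (enum-St Q)
  enum-St (branch j P f) =
    enum-Maybe (enum-⊎ (enum-St P) (enum-Σ (enum-Fin γ) (λ c → enum-St (f c))))
  enum-St (while j f)    = enum-Maybe (enum-Σ (enum-Fin γ) (λ c → enum-St (f c)))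

  entry : ∀ P → St P
  entry skip           = tt
  entry (push j c)     = false
  entry (P ⨾ Q)        = inj₁ (entry P)
  entry (branch j P f) = nothing
  entry (while j f)    = nothing

  idle : Vec (Cell γ) K → Acts
  idle = Vec.map (_, stay)

  act : Fin K → Cell γ × Move → Vec (Cell γ) K → Acts
  act j a fs = idle fs [ j ]≔ a

  -- Runs a component inside a larger program; `ex` says where to continue once the component has
  -- been left.
  redirect : {A B : Set} → (A → B) → Maybe B → Maybe A × Acts → Maybe B × Acts
  redirect ι ex = map₁ (maybe (just ∘ ι) ex)

  trans′ : ∀ P → St P → Vec (Cell γ) K → Maybe (St P) × Acts
  trans′ skip _ fs = nothing , idle fs
  trans′ (push j c) false fs = just true , act j (Vec.lookup fs j , left) fs
  trans′ (push j c) true  fs = nothing , act j (just c , stay) fs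
  trans′ (P ⨾ Q) (inj₁ s) fs = redirect inj₁ (just (inj₂ (entry Q))) (trans′ P s fs)
  trans′ (P ⨾ Q) (inj₂ s) fs = redirect inj₂ nothing (trans′ Q s fs)
  trans′ (branch j P f) nothing fs = branching (Vec.lookup fs j)
    where
    branching : Cell γ → _
    branching nothing  = just (just (inj₁ (entry P))) , idle fs
    -- The popped letter stays on the tape, but to the left of the head, where `readTape` does not
    -- look; a later push overwrites it.
    branching (just c) = just (just (inj₂ (c , entry (f c)))) , act j (just c , right) fs
  trans′ (branch j P f) (just (inj₁ s)) fs =
    redirect (just ∘ inj₁) nothing (trans′ P s fs)
  trans′ (branch j P f) (just (inj₂ (c , s))) fs =
    redirect (λ s → just (inj₂ (c , s))) nothing (trans′ (f c) s fs)
  trans′ (while j f) nothing fs = looping (Vec.lookup fs j)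
    where
    looping : Cell γ → _
    looping nothing  = nothing , idle fs
    looping (just c) = just (just (c , entry (f c))) , act j (just c , right) fs
  trans′ (while j f) (just (c , s)) fs =
    redirect (λ s → just (c , s)) (just nothing) (trans′ (f c) s fs)

  foci : Tapes → Vec (Cell γ) K
  foci = Vec.map Tape.focus

  apply : Acts → Tapes → Tapes
  apply = Vec.zipWith writeMove

  next : ∀ P → St P → Tapes → Maybe (St P)
  next P s ts = proj₁ (trans′ P s (foci ts))

  after : ∀ P → St P → Tapes → Tapes
  after P s ts = apply (proj₂ (trans′ P s (foci ts))) ts

  -- The target nothing stands for having left the program.

  data Reach (P : Prog) : ℕ → St P → Tapes → Maybe (St P) → Tapes → Set where
    one  : ∀ {s ts m us} → next P s ts ≡ m → after P s ts ≡ us → Reach P 1 s ts m us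
    more : ∀ {t s s′ ts m us} → next P s ts ≡ just s′ →
           Reach P t s′ (after P s ts) m us → Reach P (suc t) s ts m us

  Reach-++ : ∀ {P t t′ s s′ ts us m vs} → Reach P t s ts (just s′) us →
             Reach P t′ s′ us m vs → Reach P (t + t′) s ts m vs
  Reach-++ (one eq refl) r′ = more eq r′
  Reach-++ (more eq r)   r′ = more eq (Reach-++ r r′)

  embed : ∀ {P Q} (ι : St P → St Q) ex →
          (∀ s fs → trans′ Q (ι s) fs ≡ redirect ι ex (trans′ P s fs)) →
          ∀ {t s ts us} → Reach P t s ts nothing us → Reach Q t (ι s) ts ex us
  embed ι ex h {ts = ts} (one {s} eq refl) =
    one (trans (cong proj₁ (h s (foci ts))) (cong (maybe (just ∘ ι) ex) eq))
        (cong (λ r → apply (proj₂ r) ts) (h s (foci ts)))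
  embed ι ex h {ts = ts} (more {s = s} eq r) =
    more (trans (cong proj₁ (h s (foci ts))) (cong (maybe (just ∘ ι) ex) eq))
         (subst (λ a → Reach _ _ _ (apply (proj₂ a) ts) _ _) (sym (h s (foci ts)))
           (embed ι ex h r))

  record Rep (L : Words) (ts : Tapes) : Set where
    constructor represents
    field reads : ∀ i → readTape (Vec.lookup ts i) ≡ look L (toℕ i)
  open Rep public

  Exec : Prog → ℕ → Words → Words → Set
  Exec P t L L′ = ∀ ts → Rep L ts →
    ∃[ us ] ∃[ t′ ] t′ ≤ t × Rep L′ us × Reach P t′ (entry P) ts nothing us

  lookup-idle : ∀ ts i → Vec.lookup (apply (idle (foci ts)) ts) i ≡ Vec.lookup ts i
  lookup-idle ts i
    rewrite Vecₚ.lookup-zipWith writeMove i (idle (foci ts)) ts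
          | Vecₚ.lookup-map i (_, stay) (foci ts)
          | Vecₚ.lookup-map i (Tape.focus {γ}) ts = refl

  lookup-act : ∀ ts j a → Vec.lookup (apply (act j a (foci ts)) ts) j ≡ writeMove a (Vec.lookup ts j)
  lookup-act ts j a
    rewrite Vecₚ.lookup-zipWith writeMove j (act j a (foci ts)) ts
          | Vecₚ.lookup∘update j (idle (foci ts)) a = refl

  lookup-act′ : ∀ ts {i} j a → i ≢ j → Vec.lookup (apply (act j a (foci ts)) ts) i ≡ Vec.lookup ts i
  lookup-act′ ts {i} j a ne
    rewrite Vecₚ.lookup-zipWith writeMove i (act j a (foci ts)) ts
          | Vecₚ.lookup∘update′ ne (idle (foci ts)) a
          | Vecₚ.lookup-map i (_, stay) (foci ts)
          | Vecₚ.lookup-map i (Tape.focus {γ}) ts = refl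

  Rep-update : ∀ xs {v w} L {j ts us} → toℕ j ≡ length L → Rep (xs ++ v ∷ L) ts →
    readTape (Vec.lookup us j) ≡ w → (∀ {i} → i ≢ j → Vec.lookup us i ≡ Vec.lookup ts i) →
    Rep (xs ++ w ∷ L) us
  Rep-update xs {v} {w} L {j} {ts} {us} ej rep new old = represents reading
    where
    reading : ∀ i → readTape (Vec.lookup us i) ≡ look (xs ++ w ∷ L) (toℕ i)
    reading i with i Finₚ.≟ j
    ... | yes refl = trans new (sym (trans (cong (look (xs ++ w ∷ L)) ej) (look-at xs L)))
    ... | no ne    = trans (cong readTape (old ne)) (trans (reads rep i)
      (look-off xs L (λ eq → ne (Finₚ.toℕ-injective (trans eq (sym ej))))))

  Rep-idle : ∀ {L ts} → Rep L ts → Rep L (apply (idle (foci ts)) ts)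
  Rep-idle {ts = ts} rep =
    represents λ i → trans (cong readTape (lookup-idle ts i)) (reads rep i)

  Rep-at : ∀ xs {v} L {j ts} → toℕ j ≡ length L → Rep (xs ++ v ∷ L) ts →
           readTape (Vec.lookup ts j) ≡ v
  Rep-at xs {v} L {j} ej rep = trans (reads rep j) (trans (cong (look (xs ++ v ∷ L)) ej) (look-at xs L))

  readTape-[] : ∀ (t : Tape γ) → readTape t ≡ [] → Tape.focus t ≡ nothing
  readTape-[] (tape _ nothing _) eq = refl

  readTape-∷ : ∀ (t : Tape γ) {c w} → readTape t ≡ c ∷ w →
    Tape.focus t ≡ just c × readTape (move right t) ≡ w
  readTape-∷ (tape l (just c) [])      refl = refl , refl
  readTape-∷ (tape l (just c) (b ∷ r)) refl = refl , refl

  readTape-push : ∀ (t : Tape γ) c → readTape (writeMove (just c , stay) (move left t)) ≡ c ∷ readTape t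
  readTape-push (tape []      c′ r) c = refl
  readTape-push (tape (b ∷ l) c′ r) c = refl

  exec-skip : ∀ {L} → Exec skip 1 L L
  exec-skip ts rep = _ , 1 , ≤-refl , Rep-idle rep , one refl refl

  exec-≤ : ∀ {P t t′ L L′} → t ≤ t′ → Exec P t L L′ → Exec P t′ L L′
  exec-≤ le x ts rep with x ts rep
  ... | us , t″ , le′ , rep′ , r = us , t″ , ≤-trans le′ le , rep′ , r

  exec-resp : ∀ {P t L₁ L L′ L₂} → look L₁ ≗ look L → look L′ ≗ look L₂ →
              Exec P t L L′ → Exec P t L₁ L₂
  exec-resp e e′ x ts rep with x ts (represents λ i → trans (reads rep i) (e (toℕ i)))
  ... | us , t″ , le′ , rep′ , r = us , t″ , le′ , represents (λ i → trans (reads rep′ i) (e′ (toℕ i))) , r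

  exec-push : ∀ xs {v} L {j c} → toℕ j ≡ length L →
              Exec (push j c) 2 (xs ++ v ∷ L) (xs ++ (c ∷ v) ∷ L)
  exec-push xs {v} L {j} {c} ej ts rep =
    us , 2 , ≤-refl , Rep-update xs L ej rep new old , more refl (one refl refl)
    where
    a = (Vec.lookup (foci ts) j , left)
    ts′ = apply (act j a (foci ts)) ts
    us = apply (act j (just c , stay) (foci ts′)) ts′
    new : readTape (Vec.lookup us j) ≡ c ∷ v
    new rewrite lookup-act ts′ j (just c , stay) | lookup-act ts j a
              | Vecₚ.lookup-map j (Tape.focus {γ}) ts =
      trans (readTape-push (Vec.lookup ts j) c) (cong (c ∷_) (Rep-at xs L ej rep))
    old : ∀ {i} → i ≢ j → Vec.lookup us i ≡ Vec.lookup ts i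
    old ne = trans (lookup-act′ ts′ j (just c , stay) ne) (lookup-act′ ts j a ne)

  exec-⨾ : ∀ {P Q t t′ L L′ L″} → Exec P t L L′ → Exec Q t′ L′ L″ →
           Exec (P ⨾ Q) (t + t′) L L″
  exec-⨾ {P} {Q} x y ts rep with x ts rep
  ... | us , t , le , rep′ , r with y us rep′
  ... | vs , t′ , le′ , rep″ , r′ =
    vs , t + t′ , +-mono-≤ le le′ , rep″ ,
    Reach-++ (embed {P} {P ⨾ Q} inj₁ _ (λ _ _ → refl) r)
             (embed {Q} {P ⨾ Q} inj₂ _ (λ _ _ → refl) r′)

  focus-lookup : ∀ ts j → Vec.lookup (foci ts) j ≡ Tape.focus (Vec.lookup ts j)
  focus-lookup ts j = Vecₚ.lookup-map j Tape.focus ts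

  pop-Rep : ∀ xs {c v} L {j ts} → toℕ j ≡ length L → Rep (xs ++ (c ∷ v) ∷ L) ts →
    Vec.lookup (foci ts) j ≡ just c × Rep (xs ++ v ∷ L) (apply (act j (just c , right) (foci ts)) ts)
  pop-Rep xs {c} {v} L {j} {ts} ej rep with readTape-∷ (Vec.lookup ts j) (Rep-at xs L ej rep)
  ... | f , r = trans (focus-lookup ts j) f ,
    Rep-update xs L ej rep
      (trans (cong readTape (lookup-act ts j _))
        (trans (cong (λ x → readTape (writeMove (x , right) (Vec.lookup ts j))) (sym f)) r))
      (λ ne → lookup-act′ ts j _ ne)

  exec-branch-[] : ∀ xs L {j P f t L′} → toℕ j ≡ length L → Exec P t (xs ++ [] ∷ L) L′ →
                   Exec (branch j P f) (suc t) (xs ++ [] ∷ L) L′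
  exec-branch-[] xs L {j} {P} {f} ej x ts rep
    with x _ (Rep-idle rep)
  ... | us , t , le , rep′ , r =
    us , suc t , s≤s le , rep′ , more n
      (subst (λ u → Reach _ _ _ u _ _) (sym a)
        (embed {P} {branch j P f} (just ∘ inj₁) nothing (λ _ _ → refl) r))
    where
    e : Vec.lookup (foci ts) j ≡ nothing
    e = trans (focus-lookup ts j) (readTape-[] (Vec.lookup ts j) (Rep-at xs L ej rep))
    n : next (branch j P f) nothing ts ≡ just (just (inj₁ (entry P)))
    n rewrite e = refl
    a : after (branch j P f) nothing ts ≡ apply (idle (foci ts)) ts
    a rewrite e = refl

  exec-branch-∷ : ∀ xs {c v} L {j P f t L′} → toℕ j ≡ length L → Exec (f c) t (xs ++ v ∷ L) L′ →
                  Exec (branch j P f) (suc t) (xs ++ (c ∷ v) ∷ L) L′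
  exec-branch-∷ xs {c} {v} L {j} {P} {f} ej x ts rep with pop-Rep xs L ej rep
  ... | e , rep₁ with x _ rep₁
  ... | us , t , le , rep′ , r =
    us , suc t , s≤s le , rep′ , more n
      (subst (λ u → Reach _ _ _ u _ _) (sym a)
        (embed {f c} {branch j P f} (λ s → just (inj₂ (c , s))) nothing (λ _ _ → refl) r))
    where
    n : next (branch j P f) nothing ts ≡ just (just (inj₂ (c , entry (f c))))
    n rewrite e = refl
    a : after (branch j P f) nothing ts ≡ apply (act j (just c , right) (foci ts)) ts
    a rewrite e = refl

  exec-while-[] : ∀ xs L {j f} → toℕ j ≡ length L →
                  Exec (while j f) 1 (xs ++ [] ∷ L) (xs ++ [] ∷ L)
  exec-while-[] xs L {j} {f} ej ts rep = _ , 1 , ≤-refl , Rep-idle rep , one n a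
    where
    e : Vec.lookup (foci ts) j ≡ nothing
    e = trans (focus-lookup ts j) (readTape-[] (Vec.lookup ts j) (Rep-at xs L ej rep))
    n : next (while j f) nothing ts ≡ nothing
    n rewrite e = refl
    a : after (while j f) nothing ts ≡ apply (idle (foci ts)) ts
    a rewrite e = refl

  exec-while-∷ : ∀ xs {c v} L {j f t t′ L′ L″} → toℕ j ≡ length L →
    Exec (f c) t (xs ++ v ∷ L) L′ → Exec (while j f) t′ L′ L″ →
    Exec (while j f) (suc (t + t′)) (xs ++ (c ∷ v) ∷ L) L″
  exec-while-∷ xs {c} {v} L {j} {f} ej x y ts rep with pop-Rep xs L ej rep
  ... | e , rep₁ with x _ rep₁
  ... | us , t , le , rep′ , r with y us rep′
  ... | vs , t′ , le′ , rep″ , r′ =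
    vs , suc (t + t′) , s≤s (+-mono-≤ le le′) , rep″ , more n
      (subst (λ u → Reach _ _ _ u _ _) (sym a)
        (Reach-++ (embed {f c} {while j f} (λ s → just (c , s)) (just nothing) (λ _ _ → refl) r) r′))
    where
    n : next (while j f) nothing ts ≡ just (just (c , entry (f c)))
    n rewrite e = refl
    a : after (while j f) nothing ts ≡ apply (act j (just c , right) (foci ts)) ts
    a rewrite e = refl

  module _ (P : Prog) where

    states : Enum (Maybe (St P))
    states = enum-Maybe (enum-St P)

    -- A program accepts by leaving a nonempty word on its last stack.
    verdict : Cell γ → Bool
    verdict nothing  = false
    verdict (just _) = true

    decide : Maybe (St P) → Vec (Cell γ) K → Control (length (elems states)) × Acts
    decide (just s) fs = map₁ (running ∘ Enum.code states) (trans′ P s fs)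
    decide nothing  fs = halted (verdict (Vec.last fs)) , idle fs

    toTM : ∀ {a b} → a ≤ γ → b ≤ γ → TM a b
    toTM a≤γ b≤γ = record
      { k = k ; γ = γ ; q = length (elems states) ; a≤γ = a≤γ ; b≤γ = b≤γ
      ; start = Enum.code states (just (entry P))
      ; δ = λ i fs → decide (Enum.decode states i) fs }

    module _ {a b : ℕ} (a≤γ : a ≤ γ) (b≤γ : b ≤ γ) where
      open TM (toTM {a} {b} a≤γ b≤γ) using (step; runFor; initial; HaltsWith)

      cfg : Maybe (St P) → Tapes → Config _ γ K
      cfg m ts = config (running (Enum.code states m)) ts

      step-cfg : ∀ m ts → let d = decide m (foci ts) in
                 step (cfg m ts) ≡ config (proj₁ d) (apply (proj₂ d) ts)
      step-cfg m ts rewrite Enum.decode-code states m = refl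

      iterate-Reach : ∀ {t s ts m us} n → Reach P t s ts m us →
        iterate step (cfg (just s) ts) (t + n) ≡ iterate step (cfg m us) n
      iterate-Reach {s = s} {ts} n (one refl refl) rewrite step-cfg (just s) ts = refl
      iterate-Reach {s = s} {ts} n (more eq r)
        rewrite step-cfg (just s) ts | eq = iterate-Reach n r

      iterate-halted : ∀ n v ts → iterate step (config (halted v) ts) n ≡ config (halted v) ts
      iterate-halted zero    v ts = refl
      iterate-halted (suc n) v ts = iterate-halted n v ts

      -- One more step than the program itself, to enter the halted state.

      run : ∀ {t L w} → Exec P t (w ∷ []) L → ∀ (x : Word a) n → t < n →
            map (λ s → inject≤ s a≤γ) x ≡ w → ∃[ us ] Rep L us ×
            runFor n x ≡ config (halted (verdict (Vec.last (foci us)))) (apply (idle (foci us)) us)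
      run {t} {L} {w} exec x n t<n refl with exec ts₀ rep₀
        where
        ts₀ = loadTape w Vec.∷ Vec.replicate k blankTape
        untilBlank-just : ∀ (w : Word γ) → untilBlank (map just w) ≡ w
        untilBlank-just []      = refl
        untilBlank-just (c ∷ w) = cong (c ∷_) (untilBlank-just w)
        readTape-load : ∀ (w : Word γ) → readTape (loadTape w) ≡ w
        readTape-load []      = refl
        readTape-load (c ∷ w) = cong (c ∷_) (untilBlank-just w)
        reading : ∀ i → readTape (Vec.lookup ts₀ i) ≡ look (w ∷ []) (toℕ i)
        reading zero    = readTape-load w
        reading (suc i) = cong readTape (Vecₚ.lookup-replicate i (blankTape {γ}))
        rep₀ = represents reading
      ... | us , t′ , le , rep , r with m≤n⇒∃[o]m+o≡n (≤-trans (s≤s le) t<n)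
      ... | o , refl = us , rep , trans (cong (iterate step (initial x)) (sym (+-suc t′ o)))
        (trans (iterate-Reach (suc o) r)
          (trans (cong (λ c → iterate step c o) (step-cfg nothing us)) (iterate-halted o _ _)))

-- Arithmetic of polynomials

eval-mono : ∀ p {m n} → m ≤ n → eval p m ≤ eval p n
eval-mono []      le = z≤n
eval-mono (c ∷ p) le = +-monoʳ-≤ c (*-mono-≤ le (eval-mono p le))

addP : Polynomial → Polynomial → Polynomial
addP []      q       = q
addP (c ∷ p) []      = c ∷ p
addP (c ∷ p) (d ∷ q) = c + d ∷ addP p q

eval-addP : ∀ p q n → eval (addP p q) n ≡ eval p n + eval q n
eval-addP []      q       n = refl
eval-addP (c ∷ p) []      n = sym (+-identityʳ _)
eval-addP (c ∷ p) (d ∷ q) n rewrite eval-addP p q n = lem c d n (eval p n) (eval q n)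
  where
  lem : ∀ c d n x y → c + d + n * (x + y) ≡ c + n * x + (d + n * y)
  lem = solve-∀

scaleP : ℕ → Polynomial → Polynomial
scaleP a = map (a *_)

eval-scaleP : ∀ a p n → eval (scaleP a p) n ≡ a * eval p n
eval-scaleP a []      n = sym (*-zeroʳ a)
eval-scaleP a (c ∷ p) n rewrite eval-scaleP a p n = lem a c n (eval p n)
  where
  lem : ∀ a c n x → a * c + n * (a * x) ≡ a * (c + n * x)
  lem = solve-∀

mulP : Polynomial → Polynomial → Polynomial
mulP []      q = []
mulP (c ∷ p) q = addP (scaleP c q) (0 ∷ mulP p q)

eval-mulP : ∀ p q n → eval (mulP p q) n ≡ eval p n * eval q n
eval-mulP []      q n = refl
eval-mulP (c ∷ p) q n
  rewrite eval-addP (scaleP c q) (0 ∷ mulP p q) n | eval-scaleP c q n | eval-mulP p q n =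
  lem c n (eval p n) (eval q n)
  where
  lem : ∀ c n x y → c * y + n * (x * y) ≡ (c + n * x) * y
  lem = solve-∀

compP : Polynomial → Polynomial → Polynomial
compP []      q = []
compP (c ∷ p) q = addP (c ∷ []) (mulP q (compP p q))

eval-compP : ∀ p q n → eval (compP p q) n ≡ eval p (eval q n)
eval-compP []      q n = refl
eval-compP (c ∷ p) q n
  rewrite eval-addP (c ∷ []) (mulP q (compP p q)) n | eval-mulP q (compP p q) n
        | eval-compP p q n | *-zeroʳ n | +-identityʳ c = refl

-- Polynomial functions

-- Bounds are reasoned about through `fn`, which unfolds to plain arithmetic; the coefficients are
-- consulted only where a polynomial has to be exhibited or evaluated by a program.
record Poly : Set where
  field
    fn     : ℕ → ℕ
    coeffs : Polynomial
    exact  : ∀ n → fn n ≡ eval coeffs n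

  mono : ∀ {m n} → m ≤ n → fn m ≤ fn n
  mono {m} {n} le = subst₂ _≤_ (sym (exact m)) (sym (exact n)) (eval-mono coeffs le)

open Poly using (fn; coeffs; exact; mono) public

infixl 6 _⊕_
infixl 7 _⊗_

con : ℕ → Poly
con c = record { fn = λ _ → c ; coeffs = c ∷ []
               ; exact = λ n → sym (trans (cong (c +_) (*-zeroʳ n)) (+-identityʳ c)) }

X : Poly
X = record { fn = λ n → n ; coeffs = 0 ∷ 1 ∷ []
           ; exact = λ n → sym (trans (cong (λ z → n * (1 + z)) (*-zeroʳ n)) (*-identityʳ n)) }

ofPolynomial : Polynomial → Poly
ofPolynomial p = record { fn = eval p ; coeffs = p ; exact = λ _ → refl }

_⊕_ _⊗_ _⊙_ : Poly → Poly → Poly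
p ⊕ q = record { fn = λ n → fn p n + fn q n ; coeffs = addP (coeffs p) (coeffs q)
  ; exact = λ n → trans (cong₂ _+_ (exact p n) (exact q n)) (sym (eval-addP (coeffs p) (coeffs q) n)) }
p ⊗ q = record { fn = λ n → fn p n * fn q n ; coeffs = mulP (coeffs p) (coeffs q)
  ; exact = λ n → trans (cong₂ _*_ (exact p n) (exact q n)) (sym (eval-mulP (coeffs p) (coeffs q) n)) }
p ⊙ q = record { fn = λ n → fn p (fn q n) ; coeffs = compP (coeffs p) (coeffs q)
  ; exact = λ n → trans (exact p (fn q n)) (trans (cong (eval (coeffs p)) (exact q n))
              (sym (eval-compP (coeffs p) (coeffs q) n))) }

total : ∀ {n} → (Fin n → ℕ) → ℕ
total {zero}  f = 0
total {suc n} f = f zero + total (f ∘ suc)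

≤-total-at : ∀ {n} (f : Fin n → ℕ) i → f i ≤ total f
≤-total-at f zero    = m≤m+n _ _
≤-total-at f (suc i) = ≤-trans (≤-total-at (f ∘ suc) i) (m≤n+m _ (f zero))

-- Bounds each of finitely many branches by the sum of all, as the maximum of polynomials need not
-- be a polynomial.
⨁ : ∀ {n} → (Fin n → Poly) → Poly
⨁ {zero}  f = con 0
⨁ {suc n} f = f zero ⊕ ⨁ (f ∘ suc)

≤-⨁ : ∀ {n} (f : Fin n → Poly) i m → fn (f i) m ≤ fn (⨁ f) m
≤-⨁ f zero    m = m≤m+n _ _
≤-⨁ f (suc i) m = ≤-trans (≤-⨁ (f ∘ suc) i m) (m≤n+m _ (fn (f zero) m))

-- A language for polynomial-time functions, in the style of Bellantoni and
-- Cook: Exp n s has n normal and s safe variables, and only normal variables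
-- can be looped over. This makes every expression polynomial-time.

module Language (γ : ℕ) where

  Letter = Fin γ

  mutual
    -- The restriction sits in `letN`: only a value that depends on no safe variable may become
    -- normal. A `loop` runs over the word of a normal variable and updates `m` accumulators
    -- simultaneously; these are safe, while the rest of the word is one more normal variable of the
    -- body.
    data Exp (n s : ℕ) : Set where
      nvar : Fin n → Exp n s
      svar : Fin s → Exp n s
      nil  : Exp n s
      cons : Letter → Exp n s → Exp n s
      letN : Exp n 0 → Exp (suc n) s → Exp n s
      letS : Exp n s → Exp n (suc s) → Exp n s
      case : Fin s → Exp n s → (Letter → Exp n (suc s)) → Exp n s
      loop : ∀ {m} → Fin n → Exps n s m → (Letter → Exps (suc n) (m + s) m) →
             Exp n (m + s) → Exp n s

    data Exps (n s : ℕ) : ℕ → Set where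
      []  : Exps n s 0
      _∷_ : ∀ {m} → Exp n s → Exps n s m → Exps n s (suc m)

  Env : ℕ → Set
  Env = Vec (Word γ)

  mutual
    ⟦_⟧ : ∀ {n s} → Exp n s → Env n → Env s → Word γ
    ⟦ nvar i ⟧           xs as = Vec.lookup xs i
    ⟦ svar i ⟧           xs as = Vec.lookup as i
    ⟦ nil ⟧              xs as = []
    ⟦ cons c e ⟧         xs as = c ∷ ⟦ e ⟧ xs as
    ⟦ letN e e′ ⟧        xs as = ⟦ e′ ⟧ (⟦ e ⟧ xs [] ∷ xs) as
    ⟦ letS e e′ ⟧        xs as = ⟦ e′ ⟧ xs (⟦ e ⟧ xs as ∷ as)
    ⟦ case j e f ⟧       xs as = ⟦case⟧ e f xs as (Vec.lookup as j)
    ⟦ loop i es body e ⟧ xs as =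
      ⟦ e ⟧ xs (⟦loop⟧ body xs as (Vec.lookup xs i) (⟦ es ⟧* xs as) Vec.++ as)

    ⟦case⟧ : ∀ {n s} → Exp n s → (Letter → Exp n (suc s)) → Env n → Env s → Word γ → Word γ
    ⟦case⟧ e f xs as []      = ⟦ e ⟧ xs as
    ⟦case⟧ e f xs as (c ∷ w) = ⟦ f c ⟧ xs (w ∷ as)

    ⟦_⟧* : ∀ {n s m} → Exps n s m → Env n → Env s → Env m
    ⟦ [] ⟧*     xs as = []
    ⟦ e ∷ es ⟧* xs as = ⟦ e ⟧ xs as ∷ ⟦ es ⟧* xs as

    ⟦loop⟧ : ∀ {n s m} → (Letter → Exps (suc n) (m + s) m) →
             Env n → Env s → Word γ → Env m → Env m
    ⟦loop⟧ body xs as []      accs = accs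
    ⟦loop⟧ body xs as (c ∷ w) accs = ⟦loop⟧ body xs as w (⟦ body c ⟧* (w ∷ xs) (accs Vec.++ as))

  mutual
    -- Bounds the growth over the longest safe argument. Growth adds up, a loop adding the same
    -- increment in each round; bounds are composed in `letN` only.
    size : ∀ {n s} → Exp n s → Poly
    size (nvar i)           = X
    size (svar i)           = con 0
    size nil                = con 0
    size (cons c e)         = con 1 ⊕ size e
    size (letN e e′)        = size e′ ⊙ (X ⊕ size e)
    size (letS e e′)        = size e′ ⊕ size e
    size (case j e f)       = size e ⊕ ⨁ (λ c → size (f c))
    size (loop i es body e) = size e ⊕ (sizes es ⊕ X ⊗ ⨁ (λ c → sizes (body c)))

    sizes : ∀ {n s m} → Exps n s m → Poly
    sizes []       = con 0
    sizes (e ∷ es) = size e ⊕ sizes es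

  mutual
    -- How far above the context stacks are used, scratch stacks included. A loop holds its word,
    -- `m` accumulators and their `m` new values at the same time.
    depth : ∀ {n s} → Exp n s → ℕ
    depth (nvar i)               = 1
    depth (svar i)               = 1
    depth nil                    = 0
    depth (cons c e)             = depth e
    depth (letN e e′)            = 2 + depth e + depth e′
    depth (letS e e′)            = 2 + depth e + depth e′
    depth (case j e f)           = 2 + depth e + total (λ c → depth (f c))
    depth (loop {m} i es body e) = 2 + m + m + depths es + total (λ c → depths (body c)) + depth e

    depths : ∀ {n s m} → Exps n s m → ℕ
    depths []             = 0
    depths (_∷_ {m} e es) = m + depths es + depth e

  record Short {n} (b : ℕ) (xs : Env n) : Set where
    constructor short
    field within : ∀ i → length (Vec.lookup xs i) ≤ b
  open Short public

  short-≤ : ∀ {n b b′} {xs : Env n} → b ≤ b′ → Short b xs → Short b′ xs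
  short-≤ le h = short λ i → ≤-trans (within h i) le

  short-[] : ∀ {b} → Short b []
  short-[] = short λ ()

  short-∷ : ∀ {n b w} {xs : Env n} → length w ≤ b → Short b xs → Short b (w ∷ xs)
  short-∷ le h = short λ { zero → le ; (suc i) → within h i }

  short-++ : ∀ {m n b} {xs : Env m} {ys : Env n} → Short b xs → Short b ys → Short b (xs Vec.++ ys)
  short-++ {xs = []}     h h′ = h′
  short-++ {xs = x ∷ xs} h h′ = short-∷ (within h zero) (short-++ (short (within h ∘ suc)) h′)

  -- The key invariant: safe arguments contribute their maximum only, not
  -- multiplied by anything.

  mutual
    size-bound : ∀ {n s} (e : Exp n s) {xs as b a} → Short b xs → Short a as →
                 length (⟦ e ⟧ xs as) ≤ fn (size e) b + a
    size-bound (nvar i) hx ha = ≤-trans (within hx i) (m≤m+n _ _)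
    size-bound (svar i) hx ha = within ha i
    size-bound nil hx ha = z≤n
    size-bound (cons c e) hx ha = s≤s (size-bound e hx ha)
    size-bound (letN e e′) {b = b} hx ha = size-bound e′
      (short-∷ (≤-trans (size-bound e hx short-[]) (≤-trans (≤-reflexive (+-identityʳ _)) (m≤n+m _ b)))
        (short-≤ (m≤m+n _ _) hx)) ha
    size-bound (letS e e′) {b = b} {a} hx ha = ≤-trans
      (size-bound e′ hx (short-∷ (size-bound e hx ha) (short-≤ (m≤n+m _ _) ha)))
      (≤-reflexive (sym (+-assoc (fn (size e′) b) (fn (size e) b) a)))
    size-bound (case j e f) {as = as} {b} {a} hx ha with Vec.lookup as j | within ha j
    ... | []    | _  = ≤-trans (size-bound e hx ha) (+-monoˡ-≤ a (m≤m+n _ _))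
    ... | c ∷ w | le = ≤-trans (size-bound (f c) hx (short-∷ (<⇒≤ le) ha))
      (+-monoˡ-≤ a (≤-trans (≤-⨁ (λ c → size (f c)) c b) (m≤n+m _ (fn (size e) b))))
    size-bound (loop i es body e) {xs} {as} {b} {a} hx ha = ≤-trans
      (size-bound e hx (short-++
        (loop-bound body (Vec.lookup xs i) hx ha (within hx i)
          (short-≤ (≤-reflexive (+-comm _ a)) (sizes-bound es hx ha))
          (m≤m+n a (fn (sizes es) b)))
        (short-≤ (≤-trans (m≤m+n a _) (m≤m+n (a + fn (sizes es) b) _)) ha)))
      (≤-trans (+-monoʳ-≤ (fn (size e) b) (+-monoʳ-≤ (a + fn (sizes es) b)
        (*-monoˡ-≤ (fn (⨁ (λ c → sizes (body c))) b) (within hx i))))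
      (≤-reflexive (lem (fn (size e) b) a (fn (sizes es) b) (b * fn (⨁ (λ c → sizes (body c))) b))))
      where
      lem : ∀ x a y z → x + (a + y + z) ≡ x + (y + z) + a
      lem = solve-∀

    sizes-bound : ∀ {n s m} (es : Exps n s m) {xs as b a} → Short b xs → Short a as →
                  Short (fn (sizes es) b + a) (⟦ es ⟧* xs as)
    sizes-bound []       hx ha = short-[]
    sizes-bound (e ∷ es) {b = b} {a} hx ha = short-∷
      (≤-trans (size-bound e hx ha) (+-monoˡ-≤ a (m≤m+n _ _)))
      (short-≤ (+-monoˡ-≤ a (m≤n+m _ _)) (sizes-bound es hx ha))

    -- The bound `g` covers the accumulators and, by `a ≤ g`, the other safe variables. Since a
    -- round exceeds the longest of them by at most a constant depending on `b`, this constant is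
    -- added once per letter and never multiplied up.
    loop-bound : ∀ {n s m} (body : Letter → Exps (suc n) (m + s) m) w {xs as accs b a g} →
      Short b xs → Short a as → length w ≤ b → Short g accs → a ≤ g →
      Short (g + length w * fn (⨁ (λ c → sizes (body c))) b) (⟦loop⟧ body xs as w accs)
    loop-bound body []      {g = g} hx ha lw hg le = short-≤ (m≤m+n g 0) hg
    loop-bound body (c ∷ w) {b = b} {a} {g} hx ha lw hg le = short-≤
      (≤-reflexive (lem g d (length w * d)))
      (loop-bound body w hx ha (<⇒≤ lw)
        (short-≤ (≤-trans (≤-reflexive (+-comm _ g)) (+-monoʳ-≤ g (≤-⨁ (λ c → sizes (body c)) c b)))
          (sizes-bound (body c) (short-∷ (<⇒≤ lw) hx) (short-++ hg (short-≤ le ha))))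
        (≤-trans le (m≤m+n g d)))
      where
      d = fn (⨁ (λ c → sizes (body c))) b
      lem : ∀ g d x → g + d + x ≡ g + (d + x)
      lem = solve-∀

-- Compiling expressions to stack programs

≤-by : ∀ {m n} o → m + o ≡ n → m ≤ n
≤-by o refl = m≤m+n _ o

-- Saturation lets the compiler work with plain numbers as addresses; that they stay within `k` is
-- left to the correctness proof.
clamp : ∀ k → ℕ → Fin (suc k)
clamp zero    n       = zero
clamp (suc k) zero    = zero
clamp (suc k) (suc n) = suc (clamp k n)

toℕ-clamp : ∀ {k n} → n ≤ k → toℕ (clamp k n) ≡ n
toℕ-clamp {zero}  z≤n      = refl
toℕ-clamp {suc k} z≤n      = refl
toℕ-clamp {suc k} (s≤s le) = cong suc (toℕ-clamp le)

look-below : ∀ {γ} w (L : List (Word γ)) {n} → n < length L → look (w ∷ L) n ≡ look L n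
look-below w L {n} lt with n ≟ length L
... | yes refl = ⊥-elim (<-irrefl refl lt)
... | no _     = refl

look-top : ∀ {γ} w (L : List (Word γ)) → look (w ∷ L) (length L) ≡ w
look-top w L = look-at [] L

assignP : Poly → Poly → Poly
assignP p q = con 3 ⊕ con 2 ⊗ p ⊕ con 6 ⊗ q

copyP : Poly
copyP = con 2 ⊕ con 8 ⊗ X

sweepP : ℕ → Poly → Poly → Poly
sweepP m p q = con m ⊗ assignP p q ⊕ con 1

-- Stack n holds the n-th variable of the context; the value of an expression
-- is left on the first stack above its context.

module Compiler (γ k : ℕ) where
  open StackMachine γ k hiding (Letter) public
  open Language γ public

  slot : ℕ → Fin K
  slot = clamp k

  pour : ℕ → ℕ → Prog
  pour a b = while (slot a) (push (slot b))

  -- Moving a stack letter by letter reverses it, so the way back from the scratch stack `c`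
  -- restores the order in the source and produces it in the copy.
  copy : ℕ → ℕ → ℕ → Prog
  copy a b c = pour a c ⨾ while (slot c) (λ x → push (slot a) x ⨾ push (slot b) x)

  assign : ℕ → ℕ → Prog
  assign s d = while (slot d) (λ _ → skip) ⨾ pour s (suc s) ⨾ pour (suc s) d

  -- The topmost value descends one stack at a time, replacing each value below it, until only it is
  -- left.
  squashes : ℕ → ℕ → Prog
  squashes zero    b = skip
  squashes (suc m) b = assign (suc (m + b)) (m + b) ⨾ squashes m b

  -- New values lie `M` stacks above the old ones. Overwriting proceeds from the top, so the stacks
  -- above the next source are empty and can serve as scratch.
  sweep : ℕ → ℕ → ℕ → Prog
  sweep M zero    b = skip
  sweep M (suc m) b = assign (M + (m + b)) (m + b) ⨾ sweep M m b

  addrs : ∀ m → ℕ → Vec ℕ m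
  addrs zero    ℓ = []
  addrs (suc m) ℓ = m + ℓ ∷ addrs m ℓ

  mutual
    comp : ∀ {n s} → Exp n s → ℕ → Vec ℕ n → Vec ℕ s → Prog
    comp (nvar i)     ℓ α β = copy (Vec.lookup α i) ℓ (suc ℓ)
    comp (svar i)     ℓ α β = copy (Vec.lookup β i) ℓ (suc ℓ)
    comp nil          ℓ α β = skip
    comp (cons c e)   ℓ α β = comp e ℓ α β ⨾ push (slot ℓ) c
    comp (letN e e′)  ℓ α β = comp e ℓ α [] ⨾ comp e′ (suc ℓ) (ℓ ∷ α) β ⨾ assign (suc ℓ) ℓ
    comp (letS e e′)  ℓ α β = comp e ℓ α β ⨾ comp e′ (suc ℓ) α (ℓ ∷ β) ⨾ assign (suc ℓ) ℓ
    comp (case j e f) ℓ α β = copy (Vec.lookup β j) ℓ (suc ℓ) ⨾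
      branch (slot ℓ) (comp e ℓ α β) (λ c → comp (f c) (suc ℓ) α (ℓ ∷ β) ⨾ assign (suc ℓ) ℓ)
    comp (loop {m} i es body e) ℓ α β =
      copy (Vec.lookup α i) ℓ (suc ℓ) ⨾ comps es (suc ℓ) α β ⨾
      while (slot ℓ) (iteration body ℓ α β) ⨾
      comp e (m + suc ℓ) α (addrs m (suc ℓ) Vec.++ β) ⨾ squashes (suc m) ℓ

    iteration : ∀ {n s m} → (Letter → Exps (suc n) (m + s) m) → ℕ → Vec ℕ n → Vec ℕ s → Letter → Prog
    iteration {m = m} body ℓ α β c =
      comps (body c) (m + suc ℓ) (ℓ ∷ α) (addrs m (suc ℓ) Vec.++ β) ⨾ sweep m m (suc ℓ)

    -- The last expression is evaluated first, so that the vector of the values lists their stacks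
    -- from the top.
    comps : ∀ {n s m} → Exps n s m → ℕ → Vec ℕ n → Vec ℕ s → Prog
    comps []               ℓ α β = skip
    comps (_∷_ {m} e es) ℓ α β = comps es ℓ α β ⨾ comp e (m + ℓ) α β

  out : ∀ {n s} → Exp n s → Poly
  out e = size e ⊕ X

  -- Bounds every word in sight during a loop: the initial accumulators and the variables, plus the
  -- growth over all rounds.
  accP : ∀ {n s m} → Exps n s m → (Letter → Exps (suc n) (m + s) m) → Poly
  accP es body = sizes es ⊕ X ⊕ X ⊗ ⨁ (λ c → sizes (body c))

  mutual
    time : ∀ {n s} → Exp n s → Poly
    time (nvar i)    = copyP
    time (svar i)    = copyP
    time nil         = con 1
    time (cons c e)  = time e ⊕ con 2
    time (letN e e′) = letP e e′
    time (letS e e′) = letP e e′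
    time (case j e f) = copyP ⊕ (con 1 ⊕ (time e ⊕ ⨁ (λ c → time (f c) ⊕ assignP X (out (f c)))))
    time (loop {m} i es body e) =
      copyP ⊕ (times es ⊕ ((X ⊗ iterP es body ⊕ con 1) ⊕
        (time e ⊙ D ⊕ sweepP (suc m) D (out e ⊙ D))))
      where D = accP es body

    letP : ∀ {n s n′ s′} → Exp n s → Exp n′ s′ → Poly
    letP e e′ = time e ⊕ (time e′ ⊙ out e ⊕ assignP (out e) (out e′ ⊙ out e))

    iterP : ∀ {n s m} → Exps n s m → (Letter → Exps (suc n) (m + s) m) → Poly
    iterP {m = m} es body = con 1 ⊕ (⨁ (λ c → times (body c)) ⊙ D ⊕ sweepP m D D)
      where D = accP es body

    times : ∀ {n s m} → Exps n s m → Poly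
    times []       = con 1
    times (e ∷ es) = times es ⊕ time e

  slot-eq : ∀ {n m} → n ≡ m → n ≤ k → toℕ (slot n) ≡ m
  slot-eq eq le = trans (toℕ-clamp le) eq

  -- A letter costs one step for the pop and two for the push; one more step finds the stack empty.
  exec-pour-up : ∀ w xs L {u i j} → toℕ i ≡ length L → toℕ j ≡ length (xs ++ w ∷ L) →
    Exec (while i (push j)) (1 + 3 * length w) (u ∷ xs ++ w ∷ L) ((w ʳ++ u) ∷ xs ++ [] ∷ L)
  exec-pour-up []      xs L {u} ei ej = exec-while-[] (u ∷ xs) L ei
  exec-pour-up (c ∷ w) xs L {u} ei ej = exec-≤ (≤-reflexive (lem (length w)))
    (exec-while-∷ (u ∷ xs) L ei (exec-push [] (xs ++ w ∷ L) ej′) (exec-pour-up w xs L ei ej′))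
    where
    ej′ = trans ej (length-mid xs L)
    lem : ∀ n → suc (2 + (1 + 3 * n)) ≡ 1 + 3 * suc n
    lem = solve-∀

  exec-pour-down : ∀ u xs L {w i j} → toℕ i ≡ length (xs ++ w ∷ L) → toℕ j ≡ length L →
    Exec (while i (push j)) (1 + 3 * length u) (u ∷ xs ++ w ∷ L) ([] ∷ xs ++ (u ʳ++ w) ∷ L)
  exec-pour-down []      xs L {w} ei ej = exec-while-[] [] (xs ++ w ∷ L) ei
  exec-pour-down (c ∷ u) xs L {w} ei ej = exec-≤ (≤-reflexive (lem (length u)))
    (exec-while-∷ [] (xs ++ w ∷ L) ei (exec-push (u ∷ xs) L ej)
      (exec-pour-down u xs L (trans ei (length-mid xs L)) ej))
    where
    lem : ∀ n → suc (2 + (1 + 3 * n)) ≡ 1 + 3 * suc n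
    lem = solve-∀

  exec-restore : ∀ u v xs L {w a b c} → toℕ a ≡ length L → toℕ b ≡ length (xs ++ w ∷ L) →
    toℕ c ≡ suc (length (xs ++ w ∷ L)) →
    Exec (while c (λ x → push a x ⨾ push b x)) (1 + 5 * length u)
      (u ∷ v ∷ xs ++ w ∷ L) ([] ∷ (u ʳ++ v) ∷ xs ++ (u ʳ++ w) ∷ L)
  exec-restore []      v xs L ea eb ec = exec-while-[] [] _ ec
  exec-restore (c ∷ u) v xs L {w} ea eb ec = exec-≤ (≤-reflexive (lem (length u)))
    (exec-while-∷ [] (v ∷ xs ++ w ∷ L) ec
      (exec-⨾ (exec-push (u ∷ v ∷ xs) L ea) (exec-push (u ∷ []) (xs ++ (c ∷ w) ∷ L) eb′))
      (exec-restore u (c ∷ v) xs L ea eb′ (trans ec (cong suc (length-mid xs L)))))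
    where
    eb′ = trans eb (length-mid xs L)
    lem : ∀ n → suc (2 + 2 + (1 + 5 * n)) ≡ 1 + 5 * suc n
    lem = solve-∀

  look-[]² : ∀ (L : Words) → look ([] ∷ [] ∷ L) ≗ look L
  look-[]² L n = trans (look-[] ([] ∷ L) n) (look-[] L n)

  exec-copy-mid : ∀ xs w L {a ℓ} → a ≡ length L → ℓ ≡ length (xs ++ w ∷ L) → suc ℓ ≤ k →
    Exec (copy a ℓ (suc ℓ)) (2 + 8 * length w) (xs ++ w ∷ L) (w ∷ xs ++ w ∷ L)
  exec-copy-mid xs w L {a} {ℓ} ea eℓ le = exec-≤ (≤-reflexive time≡)
    (exec-resp (λ n → sym (look-[]² _ n)) (λ n → trans (look-[] _ n) (cong (λ z → look z n) final))
      (exec-⨾ (exec-pour-up w ([] ∷ xs) L {[]} ea′ ec)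
              (exec-restore (reverse w) [] xs L ea′ eb″ ec″)))
    where
    a≤ : a ≤ k
    a≤ = subst₂ _≤_ (sym ea) refl (≤-trans (<⇒≤ (length-mid< xs L)) (subst (_≤ k) eℓ (<⇒≤ le)))
    ea′ = slot-eq ea a≤
    ec = slot-eq (cong suc eℓ) le
    eb″ = slot-eq (trans eℓ (length-mid xs L)) (<⇒≤ le)
    ec″ = trans ec (cong suc (length-mid xs L))
    final : ((reverse w ʳ++ []) ∷ xs ++ (reverse w ʳ++ []) ∷ L) ≡ (w ∷ xs ++ w ∷ L)
    final = cong (λ z → z ∷ xs ++ z ∷ L) (Listₚ.reverse-involutive w)
    lem : ∀ n → 1 + 3 * n + (1 + 5 * n) ≡ 2 + 8 * n
    lem = solve-∀
    time≡ : 1 + 3 * length w + (1 + 5 * length (reverse w)) ≡ 2 + 8 * length w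
    time≡ = trans (cong (λ z → 1 + 3 * length w + (1 + 5 * z)) (Listₚ.length-reverse w)) (lem (length w))

  exec-clear : ∀ w xs L {i} → toℕ i ≡ length L →
    Exec (while i (λ _ → skip)) (1 + 2 * length w) (xs ++ w ∷ L) (xs ++ [] ∷ L)
  exec-clear []      xs L ei = exec-while-[] xs L ei
  exec-clear (c ∷ w) xs L ei = exec-≤ (≤-reflexive (lem (length w)))
    (exec-while-∷ xs L ei exec-skip (exec-clear w xs L ei))
    where
    lem : ∀ n → suc (1 + (1 + 2 * n)) ≡ 1 + 2 * suc n
    lem = solve-∀

  exec-assign : ∀ u zs a L {s d p q} → s ≡ length (zs ++ a ∷ L) → d ≡ length L → suc s ≤ k →
    length a ≤ p → length u ≤ q →
    Exec (assign s d) (3 + 2 * p + 6 * q) (u ∷ zs ++ a ∷ L) (zs ++ u ∷ L)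
  exec-assign u zs a L {s} {d} {p} {q} es ed le ap uq = exec-≤ time≤
    (exec-resp (λ n → sym (look-[] _ n)) (λ n → trans (look-[]² _ n) (cong (λ z → look z n) final))
      (exec-⨾ (exec-clear a ([] ∷ u ∷ zs) L ed′)
      (exec-⨾ (exec-pour-up u [] (zs ++ [] ∷ L) {[]} es′ ec)
              (exec-pour-down (reverse u) ([] ∷ zs) L ec ed′))))
    where
    es≤ = <⇒≤ le
    d≤ : d ≤ k
    d≤ = subst (_≤ k) (sym ed) (≤-trans (<⇒≤ (length-mid< zs L)) (subst (_≤ k) es es≤))
    ed′ = slot-eq ed d≤
    es′ = slot-eq (trans es (length-mid zs L)) es≤
    ec = slot-eq (cong suc (trans es (length-mid zs L))) le
    final : (zs ++ (reverse u ʳ++ []) ∷ L) ≡ (zs ++ u ∷ L)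
    final = cong (λ z → zs ++ z ∷ L) (Listₚ.reverse-involutive u)
    lem : ∀ m n → 1 + 2 * m + (1 + 3 * n + (1 + 3 * n)) ≡ 3 + 2 * m + 6 * n
    lem = solve-∀
    time≤ : 1 + 2 * length a + (1 + 3 * length u + (1 + 3 * length (reverse u))) ≤ 3 + 2 * p + 6 * q
    time≤ = ≤-trans (≤-reflexive (trans
      (cong (λ z → 1 + 2 * length a + (1 + 3 * length u + (1 + 3 * z))) (Listₚ.length-reverse u))
      (lem (length a) (length u)))) (+-mono-≤ (+-monoʳ-≤ 3 (*-monoʳ-≤ 2 ap)) (*-monoʳ-≤ 6 uq))

  exec-squashes : ∀ u as L {b p q} → b ≡ length L → suc (length as + b) ≤ k →
    All (λ a → length a ≤ p) as → length u ≤ q →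
    Exec (squashes (length as) b) (length as * (3 + 2 * p + 6 * q) + 1) (u ∷ as ++ L) (u ∷ L)
  exec-squashes u []       L eb le [] uq = exec-skip
  exec-squashes u (a ∷ as) L {b} {p} {q} eb le (ap ∷ asp) uq = exec-≤
    (≤-reflexive (sym (+-assoc (3 + 2 * p + 6 * q) _ 1)))
    (exec-⨾ (exec-assign u [] a (as ++ L) (cong suc e) e le ap uq)
            (exec-squashes u as L eb (<⇒≤ le) asp uq))
    where
    e : length as + b ≡ length (as ++ L)
    e = trans (cong (length as +_) eb) (sym (Listₚ.length-++ as))

  -- The values already moved form `done`, just above the old values `as` not yet replaced. With
  -- every move `us` shrinks as `done` grows, so that the distance `M` from source to destination is
  -- constant.
  exec-sweep : ∀ {m M} (us done as : Words) L {b p} → length us ≡ m → length as ≡ m →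
    length us + length done ≡ M → b ≡ length L → M + (m + b) ≤ k →
    All (λ a → length a ≤ p) us → All (λ a → length a ≤ p) as →
    Exec (sweep M m b) (m * (3 + 2 * p + 6 * p) + 1) (us ++ done ++ as ++ L) ((done ++ us) ++ L)
  exec-sweep []       done []       L refl refl eM eb le up ap =
    subst (λ z → Exec skip 1 (done ++ L) (z ++ L)) (sym (Listₚ.++-identityʳ done)) exec-skip
  exec-sweep {suc m} {M} (u ∷ us) done (a ∷ as) L {b} {p} refl ea refl eb le (uq ∷ up) (aq ∷ ap) = exec-≤
    (≤-reflexive (sym (+-assoc (3 + 2 * p + 6 * p) _ 1)))
    (exec-⨾
      (subst (λ z → Exec (assign (M + (m + b)) (m + b)) _ (u ∷ z) ((us ++ done) ++ u ∷ as ++ L))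
        (Listₚ.++-assoc us done _)
        (exec-assign u (us ++ done) a (as ++ L) es ed
          (≤-trans (≤-reflexive (sym (+-suc M (m + b)))) le) aq uq))
      (subst₂ (Exec (sweep M m b) _)
        (trans (cong (us ++_) (Listₚ.++-assoc done (u ∷ []) (as ++ L))) (sym (Listₚ.++-assoc us done _)))
        (cong (_++ L) (Listₚ.++-assoc done (u ∷ []) us))
        (exec-sweep {m} {M} us (done ++ u ∷ []) as L refl (suc-injective ea) eM eb
          (≤-trans (+-monoʳ-≤ M (n≤1+n _)) le) up ap)))
    where
    ed : m + b ≡ length (as ++ L)
    ed = trans (cong₂ _+_ (sym (suc-injective ea)) eb) (sym (Listₚ.length-++ as))
    es : M + (m + b) ≡ length ((us ++ done) ++ a ∷ as ++ L)
    es rewrite Listₚ.length-++ (us ++ done) {a ∷ as ++ L} | Listₚ.length-++ us {done} | sym ed =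
      sym (+-suc _ _)
    eM : length us + length (done ++ u ∷ []) ≡ M
    eM rewrite Listₚ.length-++ done {u ∷ []} | +-comm (length done) 1 = +-suc _ _

  record Holds {n} (L : Words) (α : Vec ℕ n) (xs : Env n) : Set where
    constructor holds
    field
      below : ∀ i → Vec.lookup α i < length L
      value : ∀ i → look L (Vec.lookup α i) ≡ Vec.lookup xs i
  open Holds public

  holds-∷ : ∀ {n L w} {α : Vec ℕ n} {xs} → Holds L α xs → Holds (w ∷ L) α xs
  holds-∷ {L = L} {w} h = holds (λ i → m≤n⇒m≤1+n (below h i))
    (λ i → trans (look-below w L (below h i)) (value h i))

  holds-++ : ∀ {n} ws {L} {α : Vec ℕ n} {xs} → Holds L α xs → Holds (ws ++ L) α xs
  holds-++ []       h = h
  holds-++ (w ∷ ws) h = holds-∷ (holds-++ ws h)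

  holds-new : ∀ {n L w ℓ} {α : Vec ℕ n} {xs} → ℓ ≡ length L → Holds L α xs →
              Holds (w ∷ L) (ℓ ∷ α) (w ∷ xs)
  holds-new {L = L} {w} refl h = holds
    (λ { zero → ≤-refl ; (suc i) → below (holds-∷ {w = w} h) i })
    (λ { zero → look-top w L ; (suc i) → value (holds-∷ {w = w} h) i })

  holds-[] : ∀ {L} → Holds L [] []
  holds-[] = holds (λ ()) (λ ())

  length-toList++ : ∀ {m} (vs : Env m) (L : Words) {ℓ} → ℓ ≡ length L →
                    m + ℓ ≡ length (Vec.toList vs ++ L)
  length-toList++ []       L refl = refl
  length-toList++ (v ∷ vs) L eq   = cong suc (length-toList++ vs L eq)

  holds-addrs : ∀ {m n L ℓ} {β : Vec ℕ n} {as} (vs : Env m) → ℓ ≡ length L → Holds L β as →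
                Holds (Vec.toList vs ++ L) (addrs m ℓ Vec.++ β) (vs Vec.++ as)
  holds-addrs []       eq h = h
  holds-addrs {L = L} (v ∷ vs) eq h = holds-new (length-toList++ vs L eq) (holds-addrs vs eq h)

  short-All : ∀ {m b} {vs : Env m} → Short b vs → All (λ v → length v ≤ b) (Vec.toList vs)
  short-All {vs = []}     h = []
  short-All {vs = v ∷ vs} h = within h zero ∷ short-All (short (within h ∘ suc))

  exec-copy : ∀ {n L ℓ C} {α : Vec ℕ n} {xs} i → ℓ ≡ length L → Holds L α xs → Short C xs → ℓ + 1 ≤ k →
    Exec (copy (Vec.lookup α i) ℓ (suc ℓ)) (fn copyP C) L (Vec.lookup xs i ∷ L)
  exec-copy {L = L} {ℓ} {C} {α} {xs} i eℓ h hs le with look-split L (below h i)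
  ... | ys , L′ , eq , ea = subst₂ (λ u v → Exec _ _ u (v ∷ u)) (sym eq) (value h i)
    (exec-≤ (+-monoʳ-≤ 2 (*-monoʳ-≤ 8 (subst (_≤ C) (cong length (sym (value h i))) (within hs i))))
      (exec-copy-mid ys (look L (Vec.lookup α i)) L′ ea (trans eℓ (cong length eq))
        (subst (_≤ k) (+-comm ℓ 1) le)))

  out-bound : ∀ {n s} (e : Exp n s) {xs as C} → Short C xs → Short C as →
              length (⟦ e ⟧ xs as) ≤ fn (out e) C
  out-bound e = size-bound e

  exec-under : ∀ {P t u v L ℓ p q} → ℓ ≡ length L → 2 + ℓ ≤ k → length v ≤ p → length u ≤ q →
    Exec P t (v ∷ L) (u ∷ v ∷ L) →
    Exec (P ⨾ assign (suc ℓ) ℓ) (t + (3 + 2 * p + 6 * q)) (v ∷ L) (u ∷ L)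
  exec-under {u = u} {v} {L} eℓ le vp uq x =
    exec-⨾ x (exec-assign u [] v L (cong suc eℓ) eℓ le vp uq)

  fits : ∀ {a b c} o → a + o ≡ b → b ≤ c → a ≤ c
  fits o eq le = ≤-trans (≤-by o eq) le

  mutual
    -- Here `C` bounds normal and safe variables alike. The distinction has done its work in
    -- `size-bound`, which keeps all intermediate words polynomial in `C`; the time then is a
    -- polynomial as well.
    exec-comp : ∀ {n s} (e : Exp n s) {L ℓ α β xs as C} → ℓ ≡ length L →
      Holds L α xs → Holds L β as → Short C xs → Short C as → ℓ + depth e ≤ k →
      Exec (comp e ℓ α β) (fn (time e) C) L (⟦ e ⟧ xs as ∷ L)
    exec-comp (nvar i) eℓ hx ha sx sa le = exec-copy i eℓ hx sx le
    exec-comp (svar i) eℓ hx ha sx sa le = exec-copy i eℓ ha sa le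
    exec-comp nil {L} eℓ hx ha sx sa le = exec-resp {L₁ = L} {L} (λ _ → refl) (λ n → sym (look-[] L n)) exec-skip
    exec-comp (cons c e) {L} {ℓ} eℓ hx ha sx sa le =
      exec-⨾ (exec-comp e eℓ hx ha sx sa le)
             (exec-push [] L (slot-eq eℓ (≤-trans (m≤m+n ℓ _) le)))
    exec-comp (letN e e′) {ℓ = ℓ} {C = C} eℓ hx ha sx sa le =
      exec-⨾ (exec-comp e eℓ hx holds-[] sx short-[] (fits (2 + depth e′) (lem₁ ℓ (depth e) (depth e′)) le))
        (exec-under eℓ (fits (depth e + depth e′) (lem₃ ℓ (depth e) (depth e′)) le) v≤
          (out-bound e′ sx′ sa′)
          (exec-comp e′ (cong suc eℓ) (holds-new eℓ hx) (holds-∷ ha) sx′ sa′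
            (fits (1 + depth e) (lem₂ ℓ (depth e) (depth e′)) le)))
      where
      v≤ = out-bound e sx (short-[] {b = C})
      sx′ = short-∷ v≤ (short-≤ (m≤n+m _ _) sx)
      sa′ = short-≤ (m≤n+m _ (fn (size e) C)) sa
      lem₁ : ∀ ℓ d d′ → ℓ + d + (2 + d′) ≡ ℓ + (2 + d + d′)
      lem₁ = solve-∀
      lem₂ : ∀ ℓ d d′ → suc ℓ + d′ + (1 + d) ≡ ℓ + (2 + d + d′)
      lem₂ = solve-∀
      lem₃ : ∀ ℓ d d′ → 2 + ℓ + (d + d′) ≡ ℓ + (2 + d + d′)
      lem₃ = solve-∀
    exec-comp (letS e e′) {ℓ = ℓ} {C = C} eℓ hx ha sx sa le =
      exec-⨾ (exec-comp e eℓ hx ha sx sa (fits (2 + depth e′) (lem₁ ℓ (depth e) (depth e′)) le))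
        (exec-under eℓ (fits (depth e + depth e′) (lem₃ ℓ (depth e) (depth e′)) le) v≤
          (out-bound e′ sx′ sa′)
          (exec-comp e′ (cong suc eℓ) (holds-∷ hx) (holds-new eℓ ha) sx′ sa′
            (fits (1 + depth e) (lem₂ ℓ (depth e) (depth e′)) le)))
      where
      v≤ = out-bound e sx sa
      sx′ = short-≤ (m≤n+m _ (fn (size e) C)) sx
      sa′ = short-∷ v≤ (short-≤ (m≤n+m _ _) sa)
      lem₁ : ∀ ℓ d d′ → ℓ + d + (2 + d′) ≡ ℓ + (2 + d + d′)
      lem₁ = solve-∀
      lem₂ : ∀ ℓ d d′ → suc ℓ + d′ + (1 + d) ≡ ℓ + (2 + d + d′)
      lem₂ = solve-∀
      lem₃ : ∀ ℓ d d′ → 2 + ℓ + (d + d′) ≡ ℓ + (2 + d + d′)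
      lem₃ = solve-∀
    exec-comp (case j e f) {L} {ℓ} {α} {β} {xs} {as} {C} eℓ hx ha sx sa le =
      exec-⨾ (exec-copy j eℓ ha sa (fits (1 + (depth e + d)) (lem₀ ℓ (depth e) d) le))
        (branches (Vec.lookup as j) (within sa j))
      where
      d = total (λ c → depth (f c))
      lem₀ : ∀ ℓ d d′ → ℓ + 1 + (1 + (d + d′)) ≡ ℓ + (2 + d + d′)
      lem₀ = solve-∀
      lem₁ : ∀ ℓ d d′ → ℓ + d + (2 + d′) ≡ ℓ + (2 + d + d′)
      lem₁ = solve-∀
      lem₂ : ∀ ℓ d d′ → suc ℓ + d′ + (1 + d) ≡ ℓ + (2 + d + d′)
      lem₂ = solve-∀
      lem₃ : ∀ ℓ d d′ → 2 + ℓ + (d + d′) ≡ ℓ + (2 + d + d′)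
      lem₃ = solve-∀
      ej = slot-eq eℓ (≤-trans (m≤m+n ℓ _) le)
      branches : ∀ w → length w ≤ C →
        Exec (branch (slot ℓ) (comp e ℓ α β) (λ c → comp (f c) (suc ℓ) α (ℓ ∷ β) ⨾ assign (suc ℓ) ℓ))
          (1 + (fn (time e) C + fn (⨁ (λ c → time (f c) ⊕ assignP X (out (f c)))) C))
          (w ∷ L) (⟦case⟧ e f xs as w ∷ L)
      branches [] _ = exec-≤ (s≤s (m≤m+n _ _)) (exec-branch-[] [] L ej
        (exec-resp (look-[] L) (λ _ → refl)
          (exec-comp e eℓ hx ha sx sa (fits (2 + d) (lem₁ ℓ (depth e) d) le))))
      branches (c ∷ w) c≤ = exec-≤ (s≤s (≤-trans
          (≤-⨁ (λ c → time (f c) ⊕ assignP X (out (f c))) c C) (m≤n+m _ (fn (time e) C))))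
        (exec-branch-∷ [] L ej (exec-under eℓ
          (fits (depth e + d) (lem₃ ℓ (depth e) d) le) (<⇒≤ c≤)
          (out-bound (f c) sx (short-∷ (<⇒≤ c≤) sa))
          (exec-comp (f c) (cong suc eℓ) (holds-∷ hx) (holds-new eℓ ha) sx (short-∷ (<⇒≤ c≤) sa)
            (≤-trans (+-monoʳ-≤ (suc ℓ) (≤-total-at (λ c → depth (f c)) c))
              (fits (1 + depth e) (lem₂ ℓ (depth e) d) le)))))
    exec-comp (loop {m} i es body e) {L} {ℓ} {α} {β} {xs} {as} {C} eℓ hx ha sx sa le =
      exec-⨾ (exec-copy i eℓ hx sx (fits (1 + m + m + ds + d + depth e) (lem₀ ℓ m ds d (depth e)) le))
      (exec-⨾ (exec-comps es (cong suc eℓ) (holds-∷ hx) (holds-∷ ha) sx sa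
          (fits (1 + m + m + d + depth e) (lem₁ ℓ m ds d (depth e)) le))
      (exec-⨾ (exec-≤ (+-monoˡ-≤ 1 (*-monoˡ-≤ (fn (iterP es body) C) (within sx i)))
          (exec-loop body es w {D = fn D C} eℓ hx ha sx sa
            (within sx i) (sizes-bound es sx sa) (m≤n+m C _)
            (+-monoʳ-≤ _ (*-monoˡ-≤ _ (within sx i))) C≤D
            (fits (1 + m + ds + depth e) (lem₂ ℓ m ds d (depth e)) le)
            (fits (1 + ds + d + depth e) (lem₄ ℓ m ds d (depth e)) le) refl))
      (exec-⨾ (exec-comp e (length-toList++ final ([] ∷ L) (cong suc eℓ))
          (holds-++ (Vec.toList final) (holds-∷ hx)) (holds-addrs final (cong suc eℓ) (holds-∷ ha))
          (short-≤ C≤D sx) sfin (fits (1 + m + ds + d) (lem₃ ℓ m ds d (depth e)) le))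
        (subst₂ (λ z z′ → Exec (squashes z ℓ) (z * fn (assignP D (out e ⊙ D)) C + 1) (⟦ e ⟧ xs (final Vec.++ as) ∷ z′) (⟦ e ⟧ xs (final Vec.++ as) ∷ L))
          len (Listₚ.++-assoc (Vec.toList final) ([] ∷ []) L)
          (exec-squashes (⟦ e ⟧ xs (final Vec.++ as)) (Vec.toList final ++ [] ∷ []) L {p = fn D C} {fn (out e ⊙ D) C} eℓ
            (subst (λ z → suc (z + ℓ) ≤ k) (sym len)
              (fits (m + ds + d + depth e) (lem₅ ℓ m ds d (depth e)) le))
            (Allₚ.++⁺ (short-All (short-≤ final≤ (loop-bound body w sx sa (within sx i)
                (sizes-bound es sx sa) (m≤n+m C _)))) (z≤n ∷ []))
            (out-bound e (short-≤ C≤D sx) sfin))))))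
      where
      w = Vec.lookup xs i
      final = ⟦loop⟧ body xs as w (⟦ es ⟧* xs as)
      D = accP es body
      ds = depths es
      d = total (λ c → depths (body c))
      C≤D : C ≤ fn D C
      C≤D = ≤-trans (m≤n+m C (fn (sizes es) C)) (m≤m+n _ _)
      final≤ = +-monoʳ-≤ (fn (sizes es) C + C) (*-monoˡ-≤ (fn (⨁ (λ c → sizes (body c))) C) (within sx i))
      sfin : Short (fn D C) (final Vec.++ as)
      sfin = short-++ (short-≤ final≤
        (loop-bound body w sx sa (within sx i) (sizes-bound es sx sa) (m≤n+m C _))) (short-≤ C≤D sa)
      len : length (Vec.toList final ++ [] ∷ []) ≡ suc m
      len = trans (sym (length-toList++ final ([] ∷ []) {1} refl)) (+-comm m 1)
      lem₀ : ∀ ℓ m s d x → ℓ + 1 + (1 + m + m + s + d + x) ≡ ℓ + (2 + m + m + s + d + x)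
      lem₀ = solve-∀
      lem₁ : ∀ ℓ m s d x → suc ℓ + s + (1 + m + m + d + x) ≡ ℓ + (2 + m + m + s + d + x)
      lem₁ = solve-∀
      lem₂ : ∀ ℓ m s d x → m + suc ℓ + d + (1 + m + s + x) ≡ ℓ + (2 + m + m + s + d + x)
      lem₂ = solve-∀
      lem₃ : ∀ ℓ m s d x → m + suc ℓ + x + (1 + m + s + d) ≡ ℓ + (2 + m + m + s + d + x)
      lem₃ = solve-∀
      lem₄ : ∀ ℓ m s d x → m + (m + suc ℓ) + (1 + s + d + x) ≡ ℓ + (2 + m + m + s + d + x)
      lem₄ = solve-∀
      lem₅ : ∀ ℓ m s d x → 2 + m + ℓ + (m + s + d + x) ≡ ℓ + (2 + m + m + s + d + x)
      lem₅ = solve-∀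

    exec-comps : ∀ {n s m} (es : Exps n s m) {L ℓ α β xs as C} → ℓ ≡ length L →
      Holds L α xs → Holds L β as → Short C xs → Short C as → ℓ + depths es ≤ k →
      Exec (comps es ℓ α β) (fn (times es) C) L (Vec.toList (⟦ es ⟧* xs as) ++ L)
    exec-comps [] eℓ hx ha sx sa le = exec-skip
    exec-comps (_∷_ {m} e es) {L} {ℓ} {xs = xs} {as} eℓ hx ha sx sa le =
      exec-⨾ (exec-comps es eℓ hx ha sx sa (fits (m + depth e) (lem₁ ℓ m (depths es) (depth e)) le))
        (exec-comp e (length-toList++ (⟦ es ⟧* xs as) L eℓ)
          (holds-++ (Vec.toList (⟦ es ⟧* xs as)) hx) (holds-++ (Vec.toList (⟦ es ⟧* xs as)) ha) sx sa
          (fits (depths es) (lem₂ ℓ m (depths es) (depth e)) le))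
      where
      lem₁ : ∀ ℓ m s d → ℓ + s + (m + d) ≡ ℓ + (m + s + d)
      lem₁ = solve-∀
      lem₂ : ∀ ℓ m s d → m + ℓ + d + s ≡ ℓ + (m + s + d)
      lem₂ = solve-∀

    -- Two bounds are needed: the growth per round is measured with `C`, which bounds the normal
    -- variables, whereas the time per round is measured with `D`, which bounds all accumulators
    -- that will ever occur. So each round costs at most `it`.
    exec-loop : ∀ {n s m} (body : Letter → Exps (suc n) (m + s) m) (es : Exps n s m) w
      {L ℓ α β xs as accs C g D it} → ℓ ≡ length L →
      Holds L α xs → Holds L β as → Short C xs → Short C as →
      length w ≤ C → Short g accs → C ≤ g →
      g + length w * fn (⨁ (λ c → sizes (body c))) C ≤ D → C ≤ D →
      m + suc ℓ + total (λ c → depths (body c)) ≤ k → m + (m + suc ℓ) ≤ k →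
      1 + (fn (⨁ (λ c → times (body c))) D + (m * (3 + 2 * D + 6 * D) + 1)) ≡ it →
      Exec (while (slot ℓ) (iteration body ℓ α β)) (length w * it + 1)
        (Vec.toList accs ++ w ∷ L) (Vec.toList (⟦loop⟧ body xs as w accs) ++ [] ∷ L)
    exec-loop {m = m} body es [] {L} {accs = accs} eℓ hx ha sx sa wC hg Cg gD CD le le′ eit =
      exec-while-[] (Vec.toList accs) L (slot-eq eℓ (≤-trans (m≤n+m _ m)
        (≤-trans (+-monoʳ-≤ m (n≤1+n _)) (≤-trans (m≤n+m _ m) le′))))
    exec-loop {m = m} body es (c ∷ w) {L} {ℓ} {xs = xs} {as} {accs} {C} {g} {D} eℓ hx ha sx sa wC hg Cg gD CD le le′ refl =
      exec-≤ (≤-reflexive (sym (+-assoc it (length w * it) 1)))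
        (exec-while-∷ (Vec.toList accs) L (slot-eq eℓ (≤-trans (m≤n+m _ m)
            (≤-trans (+-monoʳ-≤ m (n≤1+n _)) (≤-trans (m≤n+m _ m) le′))))
          (exec-⨾
            (exec-≤ (≤-⨁ (λ c → times (body c)) c D)
              (exec-comps (body c) (length-toList++ accs (w ∷ L) (cong suc eℓ))
                (holds-++ (Vec.toList accs) (holds-new eℓ hx))
                (holds-addrs accs (cong suc eℓ) (holds-∷ ha))
                (short-≤ CD (short-∷ (<⇒≤ wC) sx))
                (short-++ (short-≤ g≤D hg) (short-≤ CD sa))
                (≤-trans (+-monoʳ-≤ (m + suc ℓ) (≤-total-at (λ c → depths (body c)) c)) le)))
            (exec-sweep (Vec.toList news) [] (Vec.toList accs) (w ∷ L)
              (len news) (len accs) (trans (+-identityʳ _) (len news)) (cong suc eℓ) le′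
              (short-All (short-≤ news≤D news≤)) (short-All (short-≤ g≤D hg))))
          (exec-loop body es w eℓ hx ha sx sa (<⇒≤ wC) news≤ (≤-trans Cg (m≤n+m g _))
            (≤-trans (≤-reflexive (lem g d (length w * d)))
              (≤-trans (+-monoʳ-≤ g (+-monoˡ-≤ _ (≤-refl {d}))) gD))
            CD le le′ refl))
      where
      d = fn (⨁ (λ c → sizes (body c))) C
      it = 1 + (fn (⨁ (λ c → times (body c))) D + (m * (3 + 2 * D + 6 * D) + 1))
      news = ⟦ body c ⟧* (w ∷ xs) (accs Vec.++ as)
      len : (vs : Env m) → length (Vec.toList vs) ≡ m
      len vs = Vecₚ.length-toList vs
      g≤D : g ≤ D
      g≤D = ≤-trans (m≤m+n g _) gD
      lem : ∀ g d x → d + g + x ≡ g + (d + x)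
      lem = solve-∀
      news≤ : Short (d + g) news
      news≤ = short-≤ (+-monoˡ-≤ g (≤-⨁ (λ c → sizes (body c)) c C))
        (sizes-bound (body c) (short-∷ (<⇒≤ wC) sx) (short-++ hg (short-≤ Cg sa)))
      news≤D : d + g ≤ D
      news≤D = ≤-trans (≤-trans (≤-reflexive (+-comm d g)) (+-monoʳ-≤ g (m≤m+n d _))) gD

-- Expressions as Turing machines

last-lookup : ∀ {A : Set} {n} (xs : Vec A (suc n)) → Vec.last xs ≡ Vec.lookup xs (fromℕ n)
last-lookup {A} {n} xs with Vec.initLast xs
... | ys , y , refl = sym (lookup-∷ʳ ys)
  where
  lookup-∷ʳ : ∀ {n} {y : A} (ys : Vec A n) → Vec.lookup (ys Vec.∷ʳ y) (fromℕ n) ≡ y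
  lookup-∷ʳ []       = refl
  lookup-∷ʳ (_ ∷ ys) = lookup-∷ʳ ys

look-padded : ∀ {γ} n (L : List (Word γ)) → look (replicate n [] ++ L) ≗ look L
look-padded zero    L i = refl
look-padded (suc n) L i = trans (look-[] (replicate n [] ++ L) i) (look-padded n L i)

inject : ∀ {a γ} → a ≤ γ → Word a → Word γ
inject a≤γ = map (λ s → inject≤ s a≤γ)

module Realise {γ : ℕ} (e : Language.Exp γ 1 0) where
  open Language γ using (⟦_⟧)
  k = 3 + Language.depth γ e
  open Compiler γ k hiding (⟦_⟧)

  main : Prog
  -- The result lies on stack 1, above the input. Two moves bring it to the last stack in its
  -- original order; `k` is at least 3, so stack 2 is free for the detour.
  main = comp e 1 (0 ∷ []) [] ⨾ pour 1 2 ⨾ pour 2 k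

  mainTime : Poly
  mainTime = time e ⊕ ((con 1 ⊕ con 3 ⊗ out e) ⊕ (con 1 ⊕ con 3 ⊗ out e))

  exec-main : ∀ w → ∃[ L ] look L k ≡ ⟦ e ⟧ (w ∷ []) [] ×
              Exec main (fn mainTime (length w)) (w ∷ []) L
  exec-main w = (reverse (reverse u) ∷ zs) , final ,
    exec-⨾ (exec-comp e refl (holds-new refl holds-[]) holds-[]
             (short-∷ ≤-refl short-[]) short-[] (s≤s (≤-trans (n≤1+n _) (n≤1+n _))))
    (exec-⨾ (exec-≤ (+-monoʳ-≤ 1 (*-monoʳ-≤ 3 u≤))
        (exec-resp (λ i → sym (look-[] (u ∷ w ∷ []) i)) (λ i → sym (pad (reverse u) i))
          (exec-pour-up u [] (w ∷ []) {[]} (slot-eq refl 1≤k) (slot-eq refl 2≤k))))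
      (exec-≤ (+-monoʳ-≤ 1 (*-monoʳ-≤ 3 (≤-trans (≤-reflexive (Listₚ.length-reverse u)) u≤)))
        (exec-pour-up (reverse u) (replicate d []) ([] ∷ w ∷ []) {[]} (slot-eq refl 2≤k)
          (slot-eq len ≤-refl))))
    where
    d = Language.depth γ e
    u = ⟦ e ⟧ (w ∷ []) []
    zs = replicate d [] ++ [] ∷ [] ∷ w ∷ []
    u≤ = out-bound e {w ∷ []} (short-∷ ≤-refl short-[]) short-[]
    1≤k : 1 ≤ k
    1≤k = s≤s z≤n
    2≤k : 2 ≤ k
    2≤k = s≤s (s≤s z≤n)
    pad : ∀ v → look ([] ∷ replicate d [] ++ v ∷ [] ∷ w ∷ []) ≗ look (v ∷ [] ∷ w ∷ [])
    pad v i = trans (look-[] (replicate d [] ++ v ∷ [] ∷ w ∷ []) i) (look-padded d (v ∷ [] ∷ w ∷ []) i)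
    len : ∀ {v : Word γ} → k ≡ length (replicate d [] ++ v ∷ [] ∷ w ∷ [])
    len {v} = sym (trans (Listₚ.length-++ (replicate d [])) (trans
      (cong (_+ 3) (Listₚ.length-replicate d)) (+-comm d 3)))
    final : look (reverse (reverse u) ∷ zs) k ≡ u
    final = trans (subst (λ z → look (reverse (reverse u) ∷ zs) z ≡ reverse (reverse u)) (sym len)
      (look-top (reverse (reverse u)) zs)) (Listₚ.reverse-involutive u)

  module _ {a b : ℕ} (a≤γ : a ≤ γ) (b≤γ : b ≤ γ) where
    open TM (toTM main {a} {b} a≤γ b≤γ) using (runFor; HaltsWith; Outputs)

    steps : Poly
    steps = con 1 ⊕ mainTime

    Result : Word a → Config (length (elems (states main))) γ K → Set
    Result x c = readTape (Vec.last (Config.tapes c)) ≡ u ×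
      ∃[ f ] Config.control c ≡ halted (verdict main f) × (f ≡ nothing ⇔ u ≡ [])
      where u = ⟦ e ⟧ (inject a≤γ x ∷ []) []

    result : ∀ x {L} us → Rep L us → look L k ≡ ⟦ e ⟧ (inject a≤γ x ∷ []) [] →
      Result x (config (halted (verdict main (Vec.last (foci us)))) (apply (idle (foci us)) us))
    result x {L} us rep val =
      trans (cong readTape (trans (last-lookup ts′) (lookup-idle us (fromℕ k)))) reads-u ,
      Vec.last (foci us) , refl , mk⇔ to from
      where
      ts′ = apply (idle (foci us)) us
      u = ⟦ e ⟧ (inject a≤γ x ∷ []) []
      reads-u : readTape (Vec.lookup us (fromℕ k)) ≡ u
      reads-u = trans (reads rep (fromℕ k)) (trans (cong (look L) (Finₚ.toℕ-fromℕ k)) val)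
      focus-eq : Vec.last (foci us) ≡ Tape.focus (Vec.lookup us (fromℕ k))
      focus-eq = trans (last-lookup (foci us)) (focus-lookup us (fromℕ k))
      blank : ∀ (t : Tape γ) → Tape.focus t ≡ nothing → readTape t ≡ []
      blank (tape _ nothing _) eq = refl
      to : Vec.last (foci us) ≡ nothing → u ≡ []
      to eq = trans (sym reads-u) (blank (Vec.lookup us (fromℕ k)) (trans (sym focus-eq) eq))
      from : u ≡ [] → Vec.last (foci us) ≡ nothing
      from eq = trans focus-eq (readTape-[] (Vec.lookup us (fromℕ k)) (trans reads-u eq))

    halts-within : ∀ x n {t L} → look L k ≡ ⟦ e ⟧ (inject a≤γ x ∷ []) [] →
      Exec main t (inject a≤γ x ∷ []) L → t < n → Result x (runFor n x)
    halts-within x n val exec lt with run main a≤γ b≤γ exec x n lt refl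
    ... | us , rep , eq = subst (Result x) (sym eq) (result x us rep val)

    enough : ∀ x → fn mainTime (length (inject a≤γ x)) < eval (coeffs steps) (length x)
    enough x = ≤-trans
      (s≤s (mono mainTime (≤-reflexive (Listₚ.length-map (λ s → inject≤ s a≤γ) x))))
      (≤-reflexive (exact steps (length x)))

    halts : ∀ x → Result x (runFor (eval (coeffs steps) (length x)) x)
    halts x =
      let (L , val , exec) = exec-main (inject a≤γ x) in halts-within x _ val exec (enough x)

    computes : ∀ x c {y} → ⟦ e ⟧ (inject a≤γ x ∷ []) [] ≡ inject b≤γ y → Result x c →
               (∃[ v ] HaltsWith v c) × Outputs y c
    computes x c correct (out , f , ctl , _) = (_ , ctl) , trans out correct

    toPolyTime : (f : Word a → Word b) →
      (∀ x → ⟦ e ⟧ (inject a≤γ x ∷ []) [] ≡ inject b≤γ (f x)) → PolyTimeComputable f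
    toPolyTime f correct = toTM main a≤γ b≤γ , coeffs steps , λ x →
      computes x (runFor (eval (coeffs steps) (length x)) x) (correct x) (halts x)

  module _ {a : ℕ} (a≤γ : a ≤ γ) where

    Accepts : Language a
    Accepts x = ∃[ c ] ∃[ w ] ⟦ e ⟧ (inject a≤γ x ∷ []) [] ≡ c ∷ w

    classify : ∀ {v : Bool} {u : Word γ} {f : Cell γ} → (f ≡ nothing ⇔ u ≡ []) → v ≡ verdict main f →
      (v ≡ true × ∃[ c ] ∃[ w ] u ≡ c ∷ w) ⊎ (v ≡ false × ¬ (∃[ c ] ∃[ w ] u ≡ c ∷ w))
    classify {u = u} {nothing} iff eq =
      inj₂ (eq , λ (c , w , eq′) → case trans (sym eq′) (Equivalence.to iff refl) of λ ())
    classify {u = []}    {just s} iff eq = case Equivalence.from iff refl of λ ()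
    classify {u = c ∷ w} {just s} iff eq = inj₁ (eq , c , w , refl)

    decides : ∀ x c → Result a≤γ (z≤n {γ}) x c →
              (Config.control c ≡ halted true × Accepts x) ⊎ (Config.control c ≡ halted false × ¬ Accepts x)
    decides x c (_ , f , ctl , iff) with classify iff refl
    ... | inj₁ (v , acc) = inj₁ (trans ctl (cong halted v) , acc)
    ... | inj₂ (v , rej) = inj₂ (trans ctl (cong halted v) , rej)

    toP : P Accepts
    toP = toTM main a≤γ z≤n , coeffs (steps a≤γ (z≤n {γ})) , λ x →
      decides x (TM.runFor (toTM main {a} {0} a≤γ z≤n) (eval (coeffs (steps a≤γ (z≤n {γ}))) (length x)) x)
        (halts a≤γ (z≤n {γ}) x)

-- Area of a tiling

sumTo : ℕ → (ℕ → ℕ) → ℕ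
sumTo zero    f = 0
sumTo (suc n) f = f 0 + sumTo n (f ∘ suc)

sumTo-cong : ∀ n {f g} → (∀ i → i < n → f i ≡ g i) → sumTo n f ≡ sumTo n g
sumTo-cong zero    h = refl
sumTo-cong (suc n) h = cong₂ _+_ (h 0 (s≤s z≤n)) (sumTo-cong n (λ i lt → h (suc i) (s≤s lt)))

sumTo-const : ∀ n c → sumTo n (λ _ → c) ≡ n * c
sumTo-const zero    c = refl
sumTo-const (suc n) c = cong (c +_) (sumTo-const n c)

sumTo-+ : ∀ n f g → sumTo n (λ i → f i + g i) ≡ sumTo n f + sumTo n g
sumTo-+ zero    f g = refl
sumTo-+ (suc n) f g = trans (cong (f 0 + g 0 +_) (sumTo-+ n (f ∘ suc) (g ∘ suc)))
  (lem (f 0) (g 0) (sumTo n (f ∘ suc)) (sumTo n (g ∘ suc)))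
  where
  lem : ∀ a b x y → a + b + (x + y) ≡ a + x + (b + y)
  lem = solve-∀

sumTo-* : ∀ n c f → sumTo n (λ i → c * f i) ≡ c * sumTo n f
sumTo-* zero    c f = sym (*-zeroʳ c)
sumTo-* (suc n) c f = trans (cong (c * f 0 +_) (sumTo-* n c (f ∘ suc)))
  (sym (*-distribˡ-+ c (f 0) (sumTo n (f ∘ suc))))

sumTo-*ʳ : ∀ n c f → sumTo n (λ i → f i * c) ≡ sumTo n f * c
sumTo-*ʳ n c f = trans (sumTo-cong n (λ i _ → *-comm (f i) c))
  (trans (sumTo-* n c f) (*-comm c (sumTo n f)))

-- The indicator function of the half-open interval from `a` to `a + l`, by recursion so that it can
-- be summed.
interval : ℕ → ℕ → ℕ → ℕ
interval zero    zero    x       = 0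
interval zero    (suc l) zero    = 1
interval zero    (suc l) (suc x) = interval zero l x
interval (suc a) l       zero    = 0
interval (suc a) l       (suc x) = interval a l x

interval-in : ∀ a l x → a ≤ x → x < a + l → interval a l x ≡ 1
interval-in zero    (suc l) zero    _        _        = refl
interval-in zero    (suc l) (suc x) _        (s≤s lt) = interval-in zero l x z≤n lt
interval-in (suc a) l       (suc x) (s≤s le) (s≤s lt) = interval-in a l x le lt

interval-out : ∀ a l x → ¬ (a ≤ x × x < a + l) → interval a l x ≡ 0
interval-out zero    zero    x       h = refl
interval-out zero    (suc l) zero    h = ⊥-elim (h (z≤n , s≤s z≤n))
interval-out zero    (suc l) (suc x) h = interval-out zero l x (λ (_ , lt) → h (z≤n , s≤s lt))
interval-out (suc a) l       zero    h = refl
interval-out (suc a) l       (suc x) h = interval-out a l x (λ (le , lt) → h (s≤s le , s≤s lt))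

sumTo-interval : ∀ n a l → a + l ≤ n → sumTo n (interval a l) ≡ l
sumTo-interval n       zero    zero    le       = trans (sumTo-const n 0) (*-zeroʳ n)
sumTo-interval (suc n) zero    (suc l) (s≤s le) = cong suc (sumTo-interval n zero l le)
sumTo-interval (suc n) (suc a) l       (s≤s le) = sumTo-interval n a l le

module _ (r c : ℕ) where

  covers? : ∀ t → Dec (Covers r c t)
  covers? t = ((row ≤? r) ×-dec (r <? row + height)) ×-dec ((col ≤? c) ×-dec (c <? col + width))
    where open Tile t

  indicator : Tile → ℕ
  indicator t = interval row height r * interval col width c
    where open Tile t

  indicator-1 : ∀ {t} → Covers r c t → indicator t ≡ 1
  indicator-1 {t} ((r₁ , r₂) , (c₁ , c₂)) =
    cong₂ _*_ (interval-in row height r r₁ r₂) (interval-in col width c c₁ c₂)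
    where open Tile t

  indicator-0 : ∀ {t} → ¬ Covers r c t → indicator t ≡ 0
  indicator-0 {t} ¬cov with (row ≤? r) ×-dec (r <? row + height)
    where open Tile t
  ... | no ¬r = cong (_* interval (Tile.col t) (Tile.width t) c)
                  (interval-out (Tile.row t) (Tile.height t) r ¬r)
  ... | yes i = trans (cong (interval (Tile.row t) (Tile.height t) r *_)
                  (interval-out (Tile.col t) (Tile.width t) c (λ j → ¬cov (i , j)))) (*-zeroʳ (interval (Tile.row t) (Tile.height t) r))

  count-0 : ∀ {s ts} → Covers r c s → All (Disjoint s) ts → sum (map indicator ts) ≡ 0
  count-0 cov []       = refl
  count-0 cov (d ∷ ds) = cong₂ _+_ (indicator-0 (λ cov′ → d r c (cov , cov′))) (count-0 cov ds)

  count-1 : ∀ {ts} → Any (Covers r c) ts → AllPairs Disjoint ts → sum (map indicator ts) ≡ 1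
  count-1 {t ∷ ts} any (d ∷ ds) with covers? t
  ... | yes cov = cong₂ _+_ (indicator-1 cov) (count-0 cov d)
  ... | no ¬cov with any
  ...   | here cov  = contradiction cov ¬cov
  ...   | there any = cong₂ _+_ (indicator-0 ¬cov) (count-1 any ds)

area : Shape → ℕ
area (h by w) = h * w

sum-indicator : ∀ {n m t} → InRectangle n m t →
  sumTo n (λ r → sumTo m (λ c → indicator r c t)) ≡ area (Tile.shape t)
sum-indicator {n} {m} {t} inside = trans
  (sumTo-cong n (λ r _ → trans (sumTo-* m (interval row height r) (interval col width))
    (cong (interval row height r *_) (sumTo-interval m col width side))))
  (trans (sumTo-*ʳ n width (interval row height)) (cong (_* width) (sumTo-interval n row height top)))
  where
  open Tile t
  open InRectangle inside

sum-areas : ∀ {n m ts} → All (InRectangle n m) ts →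
  sumTo n (λ r → sumTo m (λ c → sum (map (indicator r c) ts))) ≡ sum (map area (shapes ts))
sum-areas {n} {m} [] = trans (sumTo-cong n (λ _ _ → trans (sumTo-const m 0) (*-zeroʳ m)))
  (trans (sumTo-const n 0) (*-zeroʳ n))
sum-areas {n} {m} {t ∷ ts} (i ∷ is) = trans
  (sumTo-cong n (λ r _ → sumTo-+ m (λ c → indicator r c t) (λ c → sum (map (indicator r c) ts))))
  (trans (sumTo-+ n _ _) (cong₂ _+_ (sum-indicator i) (sum-areas is)))

-- Double counting of the pairs of a tile and a cell covered by it: every tile contributes its area,
-- every cell contributes 1.
tiling-area : ∀ {n m ts} → IsTiling n m ts → sum (map area (shapes ts)) ≡ n * m
tiling-area {n} {m} {ts} tiling = trans (sym (sum-areas inside))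
  (trans (sumTo-cong n (λ r r<n → trans
    (sumTo-cong m (λ c c<m → count-1 r c (covering r c r<n c<m) disjoint)) (trans (sumTo-const m 1) (*-identityʳ m))))
  (sumTo-const n m))
  where open IsTiling tiling

tiling-bounded : ∀ {n m n′ m′ ts} → 0 < n → 0 < m → IsTiling n m ts → IsTiling n′ m′ ts → n ≤ n′ × m ≤ m′
tiling-bounded {suc n} {suc m} {n′} {m′} {ts} _ _ tiling tiling′ =
  go (IsTiling.covering tiling n m ≤-refl ≤-refl) (IsTiling.inside tiling′)
  where
  go : ∀ {ts} → Any (Covers n m) ts → All (InRectangle n′ m′) ts → suc n ≤ n′ × suc m ≤ m′
  go (here ((_ , r) , (_ , c))) (i ∷ _) =
    ≤-trans r (InRectangle.top i) , ≤-trans c (InRectangle.side i)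
  go (there any) (_ ∷ is) = go any is

-- An input word does not mention the rectangle. It is determined nevertheless, because the tile at
-- the top right corner of either rectangle has to lie in the other.
tiling-dimensions : ∀ {n m n′ m′ ts} → 0 < n → 0 < m → 0 < n′ → 0 < m′ →
  IsTiling n m ts → IsTiling n′ m′ ts → n ≡ n′ × m ≡ m′
tiling-dimensions p q p′ q′ t t′ with tiling-bounded p q t t′ | tiling-bounded p′ q′ t′ t
... | a , b | a′ , b′ = ≤-antisym a a′ , ≤-antisym b b′

-- Interleavings and sublists with a given sum

data Split {A : Set} : List A → List A → List A → Set where
  []  : Split [] [] []
  inˡ : ∀ {x xs ys zs} → Split xs ys zs → Split (x ∷ xs) ys (x ∷ zs)
  inʳ : ∀ {y xs ys zs} → Split xs ys zs → Split xs (y ∷ ys) (y ∷ zs)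

split-++ : ∀ {A : Set} (xs ys : List A) → Split xs ys (xs ++ ys)
split-++ []       []       = []
split-++ []       (y ∷ ys) = inʳ (split-++ [] ys)
split-++ (x ∷ xs) ys       = inˡ (split-++ xs ys)

-- Each element keeps its side while it is followed through the permutation. Thus a juxtaposition,
-- which is known up to order only, tells for each tile of the original list on which side it ends
-- up.
split-↭ : ∀ {A : Set} {xs ys zs ws : List A} → zs ↭ ws → Split xs ys ws →
          ∃[ xs′ ] ∃[ ys′ ] Split xs′ ys′ zs × xs′ ↭ xs × ys′ ↭ ys
split-↭ Perm.refl s = _ , _ , s , Perm.refl , Perm.refl
split-↭ (Perm.prep x p) (inˡ s) with split-↭ p s
... | _ , _ , s′ , l , r = _ , _ , inˡ s′ , Perm.prep x l , r
split-↭ (Perm.prep x p) (inʳ s) with split-↭ p s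
... | _ , _ , s′ , l , r = _ , _ , inʳ s′ , l , Perm.prep x r
split-↭ (Perm.swap x y p) (inˡ (inˡ s)) with split-↭ p s
... | _ , _ , s′ , l , r = _ , _ , inˡ (inˡ s′) , Perm.swap x y l , r
split-↭ (Perm.swap x y p) (inˡ (inʳ s)) with split-↭ p s
... | _ , _ , s′ , l , r = _ , _ , inʳ (inˡ s′) , Perm.prep y l , Perm.prep x r
split-↭ (Perm.swap x y p) (inʳ (inˡ s)) with split-↭ p s
... | _ , _ , s′ , l , r = _ , _ , inˡ (inʳ s′) , Perm.prep x l , Perm.prep y r
split-↭ (Perm.swap x y p) (inʳ (inʳ s)) with split-↭ p s
... | _ , _ , s′ , l , r = _ , _ , inʳ (inʳ s′) , l , Perm.swap x y r
split-↭ (Perm.trans p q) s with split-↭ q s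
... | _ , _ , s′ , l , r with split-↭ p s′
... | _ , _ , s″ , l′ , r′ = _ , _ , s″ , Perm.trans l′ l , Perm.trans r′ r

data Subsum : List ℕ → ℕ → Set where
  []   : Subsum [] 0
  take : ∀ {a as t} → Subsum as t → Subsum (a ∷ as) (a + t)
  skip : ∀ {a as t} → Subsum as t → Subsum (a ∷ as) t

Subsum-↭ : ∀ {as t} → Subsum as t → ∃[ bs ] ∃[ cs ] as ↭ bs ++ cs × sum bs ≡ t
Subsum-↭ [] = [] , [] , Perm.refl , refl
Subsum-↭ (take {a} s) with Subsum-↭ s
... | bs , cs , p , eq = a ∷ bs , cs , Perm.prep a p , cong (a +_) eq
Subsum-↭ (skip {a} s) with Subsum-↭ s
... | bs , cs , p , eq = bs , a ∷ cs , Perm.trans (Perm.prep a p) (Perm.↭-sym (Permₚ.shift a bs cs)) , eq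

-- From subset sums to tilings

disjoint-cols : ∀ {s t} → Tile.col s + Tile.width s ≤ Tile.col t → Disjoint s t
disjoint-cols le r c ((_ , (_ , lt)) , (_ , (ge , _))) = <⇒≱ lt (≤-trans le ge)

disjoint-rows : ∀ {s t} → Tile.row s + Tile.height s ≤ Tile.row t → Disjoint s t
disjoint-rows le r c (((_ , lt) , _) , ((ge , _) , _)) = <⇒≱ lt (≤-trans le ge)

disjoint-sym : ∀ {s t} → Disjoint s t → Disjoint t s
disjoint-sym d r c (x , y) = d r c (y , x)

covers-shift : ∀ {r c m t} → Covers r c t → Covers r (m + c) (shiftRight m t)
covers-shift {c = c} {m} {(h by w) at r′ , c′} (rs , (c₁ , c₂)) =
  rs , (+-monoʳ-≤ m c₁ , ≤-trans (≤-reflexive (sym (+-suc m c)))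
         (≤-trans (+-monoʳ-≤ m c₂) (≤-reflexive (sym (+-assoc m c′ w)))))

juxtaposition : ∀ {n m′ m″ as bs} → IsTiling n m′ as → IsTiling n m″ bs →
                IsTiling n (m′ + m″) (as ++ map (shiftRight m′) bs)
juxtaposition {n} {m′} {m″} {as} {bs} ta tb = record
  { inside   = Allₚ.++⁺ (All.map widen (inside ta)) (Allₚ.map⁺ (All.map shift (inside tb)))
  ; covering = covering′
  ; disjoint = AllPairsₚ.++⁺ (disjoint ta) (AllPairsₚ.map⁺ (AllPairs.map shift-disjoint (disjoint tb)))
      (All.map (λ i → Allₚ.map⁺ (All.map (λ {t} _ → disjoint-cols (≤-trans (InRectangle.side i)
        (m≤m+n m′ (Tile.col t)))) (inside tb))) (inside ta))
  }
  where
  open IsTiling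
  widen : ∀ {t} → InRectangle n m′ t → InRectangle n (m′ + m″) t
  widen i = record { InRectangle i ; side = ≤-trans (InRectangle.side i) (m≤m+n m′ m″) }
  shift : ∀ {t} → InRectangle n m″ t → InRectangle n (m′ + m″) (shiftRight m′ t)
  shift {t} i = record { InRectangle i ; side =
    ≤-trans (≤-reflexive (+-assoc m′ (Tile.col t) (Tile.width t))) (+-monoʳ-≤ m′ (InRectangle.side i)) }
  shift-disjoint : ∀ {s t} → Disjoint s t → Disjoint (shiftRight m′ s) (shiftRight m′ t)
  shift-disjoint {(h by w) at r , a} {(h′ by w′) at r′ , a′} d i j ((ri , (le , lt)) , (ri′ , (le′ , lt′)))
    with m≤n⇒∃[o]m+o≡n (≤-trans (m≤m+n m′ a) le)
  ... | o , refl = d i o ((ri , +-cancelˡ-≤ m′ _ _ le , un lt) , (ri′ , +-cancelˡ-≤ m′ _ _ le′ , un lt′))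
    where
    un : ∀ {x y} → m′ + o < m′ + x + y → o < x + y
    un {x} {y} lt = +-cancelˡ-< m′ _ _ (≤-trans lt (≤-reflexive (+-assoc m′ x y)))
  covering′ : ∀ r c → r < n → c < m′ + m″ → Any (Covers r c) (as ++ map (shiftRight m′) bs)
  covering′ r c r<n c<m with c <? m′
  ... | yes c<m′ = Anyₚ.++⁺ˡ (covering ta r c r<n c<m′)
  ... | no c≮m′ with m≤n⇒∃[o]m+o≡n (≮⇒≥ c≮m′)
  ...   | o , refl = Anyₚ.++⁺ʳ as (Anyₚ.map⁺ (Any.map (λ {t} → covers-shift {m = m′} {t})
                       (covering tb r o r<n (+-cancelˡ-< m′ _ _ c<m))))

shapes-shiftRight : ∀ d ts → shapes (map (shiftRight d) ts) ≡ shapes ts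
shapes-shiftRight d ts = sym (Listₚ.map-∘ ts)

-- The row grows to the right as the list grows at its head, so that adding a number moves no tile.
-- A program can write the row while summing up the numbers.
row₀ : List ℕ → List Tile
row₀ []       = []
row₀ (a ∷ as) = ((1 by a) at 0 , sum as) ∷ row₀ as

shapes-row₀ : ∀ as → shapes (row₀ as) ≡ map (1 by_) as
shapes-row₀ []       = refl
shapes-row₀ (a ∷ as) = cong ((1 by a) ∷_) (shapes-row₀ as)

row₀-inside : ∀ {n m} as → 0 < n → sum as ≤ m → All (0 <_) as → All (InRectangle n m) (row₀ as)
row₀-inside []       n>0 le []         = []
row₀-inside (a ∷ as) n>0 le (a>0 ∷ ps) = record
  { height>0 = s≤s z≤n ; width>0 = a>0 ; top = n>0 ; side = ≤-trans (≤-reflexive (+-comm (sum as) a)) le }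
  ∷ row₀-inside as n>0 (≤-trans (m≤n+m _ a) le) ps

row₀-covering : ∀ c as → c < sum as → Any (Covers 0 c) (row₀ as)
row₀-covering c (a ∷ as) lt with c <? sum as
... | yes lt′ = there (row₀-covering c as lt′)
... | no ge   = here ((z≤n , s≤s z≤n) , (≮⇒≥ ge , ≤-trans lt (≤-reflexive (+-comm a (sum as)))))

row₀-left : ∀ as {m} → sum as ≤ m → All (λ t → Tile.col t + Tile.width t ≤ m) (row₀ as)
row₀-left []       le = []
row₀-left (a ∷ as) le = ≤-trans (≤-reflexive (+-comm (sum as) a)) le ∷
  row₀-left as (≤-trans (m≤n+m _ a) le)

row₀-disjoint : ∀ as → AllPairs Disjoint (row₀ as)
row₀-disjoint []       = []
row₀-disjoint (a ∷ as) = All.map (λ le → disjoint-sym (disjoint-cols le)) (row₀-left as ≤-refl) ∷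
  row₀-disjoint as

row₀-low : ∀ as → All (λ t → Tile.row t + Tile.height t ≤ 1) (row₀ as)
row₀-low []       = []
row₀-low (a ∷ as) = ≤-refl ∷ row₀-low as

module _ {H : ℕ} (H>0 : 0 < H) where

  half-tiling : ∀ {S} as → sum as ≡ S → 0 < S → All (0 <_) as →
                IsTiling (suc H) S (((H by S) at 1 , 0) ∷ row₀ as)
  half-tiling {S} as refl S>0 pos = record
    { inside   = record { height>0 = H>0 ; width>0 = S>0 ; top = ≤-refl ; side = ≤-refl } ∷
                 row₀-inside as (s≤s z≤n) ≤-refl pos
    ; covering = λ { zero    c _  lt → there (row₀-covering c as lt)
                   ; (suc r) c lt lt′ → here ((s≤s z≤n , lt) , (z≤n , lt′)) }
    ; disjoint = All.map (λ le → disjoint-sym (disjoint-rows le)) (row₀-low as) ∷ row₀-disjoint as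
    }

  module _ {S : ℕ} (S>0 : 0 < S) where

    instanceTiling : List ℕ → List Tile
    instanceTiling as = ((H by S) at 1 , 0) ∷ ((H by S) at 1 , S) ∷ row₀ as

    instance-tiling : ∀ as → sum as ≡ S + S → All (0 <_) as → IsTiling (suc H) (S + S) (instanceTiling as)
    instance-tiling as eq pos = record
      { inside   = record { height>0 = H>0 ; width>0 = S>0 ; top = ≤-refl ; side = m≤m+n S S } ∷
                   record { height>0 = H>0 ; width>0 = S>0 ; top = ≤-refl ; side = ≤-refl } ∷
                   row₀-inside as (s≤s z≤n) (≤-reflexive eq) pos
      ; covering = covering
      ; disjoint = (disjoint-cols ≤-refl ∷ low) ∷ low ∷ row₀-disjoint as
      }
      where
      low : ∀ {s c} → All (Disjoint (s at 1 , c)) (row₀ as)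
      low = All.map (λ le → disjoint-sym (disjoint-rows le)) (row₀-low as)
      covering : ∀ r c → r < suc H → c < S + S → Any (Covers r c) (instanceTiling as)
      covering zero    c _  lt′ = there (there (row₀-covering c as (subst (c <_) (sym eq) lt′)))
      covering (suc r) c lt lt′ with c <? S
      ... | yes c<S = here ((s≤s z≤n , lt) , (z≤n , c<S))
      ... | no c≮S  = there (here ((s≤s z≤n , lt) , (≮⇒≥ c≮S , lt′)))

module SubsetSum {as : List ℕ} {T H : ℕ} (pos : All (0 <_) as) (T>0 : 0 < T) where
  A = sum as
  S = A + T

  module _ (big : S + S < H) where

    H>0 : 0 < H
    H>0 = ≤-<-trans z≤n big

    S>0 : 0 < S
    S>0 = ≤-trans T>0 (m≤n+m T A)

    -- The usual passage from subset sum to partition: the total is twice `S`, and as `A` and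
    -- `T + T` together exceed `S`, a partition into equal halves separates them.
    row : List ℕ
    row = A ∷ T + T ∷ as

    tiles : List Tile
    tiles = instanceTiling H>0 S>0 row

    row-sum : sum row ≡ S + S
    row-sum = lem A T
      where
      lem : ∀ a t → a + (t + t + a) ≡ a + t + (a + t)
      lem = solve-∀

    module _ (A>0 : 0 < A) where

      row-pos : All (0 <_) row
      row-pos = A>0 ∷ ≤-trans T>0 (m≤m+n T T) ∷ pos

      tiles-tiling : IsTiling (suc H) (S + S) tiles
      tiles-tiling = instance-tiling H>0 S>0 row row-sum row-pos

      Subsum⇒subtiling : Subsum as T → AdmitsSubtiling (suc H) (S + S) tiles
      Subsum⇒subtiling sub with Subsum-↭ sub
      ... | bs , cs , p , eq = _ , (juxtaposition left-half right-half , perm) ,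
        S , S , refl , S>0 , S>0 , _ , _ , left-half , right-half , Perm.refl
        where
        pos′ = Allₚ.++⁻ bs (Permₚ.All-resp-↭ p pos)
        total≡ : A ≡ T + sum cs
        total≡ = trans (sum-↭ p) (trans (sum-++ bs cs) (cong (_+ sum cs) eq))
        left-half : IsTiling (suc H) S (((H by S) at 1 , 0) ∷ row₀ (A ∷ bs))
        left-half = half-tiling H>0 (A ∷ bs) (cong (A +_) eq) S>0 (A>0 ∷ proj₁ pos′)
        right-half : IsTiling (suc H) S (((H by S) at 1 , 0) ∷ row₀ (T + T ∷ cs))
        right-half = half-tiling H>0 (T + T ∷ cs)
          (trans (lem T (sum cs)) (cong (_+ T) (sym total≡))) S>0
          (≤-trans T>0 (m≤m+n T T) ∷ proj₂ pos′)
          where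
          lem : ∀ t c → t + t + c ≡ t + c + t
          lem = solve-∀
        B = H by S
        perm : shapes ((((H by S) at 1 , 0) ∷ row₀ (A ∷ bs)) ++
                 map (shiftRight S) (((H by S) at 1 , 0) ∷ row₀ (T + T ∷ cs))) ↭ shapes tiles
        perm = begin
          shapes ((((H by S) at 1 , 0) ∷ row₀ (A ∷ bs)) ++ map (shiftRight S) (((H by S) at 1 , 0) ∷ row₀ (T + T ∷ cs)))
            ≡⟨ trans (Listₚ.map-++ Tile.shape (((H by S) at 1 , 0) ∷ row₀ (A ∷ bs)) _)
                (cong₂ _++_ (cong (B ∷_) (shapes-row₀ (A ∷ bs)))
                  (trans (shapes-shiftRight S (((H by S) at 1 , 0) ∷ row₀ (T + T ∷ cs))) (cong (B ∷_) (shapes-row₀ (T + T ∷ cs))))) ⟩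
          B ∷ map (1 by_) (A ∷ bs) ++ B ∷ map (1 by_) (T + T ∷ cs)
            ↭⟨ Perm.prep B (Permₚ.shift B (map (1 by_) (A ∷ bs)) _) ⟩
          B ∷ B ∷ (1 by A) ∷ map (1 by_) bs ++ (1 by (T + T)) ∷ map (1 by_) cs
            ↭⟨ Perm.prep B (Perm.prep B (Perm.prep (1 by A) (Permₚ.shift (1 by (T + T)) (map (1 by_) bs) _))) ⟩
          B ∷ B ∷ (1 by A) ∷ (1 by (T + T)) ∷ map (1 by_) bs ++ map (1 by_) cs
            ≡⟨ cong (λ z → B ∷ B ∷ (1 by A) ∷ (1 by (T + T)) ∷ z) (sym (Listₚ.map-++ (1 by_) bs cs)) ⟩
          B ∷ B ∷ map (1 by_) (A ∷ T + T ∷ bs ++ cs)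
            ↭⟨ Perm.prep B (Perm.prep B (Permₚ.map⁺ (1 by_) (Perm.prep A (Perm.prep (T + T) (Perm.↭-sym p))))) ⟩
          B ∷ B ∷ map (1 by_) row
            ≡⟨ cong (λ z → B ∷ B ∷ z) (sym (shapes-row₀ row)) ⟩
          shapes tiles ∎
          where open Perm.PermutationReasoning

-- From tilings to subset sums

data Parts : List ℕ → ℕ → ℕ → Set where
  []  : Parts [] 0 0
  inˡ : ∀ {a as p q} → Parts as p q → Parts (a ∷ as) (a + p) q
  inʳ : ∀ {a as p q} → Parts as p q → Parts (a ∷ as) p (a + q)

Parts-sum : ∀ {as p q} → Parts as p q → p + q ≡ sum as
Parts-sum [] = refl
Parts-sum (inˡ {a} {p = p} {q} s) = trans (+-assoc a p q) (cong (a +_) (Parts-sum s))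
Parts-sum (inʳ {a} {p = p} {q} s) = trans (lem p a q) (cong (a +_) (Parts-sum s))
  where
  lem : ∀ p a q → p + (a + q) ≡ a + (p + q)
  lem = solve-∀

Parts-Subsum : ∀ {as p q} → Parts as p q → Subsum as p × Subsum as q
Parts-Subsum []      = [] , []
Parts-Subsum (inˡ s) = let (l , r) = Parts-Subsum s in take l , skip r
Parts-Subsum (inʳ s) = let (l , r) = Parts-Subsum s in skip l , take r

area-rotated : ∀ {s s′} → RotatedCopy s s′ → area s ≡ area s′
area-rotated unturned         = refl
area-rotated (turned {h} {w}) = *-comm h w

-- A low tile has its length as area, turned or not. So areas alone reveal the sums of the numbers
-- on both sides, and where the low tiles lie is irrelevant.
low-parts : ∀ {as ss ls rs} → Pointwise RotatedCopy (map (1 by_) as) ss → Split ls rs ss →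
            Parts as (sum (map area ls)) (sum (map area rs))
low-parts {[]} [] [] = []
low-parts {a ∷ as} {ls = l ∷ ls} (rot ∷ rots) (inˡ s) = subst (λ z → Parts (a ∷ as) (z + _) _)
  (trans (sym (*-identityˡ a)) (area-rotated rot)) (inˡ (low-parts rots s))
low-parts {a ∷ as} {rs = r ∷ rs} (rot ∷ rots) (inʳ s) = subst (λ z → Parts (a ∷ as) _ (z + _))
  (trans (sym (*-identityˡ a)) (area-rotated rot)) (inʳ (low-parts rots s))

Fits : ℕ → ℕ → Shape → Set
Fits n m s = Shape.height s ≤ n × Shape.width s ≤ m

inside-fits : ∀ {n m ts} → All (InRectangle n m) ts → All (Fits n m) (shapes ts)
inside-fits [] = []
inside-fits {ts = t ∷ ts} (i ∷ is) =
  (≤-trans (m≤n+m _ (Tile.row t)) (InRectangle.top i) ,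
   ≤-trans (m≤n+m _ (Tile.col t)) (InRectangle.side i)) ∷ inside-fits is

rearrangement-with-rotations : ∀ {n m ts ss} → Rearrangement n m ts ss → RearrangementWithRotations n m ts ss
rearrangement-with-rotations (tiling , p) = tiling , _ , unrotated _ , p
  where
  unrotated : ∀ ss → Pointwise RotatedCopy ss ss
  unrotated []       = []
  unrotated (_ ∷ ss) = unturned ∷ unrotated ss

-- Keeps just two consequences of a subtiling, which suffice for the converse: every tile fits into
-- its side, and the areas add up to the areas of the sides.
subtiling-sides : ∀ {n m ts} → AdmitsSubtilingWithRotations n m ts →
  ∃[ m′ ] ∃[ m″ ] m ≡ m′ + m″ × 0 < m′ × 0 < m″ × ∃[ ss ] ∃[ ls ] ∃[ rs ]
    Pointwise RotatedCopy (shapes ts) ss × Split ls rs ss ×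
    All (Fits n m′) ls × All (Fits n m″) rs ×
    sum (map area ls) ≡ n * m′ × sum (map area rs) ≡ n * m″
subtiling-sides (ss , (_ , T′ , rot , p) , m′ , m″ , eq , m′>0 , m″>0 , as , bs , ta , tb , q)
  with split-↭ (Perm.trans (Perm.↭-sym p) (Perm.trans (Permₚ.map⁺ Tile.shape q)
    (Perm.↭-reflexive (trans (Listₚ.map-++ Tile.shape as _)
      (cong (shapes as ++_) (shapes-shiftRight m′ bs)))))) (split-++ (shapes as) (shapes bs))
... | ls , rs , s , l , r = m′ , m″ , eq , m′>0 , m″>0 , T′ , ls , rs , rot , s ,
  Permₚ.All-resp-↭ (Perm.↭-sym l) (inside-fits (IsTiling.inside ta)) ,
  Permₚ.All-resp-↭ (Perm.↭-sym r) (inside-fits (IsTiling.inside tb)) ,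
  trans (sum-↭ (Permₚ.map⁺ area l)) (tiling-area ta) ,
  trans (sum-↭ (Permₚ.map⁺ area r)) (tiling-area tb)

module _ {as : List ℕ} {T H : ℕ} (pos : All (0 <_) as) (T>0 : 0 < T) (A>0 : 0 < sum as)
         (big : (sum as + T) + (sum as + T) < H) where
  open SubsetSum {as} {T} {H} pos T>0

  parts⇒Subsum : ∀ {p q} → Parts (row big) p q → p ≡ S → q ≡ S → Subsum as T
  parts⇒Subsum (inˡ (inˡ {p = p} s)) e e′ = ⊥-elim (<-irrefl (sym (+-cancelˡ-≡ A _ _ e))
    (<-≤-trans (m<m+n T T>0) (m≤m+n (T + T) p)))
  parts⇒Subsum (inˡ (inʳ s)) e e′ = subst (Subsum as) (+-cancelˡ-≡ A _ _ e) (proj₁ (Parts-Subsum s))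
  parts⇒Subsum (inʳ (inˡ s)) e e′ = subst (Subsum as) (+-cancelˡ-≡ A _ _ e′) (proj₂ (Parts-Subsum s))
  parts⇒Subsum (inʳ (inʳ {q = q} s)) e e′ = ⊥-elim (<-irrefl (sym (+-cancelˡ-≡ A _ _ e′))
    (<-≤-trans (m<m+n T T>0) (m≤m+n (T + T) q)))

  big-unturned : ∀ {s n m} → RotatedCopy (H by S) s → Fits n m s → m ≤ S + S → s ≡ H by S
  big-unturned unturned fits m≤ = refl
  big-unturned turned   fits m≤ = ⊥-elim (<⇒≱ big (≤-trans (proj₂ fits) m≤))

  -- A side without a big tile has too little area for its height.

  no-big : ∀ {p q m} → Parts (row big) p q → p ≡ suc H * m → 0 < m → ⊥
  no-big {p} {q} {suc m} s eq m>0 = <⇒≱ big (≤-trans (n≤1+n H) (≤-trans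
    (≤-trans (m≤m+n (suc H) _) (≤-reflexive (trans (sym (*-suc (suc H) m)) (sym eq))))
    (≤-trans (m≤m+n p q) (≤-reflexive (trans (Parts-sum s) (row-sum big))))))

  one-each : ∀ {m′ m″ p q} → S + S ≡ m′ + m″ → S ≤ m′ → S ≤ m″ → Parts (row big) p q →
    H * S + p ≡ suc H * m′ → H * S + q ≡ suc H * m″ → Subsum as T
  one-each {m′} {m″} eq le le′ s al ar with ≤-antisym le (+-cancelʳ-≤ S m′ S
      (≤-trans (+-monoʳ-≤ m′ le′) (≤-reflexive (sym eq))))
  ... | refl with +-cancelˡ-≡ S S m″ eq
  ... | refl = parts⇒Subsum s (cancel al) (cancel ar)
    where
    cancel : ∀ {p} → H * S + p ≡ suc H * S → p ≡ S
    cancel {p} e = +-cancelˡ-≡ (H * S) p S (trans e (+-comm S (H * S)))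

  -- Hence both sides have exactly one big tile and width S, and comparing
  -- areas, the low tiles on each side have total length S.

  sides⇒Subsum : ∀ {m′ m″ ss ls rs} → S + S ≡ m′ + m″ → 0 < m′ → 0 < m″ →
    Pointwise RotatedCopy ((H by S) ∷ (H by S) ∷ map (1 by_) (row big)) ss → Split ls rs ss →
    All (Fits (suc H) m′) ls → All (Fits (suc H) m″) rs →
    sum (map area ls) ≡ suc H * m′ → sum (map area rs) ≡ suc H * m″ → Subsum as T
  sides⇒Subsum {m′} {m″} eq p p′ (r₁ ∷ r₂ ∷ rots) s fl fr al ar
    with ≤-trans (m≤m+n m′ m″) (≤-reflexive (sym eq)) | ≤-trans (m≤n+m m″ m′) (≤-reflexive (sym eq))
  sides⇒Subsum eq p p′ (r₁ ∷ r₂ ∷ rots) (inˡ (inˡ s)) fl fr al ar | m′≤ | m″≤ =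
    ⊥-elim (no-big (swap-parts (low-parts rots s)) ar p′)
    where
    swap-parts : ∀ {xs p q} → Parts xs p q → Parts xs q p
    swap-parts []      = []
    swap-parts (inˡ s) = inʳ (swap-parts s)
    swap-parts (inʳ s) = inˡ (swap-parts s)
  sides⇒Subsum eq p p′ (r₁ ∷ r₂ ∷ rots) (inʳ (inʳ s)) fl fr al ar | m′≤ | m″≤ =
    ⊥-elim (no-big (low-parts rots s) al p)
  sides⇒Subsum eq p p′ (r₁ ∷ r₂ ∷ rots) (inˡ (inʳ s)) (f ∷ _) (f′ ∷ _) al ar | m′≤ | m″≤
    with big-unturned r₁ f m′≤ | big-unturned r₂ f′ m″≤
  ... | refl | refl = one-each eq (proj₂ f) (proj₂ f′) (low-parts rots s) al ar
  sides⇒Subsum eq p p′ (r₁ ∷ r₂ ∷ rots) (inʳ (inˡ s)) (f ∷ _) (f′ ∷ _) al ar | m′≤ | m″≤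
    with big-unturned r₂ f m′≤ | big-unturned r₁ f′ m″≤
  ... | refl | refl = one-each eq (proj₂ f) (proj₂ f′) (low-parts rots s) al ar

  subtiling⇒Subsum : ∀ {n m} → 0 < n → 0 < m → IsTiling n m (tiles big) →
    AdmitsSubtilingWithRotations n m (tiles big) → Subsum as T
  subtiling⇒Subsum n>0 m>0 tiling sub
    with tiling-dimensions {n′ = suc H} n>0 m>0 (s≤s z≤n) (≤-trans (S>0 big) (m≤m+n S S)) tiling (tiles-tiling big A>0)
  ... | refl , refl with subtiling-sides {suc H} {S + S} {tiles big} sub
  ... | m′ , m″ , eq , p , p′ , ss , ls , rs , rot , s , fl , fr , al , ar =
    sides⇒Subsum eq p p′
      (subst (λ z → Pointwise RotatedCopy ((H by S) ∷ (H by S) ∷ z) ss) (shapes-row₀ (row big)) rot)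
      s fl fr al ar

-- Digits, and subset sums of concatenations and multiples

digits-unique : ∀ B {a a′ b b′} → a < B → a′ < B → a + B * b ≡ a′ + B * b′ → a ≡ a′ × b ≡ b′
digits-unique (suc B) {a} {a′} {b} {b′} lt lt′ eq = a≡a′ ,
  *-cancelˡ-≡ b b′ (suc B) (+-cancelˡ-≡ a _ _ (trans eq (cong (_+ suc B * b′) (sym a≡a′))))
  where
  mod : ∀ {a} b → a < suc B → (a + suc B * b) DivMod.% suc B ≡ a
  mod {a} b lt = trans (cong (λ z → (a + z) DivMod.% suc B) (*-comm (suc B) b))
    (trans (DivMod.[m+kn]%n≡m%n a b (suc B)) (DivMod.m<n⇒m%n≡m lt))
  a≡a′ = trans (sym (mod b lt)) (trans (cong (DivMod._% suc B) eq) (mod b′ lt′))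

Subsum-++⁻ : ∀ xs {ys t} → Subsum (xs ++ ys) t →
             ∃[ u ] ∃[ v ] t ≡ u + v × Subsum xs u × Subsum ys v
Subsum-++⁻ []       s = 0 , _ , refl , [] , s
Subsum-++⁻ (x ∷ xs) (take s) with Subsum-++⁻ xs s
... | u , v , eq , su , sv = x + u , v , trans (cong (x +_) eq) (sym (+-assoc x u v)) , take su , sv
Subsum-++⁻ (x ∷ xs) (skip s) with Subsum-++⁻ xs s
... | u , v , eq , su , sv = u , v , eq , skip su , sv

Subsum-++⁺ : ∀ {xs ys u v} → Subsum xs u → Subsum ys v → Subsum (xs ++ ys) (u + v)
Subsum-++⁺ [] s = s
Subsum-++⁺ (take {a} {t = t} s) s′ = subst (Subsum _) (sym (+-assoc a t _)) (take (Subsum-++⁺ s s′))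
Subsum-++⁺ (skip s) s′ = skip (Subsum-++⁺ s s′)

Subsum-*⁻ : ∀ c xs {t} → Subsum (map (c *_) xs) t → ∃[ u ] t ≡ c * u × Subsum xs u
Subsum-*⁻ c []       []       = 0 , sym (*-zeroʳ c) , []
Subsum-*⁻ c (x ∷ xs) (take s) with Subsum-*⁻ c xs s
... | u , eq , s′ = x + u , trans (cong (c * x +_) eq) (sym (*-distribˡ-+ c x u)) , take s′
Subsum-*⁻ c (x ∷ xs) (skip s) with Subsum-*⁻ c xs s
... | u , eq , s′ = u , eq , skip s′

Subsum-*⁺ : ∀ c {xs t} → Subsum xs t → Subsum (map (c *_) xs) (c * t)
Subsum-*⁺ c [] = subst (Subsum []) (sym (*-zeroʳ c)) []
Subsum-*⁺ c (take {a} {t = t} s) = subst (Subsum _) (sym (*-distribˡ-+ c a t)) (take (Subsum-*⁺ c s))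
Subsum-*⁺ c (skip s) = skip (Subsum-*⁺ c s)

Subsum-none : ∀ xs → Subsum xs 0
Subsum-none []       = []
Subsum-none (x ∷ xs) = skip (Subsum-none xs)

Subsum-∈ : ∀ {x xs} → x ∈ xs → Subsum xs x
Subsum-∈ {x} (here {xs = xs} refl) = subst (Subsum _) (+-identityʳ x) (take (Subsum-none xs))
Subsum-∈ (there m) = skip (Subsum-∈ m)

-- Wang tiles with numbers as colours. A tile can be read as a transition of
-- an automaton with a queue: in state west it removes south from the front,
-- appends north and moves to state east. For a queue of constant length N the
-- tiles of a run cover a strip wound around a cylinder of circumference N.

record WangTile : Set where
  constructor wang
  field west south north east : ℕ
open WangTile public

data Run (ts : List WangTile) : ℕ → List ℕ → ℕ → ℕ → List ℕ → Set where
  stop : ∀ {h q} → Run ts h q 0 h q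
  step : ∀ {t h h′ s q k q′} → t ∈ ts → west t ≡ h → south t ≡ s →
         Run ts (east t) (q ++ north t ∷ []) k h′ q′ → Run ts h (s ∷ q) (suc k) h′ q′

-- A run becomes a choice of numbers with a prescribed sum. In base B, every
-- step owns three digits: the number of tiles chosen for it (to be 1), and two
-- digits where the colours a tile consumes meet the complements, with respect
-- to K, of the colours produced 1 and N steps before (each sum to be K).

module Encoding (ts : List WangTile) (K B : ℕ)
  (bounded : All (λ t → west t ≤ K × south t ≤ K × north t ≤ K × east t ≤ K) ts)
  -- Nothing prevents a subset from taking all tiles for one step. Even then a digit receives at
  -- most `length ts * K` from them and at most `K` from a complement, so that no carry can disturb
  -- the comparison.
  (B-large : length ts * suc K + suc K < B) where

  X³ : ℕ
  X³ = B * (B * B)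

  κ : ℕ → ℕ
  κ x = K ∸ x

  κ-+ : ∀ {x} → x ≤ K → x + κ x ≡ K
  κ-+ le = m+[n∸m]≡n le

  κ-injective : ∀ {x y} → x ≤ K → y ≤ K → κ x ≡ κ y → x ≡ y
  κ-injective {x} {y} lx ly eq = +-cancelʳ-≡ (κ x) x y
    (trans (κ-+ lx) (trans (sym (κ-+ ly)) (cong (y +_) (sym eq))))

  weight : ℕ → ℕ → ℕ → ℕ → ℕ → ℕ → ℕ
  weight N c w s n e = c + B * (w + B * s) + X³ * (B * e) + X³ ^ N * (B * (B * n))

  item : ℕ → WangTile → ℕ
  item N t = weight N 1 (west t) (south t) (κ (north t)) (κ (east t))

  items : ℕ → ℕ → List ℕ
  items N zero    = []
  items N (suc M) = map (item N) ts ++ map (X³ *_) (items N M)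

  -- What the colours in the queue still owe to the digits of the steps that are going to consume
  -- them.
  queued : List ℕ → ℕ
  queued []      = 0
  queued (s ∷ q) = B * (B * κ s) + X³ * queued q

  pending : ℕ → List ℕ → ℕ
  pending h q = B * κ h + queued q

  -- The digits `1`, `K` and `K` demanded of each of `M` steps.
  quota : ℕ → ℕ
  quota zero    = 0
  quota (suc M) = 1 + B * (K + B * K) + X³ * quota M

  queued-∷ʳ : ∀ q n → queued (q ++ n ∷ []) ≡ queued q + X³ ^ length q * (B * (B * κ n))
  queued-∷ʳ []      n = lem (B * (B * κ n)) X³
    where
    lem : ∀ a x → a + x * 0 ≡ 1 * a
    lem = solve-∀
  queued-∷ʳ (s ∷ q) n = trans (cong (λ z → B * (B * κ s) + X³ * z) (queued-∷ʳ q n))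
    (lem (B * (B * κ s)) X³ (queued q) (X³ ^ length q) (B * (B * κ n)))
    where
    lem : ∀ a x b y c → a + x * (b + y * c) ≡ a + x * b + x * y * c
    lem = solve-∀

  K<B : K < B
  K<B = ≤-trans (n<1+n K) (≤-trans (m≤n+m (suc K) (length ts * suc K)) (<⇒≤ B-large))

  1<B : 1 < B
  1<B = ≤-<-trans (s≤s z≤n) (≤-<-trans (m≤n+m (suc K) (length ts * suc K)) B-large)

  -- A group of items is summarised by five totals. Bounds are kept only for those that reach the
  -- three lowest digits; `n` and `e` become known once the count `c` turns out to be 1.
  record Selection (us : List WangTile) (N t : ℕ) : Set where
    field
      c w s n e : ℕ
      sum≡      : t ≡ weight N c w s n e
      c≤        : c ≤ length us
      w≤        : w ≤ length us * K
      s≤        : s ≤ length us * K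
      none      : c ≡ 0 → w ≡ 0 × s ≡ 0 × n ≡ 0 × e ≡ 0
      single    : c ≡ 1 → ∃[ t ] t ∈ us × w ≡ west t × s ≡ south t × n ≡ κ (north t) × e ≡ κ (east t)

  weight-+ : ∀ N c w s n e c′ w′ s′ n′ e′ → weight N c w s n e + weight N c′ w′ s′ n′ e′ ≡
             weight N (c + c′) (w + w′) (s + s′) (n + n′) (e + e′)
  weight-+ N = lem B X³ (X³ ^ N)
    where
    lem : ∀ B X Y c w s n e c′ w′ s′ n′ e′ →
      (c + B * (w + B * s) + X * (B * e) + Y * (B * (B * n))) +
      (c′ + B * (w′ + B * s′) + X * (B * e′) + Y * (B * (B * n′))) ≡
      (c + c′) + B * ((w + w′) + B * (s + s′)) + X * (B * (e + e′)) + Y * (B * (B * (n + n′)))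
    lem = solve-∀

  weight-0 : ∀ N → 0 ≡ weight N 0 0 0 0 0
  weight-0 N = lem B X³ (X³ ^ N)
    where
    lem : ∀ B X Y → 0 ≡ 0 + B * (0 + B * 0) + X * (B * 0) + Y * (B * (B * 0))
    lem = solve-∀

  Bounded : WangTile → Set
  Bounded t = west t ≤ K × south t ≤ K × north t ≤ K × east t ≤ K

  selection : ∀ N us → All Bounded us → ∀ {t} → Subsum (map (item N) us) t → Selection us N t
  selection N [] [] [] = record
    { c = 0 ; w = 0 ; s = 0 ; n = 0 ; e = 0 ; sum≡ = weight-0 N ; c≤ = z≤n ; w≤ = z≤n ; s≤ = z≤n
    ; none = λ _ → refl , refl , refl , refl ; single = λ () }
  selection N (u ∷ us) (_ ∷ bs) (skip p) = record
    { Selection S using (c; w; s; n; e; sum≡; none)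
    ; c≤ = ≤-trans c≤ (n≤1+n _) ; w≤ = ≤-trans w≤ (m≤n+m _ K) ; s≤ = ≤-trans s≤ (m≤n+m _ K)
    ; single = λ eq → let (t , m , rest) = single eq in t , there m , rest }
    where
    S = selection N us bs p
    open Selection S
  selection N (u ∷ us) ((bw , bs , bn , be) ∷ bds) (take p) = record
    { c = 1 + c ; w = west u + w ; s = south u + s ; n = κ (north u) + n ; e = κ (east u) + e
    ; sum≡ = trans (cong (item N u +_) sum≡)
        (weight-+ N 1 (west u) (south u) (κ (north u)) (κ (east u)) c w s n e)
    ; c≤ = s≤s c≤ ; w≤ = +-mono-≤ bw w≤ ; s≤ = +-mono-≤ bs s≤
    ; none = λ ()
    ; single = λ eq → let (w0 , s0 , n0 , e0) = none (suc-injective eq) in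
        u , here refl , plus w0 , plus s0 , plus n0 , plus e0 }
    where
    S = selection N us bds p
    open Selection S
    plus : ∀ {x y} → y ≡ 0 → x + y ≡ x
    plus {x} refl = +-identityʳ x

  pending-injective : ∀ {h h′} q q′ → h ≤ K → h′ ≤ K → All (_≤ K) q → All (_≤ K) q′ →
    length q ≡ length q′ → pending h q ≡ pending h′ q′ → h ≡ h′ × q ≡ q′
  pending-injective [] [] lh lh′ _ _ _ eq =
    κ-injective lh lh′ (*-cancelˡ-≡ _ _ B {{B≢0}} (trans (sym (+-identityʳ _)) (trans eq (+-identityʳ _)))) , refl
    where B≢0 = >-nonZero (<⇒≤ 1<B)
  pending-injective {h} {h′} (s ∷ q) (s′ ∷ q′) lh lh′ (ls ∷ lq) (ls′ ∷ lq′) len eq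
    with digits-unique B (<⇒≤ 1<B) (<⇒≤ 1<B) (trans (expand h s q) (trans eq (sym (expand h′ s′ q′))))
    where
    lem : ∀ B k l r → 0 + B * (k + B * (l + B * r)) ≡ B * k + (B * (B * l) + B * (B * B) * r)
    lem = solve-∀
    expand : ∀ h s q → 0 + B * (κ h + B * (κ s + B * queued q)) ≡ pending h (s ∷ q)
    expand h s q = lem B (κ h) (κ s) (queued q)
  ... | _ , eq₁ with digits-unique B (κ<B h) (κ<B h′) eq₁
    where
    κ<B : ∀ x → κ x < B
    κ<B x = ≤-<-trans (ℕₚ.m∸n≤m K x) K<B
  ... | eh , eq₂ with digits-unique B (≤-<-trans (ℕₚ.m∸n≤m K s) K<B) (≤-<-trans (ℕₚ.m∸n≤m K s′) K<B) eq₂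
  ... | es , eq₃ with pending-injective {h} {h} q q′ lh lh lq lq′ (suc-injective len) (cong (B * κ h +_) eq₃)
  ... | _ , refl = κ-injective lh lh′ eh , cong (_∷ q) (κ-injective ls ls′ es)

  -- Comparing the lowest three digits.

  low-digits : ∀ {c w s r r′ h s₀} → h ≤ K → s₀ ≤ K → c ≤ length ts → w ≤ length ts * K → s ≤ length ts * K →
    c + B * ((w + κ h) + B * ((s + κ s₀) + B * r)) ≡ 1 + B * (K + B * (K + B * r′)) →
    c ≡ 1 × w + κ h ≡ K × s + κ s₀ ≡ K × r ≡ r′
  low-digits {c} {w} {s} {h = h} {s₀} lh ls c≤ w≤ s≤ eq
    with digits-unique B (≤-<-trans (≤-trans c≤ (≤-trans (≤-trans (≤-reflexive (sym (*-identityʳ _)))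
             (*-monoʳ-≤ (length ts) (s≤s z≤n))) (m≤m+n _ _))) B-large) 1<B eq
  ... | c≡ , eq₁ with digits-unique B (small {y = h} w≤) K<B eq₁
    where
    small : ∀ {x y} → x ≤ length ts * K → x + κ y < B
    small {x} {y} le = ≤-<-trans (+-mono-≤ (≤-trans le (*-monoʳ-≤ (length ts) (n≤1+n K)))
      (≤-trans (ℕₚ.m∸n≤m K y) (n≤1+n K))) B-large
  ... | w≡ , eq₂ with digits-unique B (small {y = s₀} s≤) K<B eq₂
    where
    small : ∀ {x y} → x ≤ length ts * K → x + κ y < B
    small {x} {y} le = ≤-<-trans (+-mono-≤ (≤-trans le (*-monoʳ-≤ (length ts) (n≤1+n K)))
      (≤-trans (ℕₚ.m∸n≤m K y) (n≤1+n K))) B-large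
  ... | s≡ , eq₃ = c≡ , w≡ , s≡ , eq₃

  weigh : ∀ N c w s n e t h s₀ q →
    weight (suc N) c w s n e + X³ * t + pending h (s₀ ∷ q) ≡
    c + B * ((w + κ h) + B * ((s + κ s₀) + B * (B * e + X³ ^ N * (B * (B * n)) + t + queued q)))
  weigh N c w s n e t h s₀ q = lem B (X³ ^ N) c w s n e t (κ h) (κ s₀) (queued q)
    where
    lem : ∀ B Y c w s n e t k l r → c + B * (w + B * s) + B * (B * B) * (B * e) + B * (B * B) * Y * (B * (B * n))
        + B * (B * B) * t + (B * k + (B * (B * l) + B * (B * B) * r))
      ≡ c + B * ((w + k) + B * ((s + l) + B * (B * e + Y * (B * (B * n)) + t + r)))
    lem = solve-∀

  quota-suc : ∀ M p → quota (suc M) + X³ ^ suc M * p ≡ 1 + B * (K + B * (K + B * (quota M + X³ ^ M * p)))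
  quota-suc M p = lem B K (quota M) (X³ ^ M) p
    where
    lem : ∀ B K u y p → 1 + B * (K + B * K) + B * (B * B) * u + B * (B * B) * y * p
      ≡ 1 + B * (K + B * (K + B * (u + y * p)))
    lem = solve-∀

  pending-next : ∀ {N} t q n e → length q ≡ N →
    B * κ e + X³ ^ N * (B * (B * κ n)) + t + queued q ≡ t + pending e (q ++ n ∷ [])
  pending-next t q n e refl = trans (lem (B * κ e) (X³ ^ length q * (B * (B * κ n))) (queued q) t)
    (cong (λ z → t + (B * κ e + z)) (sym (queued-∷ʳ q n)))
    where
    lem : ∀ b y r t → b + y + t + r ≡ t + (b + (r + y))
    lem = solve-∀

  length-∷ʳ : ∀ {N} (q : List ℕ) n → length q ≡ N → length (q ++ n ∷ []) ≡ suc N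
  length-∷ʳ q n refl = trans (Listₚ.length-++ q) (+-comm (length q) 1)

  -- The three lowest digits of the equation force exactly one tile for the first step, and its west
  -- and south to be the state and the front of the queue. What is left after division by `X³` is
  -- the equation for the remaining steps.
  Subsum⇒Run : ∀ N M {T h q h′ q′} → length q ≡ suc N → length q′ ≡ suc N →
    h ≤ K → All (_≤ K) q → h′ ≤ K → All (_≤ K) q′ → Subsum (items (suc N) M) T →
    T + pending h q ≡ quota M + X³ ^ M * pending h′ q′ → Run ts h q M h′ q′
  Subsum⇒Run N zero {q = q} {q′ = q′} lq lq′ bh bq bh′ bq′ [] eq
    with pending-injective q q′ bh bh′ bq bq′ (trans lq (sym lq′)) (trans eq (+-identityʳ _))
  ... | refl , refl = stop
  Subsum⇒Run N (suc M) {T} {h} {s ∷ q} {h′} {q′} lq lq′ bh (bs ∷ bq) bh′ bq′ sub eq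
    with Subsum-++⁻ (map (item (suc N)) ts) sub
  ... | T₁ , T₂ , eq₁ , sub₁ , sub₂ with Subsum-*⁻ X³ (items (suc N) M) sub₂
  ... | T₃ , eq₂ , sub₃ = proceed (selection (suc N) ts bounded sub₁)
    where
    proceed : Selection ts (suc N) T₁ → Run ts h (s ∷ q) (suc M) h′ q′
    proceed S with low-digits bh bs c≤ w≤ s≤
      (trans (sym (weigh N c w sᵢ n e T₃ h s q)) (trans
        (cong (_+ pending h (s ∷ q)) (sym (trans eq₁ (cong₂ _+_ sum≡ eq₂))))
        (trans eq (quota-suc M (pending h′ q′)))))
      where open Selection S renaming (s to sᵢ; s≤ to s≤)
    ... | c≡ , w≡ , s≡ , r≡ with Selection.single S c≡
    ... | t , mem , ew , es , en , ee = step mem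
      (+-cancelʳ-≡ (κ h) (west t) h (trans (cong (_+ κ h) (sym ew)) (trans w≡ (sym (κ-+ bh)))))
      (+-cancelʳ-≡ (κ s) (south t) s (trans (cong (_+ κ s) (sym es)) (trans s≡ (sym (κ-+ bs)))))
      (Subsum⇒Run N M (length-∷ʳ q (north t) (suc-injective lq)) lq′
        (proj₂ (proj₂ (proj₂ bt))) (Allₚ.++⁺ bq (proj₁ (proj₂ (proj₂ bt)) ∷ [])) bh′ bq′ sub₃
        (trans (sym (pending-next T₃ q (north t) (east t) (suc-injective lq)))
          (trans (cong₂ (λ x y → B * x + X³ ^ N * (B * (B * y)) + T₃ + queued q) (sym ee) (sym en)) r≡)))
      where bt = All.lookup bounded mem

  Run⇒Subsum : ∀ N M {h q h′ q′} → length q ≡ suc N → Run ts h q M h′ q′ →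
    ∃[ T ] Subsum (items (suc N) M) T × T + pending h q ≡ quota M + X³ ^ M * pending h′ q′
  Run⇒Subsum N zero lq stop = 0 , [] , sym (+-identityʳ _)
  Run⇒Subsum N (suc M) {q = s ∷ q} {h′} {q′} lq (step {t} mem refl refl run)
    with Run⇒Subsum N M (length-∷ʳ q (north t) (suc-injective lq)) run
  ... | T , sub , eq = item (suc N) t + X³ * T ,
    Subsum-++⁺ (Subsum-∈ (∈ₚ.∈-map⁺ (item (suc N)) mem)) (Subsum-*⁺ X³ sub) , (begin
      item (suc N) t + X³ * T + pending (west t) (south t ∷ q)
        ≡⟨ weigh N 1 (west t) (south t) (κ (north t)) (κ (east t)) T (west t) (south t) q ⟩
      1 + B * ((west t + κ (west t)) + B * ((south t + κ (south t)) +
        B * (B * κ (east t) + X³ ^ N * (B * (B * κ (north t))) + T + queued q)))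
        ≡⟨ cong (λ z → 1 + B * ((west t + κ (west t)) + B * ((south t + κ (south t)) + B * z)))
             (pending-next T q (north t) (east t) (suc-injective lq)) ⟩
      1 + B * ((west t + κ (west t)) + B * ((south t + κ (south t)) + B * (T + pending (east t) (q ++ north t ∷ []))))
        ≡⟨ cong₂ (λ x y → 1 + B * (x + B * (y + B * (T + pending (east t) (q ++ north t ∷ []))))) (κ-+ (proj₁ bt)) (κ-+ (proj₁ (proj₂ bt))) ⟩
      1 + B * (K + B * (K + B * (T + pending (east t) (q ++ north t ∷ []))))
        ≡⟨ cong (λ z → 1 + B * (K + B * (K + B * z))) eq ⟩
      1 + B * (K + B * (K + B * (quota M + X³ ^ M * pending h′ q′)))
        ≡⟨ sym (quota-suc M (pending h′ q′)) ⟩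
      quota (suc M) + X³ ^ suc M * pending h′ q′ ∎)
    where
    open ≡-Reasoning
    bt = All.lookup bounded mem

  -- Numbers given by their digits in base X³, the least significant first

  horner : List ℕ → ℕ → ℕ
  horner []       t = t
  horner (d ∷ ds) t = d + X³ * horner ds t

  horner-++ : ∀ ds es t → horner (ds ++ es) t ≡ horner ds (horner es t)
  horner-++ []       es t = refl
  horner-++ (d ∷ ds) es t = cong (λ z → d + X³ * z) (horner-++ ds es t)

  horner-zeros : ∀ k t → horner (replicate k 0) t ≡ X³ ^ k * t
  horner-zeros zero    t = sym (+-identityʳ t)
  horner-zeros (suc k) t = trans (cong (X³ *_) (horner-zeros k t)) (sym (*-assoc X³ (X³ ^ k) t))

  horner-bound : ∀ ds {t} → All (_< X³) ds → t < X³ → horner ds t < X³ ^ suc (length ds)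
  horner-bound [] [] lt = ≤-trans lt (≤-reflexive (sym (*-identityʳ X³)))
  horner-bound (d ∷ ds) {t} (l ∷ ls) lt = <-≤-trans (+-monoˡ-< (X³ * horner ds t) l)
    (≤-trans (≤-reflexive (sym (*-suc X³ (horner ds t)))) (*-monoʳ-≤ X³ (horner-bound ds ls lt)))

  low high : WangTile → ℕ
  low t  = 1 + B * (west t + B * south t)
  high t = B * κ (east t)

  topDigit : WangTile → ℕ
  topDigit t = B * (B * κ (north t))

  -- For a circumference of at least 2 the contributions to the present step, to the next one and to
  -- the one a row later occupy different digits in base `X³`. So an item can be written down
  -- without any addition.
  item-digits : ∀ N t → horner (low t ∷ high t ∷ replicate N 0) (topDigit t) ≡ item (2 + N) t
  item-digits N t = trans (cong (λ z → low t + X³ * (high t + X³ * z)) (horner-zeros N (topDigit t)))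
    (lem (low t) X³ (high t) (X³ ^ N) (topDigit t))
    where
    lem : ∀ l x h p t → l + x * (h + x * (p * t)) ≡ l + x * h + x * (x * p) * t
    lem = solve-∀

  -- The recursive definition suits the induction over steps; this form, with an explicit power for
  -- each group, is the one in which a program writes the items.
  items-∷ʳ : ∀ N M → items N (suc M) ≡ items N M ++ map (λ t → X³ ^ M * item N t) ts
  items-∷ʳ N zero    = trans (Listₚ.++-identityʳ _) (Listₚ.map-cong (λ t → sym (+-identityʳ (item N t))) ts)
  items-∷ʳ N (suc M) = trans (cong (λ z → map (item N) ts ++ map (X³ *_) z) (items-∷ʳ N M))
    (trans (cong (map (item N) ts ++_) (trans (Listₚ.map-++ (X³ *_) (items N M) _)
      (cong (map (X³ *_) (items N M) ++_) (trans (sym (Listₚ.map-∘ ts))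
        (Listₚ.map-cong (λ t → sym (*-assoc X³ (X³ ^ M) (item N t))) ts)))))
    (sym (Listₚ.++-assoc (map (item N) ts) _ _)))

  length-items : ∀ N M → length (items N M) ≡ M * length ts
  length-items N zero    = refl
  length-items N (suc M) = trans (Listₚ.length-++ (map (item N) ts)) (cong₂ _+_ (Listₚ.length-map (item N) ts)
    (trans (Listₚ.length-map (X³ *_) (items N M)) (length-items N M)))

  B>0 : 0 < B
  B>0 = <⇒≤ 1<B

  X³>0 : 0 < X³
  X³>0 = *-mono-≤ B>0 (*-mono-≤ B>0 B>0)

  cons-digit< : ∀ {d h m} → d < B → h < m → d + B * h < B * m
  cons-digit< {h = h} lt lt′ = <-≤-trans (+-monoˡ-< (B * h) lt)
    (≤-trans (≤-reflexive (sym (*-suc B h))) (*-monoʳ-≤ B lt′))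

  digit< : ∀ {c w s} → c < B → w < B → s < B → c + B * (w + B * s) < X³
  digit< lc lw ls = cons-digit< lc (cons-digit< lw ls)

  κ<B : ∀ x → κ x < B
  κ<B x = ≤-<-trans (ℕₚ.m∸n≤m K x) K<B

  items-pos : ∀ N M → All (0 <_) (items N M)
  items-pos N zero    = []
  items-pos N (suc M) = Allₚ.++⁺ (Allₚ.map⁺ (All.universal (λ t → s≤s z≤n) ts))
    (Allₚ.map⁺ (All.map (λ lt → *-mono-≤ X³>0 lt) (items-pos N M)))

  X³^-mono : ∀ {m n} → m ≤ n → X³ ^ m ≤ X³ ^ n
  X³^-mono = ℕₚ.^-monoʳ-≤ X³ {{>-nonZero X³>0}}

  tile-digits< : ∀ {t} → Bounded t → low t < X³ × high t < X³ × topDigit t < X³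
  tile-digits< {t} (bw , bs , bn , be) =
    digit< 1<B (≤-<-trans bw K<B) (≤-<-trans bs K<B) ,
    subst (_< X³) (trans (cong (λ z → B * (κ (east t) + z)) (*-zeroʳ B)) (cong (B *_) (+-identityʳ _)))
      (digit< {0} {κ (east t)} {0} B>0 (κ<B (east t)) B>0) ,
    digit< {0} {0} {κ (north t)} B>0 B>0 (κ<B (north t))

  item-bound : ∀ N {t} → Bounded t → item (2 + N) t < X³ ^ (3 + N)
  item-bound N {t} b = let (l , h , tp) = tile-digits< b in
    subst₂ _<_ (item-digits N t) (cong (λ z → X³ ^ (3 + z)) (Listₚ.length-replicate N))
      (horner-bound (low t ∷ high t ∷ replicate N 0) (l ∷ h ∷ Allₚ.replicate⁺ N X³>0) tp)

  items-bound : ∀ N M → All (_< X³ ^ (M + (3 + N))) (items (2 + N) M)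
  items-bound N zero    = []
  items-bound N (suc M) = Allₚ.++⁺
    (Allₚ.map⁺ (All.map (λ b → ≤-trans (item-bound N b) (X³^-mono (m≤n+m (3 + N) (suc M)))) bounded))
    (Allₚ.map⁺ (All.map (*-monoʳ-< X³ {{>-nonZero X³>0}}) (items-bound N M)))

  quota-+ : ∀ m k → quota (m + k) ≡ quota m + X³ ^ m * quota k
  quota-+ zero    k = sym (+-identityʳ (quota k))
  quota-+ (suc m) k = trans (cong (λ z → 1 + B * (K + B * K) + X³ * z) (quota-+ m k))
    (lem (1 + B * (K + B * K)) X³ (quota m) (X³ ^ m) (quota k))
    where
    lem : ∀ a x u p v → a + x * (u + p * v) ≡ a + x * u + x * p * v
    lem = solve-∀

  -- Digits of the target, solved for in the equation of a run. In the first row the complement of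
  -- `s` comes from outside, which leaves `s` of `K`; beyond the last row there are only the
  -- complements still owed.
  firstDigit middleDigit finalDigit : ℕ → ℕ
  firstDigit s  = 1 + B * (K + B * s)
  middleDigit _ = 1 + B * (K + B * K)
  finalDigit s  = B * (B * κ s)

  horner-middle : ∀ k t → horner (replicate k (1 + B * (K + B * K))) t ≡ quota k + X³ ^ k * t
  horner-middle zero    t = sym (+-identityʳ t)
  horner-middle (suc k) t = trans (cong (λ z → 1 + B * (K + B * K) + X³ * z) (horner-middle k t))
    (lem (1 + B * (K + B * K)) X³ (quota k) (X³ ^ k) t)
    where
    lem : ∀ a x u p v → a + x * (u + p * v) ≡ a + x * u + x * p * v
    lem = solve-∀

  horner-first : ∀ q t → All (_≤ K) q → horner (map firstDigit q) t + queued q ≡ quota (length q) + X³ ^ length q * t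
  horner-first []      t []       = refl
  horner-first (s ∷ q) t (l ∷ ls) = trans
    (lem B K s (κ s) (horner (map firstDigit q) t) (queued q))
    (trans (cong₂ (λ x y → 1 + B * (K + B * x) + X³ * y) (κ-+ l) (horner-first q t ls))
      (lem′ (1 + B * (K + B * K)) X³ (quota (length q)) (X³ ^ length q) t))
    where
    lem : ∀ B K s k h u → 1 + B * (K + B * s) + B * (B * B) * h + (B * (B * k) + B * (B * B) * u) ≡
      1 + B * (K + B * (s + k)) + B * (B * B) * (h + u)
    lem = solve-∀
    lem′ : ∀ a x u p v → a + x * (u + p * v) ≡ a + x * u + x * p * v
    lem′ = solve-∀

  horner-first-row : ∀ h s q t → h ≤ K → s ≤ K → All (_≤ K) q →
    horner ((1 + B * (h + B * s)) ∷ map firstDigit q) t + pending h (s ∷ q) ≡ quota (suc (length q)) + X³ ^ suc (length q) * t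
  horner-first-row h s q t lh ls lq = trans
    (lem B h (κ h) s (κ s) (horner (map firstDigit q) t) (queued q))
    (trans (cong₂ (λ x y → 1 + B * (x + B * y) + X³ * (horner (map firstDigit q) t + queued q)) (κ-+ lh) (κ-+ ls))
    (trans (cong (λ y → 1 + B * (K + B * K) + X³ * y) (horner-first q t lq))
      (lem′ (1 + B * (K + B * K)) X³ (quota (length q)) (X³ ^ length q) t)))
    where
    lem : ∀ B h k s l r u → 1 + B * (h + B * s) + B * (B * B) * r + (B * k + (B * (B * l) + B * (B * B) * u)) ≡
      1 + B * ((h + k) + B * (s + l)) + B * (B * B) * (r + u)
    lem = solve-∀
    lem′ : ∀ a x u p v → a + x * (u + p * v) ≡ a + x * u + x * p * v
    lem′ = solve-∀

  horner-final : ∀ q s → horner (map finalDigit q) (finalDigit s) ≡ queued (q ++ s ∷ [])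
  horner-final []      s = sym (trans (cong (λ z → finalDigit s + z) (*-zeroʳ X³)) (+-identityʳ _))
  horner-final (d ∷ q) s = cong (λ z → finalDigit d + X³ * z) (horner-final q s)

  -- The first row, `k` further steps, and the row left at the end without its last cell. The latter
  -- gives the leading digit, which `horner` takes separately.
  targetDigits : ℕ → ℕ → List ℕ → ℕ → ℕ → ℕ → List ℕ → List ℕ
  targetDigits h s q k h′ s′ q′ = ((1 + B * (h + B * s)) ∷ map firstDigit q) ++
    replicate k (1 + B * (K + B * K)) ++ (B * (κ h′ + B * κ s′)) ∷ map finalDigit q′

  target-equation : ∀ {h s q h′ s′} k q′ l → h ≤ K → s ≤ K → All (_≤ K) q →
    horner (targetDigits h s q k h′ s′ q′) (finalDigit l) + pending h (s ∷ q) ≡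
    quota (suc (length q) + k) + X³ ^ (suc (length q) + k) * pending h′ (s′ ∷ q′ ++ l ∷ [])
  target-equation {h} {s} {q} {h′} {s′} k q′ l lh ls lq = trans
    (cong (_+ pending h (s ∷ q)) (horner-++ ((1 + B * (h + B * s)) ∷ map firstDigit q) _ (finalDigit l)))
    (trans (horner-first-row h s q _ lh ls lq)
    (trans (cong (λ z → quota n + X³ ^ n * z) (trans (horner-++ (replicate k (1 + B * (K + B * K))) _ (finalDigit l))
      (trans (horner-middle k _) (cong (λ z → quota k + X³ ^ k * z) final))))
    (trans (lem (quota n) (X³ ^ n) (quota k) (X³ ^ k) (pending h′ (s′ ∷ q′ ++ l ∷ [])))
      (sym (cong₂ (λ x y → x + y * pending h′ (s′ ∷ q′ ++ l ∷ [])) (quota-+ n k) (^-distribˡ-+-* X³ n k))))))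
    where
    n = suc (length q)
    lem : ∀ u p v r w → u + p * (v + r * w) ≡ u + p * v + p * r * w
    lem = solve-∀
    lem′ : ∀ B k l u → B * (k + B * l) + u ≡ B * k + (B * (B * l) + u)
    lem′ = solve-∀
    final : horner ((B * (κ h′ + B * κ s′)) ∷ map finalDigit q′) (finalDigit l) ≡ pending h′ (s′ ∷ q′ ++ l ∷ [])
    final = trans (cong (λ z → B * (κ h′ + B * κ s′) + X³ * z) (horner-final q′ l))
      (lem′ B (κ h′) (κ s′) (X³ * queued (q′ ++ l ∷ [])))

  targetDigits< : ∀ {h s q h′ s′} k q′ → h ≤ K → s ≤ K → All (_≤ K) q →
    All (_< X³) (targetDigits h s q k h′ s′ q′)
  targetDigits< {h′ = h′} {s′} k q′ lh ls lq = Allₚ.++⁺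
    (digit< 1<B (≤-<-trans lh K<B) (≤-<-trans ls K<B) ∷ Allₚ.map⁺ (All.map (λ l → digit< 1<B K<B (≤-<-trans l K<B)) lq))
    (Allₚ.++⁺ (Allₚ.replicate⁺ k (digit< 1<B K<B K<B)) (digit< {0} B>0 (κ<B h′) (κ<B s′) ∷
      Allₚ.map⁺ (All.universal (λ s → digit< {0} {0} B>0 B>0 (κ<B s)) q′)))

  length-targetDigits : ∀ h s q k h′ s′ q′ →
    length (targetDigits h s q k h′ s′ q′) ≡ suc (length q) + k + suc (length q′)
  length-targetDigits h s q k h′ s′ q′ = trans (Listₚ.length-++ ((1 + B * (h + B * s)) ∷ map firstDigit q))
    (trans (cong₂ (λ x y → suc x + y) (Listₚ.length-map firstDigit q)
      (trans (Listₚ.length-++ (replicate k _)) (cong₂ (λ x y → x + suc y) (Listₚ.length-replicate k) (Listₚ.length-map finalDigit q′))))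
    (sym (+-assoc (suc (length q)) k (suc (length q′)))))

-- Nondeterministic multi-stack machines as queue automata

data Kind : Set where
  insert remove keep erase : Kind

enum-Kind : Enum Kind
enum-Kind = enum (insert ∷ remove ∷ keep ∷ erase ∷ []) λ
  { insert → here refl ; remove → there (here refl)
  ; keep → there (there (here refl)) ; erase → there (there (there (here refl))) }

enum-lists : ∀ {A} → Enum A → ℕ → List (List A)
enum-lists e zero    = [] ∷ []
enum-lists e (suc n) = [] ∷ concatMap (λ x → map (x ∷_) (enum-lists e n)) (elems e)

∈-enum-lists : ∀ {A} (e : Enum A) {n} xs → length xs ≤ n → xs ∈ enum-lists e n
∈-enum-lists e {zero}  []       le       = here refl
∈-enum-lists e {suc n} []       le       = here refl
∈-enum-lists e {suc n} (x ∷ xs) (s≤s le) = there (∈ₚ.∈-concatMap⁺ (λ x → map (x ∷_) (enum-lists e n))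
  (lose (mem e x) (∈ₚ.∈-map⁺ (x ∷_) (∈-enum-lists e xs le))))

code-list : ∀ {A} → Enum A → List A → ℕ
code-list e []       = 0
code-list e (x ∷ xs) = suc (toℕ (Enum.code e x) + length (elems e) * code-list e xs)

code-list-injective : ∀ {A} (e : Enum A) xs ys → code-list e xs ≡ code-list e ys → xs ≡ ys
code-list-injective e []       []       eq = refl
code-list-injective e (x ∷ xs) (y ∷ ys) eq
  with digits-unique (length (elems e)) (Finₚ.toℕ<n (Enum.code e x)) (Finₚ.toℕ<n (Enum.code e y)) (suc-injective eq)
... | ex , es = cong₂ _∷_ (Enum.code-injective e ex) (code-list-injective e xs ys es)

-- Each control state change comes with one operation per stack. All stacks
-- have the same constant length; the bottom is filled with blanks, and a
-- full stack cannot be inserted into.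

module MultiStack {A Q R : Set} (eA : Enum A) (eQ : Enum Q) (eR : Enum R) (blank : A) (S : ℕ)
  (source target : R → Q) (ops : R → List (Kind × A)) (ops-length : ∀ r → length (ops r) ≡ S) where

  Op = Kind × A

  -- Inserting and removing shift the stack by one cell: at one end a letter enters or leaves, at
  -- the other a blank leaves or enters, and the length is kept.
  Affects : Op → List A → List A → Set
  Affects (insert , x) v v′ = x ∷ v ≡ v′ ++ blank ∷ []
  Affects (remove , x) v v′ = v ++ blank ∷ [] ≡ x ∷ v′
  Affects (keep   , x) v v′ = x ≡ blank × v ≡ v′
  Affects (erase  , x) v v′ = x ≡ blank × v′ ≡ replicate (length v) blank

  data Affect : List Op → List (List A) → List (List A) → Set where
    []  : Affect [] [] []
    _∷_ : ∀ {o os v v′ vs vs′} → Affects o v v′ → Affect os vs vs′ → Affect (o ∷ os) (v ∷ vs) (v′ ∷ vs′)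

  data Steps : Q → List (List A) → ℕ → Q → List (List A) → Set where
    stop : ∀ {q vs} → Steps q vs 0 q vs
    step : ∀ r {q vs vs′ n q″ vs″} → source r ≡ q → Affect (ops r) vs vs′ →
           Steps (target r) vs′ n q″ vs″ → Steps q vs (suc n) q″ vs″

  Symbol : Set
  Symbol = Q ⊎ Maybe A

  pattern ctrl q = inj₁ q
  pattern cell a = inj₂ (just a)
  pattern sep    = inj₂ nothing

  -- The horizontal colour is the list of the operations not yet completed,
  -- the first one with the letter handed from cell to cell.

  data Local : List Op → Symbol → Symbol → List Op → Set where
    change  : ∀ r → Local [] (ctrl (source r)) (ctrl (target r)) (ops r)
    -- At the bottom the letter handed on has to be blank: an insertion loses no letter there, and a
    -- removal draws in a blank.
    next    : ∀ k {os} → Local ((k , blank) ∷ os) sep sep os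
    inserts : ∀ x y {os} → Local ((insert , x) ∷ os) (cell y) (cell x) ((insert , y) ∷ os)
    -- Letters have to move against the direction of reading. So `y` is guessed here and, being
    -- handed on, compared with the next cell.
    removes : ∀ x y {os} → Local ((remove , x) ∷ os) (cell x) (cell y) ((remove , y) ∷ os)
    keeps   : ∀ x y {os} → Local ((keep , x) ∷ os) (cell y) (cell y) ((keep , x) ∷ os)
    erases  : ∀ x y {os} → Local ((erase , x) ∷ os) (cell y) (cell blank) ((erase , x) ∷ os)

  eOp : Enum Op
  eOp = enum-Σ enum-Kind (λ _ → eA)

  eSymbol : Enum Symbol
  eSymbol = enum-⊎ eQ (enum-Maybe eA)

  codeH : List Op → ℕ
  codeH = code-list eOp

  codeV : Symbol → ℕ
  codeV s = toℕ (Enum.code eSymbol s)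

  codeV-injective : ∀ {s s′} → codeV s ≡ codeV s′ → s ≡ s′
  codeV-injective = Enum.code-injective eSymbol

  encodeWang : ∀ {w s n e} → Local w s n e → WangTile
  encodeWang {w} {s} {n} {e} _ = wang (codeH w) (codeV s) (codeV n) (codeH e)

  Code : WangTile → Set
  Code t = ∃[ w ] ∃[ s ] ∃[ n ] ∃[ e ] Σ (Local w s n e) λ l → t ≡ encodeWang l

  inner : List Op × Kind × A × A → List WangTile
  inner (os , k , x , y) = encodeWang (next k {os}) ∷ encodeWang (inserts x y {os}) ∷
    encodeWang (removes x y {os}) ∷ encodeWang (keeps x y {os}) ∷ encodeWang (erases x y {os}) ∷ []

  params : List (List Op × Kind × A × A)
  params = concatMap (λ os → map (os ,_) (elems (enum-Σ enum-Kind (λ _ → enum-Σ eA (λ _ → eA))))) (enum-lists eOp S)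

  wangs : List WangTile
  wangs = map (λ r → encodeWang (change r)) (elems eR) ++ concatMap inner params

  wangs-sound : ∀ {t} → t ∈ wangs → Code t
  wangs-sound m with ∈ₚ.∈-++⁻ (map (λ r → encodeWang (change r)) (elems eR)) m
  ... | inj₁ m′ with ∈ₚ.∈-map⁻ (λ r → encodeWang (change r)) m′
  ...   | r , _ , refl = _ , _ , _ , _ , change r , refl
  wangs-sound m | inj₂ m′ with Any.satisfied (∈ₚ.∈-concatMap⁻ inner {xs = params} m′)
  ... | (os , k , x , y) , here refl = _ , _ , _ , _ , next k {os} , refl
  ... | (os , k , x , y) , there (here refl) = _ , _ , _ , _ , inserts x y {os} , refl
  ... | (os , k , x , y) , there (there (here refl)) = _ , _ , _ , _ , removes x y {os} , refl
  ... | (os , k , x , y) , there (there (there (here refl))) = _ , _ , _ , _ , keeps x y {os} , refl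
  ... | (os , k , x , y) , there (there (there (there (here refl)))) = _ , _ , _ , _ , erases x y {os} , refl

  ∈-inner : ∀ {t os k x y} → length os ≤ S → t ∈ inner (os , k , x , y) → t ∈ wangs
  ∈-inner {os = os} {k} {x} {y} le m = ∈ₚ.∈-++⁺ʳ (map (λ r → encodeWang (change r)) (elems eR)) (∈ₚ.∈-concatMap⁺ inner
    (lose (∈ₚ.∈-concatMap⁺ (λ os → map (os ,_) _)
      (lose (∈-enum-lists eOp os le) (∈ₚ.∈-map⁺ (os ,_) (mem (enum-Σ enum-Kind (λ _ → enum-Σ eA (λ _ → eA))) (k , x , y))))) m))

  wangs-complete : ∀ {w s n e} (l : Local w s n e) → length w ≤ S → encodeWang l ∈ wangs
  wangs-complete (change r) le = ∈ₚ.∈-++⁺ˡ (∈ₚ.∈-map⁺ (λ r → encodeWang (change r)) (mem eR r))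
  wangs-complete (next k) le = ∈-inner {k = k} {blank} {blank} (<⇒≤ le) (here refl)
  wangs-complete (inserts x y) le = ∈-inner {k = keep} {x} {y} (<⇒≤ le) (there (here refl))
  wangs-complete (removes x y) le = ∈-inner {k = keep} {x} {y} (<⇒≤ le) (there (there (here refl)))
  wangs-complete (keeps x y) le = ∈-inner {k = keep} {x} {y} (<⇒≤ le) (there (there (there (here refl))))
  wangs-complete (erases x y) le = ∈-inner {k = keep} {x} {y} (<⇒≤ le) (there (there (there (there (here refl)))))

  -- A row never has more than `S` operations pending, which is why finitely many tiles suffice.
  local-length : ∀ {w s n e} → Local w s n e → length w ≤ S → length e ≤ S
  local-length (change r)    le = ≤-reflexive (ops-length r)
  local-length (next k)      le = <⇒≤ le
  local-length (inserts x y) le = le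
  local-length (removes x y) le = le
  local-length (keeps x y)   le = le
  local-length (erases x y)  le = le

  data Locals : List Op → List Symbol → List Symbol → List Op → Set where
    []  : ∀ {h} → Locals h [] [] h
    _∷_ : ∀ {w s n e ss ns h} → Local w s n e → Locals e ss ns h → Locals w (s ∷ ss) (n ∷ ns) h

  -- While `ss` is consumed, its successors gather behind `ys`. For empty `ys` this cuts one row of
  -- the tableau out of a run of the queue automaton.
  run⇒locals : ∀ {h} ss ys {k h′ q′} → Run wangs (codeH h) (map codeV (ss ++ ys)) (length ss + k) h′ q′ →
    ∃[ ns ] ∃[ e ] Locals h ss ns e × Run wangs (codeH e) (map codeV (ys ++ ns)) k h′ q′
  run⇒locals {h} [] ys r = [] , _ , [] , subst (λ z → Run wangs (codeH h) (map codeV z) _ _ _) (sym (Listₚ.++-identityʳ ys)) r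
  run⇒locals {h} (s ∷ ss) ys {k} (step m ew es r) with wangs-sound m
  ... | w , s′ , n , e , l , refl with code-list-injective eOp w h ew | codeV-injective es
  ... | refl | refl with run⇒locals ss (ys ++ n ∷ [])
    (subst (λ z → Run wangs (codeH e) z (length ss + k) _ _)
      (trans (sym (Listₚ.map-++ codeV (ss ++ ys) (n ∷ []))) (cong (map codeV) (Listₚ.++-assoc ss ys (n ∷ [])))) r)
  ... | ns , e′ , ls , r′ = n ∷ ns , e′ , l ∷ ls ,
    subst (λ z → Run wangs (codeH e′) (map codeV z) k _ _) (Listₚ.++-assoc ys (n ∷ []) ns) r′

  locals⇒run : ∀ {h ss ns e} → Locals h ss ns e → length h ≤ S → ∀ ys {k h′ q′} →
    Run wangs (codeH e) (map codeV (ys ++ ns)) k h′ q′ → Run wangs (codeH h) (map codeV (ss ++ ys)) (length ss + k) h′ q′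
  locals⇒run {h} [] le ys r = subst (λ z → Run wangs (codeH h) (map codeV z) _ _ _) (Listₚ.++-identityʳ ys) r
  locals⇒run {ss = s ∷ ss} {n ∷ ns} {e = e′} (l ∷ ls) le ys {k} r = step (wangs-complete l le) refl refl
    (subst (λ z → Run wangs _ z (length ss + k) _ _)
      (trans (cong (map codeV) (sym (Listₚ.++-assoc ss ys (n ∷ [])))) (Listₚ.map-++ codeV (ss ++ ys) (n ∷ [])))
      (locals⇒run ls (local-length l le) (ys ++ n ∷ [])
        (subst (λ z → Run wangs (codeH e′) (map codeV z) k _ _) (sym (Listₚ.++-assoc ys (n ∷ []) ns)) r)))

  column : List A → List Symbol → List Symbol
  column v ss = map cell v ++ sep ∷ ss

  columns : List (List A) → List Symbol
  columns []       = []
  columns (v ∷ vs) = column v (columns vs)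

  row : Q → List (List A) → List Symbol
  row q vs = ctrl q ∷ columns vs

  Level : ℕ → List (List A) → Set
  Level L = All (λ v → length v ≡ L)

  column⇒affects : ∀ {k x os} v {ss ns e} → Locals ((k , x) ∷ os) (column v ss) ns e →
    ∃[ v′ ] ∃[ ns′ ] ns ≡ column v′ ns′ × length v′ ≡ length v × Affects (k , x) v v′ × Locals os ss ns′ e
  column⇒affects {insert} [] (next _ ∷ ls) = [] , _ , refl , refl , refl , ls
  column⇒affects {remove} [] (next _ ∷ ls) = [] , _ , refl , refl , refl , ls
  column⇒affects {keep}   [] (next _ ∷ ls) = [] , _ , refl , refl , (refl , refl) , ls
  column⇒affects {erase}  [] (next _ ∷ ls) = [] , _ , refl , refl , (refl , refl) , ls
  column⇒affects (y ∷ v) (inserts x _ ∷ ls) with column⇒affects v ls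
  ... | v′ , ns , refl , len , aff , ls′ = x ∷ v′ , ns , refl , cong suc len , cong (x ∷_) aff , ls′
  column⇒affects (x ∷ v) (removes _ y ∷ ls) with column⇒affects v ls
  ... | v′ , ns , refl , len , aff , ls′ = y ∷ v′ , ns , refl , cong suc len , cong (x ∷_) aff , ls′
  column⇒affects (y ∷ v) (keeps x _ ∷ ls) with column⇒affects v ls
  ... | v′ , ns , refl , len , (eq , aff) , ls′ = y ∷ v′ , ns , refl , cong suc len , (eq , cong (y ∷_) aff) , ls′
  column⇒affects (y ∷ v) (erases x _ ∷ ls) with column⇒affects v ls
  ... | v′ , ns , refl , len , (eq , aff) , ls′ = blank ∷ v′ , ns , refl , cong suc len , (eq , cong (blank ∷_) aff) , ls′

  affects⇒column : ∀ {k x os} v {v′ ss ns e} → Affects (k , x) v v′ → Locals os ss ns e →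
    Locals ((k , x) ∷ os) (column v ss) (column v′ ns) e
  affects⇒column {insert} [] {[]} refl ls = next insert ∷ ls
  affects⇒column {insert} [] {_ ∷ []} () ls
  affects⇒column {insert} [] {_ ∷ _ ∷ _} () ls
  affects⇒column {insert} (y ∷ v) {[]} () ls
  affects⇒column {insert} (y ∷ v) {x ∷ v′} aff ls with Listₚ.∷-injective aff
  ... | refl , aff′ = inserts x y ∷ affects⇒column v aff′ ls
  affects⇒column {remove} [] refl ls = next remove ∷ ls
  affects⇒column {remove} (x ∷ []) refl ls = removes x blank ∷ next remove ∷ ls
  affects⇒column {remove} (x ∷ y ∷ v) refl ls = removes x y ∷ affects⇒column (y ∷ v) refl ls
  affects⇒column {keep} [] (refl , refl) ls = next keep ∷ ls
  affects⇒column {keep} (y ∷ v) (refl , refl) ls = keeps blank y ∷ affects⇒column v (refl , refl) ls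
  affects⇒column {erase} [] (refl , refl) ls = next erase ∷ ls
  affects⇒column {erase} (y ∷ v) (refl , refl) ls = erases blank y ∷ affects⇒column v (refl , refl) ls

  columns⇒affect : ∀ {os} vs {ns e} → length os ≡ length vs → Locals os (columns vs) ns e →
    ∃[ vs′ ] ns ≡ columns vs′ × e ≡ [] × Affect os vs vs′ × (∀ {L} → Level L vs → Level L vs′)
  columns⇒affect {[]} [] len [] = [] , refl , refl , [] , λ _ → []
  columns⇒affect {o ∷ os} (v ∷ vs) len ls with column⇒affects v ls
  ... | v′ , ns , refl , lv , aff , ls′ with columns⇒affect vs (suc-injective len) ls′
  ... | vs′ , refl , e≡ , affs , lev = v′ ∷ vs′ , refl , e≡ , aff ∷ affs ,
    λ { (l ∷ ls) → trans lv l ∷ lev ls }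

  affect⇒columns : ∀ {os vs vs′} → Affect os vs vs′ → Locals os (columns vs) (columns vs′) []
  affect⇒columns []           = []
  affect⇒columns (aff ∷ affs) = affects⇒column _ aff (affect⇒columns affs)

  length-columns : ∀ {L vs} → Level L vs → length (columns vs) ≡ length vs * suc L
  length-columns [] = refl
  length-columns {L} {v ∷ vs} (l ∷ ls) = trans (Listₚ.length-++ (map cell v))
    (trans (cong₂ _+_ (trans (Listₚ.length-map cell v) l) (cong suc (length-columns ls))) (+-suc L _))

  column-injective : ∀ v v′ {ss ss′} → column v ss ≡ column v′ ss′ → v ≡ v′ × ss ≡ ss′
  column-injective []      []       eq = refl , Listₚ.∷-injectiveʳ eq
  column-injective []      (_ ∷ v′) ()
  column-injective (_ ∷ v) []       ()
  column-injective (x ∷ v) (y ∷ v′) eq with Listₚ.∷-injective eq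
  ... | refl , eq′ with column-injective v v′ eq′
  ... | refl , eq″ = refl , eq″

  columns-injective : ∀ vs vs′ → columns vs ≡ columns vs′ → vs ≡ vs′
  columns-injective [] [] eq = refl
  columns-injective [] ([] ∷ vs′) ()
  columns-injective [] ((_ ∷ _) ∷ vs′) ()
  columns-injective ([] ∷ vs) [] ()
  columns-injective ((_ ∷ _) ∷ vs) [] ()
  columns-injective (v ∷ vs) (v′ ∷ vs′) eq with column-injective v v′ eq
  ... | refl , eq′ = cong (v ∷_) (columns-injective vs vs′ eq′)

  affect-length : ∀ {os vs vs′} → Affect os vs vs′ → length vs′ ≡ length vs
  affect-length []       = refl
  affect-length (_ ∷ as) = cong suc (affect-length as)

  affects-length : ∀ o {v v′} → Affects o v v′ → length v′ ≡ length v
  affects-length (insert , x) {v} {v′} eq = suc-injective (trans (+-comm 1 (length v′))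
    (trans (sym (Listₚ.length-++ v′)) (sym (cong length eq))))
  affects-length (remove , x) {v} {v′} eq = suc-injective (trans (sym (cong length eq))
    (trans (Listₚ.length-++ v) (+-comm (length v) 1)))
  affects-length (keep , x) (_ , refl) = refl
  affects-length (erase , x) {v} (_ , refl) = Listₚ.length-replicate (length v)

  affect-level : ∀ {os vs vs′ L} → Affect os vs vs′ → Level L vs → Level L vs′
  affect-level [] [] = []
  affect-level (_∷_ {o} a as) (l ∷ ls) = trans (affects-length o a) l ∷ affect-level as ls

  width : ℕ → ℕ
  width L = suc (S * suc L)

  length-row : ∀ {L vs} q → length vs ≡ S → Level L vs → length (row q vs) ≡ width L
  length-row {L} {vs} q refl lev = cong suc (length-columns lev)

  run⇒steps : ∀ {L} R {q vs q′ vs′} → length vs ≡ S → Level L vs →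
    Run wangs (codeH []) (map codeV (row q vs)) (R * width L) (codeH []) (map codeV (row q′ vs′)) → Steps q vs R q′ vs′
  run⇒steps zero {q} {vs} {q′} {vs′} lv lev r
    with Listₚ.∷-injective (Listₚ.map-injective codeV-injective {row q vs} {row q′ vs′} (unmoved r))
    where
    unmoved : ∀ {h h′ q q′} → Run wangs h q 0 h′ q′ → q ≡ q′
    unmoved stop = refl
  ... | refl , eq with columns-injective vs vs′ eq
  ... | refl = stop
  run⇒steps {L} (suc R) {q} {vs} {q′} {vs′} lv lev r
    with run⇒locals {[]} (row q vs) [] (subst₂ (λ x y → Run wangs (codeH []) (map codeV x) (y + R * width L) (codeH []) (map codeV (row q′ vs′)))
      (sym (Listₚ.++-identityʳ (row q vs))) (sym (length-row q lv lev)) r)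
  -- With no operation pending, only `change` fits, so every row begins with a transition.
  ... | _ , e , change ρ ∷ ls , r′ with columns⇒affect vs (trans (ops-length ρ) (sym lv)) ls
  ... | _ , refl , refl , aff , lev′ = step ρ refl aff (run⇒steps R (trans (affect-length aff) lv) (lev′ lev) r′)

  steps⇒run : ∀ {L} R {q vs q′ vs′} → length vs ≡ S → Level L vs → Steps q vs R q′ vs′ →
    Run wangs (codeH []) (map codeV (row q vs)) (R * width L) (codeH []) (map codeV (row q′ vs′))
  steps⇒run zero lv lev stop = stop
  steps⇒run {L} (suc R) {vs = vs} {q′} {vs′} lv lev (step r refl aff st) =
    subst₂ (λ x y → Run wangs (codeH []) (map codeV x) (y + R * width L) (codeH []) (map codeV (row q′ vs′)))
      (Listₚ.++-identityʳ (row (source r) vs)) (length-row (source r) lv lev)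
      (locals⇒run (change r ∷ affect⇒columns aff) z≤n []
        (steps⇒run R (trans (affect-length aff) lv) (affect-level aff lev) st))

-- A nondeterministic multi-stack machine guessing a certificate and running a
-- verifier on it

-- Recursive instead of a product, so that the two stacks of a tape split off by computation.
twice : ℕ → ℕ
twice zero    = zero
twice (suc n) = suc (suc (twice n))

enum-via : ∀ {A B : Set} → Enum A → (f : A → B) (g : B → A) → (∀ y → f (g y) ≡ y) → Enum B
enum-via (enum xs m) f g inv = enum (map f xs)
  λ y → subst (_∈ map f xs) (inv y) (∈ₚ.∈-map⁺ f (m (g y)))

replicate-∷ʳ : ∀ {A : Set} n (x : A) → x ∷ replicate n x ≡ replicate n x ++ x ∷ []
replicate-∷ʳ zero    x = refl
replicate-∷ʳ (suc n) x = cong (x ∷_) (replicate-∷ʳ n x)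

∸-suc : ∀ {m n} → m < n → n ∸ m ≡ suc (n ∸ suc m)
∸-suc {zero}  {suc n} lt       = refl
∸-suc {suc m} {suc n} (s≤s lt) = ∸-suc lt

module _ {γ : ℕ} where

  top : List (Cell γ) → Cell γ
  top []      = nothing
  top (b ∷ l) = b

  rest : List (Cell γ) → List (Cell γ)
  rest []      = []
  rest (b ∷ l) = l

  move-left : ∀ (l : List (Cell γ)) c r → move left (tape l c r) ≡ tape (rest l) (top l) (c ∷ r)
  move-left []      c r = refl
  move-left (b ∷ l) c r = refl

  move-right : ∀ (l : List (Cell γ)) c r → move right (tape l c r) ≡ tape (c ∷ l) (top r) (rest r)
  move-right l c []      = refl
  move-right l c (b ∷ r) = refl

  pad : ℕ → List (Cell γ) → List (Cell γ)
  pad L l = l ++ replicate (L ∸ length l) nothing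

  length-pad : ∀ {L} l → length l ≤ L → length (pad L l) ≡ L
  length-pad {L} l le = trans (Listₚ.length-++ l)
    (trans (cong (length l +_) (Listₚ.length-replicate (L ∸ length l))) (m+[n∸m]≡n le))

  pad-insert : ∀ {L} c l → length l < L → c ∷ pad L l ≡ pad L (c ∷ l) ++ nothing ∷ []
  pad-insert {L} c l lt rewrite ∸-suc lt = cong (c ∷_) (trans
    (cong (l ++_) (replicate-∷ʳ (L ∸ suc (length l)) nothing)) (sym (Listₚ.++-assoc l _ _)))

  pad-remove : ∀ {L} l → length l ≤ L → pad L l ++ nothing ∷ [] ≡ top l ∷ pad L (rest l)
  pad-remove {L} []      le = sym (replicate-∷ʳ L nothing)
  pad-remove {L} (b ∷ l) le = sym (pad-insert b l le)

module Guessing {a c : ℕ} (M : TM (suc (a + c)) 0) where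
  open TM M renaming (step to tmStep)

  T : ℕ
  T = suc k

  ι : Fin (suc (a + c)) → Fin γ
  ι s = inject≤ s a≤γ

  ι-injective : ∀ {s s′} → ι s ≡ ι s′ → s ≡ s′
  ι-injective {s} {s′} eq = Finₚ.toℕ-injective (trans (sym (Finₚ.toℕ-inject≤ s a≤γ))
    (trans (cong toℕ eq) (Finₚ.toℕ-inject≤ s′ a≤γ)))

  hash : Cell γ
  hash = just (ι zero)

  inputLetter : Fin a → Cell γ
  inputLetter s = just (ι (suc (s ↑ˡ c)))

  guessLetter : Fin c → Cell γ
  guessLetter s = just (ι (suc (a ↑ʳ s)))

  input≢hash : ∀ {s} → inputLetter s ≢ hash
  input≢hash eq with ι-injective (just-inj eq)
    where
    just-inj : ∀ {x y : Fin γ} → just x ≡ just y → x ≡ y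
    just-inj refl = refl
  ... | ()

  -- The scanned cells belong to the state, since the two stacks of a tape hold only the cells
  -- beside the head.
  data State : Set where
    guessing copying accepted : State
    machine : Control q → Vec (Cell γ) T → State

  -- Initially the first stack has a number of marks `hash` above the reversed input. Every mark but
  -- the last is dropped or traded for a guessed letter on the second stack, the last one becomes
  -- the mark between input and certificate, and transferring the input completes the tape of the
  -- verifier. In `go s f g` the cells `g` are guesses of what will be scanned next; `rested` passes
  -- the time after halting, and `finish` produces a last row that is known in advance.
  data Rule : Set where
    skipGuess endGuess : Rule
    guess  : Fin c → Rule
    copy   : Fin a → Rule
    load   : Cell γ → Rule
    go     : Fin q → Vec (Cell γ) T → Vec (Cell γ) T → Rule
    rested : Bool → Vec (Cell γ) T → Rule
    finish : Vec (Cell γ) T → Rule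

  eCell : Enum (Cell γ)
  eCell = enum-Maybe (enum-Fin γ)

  eCells : Enum (Vec (Cell γ) T)
  eCells = enum-Vec T eCell

  eControl : Enum (Control q)
  eControl = enum-via (enum-⊎ (enum-Fin q) enum-Bool)
    (λ { (inj₁ s) → running s ; (inj₂ b) → halted b })
    (λ { (running s) → inj₁ s ; (halted b) → inj₂ b })
    (λ { (running s) → refl ; (halted b) → refl })

  eState : Enum State
  eState = enum-via (enum-⊎ (enum-Maybe enum-Bool) (enum-Σ eControl (λ _ → eCells)))
    (λ { (inj₁ nothing) → guessing ; (inj₁ (just true)) → copying ; (inj₁ (just false)) → accepted
       ; (inj₂ (s , f)) → machine s f })
    (λ { guessing → inj₁ nothing ; copying → inj₁ (just true) ; accepted → inj₁ (just false)
       ; (machine s f) → inj₂ (s , f) })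
    (λ { guessing → refl ; copying → refl ; accepted → refl ; (machine s f) → refl })

  eRule : Enum Rule
  eRule = enum-via (enum-⊎ enum-Bool (enum-⊎ (enum-Fin c) (enum-⊎ (enum-Fin a) (enum-⊎ eCell
      (enum-⊎ (enum-Σ (enum-Fin q) (λ _ → enum-Σ eCells (λ _ → eCells)))
      (enum-⊎ (enum-Σ enum-Bool (λ _ → eCells)) eCells))))))
    (λ { (inj₁ true) → skipGuess ; (inj₁ false) → endGuess ; (inj₂ (inj₁ y)) → guess y
       ; (inj₂ (inj₂ (inj₁ x))) → copy x ; (inj₂ (inj₂ (inj₂ (inj₁ v)))) → load v
       ; (inj₂ (inj₂ (inj₂ (inj₂ (inj₁ (s , f , g)))))) → go s f g
       ; (inj₂ (inj₂ (inj₂ (inj₂ (inj₂ (inj₁ (b , f))))))) → rested b f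
       ; (inj₂ (inj₂ (inj₂ (inj₂ (inj₂ (inj₂ f)))))) → finish f })
    (λ { skipGuess → inj₁ true ; endGuess → inj₁ false ; (guess y) → inj₂ (inj₁ y)
       ; (copy x) → inj₂ (inj₂ (inj₁ x)) ; (load v) → inj₂ (inj₂ (inj₂ (inj₁ v)))
       ; (go s f g) → inj₂ (inj₂ (inj₂ (inj₂ (inj₁ (s , f , g)))))
       ; (rested b f) → inj₂ (inj₂ (inj₂ (inj₂ (inj₂ (inj₁ (b , f))))))
       ; (finish f) → inj₂ (inj₂ (inj₂ (inj₂ (inj₂ (inj₂ f))))) })
    (λ { skipGuess → refl ; endGuess → refl ; (guess y) → refl ; (copy x) → refl ; (load v) → refl
       ; (go s f g) → refl ; (rested b f) → refl ; (finish f) → refl })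

  Acts : ℕ → Set
  Acts = Vec (Cell γ × Move)

  -- A move pops the new scanned cell from one of the two stacks of a tape and
  -- pushes the old one on the other.

  tapeOps : ∀ {n} → Acts n → Vec (Cell γ) n → List (Kind × Cell γ)
  tapeOps [] [] = []
  tapeOps ((x , left)  ∷ as) (g ∷ gs) = (remove , g) ∷ (insert , x) ∷ tapeOps as gs
  tapeOps ((x , stay)  ∷ as) (g ∷ gs) = (keep , nothing) ∷ (keep , nothing) ∷ tapeOps as gs
  tapeOps ((x , right) ∷ as) (g ∷ gs) = (insert , x) ∷ (remove , g) ∷ tapeOps as gs

  newFoci : ∀ {n} → Acts n → Vec (Cell γ) n → Vec (Cell γ) n
  newFoci [] [] = []
  newFoci ((x , left)  ∷ as) (g ∷ gs) = g ∷ newFoci as gs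
  newFoci ((x , stay)  ∷ as) (g ∷ gs) = x ∷ newFoci as gs
  newFoci ((x , right) ∷ as) (g ∷ gs) = g ∷ newFoci as gs

  firstOps : Kind × Cell γ → Kind × Cell γ → List (Kind × Cell γ)
  firstOps o o′ = o ∷ o′ ∷ replicate (twice k) (keep , nothing)

  source target : Rule → State
  source skipGuess    = guessing
  source endGuess     = guessing
  source (guess y)    = guessing
  source (copy x)     = copying
  source (load v)    = copying
  source (go s f g)   = machine (running s) f
  source (rested b f) = machine (halted b) f
  source (finish f)   = machine (halted true) f
  target skipGuess    = guessing
  target endGuess     = copying
  target (guess y)    = guessing
  target (copy x)     = copying
  target (load v)    = machine (running start) (v ∷ Vec.replicate k nothing)
  target (go s f g)   = machine (proj₁ (δ s f)) (newFoci (proj₂ (δ s f)) g)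
  target (rested b f) = machine (halted b) f
  target (finish f)   = accepted

  ruleOps : Rule → List (Kind × Cell γ)
  ruleOps skipGuess    = firstOps (remove , hash) (keep , nothing)
  ruleOps endGuess     = firstOps (remove , hash) (insert , hash)
  ruleOps (guess y)    = firstOps (remove , hash) (insert , guessLetter y)
  ruleOps (copy x)     = firstOps (remove , inputLetter x) (insert , inputLetter x)
  ruleOps (load v)    = firstOps (remove , nothing) (remove , v)
  ruleOps (go s f g)   = tapeOps (proj₂ (δ s f)) g
  ruleOps (rested b f) = replicate (twice T) (keep , nothing)
  ruleOps (finish f)   = replicate (twice T) (erase , nothing)

  length-tapeOps : ∀ {n} (as : Acts n) gs → length (tapeOps as gs) ≡ twice n
  length-tapeOps [] [] = refl
  length-tapeOps ((x , left)  ∷ as) (g ∷ gs) = cong (2 +_) (length-tapeOps as gs)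
  length-tapeOps ((x , stay)  ∷ as) (g ∷ gs) = cong (2 +_) (length-tapeOps as gs)
  length-tapeOps ((x , right) ∷ as) (g ∷ gs) = cong (2 +_) (length-tapeOps as gs)

  ruleOps-length : ∀ r → length (ruleOps r) ≡ twice T
  ruleOps-length skipGuess    = cong (2 +_) (Listₚ.length-replicate (twice k))
  ruleOps-length endGuess     = cong (2 +_) (Listₚ.length-replicate (twice k))
  ruleOps-length (guess y)    = cong (2 +_) (Listₚ.length-replicate (twice k))
  ruleOps-length (copy x)     = cong (2 +_) (Listₚ.length-replicate (twice k))
  ruleOps-length (load v)    = cong (2 +_) (Listₚ.length-replicate (twice k))
  ruleOps-length (go s f g)   = length-tapeOps (proj₂ (δ s f)) g
  ruleOps-length (rested b f) = Listₚ.length-replicate (twice T)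
  ruleOps-length (finish f)   = Listₚ.length-replicate (twice T)

  open MultiStack eCell eState eRule nothing (twice T) source target ruleOps ruleOps-length public

  module Depth (L : ℕ) where

    stacks : ∀ {n} → Vec (Tape γ) n → List (List (Cell γ))
    stacks [] = []
    stacks (tape l _ r ∷ ts) = pad L l ∷ pad L r ∷ stacks ts

    -- Room for `m` more steps, each of which lengthens a list by at most one cell. It guarantees
    -- that a stack of fixed depth is never full when something is inserted.
    Room : ∀ {n} → ℕ → Vec (Tape γ) n → Set
    Room m [] = ⊤
    Room m (tape l _ r ∷ ts) = (length l + m ≤ L × length r + m ≤ L) × Room m ts

    length-stacks : ∀ {n} (ts : Vec (Tape γ) n) → length (stacks ts) ≡ twice n
    length-stacks [] = refl
    length-stacks (tape l _ r ∷ ts) = cong (2 +_) (length-stacks ts)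

    level-stacks : ∀ {n m} (ts : Vec (Tape γ) n) → Room m ts → Level L (stacks ts)
    level-stacks [] _ = []
    level-stacks (tape l _ r ∷ ts) ((rl , rr) , rs) =
      length-pad l (≤-trans (m≤m+n _ _) rl) ∷ length-pad r (≤-trans (m≤m+n _ _) rr) ∷ level-stacks ts rs

    grown : ∀ {n} {m} → n + suc m ≤ L → suc n + m ≤ L
    grown {n} {m} le = ≤-trans (≤-reflexive (sym (+-suc n m))) le

    shrunk : ∀ (l : List (Cell γ)) {m} → length l + suc m ≤ L → length (rest l) + m ≤ L
    shrunk []      le = <⇒≤ le
    shrunk (b ∷ l) {m} le = ≤-trans (+-mono-≤ (n≤1+n (length l)) (n≤1+n m)) le

    fits-in : ∀ {n m} → n + suc m ≤ L → n < L
    fits-in {n} {m} le = ≤-trans (≤-trans (s≤s (m≤m+n n m)) (≤-reflexive (sym (+-suc n m)))) le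

    room-less : ∀ {n m} (ts : Vec (Tape γ) n) → Room (suc m) ts → Room m ts
    room-less [] _ = tt
    room-less (tape l _ r ∷ ts) ((rl , rr) , rs) =
      (≤-trans (+-monoʳ-≤ (length l) (n≤1+n _)) rl , ≤-trans (+-monoʳ-≤ (length r) (n≤1+n _)) rr) , room-less ts rs

    room-step : ∀ {n m} (as : Acts n) ts → Room (suc m) ts → Room m (Vec.zipWith writeMove as ts)
    room-step [] [] _ = tt
    room-step ((x , left) ∷ as) (tape l y r ∷ ts) ((rl , rr) , rs) rewrite move-left l x r =
      (shrunk l rl , grown rr) , room-step as ts rs
    room-step ((x , stay) ∷ as) (tape l y r ∷ ts) ((rl , rr) , rs) =
      (≤-trans (+-monoʳ-≤ (length l) (n≤1+n _)) rl , ≤-trans (+-monoʳ-≤ (length r) (n≤1+n _)) rr) , room-step as ts rs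
    room-step ((x , right) ∷ as) (tape l y r ∷ ts) ((rl , rr) , rs) rewrite move-right l x r =
      (grown rl , shrunk r rr) , room-step as ts rs

    tapes-affect : ∀ {n m} (as : Acts n) ts → Room (suc m) ts → let ts′ = Vec.zipWith writeMove as ts in
      Affect (tapeOps as (Vec.map Tape.focus ts′)) (stacks ts) (stacks ts′) ×
      newFoci as (Vec.map Tape.focus ts′) ≡ Vec.map Tape.focus ts′
    tapes-affect [] [] _ = [] , refl
    tapes-affect ((x , left) ∷ as) (tape l y r ∷ ts) ((rl , rr) , rs) rewrite move-left l x r =
      let (af , eq) = tapes-affect as ts rs in
      pad-remove l (<⇒≤ (fits-in rl)) ∷ pad-insert x r (fits-in rr) ∷ af , cong (top l ∷_) eq
    tapes-affect ((x , stay) ∷ as) (tape l y r ∷ ts) ((rl , rr) , rs) =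
      let (af , eq) = tapes-affect as ts rs in (refl , refl) ∷ (refl , refl) ∷ af , cong (x ∷_) eq
    tapes-affect ((x , right) ∷ as) (tape l y r ∷ ts) ((rl , rr) , rs) rewrite move-right l x r =
      let (af , eq) = tapes-affect as ts rs in
      pad-insert x l (fits-in rl) ∷ pad-remove r (<⇒≤ (fits-in rr)) ∷ af , cong (top r ∷_) eq

    inserted : ∀ {x l v} → length l < L → Affects (insert , x) (pad L l) v → v ≡ pad L (x ∷ l)
    inserted {x} {l} {v} lt aff = proj₁ (Listₚ.∷ʳ-injective v (pad L (x ∷ l)) (trans (sym aff) (pad-insert x l lt)))

    removed : ∀ {x l v} → length l ≤ L → Affects (remove , x) (pad L l) v → x ≡ top l × v ≡ pad L (rest l)
    removed {l = l} le aff with Listₚ.∷-injective (trans (sym aff) (pad-remove l le))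
    ... | e , e′ = e , e′

    -- The operations determine the new stacks, and a removal succeeds only for the letter that is
    -- on top; hence the guess `gs` cannot be wrong where it matters.
    tapes-affect⁻ : ∀ {n m} (as : Acts n) gs ts {vs} → Room (suc m) ts → Affect (tapeOps as gs) (stacks ts) vs →
      let ts′ = Vec.zipWith writeMove as ts in vs ≡ stacks ts′ × newFoci as gs ≡ Vec.map Tape.focus ts′
    tapes-affect⁻ [] [] [] _ [] = refl , refl
    tapes-affect⁻ ((x , left) ∷ as) (g ∷ gs) (tape l y r ∷ ts) ((rl , rr) , rs) (a₁ ∷ a₂ ∷ af) rewrite move-left l x r
      with removed {l = l} (<⇒≤ (fits-in rl)) a₁ | inserted {l = r} (fits-in rr) a₂ | tapes-affect⁻ as gs ts rs af
    ... | refl , refl | refl | refl , eq = refl , cong (top l ∷_) eq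
    tapes-affect⁻ ((x , stay) ∷ as) (g ∷ gs) (tape l y r ∷ ts) ((rl , rr) , rs) ((_ , refl) ∷ (_ , refl) ∷ af)
      with tapes-affect⁻ as gs ts rs af
    ... | refl , eq = refl , cong (x ∷_) eq
    tapes-affect⁻ ((x , right) ∷ as) (g ∷ gs) (tape l y r ∷ ts) ((rl , rr) , rs) (a₁ ∷ a₂ ∷ af) rewrite move-right l x r
      with removed {l = r} (<⇒≤ (fits-in rr)) a₂ | inserted {l = l} (fits-in rl) a₁ | tapes-affect⁻ as gs ts rs af
    ... | refl , refl | refl | refl , eq = refl , cong (top r ∷_) eq

    keep-affect : ∀ vs {n} → length vs ≡ n → Affect (replicate n (keep , nothing)) vs vs
    keep-affect []       refl = []
    keep-affect (v ∷ vs) refl = (refl , refl) ∷ keep-affect vs refl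

    keep-affect⁻ : ∀ n {vs vs′} → Affect (replicate n (keep , nothing)) vs vs′ → vs ≡ vs′
    keep-affect⁻ zero    []                 = refl
    keep-affect⁻ (suc n) ((_ , refl) ∷ af) = cong (_ ∷_) (keep-affect⁻ n af)

    erased : List (List (Cell γ))
    erased = replicate (twice T) (replicate L nothing)

    erase-affect : ∀ {n} vs → length vs ≡ n → Level L vs →
      Affect (replicate n (erase , nothing)) vs (replicate n (replicate L nothing))
    erase-affect []       refl []          = []
    erase-affect (v ∷ vs) refl (refl ∷ ls) = (refl , refl) ∷ erase-affect vs refl ls

    iterate-halted : ∀ n v ts → iterate tmStep (config (halted v) ts) n ≡ config (halted v) ts
    iterate-halted zero    v ts = refl
    iterate-halted (suc n) v ts = iterate-halted n v ts

    machine-sound : ∀ n s ts {vs} → Room n ts → Steps (machine s (Vec.map Tape.focus ts)) (stacks ts) n accepted vs →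
      HaltsWith true (iterate tmStep (config s ts) n)
    machine-sound (suc n) .(running s) ts {vs} rm (step (go s _ g) refl aff st)
      with tapes-affect⁻ (proj₂ (δ s (Vec.map Tape.focus ts))) g ts rm aff
    ... | refl , eq = machine-sound n _ _ (room-step (proj₂ (δ s (Vec.map Tape.focus ts))) ts rm)
      (subst (λ z → Steps (machine (proj₁ (δ s (Vec.map Tape.focus ts))) z)
        (stacks (Vec.zipWith writeMove (proj₂ (δ s (Vec.map Tape.focus ts))) ts)) n accepted vs) eq st)
    machine-sound (suc n) .(halted b) ts rm (step (rested b _) refl aff st)
      with keep-affect⁻ (twice T) aff
    ... | refl = machine-sound n (halted b) ts (room-less ts rm) st
    -- The machine has accepted already, and a halted configuration does not change in the remaining
    -- time.
    machine-sound (suc n) .(halted true) ts rm (step (finish _) refl aff st) =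
      cong Config.control (iterate-halted (suc n) true ts)

    machine-complete : ∀ n s ts → Room n ts → HaltsWith true (iterate tmStep (config s ts) n) →
      Steps (machine s (Vec.map Tape.focus ts)) (stacks ts) (suc n) accepted erased
    machine-complete zero .(halted true) ts rm refl =
      step (finish _) refl (erase-affect (stacks ts) (length-stacks ts) (level-stacks ts rm)) stop
    machine-complete (suc n) (running s) ts rm h
      with tapes-affect (proj₂ (δ s (Vec.map Tape.focus ts))) ts rm
    ... | af , eq = step (go s (Vec.map Tape.focus ts) _) refl af
      (subst (λ z → Steps (machine (proj₁ (δ s (Vec.map Tape.focus ts))) z)
          (stacks (Vec.zipWith writeMove (proj₂ (δ s (Vec.map Tape.focus ts))) ts)) (suc n) accepted erased) (sym eq)
        (machine-complete n _ _ (room-step (proj₂ (δ s (Vec.map Tape.focus ts))) ts rm) h))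
    machine-complete (suc n) (halted b) ts rm h =
      step (rested b _) refl (keep-affect (stacks ts) (length-stacks ts))
        (machine-complete n (halted b) ts (room-less ts rm) h)

module GuessPhase {a c : ℕ} (M : TM (suc (a + c)) 0) (L : ℕ) where
  open TM M renaming (step to tmStep)
  open Guessing {a} {c} M
  open Depth L

  others : List (List (Cell γ))
  others = stacks (Vec.replicate k blankTape)

  two : List (Cell γ) → List (Cell γ) → List (List (Cell γ))
  two u w = pad L u ∷ pad L w ∷ others

  length-others : length others ≡ twice k
  length-others = length-stacks (Vec.replicate k blankTape)

  room-blank : ∀ {m} n → m ≤ L → Room m (Vec.replicate n blankTape)
  room-blank zero    le = tt
  room-blank (suc n) le = (le , le) , room-blank n le

  first⁻ : ∀ {x o u w vs} → length u ≤ L → Affect (firstOps (remove , x) o) (two u w) vs →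
           x ≡ top u × ∃[ v ] Affects o (pad L w) v × vs ≡ pad L (rest u) ∷ v ∷ others
  first⁻ {u = u} le (_∷_ {v′ = v₁} a₁ (_∷_ {v′ = v₂} a₂ af)) =
    let (e , e′) = removed {l = u} le a₁ in
    e , v₂ , a₂ , cong₂ (λ v vs → v ∷ v₂ ∷ vs) e′ (sym (keep-affect⁻ (twice k) af))

  first-keep⁻ : ∀ {x} u w {vs} → length u ≤ L → Affect (firstOps (remove , x) (keep , nothing)) (two u w) vs →
                vs ≡ two (rest u) w
  first-keep⁻ u w le af =
    let (_ , v , (_ , e) , eq) = first⁻ {u = u} {w} le af in
    trans eq (cong (λ v → pad L (rest u) ∷ v ∷ others) (sym e))

  first-insert⁻ : ∀ {x z} u w {vs} → length u ≤ L → length w < L →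
    Affect (firstOps (remove , x) (insert , z)) (two u w) vs → vs ≡ two (rest u) (z ∷ w)
  first-insert⁻ u w le lw af =
    let (_ , v , a₂ , eq) = first⁻ {u = u} {w} le af in
    trans eq (cong (λ v → pad L (rest u) ∷ v ∷ others) (inserted {l = w} lw a₂))

  first-remove⁻ : ∀ {x z} u w {vs} → length u ≤ L → length w ≤ L →
    Affect (firstOps (remove , x) (remove , z)) (two u w) vs → z ≡ top w × vs ≡ two (rest u) (rest w)
  first-remove⁻ u w le lw af =
    let (_ , v , a₂ , eq) = first⁻ {u = u} {w} le af
        (e , e′) = removed {l = w} lw a₂
    in e , trans eq (cong (λ v → pad L (rest u) ∷ v ∷ others) e′)

  restate : ∀ {s vs vs′ n vs″} → vs ≡ vs′ → Steps s vs n accepted vs″ → Steps s vs′ n accepted vs″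
  restate refl st = st

  first⁺ : ∀ {o u w v} → length u ≤ L → Affects o (pad L w) v →
           Affect (firstOps (remove , top u) o) (two u w) (pad L (rest u) ∷ v ∷ others)
  first⁺ {u = u} le aff = pad-remove u le ∷ aff ∷ keep-affect others length-others

  hash≢top : ∀ xs → hash ≢ top (map inputLetter xs)
  hash≢top (x ∷ xs) eq = input≢hash (sym eq)

  -- The last mark cannot be dropped or traded for a letter, as all rules of the guessing phase
  -- remove a mark.
  stuck-guessing : ∀ xs w {n vs} → length (map inputLetter xs) ≤ L →
                   ¬ Steps guessing (two (map inputLetter xs) w) n accepted vs
  stuck-guessing xs w le (step skipGuess refl aff _) = hash≢top xs (proj₁ (first⁻ {u = map inputLetter xs} {w} le aff))
  stuck-guessing xs w le (step endGuess refl aff _)  = hash≢top xs (proj₁ (first⁻ {u = map inputLetter xs} {w} le aff))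
  stuck-guessing xs w le (step (guess y) refl aff _) = hash≢top xs (proj₁ (first⁻ {u = map inputLetter xs} {w} le aff))

  -- Guessing cannot end before the last mark, as no rule of the copying phase removes a mark. So
  -- both phases take a fixed number of steps.
  stuck-copying : ∀ u w {n vs} → length (hash ∷ u) ≤ L → ¬ Steps copying (two (hash ∷ u) w) n accepted vs
  stuck-copying u w le (step (copy x) refl aff _)  = input≢hash (proj₁ (first⁻ {u = hash ∷ u} {w} le aff))
  stuck-copying u w le (step (load v) refl aff _) = case proj₁ (first⁻ {u = hash ∷ u} {w} le aff) of λ ()

  guesses : ℕ → List (Fin a) → List (Cell γ)
  guesses j xs = replicate j hash ++ map inputLetter xs

  guess-step : ∀ u w {m vs} → length (hash ∷ u) ≤ L → length w < L →
    Steps guessing (two (hash ∷ u) w) (suc m) accepted vs →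
    Steps guessing (two u w) m accepted vs ⊎
    (∃[ y ] Steps guessing (two u (guessLetter y ∷ w)) m accepted vs) ⊎
    Steps copying (two u (hash ∷ w)) m accepted vs
  guess-step u w le lw (step skipGuess refl af st) = inj₁ (restate (first-keep⁻ (hash ∷ u) w le af) st)
  guess-step u w le lw (step (guess y) refl af st) = inj₂ (inj₁ (y , restate (first-insert⁻ (hash ∷ u) w le lw af) st))
  guess-step u w le lw (step endGuess refl af st)  = inj₂ (inj₂ (restate (first-insert⁻ (hash ∷ u) w le lw af) st))

  guess-sound : ∀ j xs w {m vs} → length (guesses (suc j) xs) ≤ L → length w + suc j ≤ L →
    Steps guessing (two (guesses (suc j) xs) w) (suc j + m) accepted vs →
    ∃[ y ] length y ≤ j × Steps copying (two (map inputLetter xs) (hash ∷ map guessLetter y ++ w)) m accepted vs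
  guess-sound zero xs w le lw st =
    [ (λ st′ → ⊥-elim (stuck-guessing xs w (<⇒≤ le) st′))
    , [ (λ (y , st′) → ⊥-elim (stuck-guessing xs (guessLetter y ∷ w) (<⇒≤ le) st′))
      , (λ st′ → [] , z≤n , st′) ]′ ]′ (guess-step (guesses zero xs) w le (fits-in lw) st)
  guess-sound (suc j) xs w le lw st =
    [ (λ st′ →
        let (y , ly , st″) = guess-sound j xs w (<⇒≤ le) (≤-trans (+-monoʳ-≤ (length w) (n≤1+n _)) lw) st′
        in y , ≤-trans ly (n≤1+n j) , st″)
    , [ (λ (y₀ , st′) →
          let (y , ly , st″) = guess-sound j xs (guessLetter y₀ ∷ w) (<⇒≤ le) (grown lw) st′
          in y ++ y₀ ∷ [] , ≤-trans (≤-reflexive (trans (Listₚ.length-++ y) (+-comm (length y) 1))) (s≤s ly) ,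
             restate (cong (λ z → two (map inputLetter xs) (hash ∷ z))
               (sym (trans (cong (_++ w) (Listₚ.map-++ guessLetter y (y₀ ∷ [])))
                 (Listₚ.++-assoc (map guessLetter y) _ w)))) st″)
      , (λ st′ → ⊥-elim (stuck-copying (guesses j xs) (hash ∷ w) (<⇒≤ le) st′)) ]′ ]′
    (guess-step (guesses (suc j) xs) w le (fits-in lw) st)

  guess-complete : ∀ j xs ys w {m vs} → length (guesses (suc j) xs) ≤ L → length w + suc j ≤ L → length ys ≤ j →
    Steps copying (two (map inputLetter xs) (hash ∷ (map guessLetter ys ʳ++ w))) m accepted vs →
    Steps guessing (two (guesses (suc j) xs) w) (suc j + m) accepted vs
  guess-complete zero xs [] w le lw _ st =
    step endGuess refl (first⁺ {u = guesses 1 xs} {w} le (pad-insert hash w (fits-in lw))) st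
  guess-complete (suc j) xs [] w le lw _ st =
    step skipGuess refl (first⁺ {u = guesses (2 + j) xs} {w} le (refl , refl))
      (guess-complete j xs [] w (<⇒≤ le) (≤-trans (+-monoʳ-≤ (length w) (n≤1+n _)) lw) z≤n st)
  guess-complete (suc j) xs (y ∷ ys) w le lw (s≤s ly) st =
    step (guess y) refl (first⁺ {u = guesses (2 + j) xs} {w} le (pad-insert (guessLetter y) w (fits-in lw)))
      (guess-complete j xs ys (guessLetter y ∷ w) (<⇒≤ le) (grown lw) ly st)

  copy-sound : ∀ xs w {m vs} → length (map inputLetter xs) ≤ L → length w + length xs ≤ L →
    Steps copying (two (map inputLetter xs) w) (length xs + m) accepted vs →
    Steps copying (two [] (map inputLetter xs ʳ++ w)) m accepted vs
  copy-sound [] w le lw st = st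
  copy-sound (x ∷ xs) w le lw (step (load v) refl aff _) =
    case proj₁ (first⁻ {u = map inputLetter (x ∷ xs)} {w} le aff) of λ ()
  copy-sound (x ∷ xs) w le lw (step (copy x′) refl aff st) =
    copy-sound xs (inputLetter x ∷ w) (<⇒≤ le) (grown lw)
      (restate (trans (first-insert⁻ (map inputLetter (x ∷ xs)) w le (fits-in lw) aff)
        (cong (λ z → two (map inputLetter xs) (z ∷ w)) (proj₁ (first⁻ {u = map inputLetter (x ∷ xs)} {w} le aff)))) st)

  copy-complete : ∀ xs w {m vs} → length (map inputLetter xs) ≤ L → length w + length xs ≤ L →
    Steps copying (two [] (map inputLetter xs ʳ++ w)) m accepted vs →
    Steps copying (two (map inputLetter xs) w) (length xs + m) accepted vs
  copy-complete [] w le lw st = st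
  copy-complete (x ∷ xs) w le lw st =
    step (copy x) refl (first⁺ {u = map inputLetter (x ∷ xs)} {w} le (pad-insert (inputLetter x) w (fits-in lw)))
      (copy-complete xs (inputLetter x ∷ w) (<⇒≤ le) (grown lw) st)

  begin-sound : ∀ w {m vs} → length w ≤ L → Steps copying (two [] w) (suc m) accepted vs →
    Steps (machine (running start) (top w ∷ Vec.replicate k nothing)) (two [] (rest w)) m accepted vs
  begin-sound w le (step (copy x) refl aff _) = case proj₁ (first⁻ {u = []} {w} z≤n aff) of λ ()
  begin-sound w le (step (load v) refl aff st) =
    let (e , eq) = first-remove⁻ [] w z≤n le aff in
    restate eq (subst (λ z → Steps (machine (running start) (z ∷ Vec.replicate k nothing)) _ _ accepted _) e st)

  begin-complete : ∀ w {m vs} → length w ≤ L →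
    Steps (machine (running start) (top w ∷ Vec.replicate k nothing)) (two [] (rest w)) m accepted vs →
    Steps copying (two [] w) (suc m) accepted vs
  begin-complete w le st = step (load (top w)) refl (first⁺ {u = []} {w} z≤n (pad-remove w le)) st

  initialTapes : Word (suc (a + c)) → Vec (Tape γ) T
  initialTapes x = loadTape (map ι x) ∷ Vec.replicate k blankTape

  load-stacks : ∀ x {w} → map (just ∘ ι) x ≡ w → w ≢ [] →
    stacks (initialTapes x) ≡ two [] (rest w) × Vec.map Tape.focus (initialTapes x) ≡ top w ∷ Vec.replicate k nothing
  load-stacks [] refl ne = contradiction refl ne
  load-stacks (s ∷ x) refl ne = cong (λ z → pad L [] ∷ pad L z ∷ others) (sym (Listₚ.map-∘ x)) ,
    cong (just (ι s) ∷_) (Vecₚ.map-replicate Tape.focus blankTape k)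

  -- Transferring the input from stack to stack reverses it; the first stack therefore starts with
  -- the reversed input.
  pair-letters : ∀ xs y → map (just ∘ ι) (pair (reverse xs) y) ≡ map inputLetter xs ʳ++ (hash ∷ map guessLetter y)
  pair-letters xs y = begin
    map (just ∘ ι) (map (λ s → suc (s ↑ˡ c)) (reverse xs) ++ zero ∷ map (λ s → suc (a ↑ʳ s)) y)
      ≡⟨ Listₚ.map-++ (just ∘ ι) (map (λ s → suc (s ↑ˡ c)) (reverse xs)) _ ⟩
    map (just ∘ ι) (map (λ s → suc (s ↑ˡ c)) (reverse xs)) ++ hash ∷ map (just ∘ ι) (map (λ s → suc (a ↑ʳ s)) y)
      ≡⟨ cong₂ (λ u v → u ++ hash ∷ v) (sym (Listₚ.map-∘ (reverse xs))) (sym (Listₚ.map-∘ y)) ⟩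
    map inputLetter (reverse xs) ++ hash ∷ map guessLetter y
      ≡⟨ cong (_++ hash ∷ map guessLetter y) (Listₚ.reverse-map inputLetter xs) ⟩
    reverse (map inputLetter xs) ++ hash ∷ map guessLetter y
      ≡⟨ sym (Listₚ.ʳ++-defn (map inputLetter xs)) ⟩
    map inputLetter xs ʳ++ (hash ∷ map guessLetter y) ∎
    where open ≡-Reasoning

  module _ (r : ℕ) (xs : List (Fin a)) (m : ℕ) (room : suc r + (length xs + suc m) ≤ L) where

    length-guesses : length (guesses (suc r) xs) ≤ L
    length-guesses = ≤-trans (≤-reflexive (trans (Listₚ.length-++ (replicate (suc r) hash))
      (cong₂ _+_ (Listₚ.length-replicate (suc r)) (Listₚ.length-map inputLetter xs))))
      (≤-trans (+-monoʳ-≤ (suc r) (m≤m+n (length xs) (suc m))) room)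

    length-xs : length (map inputLetter xs) ≤ L
    length-xs = ≤-trans (≤-trans (m≤n+m _ (length (replicate (suc r) hash)))
      (≤-reflexive (sym (Listₚ.length-++ (replicate (suc r) hash))))) length-guesses

    module _ (y : List (Fin c)) (ly : length y ≤ r) where

      full : List (Cell γ)
      full = map inputLetter xs ʳ++ (hash ∷ map guessLetter y)

      length-full : length full + suc m ≤ L
      length-full = ≤-trans (+-monoˡ-≤ (suc m) (≤-trans
        (≤-reflexive (trans (Listₚ.length-ʳ++ (map inputLetter xs)) (cong₂ (λ u v → u + suc v)
          (Listₚ.length-map inputLetter xs) (Listₚ.length-map guessLetter y))))
        (+-monoʳ-≤ (length xs) (s≤s ly)))) (≤-trans (≤-reflexive (lem (length xs) r m)) room)
        where
        lem : ∀ x r m → x + suc r + suc m ≡ suc r + (x + suc m)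
        lem = solve-∀

      full≢[] : full ≢ []
      full≢[] eq with trans (sym (Listₚ.length-ʳ++ (map inputLetter xs))) (cong length eq)
      ... | e with trans (sym (+-suc (length (map inputLetter xs)) _)) e
      ... | ()

      loaded = load-stacks (pair (reverse xs) y) (pair-letters xs y) full≢[]

      room-loaded : ∀ {n} → n ≤ suc m → Room n (initialTapes (pair (reverse xs) y))
      room-loaded {n} le = room′ (pair (reverse xs) y) (pair-letters xs y)
        where
        n≤L = ≤-trans le (≤-trans (m≤n+m (suc m) (length full)) length-full)
        room′ : ∀ x → map (just ∘ ι) x ≡ full → Room n (initialTapes x)
        room′ [] eq = (n≤L , n≤L) , room-blank k n≤L
        room′ (s ∷ x) eq = (n≤L , ≤-trans (+-mono-≤ (≤-trans (≤-reflexive (trans (Listₚ.length-map just (map ι x))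
          (trans (Listₚ.length-map ι x) (sym (Listₚ.length-map (just ∘ ι) x)))))
          (≤-trans (n≤1+n _) (≤-reflexive (cong length eq)))) le) length-full) , room-blank k n≤L

    guessing-sound : ∀ {vs} → Steps guessing (two (guesses (suc r) xs) []) (suc r + (length xs + suc m)) accepted vs →
      ∃[ y ] length y ≤ r × HaltsWith true (runFor m (pair (reverse xs) y))
    guessing-sound {vs} st =
      let (y , ly , st′) = guess-sound r xs [] length-guesses (≤-trans (m≤m+n _ _) room) st in
      y , ly , machine-sound m (running start) (initialTapes (pair (reverse xs) y)) (room-loaded y ly (n≤1+n m))
        (subst₂ (λ f v → Steps (machine (running start) f) v m accepted vs) (sym (proj₂ (loaded y ly))) (sym (proj₁ (loaded y ly)))
          (begin-sound (full y ly) (≤-trans (m≤m+n _ (suc m)) (length-full y ly))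
            (copy-sound xs (hash ∷ map guessLetter y) length-xs (copy-room y ly)
              (restate (cong (λ z → two (map inputLetter xs) (hash ∷ z)) (Listₚ.++-identityʳ _)) st′))))
      where
      copy-room : ∀ y → length y ≤ r → suc (length (map guessLetter y)) + length xs ≤ L
      copy-room y ly = ≤-trans (≤-trans (+-monoˡ-≤ (length xs) (s≤s (≤-trans (≤-reflexive (Listₚ.length-map guessLetter y)) ly)))
        (+-monoʳ-≤ (suc r) (m≤m+n (length xs) (suc m)))) room

    -- One of the `m` rows is spent on `finish`, so the verifier has to be done after `n` steps, one
    -- less than in the converse.
    guessing-complete : ∀ {n} y → suc n ≡ m → length y ≤ r → HaltsWith true (runFor n (pair (reverse xs) y)) →
      Steps guessing (two (guesses (suc r) xs) []) (suc r + (length xs + suc m)) accepted erased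
    guessing-complete {n} y refl ly h = guess-complete r xs (reverse y) [] length-guesses (≤-trans (m≤m+n _ _) room)
      (≤-trans (≤-reflexive (Listₚ.length-reverse y)) ly)
      (subst (λ z → Steps copying (two (map inputLetter xs) (hash ∷ z)) _ accepted erased)
        (sym (trans (cong (_ʳ++ []) (Listₚ.reverse-map guessLetter y)) (Listₚ.reverse-involutive _)))
        (copy-complete xs (hash ∷ map guessLetter y) length-xs copy-room
          (begin-complete (full y ly) (≤-trans (m≤m+n _ (suc m)) (length-full y ly))
            (subst₂ (λ f v → Steps (machine (running start) f) v m accepted erased) (proj₂ (loaded y ly)) (proj₁ (loaded y ly))
              (machine-complete n (running start) (initialTapes (pair (reverse xs) y))
                (room-loaded y ly (≤-trans (n≤1+n n) (n≤1+n (suc n)))) h)))))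
      where
      copy-room : suc (length (map guessLetter y)) + length xs ≤ L
      copy-room = ≤-trans (≤-trans (+-monoˡ-≤ (length xs) (s≤s (≤-trans (≤-reflexive (Listₚ.length-map guessLetter y)) ly)))
        (+-monoʳ-≤ (suc r) (m≤m+n (length xs) (suc m)))) room

-- Binary numbers

val : List Bit → ℕ
val []      = 0
val (d ∷ w) = toℕ d + 2 * val w

norm : Bit → List Bit → List Bit
norm zero    []      = []
norm zero    (d ∷ w) = zero ∷ d ∷ w
norm (suc d) w       = suc d ∷ w

strip : List Bit → List Bit
strip = foldr norm []

-- `binary` is defined by counting; these two equations make a positional notation of it.
binary-double : ∀ v → binary (2 * v) ≡ norm 0b (binary v) × binary (1 + 2 * v) ≡ 1b ∷ binary v
binary-double zero = refl , refl
binary-double (suc v) rewrite +-suc v (v + 0) with binary-double v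
... | e , e′ rewrite e = even (binary v) , trans (cong increment (even (binary v))) (odd (binary v))
  where
  even : ∀ w → increment (increment (norm 0b w)) ≡ norm 0b (increment w)
  even []          = refl
  even (zero ∷ w)  = refl
  even (suc zero ∷ w) = refl
  odd : ∀ w → increment (norm 0b (increment w)) ≡ 1b ∷ increment w
  odd []          = refl
  odd (zero ∷ w)  = refl
  odd (suc zero ∷ w) = refl

binary-norm : ∀ d v → binary (toℕ d + 2 * v) ≡ norm d (binary v)
binary-norm zero       v = proj₁ (binary-double v)
binary-norm (suc zero) v = proj₂ (binary-double v)

binary-val : ∀ w → binary (val w) ≡ strip w
binary-val []      = refl
binary-val (d ∷ w) = trans (binary-norm d (val w)) (cong (norm d) (binary-val w))

val-binary : ∀ n → val (binary n) ≡ n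
val-binary zero    = refl
val-binary (suc n) = trans (val-increment (binary n)) (cong suc (val-binary n))
  where
  val-increment : ∀ w → val (increment w) ≡ suc (val w)
  val-increment []             = refl
  val-increment (zero ∷ w)     = refl
  val-increment (suc zero ∷ w) = trans (cong (2 *_) (val-increment w)) (lem (val w))
    where
    lem : ∀ v → 2 * suc v ≡ suc (1 + 2 * v)
    lem = solve-∀

strip-binary : ∀ n → strip (binary n) ≡ binary n
strip-binary n = trans (sym (binary-val (binary n))) (cong binary (val-binary n))

binary-injective : ∀ {m n} → binary m ≡ binary n → m ≡ n
binary-injective {m} {n} eq = trans (sym (val-binary m)) (trans (cong val eq) (val-binary n))

val-++ : ∀ u v → val (u ++ v) ≡ val u + 2 ^ length u * val v
val-++ []      v = sym (*-identityˡ (val v))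
val-++ (d ∷ u) v rewrite val-++ u v = lem (toℕ d) (val u) (2 ^ length u) (val v)
  where
  lem : ∀ d u p v → d + 2 * (u + p * v) ≡ d + 2 * u + 2 * p * v
  lem = solve-∀

val-bound : ∀ w → val w < 2 ^ length w
val-bound []      = s≤s z≤n
val-bound (d ∷ w) = ≤-trans (+-monoˡ-≤ (2 * val w) (Finₚ.toℕ<n d))
  (≤-trans (≤-reflexive (lem (val w))) (*-monoʳ-≤ 2 (val-bound w)))
  where
  lem : ∀ v → 2 + 2 * v ≡ 2 * suc v
  lem = solve-∀

-- Fixed width, leading zeros included, as needed for digits in the interior of a number.
bits : ℕ → ℕ → List Bit
bits zero    n = []
bits (suc k) n with n DivMod.% 2
... | zero  = 0b ∷ bits k (n DivMod./ 2)
... | suc _ = 1b ∷ bits k (n DivMod./ 2)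

length-bits : ∀ k n → length (bits k n) ≡ k
length-bits zero    n = refl
length-bits (suc k) n with n DivMod.% 2
... | zero  = cong suc (length-bits k _)
... | suc _ = cong suc (length-bits k _)

val-bits : ∀ k n → n < 2 ^ k → val (bits k n) ≡ n
val-bits zero    zero    lt       = refl
val-bits zero    (suc n) (s≤s ())
val-bits (suc k) n lt with n DivMod.% 2 in eq | val-bits k (n DivMod./ 2) half
  where
  half : n DivMod./ 2 < 2 ^ k
  half = DivMod.m<n*o⇒m/o<n (≤-trans lt (≤-reflexive (*-comm 2 (2 ^ k))))
... | zero | ih = trans (cong (2 *_) ih) (trans (*-comm 2 (n DivMod./ 2))
  (sym (trans (DivMod.m≡m%n+[m/n]*n n 2) (cong (_+ n DivMod./ 2 * 2) eq))))
... | suc zero | ih = trans (cong (λ z → 1 + 2 * z) ih) (trans (cong suc (*-comm 2 (n DivMod./ 2)))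
  (sym (trans (DivMod.m≡m%n+[m/n]*n n 2) (cong (_+ n DivMod./ 2 * 2) eq))))
... | suc (suc r) | ih = ⊥-elim (<⇒≱ (DivMod.m%n<n n 2) (≤-trans (s≤s (s≤s z≤n)) (≤-reflexive (sym eq))))

strip-++ : ∀ u {n} → 0 < n → strip (u ++ binary n) ≡ u ++ binary n
strip-++ []      {n} n>0 = strip-binary n
strip-++ (d ∷ u) {n} n>0 = trans (cong (norm d) (strip-++ u n>0)) (norm-∷ d (u ++ binary n) nonempty)
  where
  norm-∷ : ∀ d w → w ≢ [] → norm d w ≡ d ∷ w
  norm-∷ zero    []      ne = contradiction refl ne
  norm-∷ zero    (_ ∷ w) ne = refl
  norm-∷ (suc d) w       ne = refl
  nonempty : u ++ binary n ≢ []
  nonempty eq = <⇒≢ n>0 (sym (binary-injective {n} {0} (Listₚ.++-conicalʳ u (binary n) eq)))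

length-strip : ∀ w → length (strip w) ≤ length w
length-strip []      = z≤n
length-strip (d ∷ w) = ≤-trans (length-norm d (strip w)) (s≤s (length-strip w))
  where
  length-norm : ∀ d w → length (norm d w) ≤ suc (length w)
  length-norm zero    []      = z≤n
  length-norm zero    (_ ∷ w) = ≤-refl
  length-norm (suc d) w       = ≤-refl

length-binary : ∀ k {n} → n < 2 ^ k → length (binary n) ≤ k
length-binary k {n} lt = ≤-trans (≤-reflexive (cong length (trans (cong binary (sym (val-bits k n lt))) (binary-val (bits k n)))))
  (≤-trans (length-strip (bits k n)) (≤-reflexive (length-bits k n)))

xor³ maj : Bit → Bit → Bit → Bit
xor³ zero    zero    e       = e
xor³ zero    (suc d) zero    = 1b
xor³ zero    (suc d) (suc e) = 0b
xor³ (suc c) zero    zero    = 1b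
xor³ (suc c) zero    (suc e) = 0b
xor³ (suc c) (suc d) e       = e
maj zero    zero    e       = 0b
maj zero    (suc d) e       = e
maj (suc c) zero    e       = e
maj (suc c) (suc d) e       = 1b

full-adder : ∀ c d e → toℕ c + toℕ d + toℕ e ≡ toℕ (xor³ c d e) + 2 * toℕ (maj c d e)
full-adder zero       zero       zero       = refl
full-adder zero       zero       (suc zero) = refl
full-adder zero       (suc zero) zero       = refl
full-adder zero       (suc zero) (suc zero) = refl
full-adder (suc zero) zero       zero       = refl
full-adder (suc zero) zero       (suc zero) = refl
full-adder (suc zero) (suc zero) zero       = refl
full-adder (suc zero) (suc zero) (suc zero) = refl

-- Words and binary arithmetic in the language of safe recursion

module Programs (g : ℕ) where
  γ = 3 + g
  open Language γ public

  up : Bit → Letter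
  up zero    = zero
  up (suc d) = suc zero

  bitOf : Letter → Bit
  bitOf zero    = 0b
  bitOf (suc c) = 1b

  bitOf-up : ∀ w → map bitOf (map up w) ≡ w
  bitOf-up []             = refl
  bitOf-up (zero ∷ w)     = cong (0b ∷_) (bitOf-up w)
  bitOf-up (suc zero ∷ w) = cong (1b ∷_) (bitOf-up w)

  end : Letter
  end = suc (suc zero)

  num : ℕ → Word γ
  num n = map up (binary n)

  headBit : Word γ → Bit
  headBit []      = 0b
  headBit (c ∷ w) = bitOf c

  tail : Word γ → Word γ
  tail []      = []
  tail (c ∷ w) = w

  pop : ∀ {n s} → Fin s → Exp n s
  pop j = case j nil (λ _ → svar 0F)

  ⟦pop⟧ : ∀ {n s} j (xs : Env n) (as : Env s) → ⟦ pop j ⟧ xs as ≡ tail (Vec.lookup as j)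
  ⟦pop⟧ j xs as with Vec.lookup as j
  ... | []    = refl
  ... | _ ∷ _ = refl

  transfer : ∀ {n s} → Fin s → Fin s → Exp n s
  transfer j j′ = case j (svar j′) (λ c → cons c (svar (suc j′)))

  -- An exhausted number goes on with zeros. `letS nil` supplies an empty rest, so that both
  -- branches continue in the same context.
  caseBit : ∀ {n s} → Fin s → (Bit → Exp n (suc s)) → Exp n s
  caseBit j f = case j (letS nil (f 0b)) (λ c → f (bitOf c))

  ⟦caseBit⟧ : ∀ {n s} j f (xs : Env n) (as : Env s) →
    ⟦ caseBit j f ⟧ xs as ≡ ⟦ f (headBit (Vec.lookup as j)) ⟧ xs (tail (Vec.lookup as j) ∷ as)
  ⟦caseBit⟧ j f xs as with Vec.lookup as j
  ... | []    = refl
  ... | _ ∷ _ = refl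

  opaque
    literal : ∀ {n s} → Word γ → Exp n s → Exp n s
    literal []      e = e
    literal (c ∷ w) e = cons c (literal w e)

    ⟦literal⟧ : ∀ {n s} w (e : Exp n s) xs as → ⟦ literal w e ⟧ xs as ≡ w ++ ⟦ e ⟧ xs as
    ⟦literal⟧ []      e xs as = refl
    ⟦literal⟧ (c ∷ w) e xs as = cong (c ∷_) (⟦literal⟧ w e xs as)

  copies : ℕ → Word γ → Word γ → Word γ
  copies zero    w u = u
  copies (suc n) w u = copies n w (w ++ u)

  opaque
    repeat : ∀ {n s} → Fin n → Word γ → Exp n s → Exp n s
    repeat i w e = loop i (e ∷ []) (λ _ → literal w (svar 0F) ∷ []) (svar 0F)

    ⟦repeat⟧ : ∀ {n s} i w (e : Exp n s) xs as →
      ⟦ repeat i w e ⟧ xs as ≡ copies (length (Vec.lookup xs i)) w (⟦ e ⟧ xs as)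
    ⟦repeat⟧ {n} {s} i w e xs as = go (Vec.lookup xs i) (⟦ e ⟧ xs as)
      where
      body : Letter → Exps (suc n) (1 + s) 1
      body _ = literal w (svar 0F) ∷ []
      go : ∀ v u → Vec.lookup (⟦loop⟧ body xs as v (u ∷ []) Vec.++ as) zero ≡ copies (length v) w u
      go []      u = refl
      go (c ∷ v) u = trans (cong (λ z → Vec.lookup (⟦loop⟧ body xs as v (z ∷ []) Vec.++ as) zero)
        (⟦literal⟧ w (svar 0F) (v ∷ xs) (u ∷ as))) (go v (w ++ u))

  length-copies : ∀ n w u → length (copies n w u) ≡ n * length w + length u
  length-copies zero    w u = refl
  length-copies (suc n) w u = trans (length-copies n w (w ++ u))
    (trans (cong (n * length w +_) (Listₚ.length-++ w)) (lem (n * length w) (length w) (length u)))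
    where
    lem : ∀ x y z → x + (y + z) ≡ y + x + z
    lem = solve-∀

  opaque
    -- Horner's rule on lengths. The word for the inner polynomial depends on no safe variable, so
    -- `letN` can make it normal; it is then looped over once per letter of the argument.
    unary : ∀ {n} → Polynomial → Fin n → Exp n 0
    unary []      i = nil
    unary (c ∷ p) i = letN (unary p i) (loop (suc i) (literal (replicate c zero) nil ∷ [])
      (λ _ → repeat 1F (zero ∷ []) (svar 0F) ∷ []) (svar 0F))

    length-unary : ∀ {n} p i (xs : Env n) → length (⟦ unary p i ⟧ xs []) ≡ eval p (length (Vec.lookup xs i))
    length-unary []      i xs = refl
    length-unary {n} (c ∷ p) i xs =
      trans (go (Vec.lookup xs i) (⟦ literal (replicate c zero) nil ⟧ (q ∷ xs) []))
        (trans (cong₂ (λ y z → y + length (Vec.lookup xs i) * z)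
          (trans (cong length (trans (⟦literal⟧ (replicate c zero) nil (q ∷ xs) []) (Listₚ.++-identityʳ _)))
            (Listₚ.length-replicate c)) (length-unary p i xs)) refl)
      where
      q : Word γ
      q = ⟦ unary p i ⟧ xs []
      body : Letter → Exps (suc (suc n)) 1 1
      body _ = repeat 1F (zero ∷ []) (svar 0F) ∷ []
      go : ∀ v u → length (Vec.lookup (⟦loop⟧ body (q ∷ xs) [] v (u ∷ []) Vec.++ []) zero) ≡ length u + length v * length q
      go []      u = sym (+-identityʳ _)
      go (x ∷ v) u = trans (go v _) (trans (cong (_+ length v * length q)
          (trans (cong length (⟦repeat⟧ 1F (zero ∷ []) (svar 0F) (v ∷ q ∷ xs) (u ∷ [])))
            (length-copies (length q) (zero ∷ []) u)))
        (lem (length q) (length u) (length v * length q)))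
        where
        lem : ∀ q u x → q * 1 + u + x ≡ u + (q + x)
        lem = solve-∀

  -- The variable i only serves as a clock in the following loops.

  opaque
    revOnto : ∀ {n s} → Fin n → Exp n s → Exp n s → Exp n s
    revOnto i e e′ = loop i (e ∷ e′ ∷ []) (λ _ → pop 0F ∷ transfer 0F 1F ∷ []) (svar 1F)

    ⟦revOnto⟧ : ∀ {n s} i (e e′ : Exp n s) xs as → length (⟦ e ⟧ xs as) ≤ length (Vec.lookup xs i) →
      ⟦ revOnto i e e′ ⟧ xs as ≡ ⟦ e ⟧ xs as ʳ++ ⟦ e′ ⟧ xs as
    ⟦revOnto⟧ {n} {s} i e e′ xs as = go (Vec.lookup xs i) (⟦ e ⟧ xs as) (⟦ e′ ⟧ xs as)
      where
      body : Letter → Exps (suc n) (2 + s) 2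
      body _ = pop 0F ∷ transfer 0F 1F ∷ []
      go : ∀ w u v → length u ≤ length w →
        Vec.lookup (⟦loop⟧ body xs as w (u ∷ v ∷ []) Vec.++ as) (suc zero) ≡ u ʳ++ v
      go []      []      v le = refl
      go (_ ∷ w) []      v le = go w [] v z≤n
      go (_ ∷ w) (c ∷ u) v (s≤s le) = go w u (c ∷ v) le

  opaque
    prepend : ∀ {n s} → Fin n → Exp n s → Exp n s → Exp n s
    prepend i e e′ = revOnto i (revOnto i e nil) e′

    ⟦prepend⟧ : ∀ {n s} i (e e′ : Exp n s) xs as → length (⟦ e ⟧ xs as) ≤ length (Vec.lookup xs i) →
      ⟦ prepend i e e′ ⟧ xs as ≡ ⟦ e ⟧ xs as ++ ⟦ e′ ⟧ xs as
    ⟦prepend⟧ i e e′ xs as le = trans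
      (⟦revOnto⟧ i (revOnto i e nil) e′ xs as (≤-trans (≤-reflexive (trans (cong length rev) (Listₚ.length-reverse (⟦ e ⟧ xs as)))) le))
      (trans (cong (_ʳ++ ⟦ e′ ⟧ xs as) rev) (trans (Listₚ.ʳ++-defn (reverse (⟦ e ⟧ xs as)))
        (cong (_++ ⟦ e′ ⟧ xs as) (Listₚ.reverse-involutive (⟦ e ⟧ xs as)))))
      where
      rev : ⟦ revOnto i e nil ⟧ xs as ≡ reverse (⟦ e ⟧ xs as)
      rev = ⟦revOnto⟧ i e nil xs as le

  -- Removal of leading zeros from a word with the most significant digit
  -- first; the result has the least significant digit first.

  normHead : Letter → Word γ → Word γ
  normHead zero    []      = []
  normHead zero    (d ∷ w) = zero ∷ d ∷ w
  normHead (suc c) w       = suc c ∷ w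

  normE : ∀ {n s} → Fin s → Fin s → Exp n s
  normE j j′ = case j (svar j′) λ
    { zero    → case (suc j′) nil (λ d → cons zero (cons d (svar 0F)))
    ; (suc c) → cons (suc c) (svar (suc j′)) }

  opaque
    canonical : ∀ {n s} → Fin n → Exp n s → Exp n s
    canonical i e = loop i (e ∷ nil ∷ []) (λ _ → pop 0F ∷ normE 0F 1F ∷ []) (svar 1F)

    ⟦canonical⟧ : ∀ {n s} i (e : Exp n s) xs as → length (⟦ e ⟧ xs as) ≤ length (Vec.lookup xs i) →
      ⟦ canonical i e ⟧ xs as ≡ foldl (λ w c → normHead c w) [] (⟦ e ⟧ xs as)
    ⟦canonical⟧ {n} {s} i e xs as = go (Vec.lookup xs i) (⟦ e ⟧ xs as) []
      where
      body : Letter → Exps (suc n) (2 + s) 2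
      body _ = pop 0F ∷ normE 0F 1F ∷ []
      go : ∀ w u v → length u ≤ length w →
        Vec.lookup (⟦loop⟧ body xs as w (u ∷ v ∷ []) Vec.++ as) (suc zero) ≡ foldl (λ w c → normHead c w) v u
      go []      []             v       le       = refl
      go (_ ∷ w) []             v       le       = go w [] v z≤n
      go (_ ∷ w) (zero ∷ u)     []      (s≤s le) = go w u [] le
      go (_ ∷ w) (zero ∷ u)     (d ∷ v) (s≤s le) = go w u (zero ∷ d ∷ v) le
      go (_ ∷ w) (suc c ∷ u)    v       (s≤s le) = go w u (suc c ∷ v) le

  normHead-up : ∀ d w → normHead (up d) (map up w) ≡ map up (norm d w)
  normHead-up zero       []      = refl
  normHead-up zero       (d ∷ w) = refl
  normHead-up (suc zero) w       = refl

  norm-reverse : ∀ w → foldl (λ w c → normHead c w) [] (reverse (map up w)) ≡ map up (strip w)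
  norm-reverse w = trans (Listₚ.reverse-foldl (λ w c → normHead c w) [] (map up w)) (go w)
    where
    go : ∀ w → foldr normHead [] (map up w) ≡ map up (strip w)
    go []      = refl
    go (d ∷ w) = trans (cong (normHead (up d)) (go w)) (normHead-up d (strip w))

  addBits : ℕ → Bit → Word γ → Word γ → List Bit
  addBits zero    c p q = []
  addBits (suc k) c p q = xor³ c (headBit p) (headBit q) ∷ addBits k (maj c (headBit p) (headBit q)) (tail p) (tail q)

  value : Word γ → ℕ
  value w = val (map bitOf w)

  value-step : ∀ w → value w ≡ toℕ (headBit w) + 2 * value (tail w)
  value-step []      = refl
  value-step (c ∷ w) = refl

  val-addBits : ∀ k c p q → toℕ c + value p + value q < 2 ^ k → val (addBits k c p q) ≡ toℕ c + value p + value q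
  val-addBits zero    c p q lt = sym (ℕₚ.n<1⇒n≡0 lt)
  val-addBits (suc k) c p q lt = trans
    (cong (λ z → toℕ (xor³ c (headBit p) (headBit q)) + 2 * z)
      (val-addBits k (maj c (headBit p) (headBit q)) (tail p) (tail q) (*-cancelˡ-< 2 _ _
        (≤-<-trans (≤-trans (m≤n+m _ (toℕ (xor³ c (headBit p) (headBit q)))) (≤-reflexive (sym eq))) lt))))
    (sym eq)
    where
    lem : ∀ c d e p q → c + (d + 2 * p) + (e + 2 * q) ≡ (c + d + e) + 2 * (p + q)
    lem = solve-∀
    lem′ : ∀ x m p q → x + 2 * m + 2 * (p + q) ≡ x + 2 * (m + p + q)
    lem′ = solve-∀
    eq : toℕ c + value p + value q ≡ toℕ (xor³ c (headBit p) (headBit q)) +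
           2 * (toℕ (maj c (headBit p) (headBit q)) + value (tail p) + value (tail q))
    eq = trans (cong₂ (λ x y → toℕ c + x + y) (value-step p) (value-step q))
      (trans (lem (toℕ c) (toℕ (headBit p)) (toℕ (headBit q)) (value (tail p)) (value (tail q)))
      (trans (cong (_+ 2 * (value (tail p) + value (tail q))) (full-adder c (headBit p) (headBit q)))
      (lem′ (toℕ (xor³ c (headBit p) (headBit q))) (toℕ (maj c (headBit p) (headBit q))) (value (tail p)) (value (tail q)))))

  opaque
    carryE outE : ∀ {n s} → Exp n (4 + s)
    carryE = caseBit 0F λ c → caseBit 2F λ d → caseBit 4F λ e →
      cons (up (maj c d e)) nil
    outE = caseBit 0F λ c → caseBit 2F λ d → caseBit 4F λ e →
      cons (up (xor³ c d e)) (svar 6F)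

    -- Addition with carry; the accumulators are the carry, the unread digits of the two summands,
    -- and the result. The latter comes out with the most significant digit first, as `canonical`
    -- expects it.
    sumE : ∀ {n s} → Fin n → Exp n s → Exp n s → Exp n s
    sumE i e e′ = canonical i (loop i (cons zero nil ∷ e ∷ e′ ∷ nil ∷ [])
      (λ _ → carryE ∷ pop 1F ∷ pop 2F ∷ outE ∷ []) (svar 3F))

    ⟦sumE⟧ : ∀ {n s} i (e e′ : Exp n s) xs as {u v} → ⟦ e ⟧ xs as ≡ num u → ⟦ e′ ⟧ xs as ≡ num v →
      u + v < 2 ^ length (Vec.lookup xs i) → ⟦ sumE i e e′ ⟧ xs as ≡ num (u + v)
    ⟦sumE⟧ {n} {s} i e e′ xs as {u} {v} eu ev lt =
      trans (⟦canonical⟧ i inner xs as (≤-reflexive (trans (cong length inner≡)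
        (trans (Listₚ.length-reverse (map up sumBits)) (trans (Listₚ.length-map up sumBits) (length-addBits (length ruler) 0b _ _))))))
      (trans (cong (foldl (λ w c → normHead c w) []) inner≡)
      (trans (norm-reverse sumBits) (cong (map up) (trans (sym (binary-val sumBits)) (cong binary sum≡)))))
      where
      ruler p q : Word γ
      ruler = Vec.lookup xs i
      p = ⟦ e ⟧ xs as
      q = ⟦ e′ ⟧ xs as
      sumBits : List Bit
      sumBits = addBits (length ruler) 0b p q
      inner : Exp n s
      inner = loop i (cons zero nil ∷ e ∷ e′ ∷ nil ∷ [])
        (λ _ → carryE ∷ pop 1F ∷ pop 2F ∷ outE ∷ []) (svar 3F)
      body : Letter → Exps (suc n) (4 + s) 4
      body _ = carryE ∷ pop 1F ∷ pop 2F ∷ outE ∷ []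
      length-addBits : ∀ k c p q → length (addBits k c p q) ≡ k
      length-addBits zero    c p q = refl
      length-addBits (suc k) c p q = cong suc (length-addBits k _ _ _)
      bitOf-up₁ : ∀ c → bitOf (up c) ≡ c
      bitOf-up₁ zero       = refl
      bitOf-up₁ (suc zero) = refl
      turn : ∀ w c p q o → ⟦ body zero ⟧* (w ∷ xs) ((up c ∷ []) ∷ p ∷ q ∷ o ∷ as) ≡
        (up (maj c (headBit p) (headBit q)) ∷ []) ∷ tail p ∷ tail q ∷ (up (xor³ c (headBit p) (headBit q)) ∷ o) ∷ []
      turn w c p q o = cong₂ Vec._∷_ (result (λ c d e → cons (up (maj c d e)) nil))
        (cong₂ Vec._∷_ (⟦pop⟧ 1F (w ∷ xs) as′) (cong₂ Vec._∷_ (⟦pop⟧ 2F (w ∷ xs) as′)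
          (cong₂ Vec._∷_ (result (λ c d e → cons (up (xor³ c d e)) (svar 6F))) refl)))
        where
        as′ : Env (4 + s)
        as′ = (up c ∷ []) ∷ p ∷ q ∷ o ∷ as
        result : (f : Bit → Bit → Bit → Exp (suc n) (7 + s)) →
          ⟦ caseBit 0F (λ c → caseBit 2F λ d → caseBit 4F (f c d)) ⟧ (w ∷ xs) as′ ≡
          ⟦ f c (headBit p) (headBit q) ⟧ (w ∷ xs) (tail q ∷ tail p ∷ [] ∷ as′)
        result f = trans (⟦caseBit⟧ zero (λ c → caseBit 2F λ d → caseBit 4F (f c d)) (w ∷ xs) as′)
          (trans (⟦caseBit⟧ 2F (λ d → caseBit 4F (f (bitOf (up c)) d)) (w ∷ xs) ([] ∷ as′))
          (trans (⟦caseBit⟧ 4F (f (bitOf (up c)) (headBit p)) (w ∷ xs) (tail p ∷ [] ∷ as′))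
          (cong (λ z → ⟦ f z (headBit p) (headBit q) ⟧ (w ∷ xs) (tail q ∷ tail p ∷ [] ∷ as′)) (bitOf-up₁ c))))
      go : ∀ w c p q o → Vec.lookup (⟦loop⟧ body xs as w ((up c ∷ []) ∷ p ∷ q ∷ o ∷ []) Vec.++ as) 3F ≡
        map up (addBits (length w) c p q) ʳ++ o
      go []      c p q o = refl
      go (_ ∷ w) c p q o = trans (cong (λ z → Vec.lookup (⟦loop⟧ body xs as w z Vec.++ as) 3F) (turn w c p q o))
        (go w (maj c (headBit p) (headBit q)) (tail p) (tail q) (up (xor³ c (headBit p) (headBit q)) ∷ o))
      inner≡ : ⟦ inner ⟧ xs as ≡ reverse (map up sumBits)
      inner≡ = go ruler 0b p q []
      value-num : ∀ {w : Word γ} {n} → w ≡ num n → value w ≡ n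
      value-num {n = n} refl = trans (cong val (bitOf-up (binary n))) (val-binary n)
      sum≡ : val sumBits ≡ u + v
      sum≡ = trans (val-addBits (length ruler) 0b p q
          (subst₂ (λ x y → x + y < 2 ^ length ruler) (sym (value-num {p} {u} eu)) (sym (value-num {q} {v} ev)) lt))
        (cong₂ _+_ (value-num {p} {u} eu) (value-num {q} {v} ev))

  enc : ℕ → Word γ
  enc n = num n ++ end ∷ []

  encTile : Tile → Word γ
  encTile ((h by w) at r , c) = enc h ++ enc w ++ enc r ++ enc c

  encTiles : List Tile → Word γ
  encTiles = concatMap encTile

  3≤γ : 3 ≤ γ
  3≤γ = s≤s (s≤s (s≤s z≤n))

  inject-encode : ∀ ts → inject 3≤γ (encode ts) ≡ encTiles ts
  inject-encode [] = refl
  inject-encode (t ∷ ts) = trans (Listₚ.map-++ _ (encodeTile t) (encode ts)) (cong₂ _++_ (tile t) (inject-encode ts))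
    where
    number : ∀ n → inject 3≤γ (encodeNumber n) ≡ enc n
    number n = trans (Listₚ.map-++ _ (map inject₁ (binary n)) _)
      (cong (_++ end ∷ []) (trans (sym (Listₚ.map-∘ (binary n))) (Listₚ.map-cong letter (binary n))))
      where
      letter : ∀ d → inject≤ (inject₁ d) 3≤γ ≡ up d
      letter zero       = refl
      letter (suc zero) = refl
    tile : ∀ t → inject 3≤γ (encodeTile t) ≡ encTile t
    tile ((h by w) at r , c) = trans (Listₚ.map-++ _ (encodeNumber h) _) (cong₂ _++_ (number h)
      (trans (Listₚ.map-++ _ (encodeNumber w) _) (cong₂ _++_ (number w)
      (trans (Listₚ.map-++ _ (encodeNumber r) _) (cong₂ _++_ (number r)
      (trans (cong (map _) (Listₚ.++-identityʳ (encodeNumber c))) (number c)))))))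

-- Writing down the tiling of an instance

one-low : ∀ W → binary (2 ^ W) ≡ replicate W 0b ++ 1b ∷ []
one-low W = trans (cong binary (sym (value W))) (trans (binary-val (replicate W 0b ++ 1b ∷ [])) (strip-++ (replicate W 0b) {1} (s≤s z≤n)))
  where
  value : ∀ W → val (replicate W 0b ++ 1b ∷ []) ≡ 2 ^ W
  value zero    = refl
  value (suc W) = cong (2 *_) (value W)

module Emission (g n : ℕ) (iW iM iT iL : Fin n)
  (itemE : Language.Letter (3 + g) → Language.Exp (3 + g) (2 + n) 0) where
  open Programs g

  one : Letter
  one = up 1b

  opaque
    tileE : ∀ {n s} → Fin n → Exp n s → Exp n s → Exp n s → Exp n s
    tileE i w c o = cons one (cons end (prepend i w (cons end (cons end (prepend i c (cons end o))))))

    ⟦tileE⟧ : ∀ {n s} i (w c o : Exp n s) xs as {u v} → ⟦ w ⟧ xs as ≡ num u → ⟦ c ⟧ xs as ≡ num v →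
      u < 2 ^ length (Vec.lookup xs i) → v < 2 ^ length (Vec.lookup xs i) →
      ⟦ tileE i w c o ⟧ xs as ≡ encTile ((1 by u) at 0 , v) ++ ⟦ o ⟧ xs as
    ⟦tileE⟧ i w c o xs as {u} {v} eu ev lu lv = cong (λ z → one ∷ end ∷ z)
      (trans (⟦prepend⟧ i w (cons end (cons end (prepend i c (cons end o)))) xs as (short-num eu lu))
      (trans (cong₂ _++_ eu (cong (λ z → end ∷ end ∷ z) (trans (⟦prepend⟧ i c (cons end o) xs as (short-num ev lv))
        (cong (_++ end ∷ ⟦ o ⟧ xs as) ev))))
      (sym (trans (cong (_++ ⟦ o ⟧ xs as) (cong (λ z → enc u ++ z) refl))
        (assoc (num u) (num v) (⟦ o ⟧ xs as))))))
      where
      short-num : ∀ {w m} → w ≡ num m → m < 2 ^ length (Vec.lookup xs i) → length w ≤ length (Vec.lookup xs i)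
      short-num {m = m} refl lt = ≤-trans (≤-reflexive (Listₚ.length-map up (binary m))) (length-binary _ lt)
      assoc : ∀ a b r → ((a ++ end ∷ []) ++ end ∷ b ++ end ∷ []) ++ r ≡ a ++ end ∷ end ∷ b ++ end ∷ r
      assoc a b r = trans (Listₚ.++-assoc (a ++ end ∷ []) _ r) (trans (Listₚ.++-assoc a _ _)
        (cong (λ z → a ++ end ∷ end ∷ z) (Listₚ.++-assoc b _ r)))

  colE : Letter → Exp (2 + n) (4 + 0)
  colE t = letN (itemE t) (sumE (suc (suc (suc iW))) (nvar 0F) (svar 0F))

  outE′ : Letter → Exp (2 + n) (4 + 0)
  outE′ t = letN (itemE t) (tileE (suc (suc (suc iW))) (nvar 0F) (svar 0F) (svar 1F))

  groupBody : Letter → Exps (2 + n) (2 + 2) 2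
  groupBody t = colE t ∷ outE′ t ∷ []

  opaque
    -- An expression yields one word, but the inner loop updates two accumulators, the sum and the
    -- output. So it is run once for either of them.
    groupE : Fin 2 → Exp (suc n) 2
    groupE j = loop (suc iL) (svar 0F ∷ svar 1F ∷ []) groupBody (svar (j ↑ˡ 2))

  opaque
    -- The height is a power of two because that needs no arithmetic: a zero for each letter of the
    -- clock, then a one. A clock long enough for all sums makes this height exceed them, too.
    bigE : ∀ {s} → Exp n s → Exp n s → Exp n s → Exp n s
    bigE w c o = repeat iW (zero ∷ []) (cons one (cons end (prepend iW w (cons end (cons one (cons end (prepend iW c (cons end o))))))))

  opaque
    finish₅ : Exp n 7
    finish₅ = bigE (svar 0F) nil (bigE (svar 0F) (svar 0F) (svar 1F))

    finish₅≡ : finish₅ ≡ bigE (svar 0F) nil (bigE (svar 0F) (svar 0F) (svar 1F))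
    finish₅≡ = refl

  opaque
    finish₄ : Exp n 6
    finish₄ = letS (sumE iW (svar 4F) (nvar iT)) finish₅

    finish₄≡ : finish₄ ≡ letS (sumE iW (svar 4F) (nvar iT)) finish₅
    finish₄≡ = refl

  opaque
    finish₃ : Exp n 5
    finish₃ = letS (tileE iW (svar 3F) (svar 0F) (svar 1F)) finish₄

    finish₃≡ : finish₃ ≡ letS (tileE iW (svar 3F) (svar 0F) (svar 1F)) finish₄
    finish₃≡ = refl

  opaque
    finish₂ : Exp n 4
    finish₂ = letS (sumE iW (svar 1F) (svar 2F)) finish₃

    finish₂≡ : finish₂ ≡ letS (sumE iW (svar 1F) (svar 2F)) finish₃
    finish₂≡ = refl

  opaque
    finish₁ : Exp n 3
    finish₁ = letS (tileE iW (svar 0F) (svar 1F) (svar 2F)) finish₂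

    finish₁≡ : finish₁ ≡ letS (tileE iW (svar 0F) (svar 1F) (svar 2F)) finish₂
    finish₁≡ = refl

  opaque
    finishE : Exp n 2
    -- With the least significant bit first, a zero in front doubles the target; the result is
    -- canonical because the target is positive.
    finishE = letS (cons zero (nvar iT)) finish₁

    finishE≡ : finishE ≡ letS (cons zero (nvar iT)) finish₁
    finishE≡ = refl

  mainE : Exp n 0
  mainE = loop iM (nil ∷ nil ∷ []) (λ _ → groupE 0F ∷ groupE 1F ∷ []) finishE

  module Correct (xs : Env n) (itemOf : ℕ → Letter → ℕ)
    (⟦itemE⟧ : ∀ t r r′ → ⟦ itemE t ⟧ (r′ ∷ r ∷ xs) [] ≡ num (itemOf (length r) t))
    (W T : ℕ) (W≡ : length (Vec.lookup xs iW) ≡ W) (T≡ : Vec.lookup xs iT ≡ num T) (T>0 : 0 < T) where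

    letters = Vec.lookup xs iL

    addGroup : ℕ → Word γ → List ℕ → List ℕ
    addGroup j []       as = as
    addGroup j (t ∷ ts) as = addGroup j ts (itemOf j t ∷ as)

    -- The exponent of a group is the length of the word left to the outer loop. It decreases, so
    -- the highest powers are added first and end up at the rear of the list.
    upTo : ℕ → List ℕ → List ℕ
    upTo zero    as = as
    upTo (suc m) as = upTo m (addGroup m letters as)

    addGroup-grows : ∀ j ts as → sum as ≤ sum (addGroup j ts as)
    addGroup-grows j []       as = ≤-refl
    addGroup-grows j (t ∷ ts) as = ≤-trans (m≤n+m _ (itemOf j t)) (addGroup-grows j ts (itemOf j t ∷ as))

    upTo-grows : ∀ m as → sum as ≤ sum (upTo m as)
    upTo-grows zero    as = ≤-refl
    upTo-grows (suc m) as = ≤-trans (addGroup-grows m letters as) (upTo-grows m _)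

    state : List ℕ → Env 2
    state as = num (sum as) ∷ encTiles (row₀ as) ∷ []

    2^W≡ : 2 ^ length (Vec.lookup xs iW) ≡ 2 ^ W
    2^W≡ = cong (2 ^_) W≡

    below-W : ∀ {m} → m < 2 ^ W → m < 2 ^ length (Vec.lookup xs iW)
    below-W lt = ≤-trans lt (≤-reflexive (sym 2^W≡))

    group-run : ∀ r ts as (o : Env 2) → sum (addGroup (length r) ts as) < 2 ^ W →
      ⟦loop⟧ groupBody (r ∷ xs) o ts (state as) ≡ state (addGroup (length r) ts as)
    group-run r []       as o lt = refl
    group-run r (t ∷ ts) as o lt = trans (cong (⟦loop⟧ groupBody (r ∷ xs) o ts) turn) (group-run r ts (a ∷ as) o lt)
      where
      a = itemOf (length r) t
      lt′ : a + sum as < 2 ^ W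
      lt′ = ≤-<-trans (addGroup-grows (length r) ts (a ∷ as)) lt
      item≡ = ⟦itemE⟧ t r ts
      env : Env (3 + n)
      env = ⟦ itemE t ⟧ (ts ∷ r ∷ xs) [] ∷ ts ∷ r ∷ xs
      turn : ⟦ groupBody t ⟧* (ts ∷ r ∷ xs) (state as Vec.++ o) ≡ state (a ∷ as)
      turn = cong₂ (λ y z → y ∷ z ∷ [])
        (⟦sumE⟧ (suc (suc (suc iW))) (nvar 0F) (svar 0F) env (state as Vec.++ o) {a} {sum as} item≡ refl (below-W lt′))
        (⟦tileE⟧ (suc (suc (suc iW))) (nvar 0F) (svar 0F) (svar 1F) env (state as Vec.++ o) {a} {sum as} item≡ refl
          (below-W (≤-<-trans (m≤m+n a _) lt′)) (below-W (≤-<-trans (m≤n+m _ a) lt′)))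

    opaque
      unfolding groupE
      ⟦groupE⟧ : ∀ j r as → sum (addGroup (length r) letters as) < 2 ^ W →
        ⟦ groupE j ⟧ (r ∷ xs) (state as) ≡ Vec.lookup (state (addGroup (length r) letters as)) j
      ⟦groupE⟧ j r as lt = trans (cong (λ z → Vec.lookup (z Vec.++ state as) (j ↑ˡ 2)) (group-run r letters as (state as) lt))
        (Vecₚ.lookup-++ˡ (state (addGroup (length r) letters as)) (state as) j)

    main-run : ∀ w as → sum (upTo (length w) as) < 2 ^ W →
      ⟦loop⟧ {s = 0} (λ _ → groupE 0F ∷ groupE 1F ∷ []) xs [] w (state as) ≡ state (upTo (length w) as)
    main-run []      as lt = refl
    main-run (_ ∷ w) as lt = trans
      (cong (⟦loop⟧ {s = 0} (λ _ → groupE 0F ∷ groupE 1F ∷ []) xs [] w)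
        (cong₂ (λ y z → y ∷ z ∷ []) (⟦groupE⟧ 0F w as lt′) (⟦groupE⟧ 1F w as lt′)))
      (main-run w (addGroup (length w) letters as) lt)
      where lt′ = ≤-<-trans (upTo-grows (length w) (addGroup (length w) letters as)) lt

    big : ℕ → ℕ → Tile
    big S c = ((2 ^ W) by S) at 1 , c

    opaque
      unfolding bigE
      ⟦bigE⟧ : ∀ {s} (w c o : Exp n s) as {S v} → ⟦ w ⟧ xs as ≡ num S → ⟦ c ⟧ xs as ≡ num v → S < 2 ^ W → v < 2 ^ W →
        ⟦ bigE w c o ⟧ xs as ≡ encTile (big S v) ++ ⟦ o ⟧ xs as
      ⟦bigE⟧ {s} w c o as {S} {v} eS ev lS lv = trans (⟦repeat⟧ iW (zero ∷ []) (cons one (cons end (prepend iW w after-w))) xs as)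
        (trans (cong₂ (λ k z → copies k (zero ∷ []) (one ∷ end ∷ z)) W≡
          (trans (⟦prepend⟧ iW w after-w xs as (short-num eS lS)) (cong₂ _++_ eS (cong (λ z → end ∷ one ∷ end ∷ z)
            (trans (⟦prepend⟧ iW c (cons end o) xs as (short-num ev lv)) (cong (_++ end ∷ ⟦ o ⟧ xs as) ev))))))
        (trans (copies-zero W (one ∷ end ∷ num S ++ end ∷ one ∷ end ∷ num v ++ end ∷ ⟦ o ⟧ xs as)) (sym (trans (cong (λ z → ((map up z ++ end ∷ []) ++ enc S ++ (one ∷ end ∷ []) ++ enc v) ++ ⟦ o ⟧ xs as) (one-low W))
          (trans (cong (λ z → ((z ++ end ∷ []) ++ enc S ++ (one ∷ end ∷ []) ++ enc v) ++ ⟦ o ⟧ xs as)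
            (trans (Listₚ.map-++ up (replicate W 0b) _) (cong (_++ one ∷ []) (Listₚ.map-replicate up W 0b))))
            (assoc (replicate W zero) (num S) (num v) (⟦ o ⟧ xs as)))))))
        where
        after-w : Exp n s
        after-w = cons end (cons one (cons end (prepend iW c (cons end o))))
        short-num : ∀ {w m} → w ≡ num m → m < 2 ^ W → length w ≤ length (Vec.lookup xs iW)
        short-num {m = m} refl lt = ≤-trans (≤-reflexive (Listₚ.length-map up (binary m)))
          (length-binary _ (below-W lt))
        copies-zero : ∀ k (u : Word γ) → copies k (zero ∷ []) u ≡ replicate k zero ++ u
        copies-zero zero    u = refl
        copies-zero (suc k) u = trans (copies-zero k (zero ∷ u)) (trans (sym (Listₚ.++-assoc (replicate k zero) (zero ∷ []) u))
          (cong (_++ u) (sym (replicate-∷ʳ k zero))))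
        assoc : ∀ a s v r → (((a ++ one ∷ []) ++ end ∷ []) ++ (s ++ end ∷ []) ++ (one ∷ end ∷ []) ++ (v ++ end ∷ [])) ++ r ≡
          a ++ one ∷ end ∷ s ++ end ∷ one ∷ end ∷ v ++ end ∷ r
        assoc a s v r = trans (Listₚ.++-assoc ((a ++ one ∷ []) ++ end ∷ []) _ r)
          (trans (Listₚ.++-assoc (a ++ one ∷ []) _ _) (trans (Listₚ.++-assoc a _ _)
          (cong (λ z → a ++ one ∷ end ∷ z) (trans (Listₚ.++-assoc (s ++ end ∷ []) _ r) (trans (Listₚ.++-assoc s _ _)
          (cong (λ z → s ++ end ∷ one ∷ end ∷ z) (Listₚ.++-assoc v _ r)))))))

    num-double : num (T + T) ≡ zero ∷ num T
    num-double = trans (cong num (cong (T +_) (sym (+-identityʳ T))))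
      (trans (cong (map up) (proj₁ (binary-double T))) (nonempty (binary T) refl))
      where
      nonempty : ∀ w → binary T ≡ w → map up (norm 0b w) ≡ zero ∷ map up w
      nonempty []      eq = ⊥-elim (<⇒≢ T>0 (sym (binary-injective {T} {0} eq)))
      nonempty (_ ∷ w) eq = refl

    letS≡ : ∀ {n s} {e₀ : Exp n s} {e e′ xs as v u} → e₀ ≡ letS e e′ → ⟦ e ⟧ xs as ≡ v → ⟦ e′ ⟧ xs (v ∷ as) ≡ u →
            ⟦ e₀ ⟧ xs as ≡ u
    letS≡ refl refl eq = eq

    module Finish (items : List ℕ) (lt : (sum items + T) + (sum items + T) < 2 ^ W) where
      A = sum items
      S = A + T
      A<W : A < 2 ^ W
      A<W = ≤-<-trans (≤-trans (m≤m+n A T) (m≤m+n S S)) lt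
      S<W : S < 2 ^ W
      S<W = ≤-<-trans (m≤m+n S S) lt
      row< : T + T + A < 2 ^ W
      row< = ≤-<-trans (≤-trans (m≤m+n _ A) (≤-reflexive (lem A T))) lt
        where
        lem : ∀ a t → t + t + a + a ≡ a + t + (a + t)
        lem = solve-∀
      T2<W : T + T < 2 ^ W
      T2<W = ≤-<-trans (m≤m+n _ A) row<

      last : ∀ as → Vec.lookup as 0F ≡ num S → ⟦ finish₅ ⟧ xs as ≡
             encTile (big S 0) ++ encTile (big S S) ++ Vec.lookup as 1F
      last as eq = trans (cong (λ e → ⟦ e ⟧ xs as) finish₅≡)
        (trans (⟦bigE⟧ (svar 0F) nil (bigE (svar 0F) (svar 0F) (svar 1F)) as {S} {0} eq refl S<W (m^n>0 2 W))
        (cong (encTile (big S 0) ++_) (⟦bigE⟧ (svar 0F) (svar 0F) (svar 1F) as {S} {S} eq eq S<W S<W)))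

      chain : ∀ {o₁ o₂} → encTiles (row₀ (T + T ∷ items)) ≡ o₁ → encTiles (row₀ (A ∷ T + T ∷ items)) ≡ o₂ →
        ⟦ finishE ⟧ xs (state items) ≡ encTile (big S 0) ++ encTile (big S S) ++ o₂
      chain {o₁} {o₂} eq₁ eq₂ = letS≡ finishE≡ (trans (cong (zero ∷_) T≡) (sym num-double))
        (letS≡ finish₁≡
          (trans (⟦tileE⟧ iW (svar 0F) (svar 1F) (svar 2F) xs s₁ {T + T} {A} refl refl (below-W T2<W) (below-W A<W)) eq₁)
        (letS≡ finish₂≡ (⟦sumE⟧ iW (svar 1F) (svar 2F) xs s₂ {T + T} {A} refl refl (below-W row<))
        (letS≡ finish₃≡
          (trans (⟦tileE⟧ iW (svar 3F) (svar 0F) (svar 1F) xs s₃ {A} {T + T + A} refl refl (below-W A<W) (below-W row<))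
            (trans (cong (encTile ((1 by A) at 0 , (T + T + A)) ++_) (sym eq₁)) eq₂))
        (letS≡ finish₄≡ (⟦sumE⟧ iW (svar 4F) (nvar iT) xs s₄ {A} {T} refl T≡ (below-W S<W))
        (last (num S ∷ s₄) refl)))))
        where
        s₁ : Env 3
        s₁ = num (T + T) ∷ state items
        s₂ : Env 4
        s₂ = o₁ ∷ s₁
        s₃ : Env 5
        s₃ = num (T + T + A) ∷ s₂
        s₄ : Env 6
        s₄ = o₂ ∷ s₃

    ⟦mainE⟧ : let items = upTo (length (Vec.lookup xs iM)) [] ; A = sum items ; S = A + T in S + S < 2 ^ W →
      ⟦ mainE ⟧ xs [] ≡ encTiles (big S 0 ∷ big S S ∷ row₀ (A ∷ T + T ∷ items))
    ⟦mainE⟧ lt = trans (cong (λ z → ⟦ finishE ⟧ xs (z Vec.++ [])) (main-run (Vec.lookup xs iM) []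
      (≤-<-trans (≤-trans (m≤m+n _ T) (m≤m+n _ _)) lt))) (Finish.chain (upTo (length (Vec.lookup xs iM)) []) lt refl refl)

sum-∈ : ∀ {x xs} → x ∈ xs → x ≤ sum xs
sum-∈ (here {xs = xs} refl) = m≤m+n _ (sum xs)
sum-∈ (there {x = y} m)     = ≤-trans (sum-∈ m) (m≤n+m _ y)

n<2^n : ∀ n → n < 2 ^ n
n<2^n zero    = s≤s z≤n
n<2^n (suc n) = ≤-trans (+-mono-≤ (m^n>0 2 n) (n<2^n n)) (≤-reflexive (cong (2 ^ n +_) (sym (+-identityʳ (2 ^ n)))))

-- A bit for every summand is generous, but still polynomial.
sum-bound : ∀ {w as} → All (_< 2 ^ w) as → sum as < 2 ^ (w + length as)
sum-bound {w} [] = m^n>0 2 (w + 0)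
sum-bound {w} {a ∷ as} (l ∷ ls) = ≤-trans (+-mono-≤ l (<⇒≤ (sum-bound {w} ls)))
  (≤-trans (+-mono-≤ (ℕₚ.^-monoʳ-≤ 2 (m≤m+n w (length as))) ≤-refl)
    (≤-reflexive (trans (cong (2 ^ (w + length as) +_) (sym (+-identityʳ (2 ^ (w + length as))))) (cong (2 ^_) (sym (+-suc w (length as)))))))

-- Programs for the items and the target

module ReductionProgram (a S₁ : ℕ) (ts : List WangTile) (maxCode : ℕ)
  (colours-bound : ∀ {t} → t ∈ ts → west t ≤ maxCode × south t ≤ maxCode × north t ≤ maxCode × east t ≤ maxCode)
  (start accept hash space sep : ℕ) (input : Fin a → ℕ) where

  -- `Kc` exceeds every code, so that no complement of a code is 0 and leading digits are positive.
  -- `b` is the bound demanded of the base, and `2 ^ b` exceeds it; with a power of two as base,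
  -- digits are blocks of constantly many bits that can be concatenated.
  Kc b : ℕ
  Kc = suc maxCode
  b = length ts * suc Kc + suc Kc

  bounded : All (λ t → west t ≤ Kc × south t ≤ Kc × north t ≤ Kc × east t ≤ Kc) ts
  bounded = All.tabulate λ m → let (w , s , n , e) = colours-bound m in
    ≤-trans w (n≤1+n _) , ≤-trans s (n≤1+n _) , ≤-trans n (n≤1+n _) , ≤-trans e (n≤1+n _)

  open Encoding ts Kc (2 ^ b) bounded (n<2^n b) public

  b³ : ℕ
  b³ = b + (b + b)

  X³≡ : X³ ≡ 2 ^ b³
  X³≡ = sym (trans (^-distribˡ-+-* 2 b (b + b)) (cong (2 ^ b *_) (^-distribˡ-+-* 2 b b)))

  finalDigit-pos : ∀ {s} → s ≤ maxCode → 0 < finalDigit s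
  finalDigit-pos le = *-mono-≤ B>0 (*-mono-≤ B>0 (≤-trans (s≤s z≤n) (≤-reflexive (sym (ℕₚ.+-∸-assoc 1 le)))))

  open Programs (a + length ts) public

  block : ℕ → Word γ
  block v = map up (bits b³ v)

  blocks : List ℕ → Word γ
  blocks = concatMap block

  blocks-++ : ∀ ds es → blocks (ds ++ es) ≡ blocks ds ++ blocks es
  blocks-++ ds es = Listₚ.concatMap-++ block ds es

  num-cons : ∀ {d h} → d < X³ → 0 < h → num (d + X³ * h) ≡ block d ++ num h
  num-cons {d} {h} lt h>0 = trans (cong (map up) (trans (cong binary (sym value≡))
    (trans (binary-val (bits b³ d ++ binary h)) (strip-++ (bits b³ d) h>0)))) (Listₚ.map-++ up (bits b³ d) (binary h))
    where
    value≡ : val (bits b³ d ++ binary h) ≡ d + X³ * h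
    value≡ = trans (val-++ (bits b³ d) (binary h)) (cong₂ _+_ (val-bits b³ d (≤-trans lt (≤-reflexive X³≡)))
      (cong₂ _*_ (trans (cong (2 ^_) (length-bits b³ d)) (sym X³≡)) (val-binary h)))

  horner-pos : ∀ ds {t} → 0 < t → 0 < horner ds t
  horner-pos []       t>0 = t>0
  horner-pos (d ∷ ds) t>0 = ≤-trans (*-mono-≤ X³>0 (horner-pos ds t>0)) (m≤n+m _ d)

  blocks-num : ∀ ds {t} → All (_< X³) ds → 0 < t → blocks ds ++ num t ≡ num (horner ds t)
  blocks-num []       []       t>0 = refl
  blocks-num (d ∷ ds) (l ∷ ls) t>0 = trans (Listₚ.++-assoc (block d) (blocks ds) _)
    (trans (cong (block d ++_) (blocks-num ds ls t>0)) (sym (num-cons l (horner-pos ds t>0))))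

  -- Sequences of digits, some of them repeated according to the length of a variable

  data Segment (n : ℕ) : Set where
    single : ℕ → Segment n
    many   : Fin n → ℕ → Segment n

  digits : ∀ {n} → Env n → List (Segment n) → List ℕ
  digits xs []              = []
  digits xs (single v ∷ ss) = v ∷ digits xs ss
  digits xs (many i v ∷ ss) = replicate (length (Vec.lookup xs i)) v ++ digits xs ss

  digits-++ : ∀ {n} (xs : Env n) ss ss′ → digits xs (ss ++ ss′) ≡ digits xs ss ++ digits xs ss′
  digits-++ xs []              ss′ = refl
  digits-++ xs (single v ∷ ss) ss′ = cong (v ∷_) (digits-++ xs ss ss′)
  digits-++ xs (many i v ∷ ss) ss′ = trans (cong (replicate (length (Vec.lookup xs i)) v ++_) (digits-++ xs ss ss′))
    (sym (Listₚ.++-assoc (replicate (length (Vec.lookup xs i)) v) _ _))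

  copies-block : ∀ j v u → copies j (block v) u ≡ blocks (replicate j v) ++ u
  copies-block zero    v u = refl
  copies-block (suc j) v u = trans (copies-block j v (block v ++ u)) (trans (sym (Listₚ.++-assoc (blocks (replicate j v)) _ u))
    (cong (_++ u) (trans (cong (blocks (replicate j v) ++_) (sym (Listₚ.++-identityʳ (block v))))
      (trans (sym (blocks-++ (replicate j v) (v ∷ []))) (cong blocks (sym (replicate-∷ʳ j v)))))))

  opaque
    segmentsE : ∀ {n s} → List (Segment n) → Exp n s → Exp n s
    segmentsE []              e = e
    segmentsE (single v ∷ ss) e = literal (block v) (segmentsE ss e)
    segmentsE (many i v ∷ ss) e = repeat i (block v) (segmentsE ss e)

    ⟦segmentsE⟧ : ∀ {n s} ss (e : Exp n s) xs as → ⟦ segmentsE ss e ⟧ xs as ≡ blocks (digits xs ss) ++ ⟦ e ⟧ xs as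
    ⟦segmentsE⟧ [] e xs as = refl
    ⟦segmentsE⟧ (single v ∷ ss) e xs as = trans (⟦literal⟧ (block v) (segmentsE ss e) xs as)
      (trans (cong (block v ++_) (⟦segmentsE⟧ ss e xs as)) (sym (Listₚ.++-assoc (block v) _ _)))
    ⟦segmentsE⟧ (many i v ∷ ss) e xs as = trans (⟦repeat⟧ i (block v) (segmentsE ss e) xs as)
      (trans (cong (copies (length (Vec.lookup xs i)) (block v)) (⟦segmentsE⟧ ss e xs as))
      (trans (copies-block (length (Vec.lookup xs i)) v _)
      (trans (sym (Listₚ.++-assoc (blocks (replicate (length (Vec.lookup xs i)) v)) _ _))
        (cong (_++ ⟦ e ⟧ xs as) (sym (blocks-++ (replicate (length (Vec.lookup xs i)) v) (digits xs ss)))))))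

  literalE : ∀ {n s} → Word γ → Exp n s
  literalE w = literal w nil

  ⟦literalE⟧ : ∀ {n s} w (xs : Env n) (as : Env s) → ⟦ literalE w ⟧ xs as ≡ w
  ⟦literalE⟧ w xs as = trans (⟦literal⟧ w nil xs as) (Listₚ.++-identityʳ w)

  tileLetter : Fin (length ts) → Letter
  tileLetter i = 3 ↑ʳ (a ↑ʳ i)

  -- Loop bodies are defined for all letters; those that name no tile get one within the bounds, so
  -- that statements about items hold without exception.
  tileAt : Letter → WangTile
  tileAt x = [ (λ _ → wang 0 0 0 0) , (λ y → [ (λ _ → wang 0 0 0 0) , lookup ts ]′ (Fin.splitAt a y)) ]′ (Fin.splitAt 3 x)

  tileAt-letter : ∀ i → tileAt (tileLetter i) ≡ lookup ts i
  tileAt-letter i rewrite Finₚ.splitAt-↑ʳ a (length ts) i = refl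

  tileAt-bound : ∀ x → let t = tileAt x in Bounded t × north t ≤ maxCode
  tileAt-bound x with Fin.splitAt 3 x
  ... | inj₁ _ = (z≤n , z≤n , z≤n , z≤n) , z≤n
  ... | inj₂ y with Fin.splitAt a y
  ...   | inj₁ _ = (z≤n , z≤n , z≤n , z≤n) , z≤n
  ...   | inj₂ i = All.lookup bounded (∈ₚ.∈-lookup i) , proj₁ (proj₂ (proj₂ (colours-bound (∈ₚ.∈-lookup i))))

  -- Reversed, since the items of a group are put in front of the list one after the other.
  tilesWord : Word γ
  tilesWord = reverse (map tileLetter (allFin (length ts)))

  opaque
    itemE : Letter → Exp 12 0
    -- Variable `1F` is what the outer loop has still to read; as many zero digits give the power of
    -- `X³`. The length of `8F` is the circumference less two.
    itemE x = segmentsE (many 1F 0 ∷ single (low t) ∷ single (high t) ∷ many 8F 0 ∷ []) (literalE (num (topDigit t)))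
      where
      t : WangTile
      t = tileAt x

    ⟦itemE⟧ : ∀ {xs : Env 10} x r r′ → ⟦ itemE x ⟧ (r′ ∷ r ∷ xs) [] ≡
      num (X³ ^ length r * item (2 + length (Vec.lookup xs 6F)) (tileAt x))
    ⟦itemE⟧ {xs} x r r′ = trans (⟦segmentsE⟧ (many 1F 0 ∷ single (low t) ∷ single (high t) ∷ many 8F 0 ∷ [])
        (literalE (num (topDigit t))) (r′ ∷ r ∷ xs) [])
      (trans (cong₂ (λ y z → blocks (replicate (length r) 0 ++ low t ∷ high t ∷ y) ++ z) (Listₚ.++-identityʳ (replicate j 0))
        (⟦literalE⟧ (num (topDigit t)) (r′ ∷ r ∷ xs) []))
      (trans (blocks-num (replicate (length r) 0 ++ low t ∷ high t ∷ replicate j 0) digits<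
        (finalDigit-pos (proj₂ (tileAt-bound x))))
      (cong num (trans (horner-++ (replicate (length r) 0) _ (topDigit t)) (trans (horner-zeros (length r) _)
        (cong (X³ ^ length r *_) (item-digits j t)))))))
      where
      t : WangTile
      t = tileAt x
      j : ℕ
      j = length (Vec.lookup xs 6F)
      digits< : All (_< X³) (replicate (length r) 0 ++ low t ∷ high t ∷ replicate j 0)
      digits< = let (l , h , _) = tile-digits< (proj₁ (tileAt-bound x)) in
        Allₚ.++⁺ (Allₚ.replicate⁺ (length r) X³>0) (l ∷ h ∷ Allₚ.replicate⁺ j X³>0)

  inputDigit : Letter → ℕ
  inputDigit x with toℕ x <? a
  ... | yes lt = firstDigit (input (fromℕ< lt))
  ... | no _   = 0

  a≤γ′ : a ≤ γ
  a≤γ′ = ≤-trans (m≤m+n a (length ts)) (m≤n+m _ 3)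

  inputDigit-inject : ∀ s → inputDigit (inject≤ s a≤γ′) ≡ firstDigit (input s)
  inputDigit-inject s with toℕ (inject≤ s a≤γ′) <? a
  ... | yes lt = cong (λ z → firstDigit (input z)) (Finₚ.toℕ-injective
    (trans (Finₚ.toℕ-fromℕ< lt) (Finₚ.toℕ-inject≤ s a≤γ′)))
  ... | no ge  = ⊥-elim (ge (subst (_< a) (sym (Finₚ.toℕ-inject≤ s a≤γ′)) (Finₚ.toℕ<n s)))

  opaque
    -- Putting the blocks in front of each other while scanning reverses the input, as the first row
    -- requires.
    inputE : Exp 9 0 → Exp 9 0
    inputE e = loop 8F (e ∷ []) (λ x → literal (block (inputDigit x)) (svar 0F) ∷ []) (svar 0F)

    ⟦inputE⟧ : ∀ e (xs : Env 9) x → Vec.lookup xs 8F ≡ inject a≤γ′ x →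
      ⟦ inputE e ⟧ xs [] ≡ blocks (map (λ s → firstDigit (input s)) (reverse x)) ++ ⟦ e ⟧ xs []
    ⟦inputE⟧ e xs x eq rewrite eq = trans (scan x (⟦ e ⟧ xs [])) (cong (λ z → blocks z ++ ⟦ e ⟧ xs []) (sym (trans (Listₚ.reverse-map f x) refl)))
      where
      f : Fin a → ℕ
      f s = firstDigit (input s)
      body : Letter → Exps 10 1 1
      body x = literal (block (inputDigit x)) (svar 0F) ∷ []
      scan : ∀ x u → Vec.lookup (⟦loop⟧ body xs [] (inject a≤γ′ x) (u ∷ []) Vec.++ []) 0F ≡ blocks (reverse (map f x)) ++ u
      scan []      u = refl
      scan (s ∷ x) u = trans (cong (λ z → Vec.lookup (⟦loop⟧ body xs [] (inject a≤γ′ x) (z ∷ []) Vec.++ []) 0F)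
          (trans (⟦literal⟧ (block (inputDigit (inject≤ s a≤γ′))) (svar 0F) (inject a≤γ′ x ∷ xs) (u ∷ []))
            (cong (λ z → block z ++ u) (inputDigit-inject s))))
        (trans (scan x (block (f s) ++ u)) (trans (sym (Listₚ.++-assoc (blocks (reverse (map f x))) (block (f s)) u))
          (cong (_++ u) (trans (cong (blocks (reverse (map f x)) ++_) (sym (Listₚ.++-identityʳ (block (f s)))))
            (trans (sym (blocks-++ (reverse (map f x)) (f s ∷ []))) (cong blocks (sym (Listₚ.unfold-reverse (f s) (map f x)))))))))

  firstColumns lastColumns : ℕ → List (Segment 9)
  firstColumns zero    = []
  firstColumns (suc j) = many 4F (firstDigit space) ∷ single (firstDigit sep) ∷ firstColumns j
  -- The last separator is left out here. It gives the leading digit, to be written without leading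
  -- zeros.
  lastColumns zero    = many 4F (finalDigit space) ∷ []
  lastColumns (suc j) = many 4F (finalDigit space) ∷ single (finalDigit sep) ∷ lastColumns j

  ctrl₀ ctrl₁ : ℕ
  ctrl₀ = 1 + 2 ^ b * (0 + 2 ^ b * start)
  ctrl₁ = 2 ^ b * (κ 0 + 2 ^ b * κ (accept))

  segments₁ segments₂ : List (Segment 9)
  segments₁ = single ctrl₀ ∷ many 1F (firstDigit hash) ∷ []
  segments₂ = many 3F (firstDigit space) ∷ single (firstDigit sep) ∷ firstColumns S₁ ++
    many 2F (1 + 2 ^ b * (Kc + 2 ^ b * Kc)) ∷ single ctrl₁ ∷ lastColumns S₁

  opaque
    targetE : Exp 9 0
    targetE = segmentsE segments₁ (inputE (segmentsE segments₂ (literalE (num (finalDigit sep)))))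

    ⟦targetE⟧ : ∀ xs x → Vec.lookup xs 8F ≡ inject a≤γ′ x → ⟦ targetE ⟧ xs [] ≡
      blocks (digits xs segments₁ ++ map (λ s → firstDigit (input s)) (reverse x) ++ digits xs segments₂) ++ num (finalDigit sep)
    ⟦targetE⟧ xs x eq = trans (⟦segmentsE⟧ segments₁ _ xs []) (trans (cong (blocks (digits xs segments₁) ++_)
      (trans (⟦inputE⟧ _ xs x eq) (cong (blocks ds ++_) (trans (⟦segmentsE⟧ segments₂ _ xs [])
        (cong (blocks (digits xs segments₂) ++_) (⟦literalE⟧ (num (finalDigit sep)) xs []))))))
      (sym (trans (cong (_++ num (finalDigit sep)) (trans (blocks-++ (digits xs segments₁) _) (cong (blocks (digits xs segments₁) ++_) (blocks-++ ds _))))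
        (trans (Listₚ.++-assoc (blocks (digits xs segments₁)) _ _) (cong (blocks (digits xs segments₁) ++_) (Listₚ.++-assoc (blocks ds) _ _))))))
      where
      ds : List ℕ
      ds = map (λ s → firstDigit (input s)) (reverse x)

  open Emission (a + length ts) 10 8F 7F 0F 1F itemE public

-- Unique readability of the input words

encodeNumber-injective : ∀ {m n u v} → encodeNumber m ++ u ≡ encodeNumber n ++ v → m ≡ n × u ≡ v
encodeNumber-injective {m} {n} {u} {v} eq =
  let (e , e′) = go (binary m) (binary n) (trans (sym (Listₚ.++-assoc (map inject₁ (binary m)) _ u))
                   (trans eq (Listₚ.++-assoc (map inject₁ (binary n)) _ v)))
  in binary-injective e , e′
  where
  go : ∀ l l′ → map inject₁ l ++ fromℕ 2 ∷ u ≡ map inject₁ l′ ++ fromℕ 2 ∷ v → l ≡ l′ × u ≡ v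
  go [] [] refl = refl , refl
  go [] (zero ∷ l′) ()
  go [] (suc zero ∷ l′) ()
  go (zero ∷ l) [] ()
  go (suc zero ∷ l) [] ()
  go (d ∷ l) (d′ ∷ l′) eq =
    let (e , e′) = Listₚ.∷-injective eq ; (f , f′) = go l l′ e′ in cong₂ _∷_ (Finₚ.inject₁-injective e) f , f′

encodeTile-injective : ∀ t t′ {u v} → encodeTile t ++ u ≡ encodeTile t′ ++ v → t ≡ t′ × u ≡ v
encodeTile-injective ((h by w) at r , c) ((h′ by w′) at r′ , c′) {u} {v} eq
  with encodeNumber-injective {h} {h′} (trans (sym (regroup h ((h by w) at r , c) u)) (trans eq (regroup h′ ((h′ by w′) at r′ , c′) v)))
  where
  regroup : ∀ h t u → (encodeNumber h ++ encodeNumber (Tile.width t) ++ encodeNumber (Tile.row t) ++ encodeNumber (Tile.col t) ++ []) ++ u ≡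
    encodeNumber h ++ encodeNumber (Tile.width t) ++ encodeNumber (Tile.row t) ++ encodeNumber (Tile.col t) ++ u
  regroup h t u = trans (Listₚ.++-assoc (encodeNumber h) _ u) (cong (encodeNumber h ++_)
    (trans (Listₚ.++-assoc (encodeNumber (Tile.width t)) _ u) (cong (encodeNumber (Tile.width t) ++_)
    (trans (Listₚ.++-assoc (encodeNumber (Tile.row t)) _ u) (cong (encodeNumber (Tile.row t) ++_)
    (Listₚ.++-assoc (encodeNumber (Tile.col t)) [] u))))))
... | refl , eq₁ with encodeNumber-injective {w} {w′} eq₁
... | refl , eq₂ with encodeNumber-injective {r} {r′} eq₂
... | refl , eq₃ with encodeNumber-injective {c} {c′} eq₃
... | refl , eq₄ = refl , eq₄

encode-injective : ∀ ts ts′ → encode ts ≡ encode ts′ → ts ≡ ts′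
encode-injective [] [] eq = refl
encode-injective [] (t ∷ ts) eq = ⊥-elim (nonempty (binary (Tile.height t))
  (concatMap encodeNumber (Tile.width t ∷ Tile.row t ∷ Tile.col t ∷ [])) (encode ts) eq)
  where
  nonempty : ∀ l (u v : Word 3) → [] ≢ ((map inject₁ l ++ fromℕ 2 ∷ []) ++ u) ++ v
  nonempty [] u v ()
  nonempty (_ ∷ _) u v ()
encode-injective (t ∷ ts) [] eq = sym (encode-injective [] (t ∷ ts) (sym eq))
encode-injective (t ∷ ts) (t′ ∷ ts′) eq with encodeTile-injective t t′ eq
... | refl , eq′ = cong (t ∷_) (encode-injective ts ts′ eq′)

-- Closes the circle for one reduction to both problems: yes-instances are shown to be such without
-- rotations, no-instances even with them.
TRANS⇒GEN : ∀ {w} → TRANS-ST w → GEN-ST w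
TRANS⇒GEN (ts , n , m , eq , n>0 , m>0 , tiling , ss , re , jux) =
  ts , n , m , eq , n>0 , m>0 , tiling , ss , rearrangement-with-rotations {ss = ss} re , jux

-- The instance computed from an input

module ReductionOutput (a S₁ : ℕ) (ts : List WangTile) (maxCode : ℕ)
  (colours-bound : ∀ {t} → t ∈ ts → west t ≤ maxCode × south t ≤ maxCode × north t ≤ maxCode × east t ≤ maxCode)
  (start accept hash space sep : ℕ) (input : Fin a → ℕ)
  (start≤ : start ≤ maxCode) (accept≤ : accept ≤ maxCode) (hash≤ : hash ≤ maxCode) (space≤ : space ≤ maxCode)
  (sep≤ : sep ≤ maxCode) (input≤ : ∀ s → input s ≤ maxCode) (p pr : Polynomial) where

  open ReductionProgram a S₁ ts maxCode colours-bound start accept hash space sep input public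

  -- In order: the bound on certificates, the rows after the input is copied,
  -- the rows of the tableau less one, its rows, its columns less two, its
  -- columns, its cells, its cells above the first row, and a bound on the
  -- length of all numbers.

  certP restP rowsP₋₁ rowsP columnsP₋₂ columnsP cellsP upperP lengthP : Poly
  certP      = ofPolynomial pr
  restP      = con 1 ⊕ ofPolynomial p ⊙ (X ⊕ con 1 ⊕ certP)
  rowsP₋₁    = certP ⊕ (X ⊕ (con 1 ⊕ restP))
  rowsP      = con 1 ⊕ rowsP₋₁
  columnsP₋₂ = rowsP ⊕ con S₁ ⊗ (con 1 ⊕ rowsP)
  columnsP   = con 2 ⊕ columnsP₋₂
  cellsP     = rowsP ⊗ columnsP
  upperP     = rowsP₋₁ ⊗ columnsP
  lengthP    = con b³ ⊗ (cellsP ⊕ (con 3 ⊕ columnsP₋₂)) ⊕ cellsP ⊗ con (length ts) ⊕ con 2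

  program : Exp 1 0
  program =
    letN (unary (coeffs lengthP) 0F) (letN (unary (coeffs cellsP) 1F) (letN (unary (coeffs columnsP₋₂) 2F)
    (letN (unary (coeffs rowsP) 3F) (letN (unary (coeffs (con 1 ⊕ restP)) 4F) (letN (unary (coeffs upperP) 5F)
    (letN (unary (coeffs (con 1 ⊕ certP)) 6F) (letN (literalE tilesWord) (letN targetE mainE))))))))

  module _ (x : Word a) where

    n = length x
    certBound = fn certP n
    rest′ = fn restP n
    rows = fn rowsP n
    N₂ = fn columnsP₋₂ n
    cells = fn cellsP n
    upper = fn upperP n
    W = fn lengthP n

    columnCodes lastColumnCodes : ℕ → List ℕ
    columnCodes zero        = []
    columnCodes (suc j)     = replicate rows space ++ sep ∷ columnCodes j
    lastColumnCodes zero    = replicate rows space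
    lastColumnCodes (suc j) = replicate rows space ++ sep ∷ lastColumnCodes j

    firstCodes lastCodes : List ℕ
    firstCodes = replicate (suc certBound) hash ++ map input (reverse x) ++ replicate (suc rest′) space ++ sep ∷ columnCodes S₁
    lastCodes  = lastColumnCodes S₁

    maxCode≤K : ∀ {s} → s ≤ maxCode → s ≤ Kc
    maxCode≤K le = ≤-trans le (n≤1+n _)

    firstCodes≤ : All (_≤ Kc) firstCodes
    firstCodes≤ = Allₚ.++⁺ (Allₚ.replicate⁺ (suc certBound) (maxCode≤K hash≤)) (Allₚ.++⁺
      (Allₚ.map⁺ (All.universal (λ s → maxCode≤K (input≤ s)) (reverse x))) (Allₚ.++⁺ (Allₚ.replicate⁺ (suc rest′) (maxCode≤K space≤))
      (maxCode≤K sep≤ ∷ columns≤ S₁)))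
      where
      columns≤ : ∀ j → All (_≤ Kc) (columnCodes j)
      columns≤ zero    = []
      columns≤ (suc j) = Allₚ.++⁺ (Allₚ.replicate⁺ rows (maxCode≤K space≤)) (maxCode≤K sep≤ ∷ columns≤ j)

    length-columnCodes : ∀ j → length (columnCodes j) ≡ j * suc rows
    length-columnCodes zero    = refl
    length-columnCodes (suc j) = trans (Listₚ.length-++ (replicate rows space)) (trans
      (cong₂ (λ y z → y + suc z) (Listₚ.length-replicate rows) (length-columnCodes j)) (+-suc rows (j * suc rows)))

    length-firstCodes : suc (length firstCodes) ≡ fn columnsP n
    length-firstCodes = cong suc (trans (Listₚ.length-++ (replicate (suc certBound) hash)) (trans
      (cong₂ _+_ (Listₚ.length-replicate (suc certBound)) (trans (Listₚ.length-++ (map input (reverse x))) (cong₂ _+_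
        (trans (Listₚ.length-map input (reverse x)) (Listₚ.length-reverse x)) (trans (Listₚ.length-++ (replicate (suc rest′) space))
          (cong₂ (λ y z → y + suc z) (Listₚ.length-replicate (suc rest′)) (length-columnCodes S₁))))))
      (lem certBound n rest′ (S₁ * suc rows))))
      where
      lem : ∀ c n r s → suc c + (n + (suc r + suc s)) ≡ 1 + (1 + (c + (n + (1 + r))) + s)
      lem = solve-∀

    length-lastCodes : ∀ j → length (lastColumnCodes j) ≡ rows + j * suc rows
    length-lastCodes zero    = trans (Listₚ.length-replicate rows) (sym (+-identityʳ rows))
    length-lastCodes (suc j) = trans (Listₚ.length-++ (replicate rows space)) (cong₂ (λ y z → y + suc z) (Listₚ.length-replicate rows) (length-lastCodes j))

    targetList : List ℕ
    targetList = targetDigits 0 start firstCodes upper 0 accept lastCodes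

    target : ℕ
    target = horner targetList (finalDigit sep)

    target>0 : 0 < target
    target>0 = horner-pos targetList (finalDigit-pos sep≤)

    target-sum : target + pending 0 (start ∷ firstCodes) ≡
      quota cells + X³ ^ cells * pending 0 (accept ∷ lastCodes ++ sep ∷ [])
    target-sum = trans (target-equation {h′ = 0} {accept} upper lastCodes sep z≤n (maxCode≤K start≤) firstCodes≤)
      (cong (λ z → quota (z + upper) + X³ ^ (z + upper) * pending 0 (accept ∷ lastCodes ++ sep ∷ [])) length-firstCodes)

    targetList< : All (_< X³) targetList
    targetList< = targetDigits< {h′ = 0} {accept} upper lastCodes z≤n (maxCode≤K start≤) firstCodes≤

    numbers : List ℕ
    numbers = items (2 + N₂) cells

    -- Every item and the target are less than 2 ^ (W - number of items - 2).

    sum-small : (sum numbers + target) + (sum numbers + target) < 2 ^ W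
    sum-small = ≤-trans (double (suc (w + cells * length ts)) sum≤ sum≤)
      (≤-reflexive (cong (2 ^_) (+-comm 2 (w + cells * length ts))))
      where
      w : ℕ
      w = b³ * (cells + (3 + N₂))
      X³^≡ : ∀ j → X³ ^ j ≡ 2 ^ (b³ * j)
      X³^≡ j = trans (cong (_^ j) X³≡) (ℕₚ.^-*-assoc 2 b³ j)
      sum-bound′ : All (_< X³ ^ (cells + (3 + N₂))) numbers → sum numbers < 2 ^ (w + cells * length ts)
      sum-bound′ h = subst (λ z → sum numbers < 2 ^ (w + z)) (length-items (2 + N₂) cells)
        (sum-bound {w} (All.map (λ lt → ≤-trans lt (≤-reflexive (X³^≡ (cells + (3 + N₂))))) h))
      target-small : target < 2 ^ (w + cells * length ts)
      target-small = ≤-trans (horner-bound targetList targetList< (proj₂ (proj₂ top<))) (≤-trans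
        (≤-trans (X³^-mono {suc (length targetList)} {cells + (3 + N₂)} len≤) (≤-reflexive (X³^≡ (cells + (3 + N₂))))) (ℕₚ.^-monoʳ-≤ 2 (m≤m+n w _)))
        where
        top< : low (wang 0 0 sep 0) < X³ × high (wang 0 0 sep 0) < X³ × topDigit (wang 0 0 sep 0) < X³
        top< = tile-digits< {wang 0 0 sep 0} (z≤n , z≤n , maxCode≤K sep≤ , z≤n)
        len≤ : suc (length targetList) ≤ cells + (3 + N₂)
        len≤ = ≤-trans (≤-reflexive (trans (cong suc (trans (length-targetDigits 0 start firstCodes upper 0 accept lastCodes)
          (cong₂ (λ y z → y + upper + suc z) length-firstCodes (length-lastCodes S₁)))) (lem (fn columnsP n + upper) N₂)))
          (+-monoʳ-≤ cells (n≤1+n _))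
          where
          lem : ∀ y z → suc (y + suc z) ≡ y + (2 + z)
          lem = solve-∀
      double : ∀ {u v} j → u < 2 ^ j → v < 2 ^ j → u + v < 2 ^ suc j
      double j lu lv = ≤-trans (+-mono-< lu lv) (≤-reflexive (cong (2 ^ j +_) (sym (+-identityʳ (2 ^ j)))))
      sum≤ : sum numbers + target < 2 ^ suc (w + cells * length ts)
      sum≤ = double (w + cells * length ts) (sum-bound′ (items-bound N₂ cells)) target-small

    numbers-pos : All (0 <_) numbers
    numbers-pos = items-pos (2 + N₂) cells

    totalNumbers half : ℕ
    totalNumbers = sum numbers
    half = totalNumbers + target

    outputTiles : List Tile
    outputTiles = (((2 ^ W) by half) at 1 , 0) ∷ (((2 ^ W) by half) at 1 , half) ∷ row₀ (totalNumbers ∷ target + target ∷ numbers)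

    -- Apart from the word of the tiles and the input, the auxiliary words matter by their lengths
    -- only.
    module Evaluation (tw sr md pd l n₂ ms w x′ : Word γ) (tw≡ : tw ≡ tilesWord) (sr≡ : length sr ≡ suc certBound)
      (md≡ : length md ≡ upper) (pd≡ : length pd ≡ suc rest′) (l≡ : length l ≡ rows) (n₂≡ : length n₂ ≡ N₂)
      (ms≡ : length ms ≡ cells) (w≡ : length w ≡ W) (x≡ : x′ ≡ inject a≤γ′ x) where

      env₉ : Env 9
      env₉ = tw ∷ sr ∷ md ∷ pd ∷ l ∷ n₂ ∷ ms ∷ w ∷ x′ ∷ []

      replicate-map : ∀ (f : ℕ → ℕ) {i j} s → i ≡ j → replicate i (f s) ≡ map f (replicate j s)
      replicate-map f {i} s refl = sym (Listₚ.map-replicate f i s)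

      first-columns : ∀ j → digits env₉ (firstColumns j) ≡ map firstDigit (columnCodes j)
      first-columns zero    = refl
      first-columns (suc j) = trans (cong₂ (λ y z → y ++ firstDigit sep ∷ z) (replicate-map firstDigit space l≡) (first-columns j))
        (sym (Listₚ.map-++ firstDigit (replicate rows space) _))

      last-columns : ∀ j → digits env₉ (lastColumns j) ≡ map finalDigit (lastColumnCodes j)
      last-columns zero    = trans (Listₚ.++-identityʳ _) (replicate-map finalDigit space l≡)
      last-columns (suc j) = trans (cong₂ (λ y z → y ++ finalDigit sep ∷ z) (replicate-map finalDigit space l≡) (last-columns j))
        (sym (Listₚ.map-++ finalDigit (replicate rows space) _))

      digits≡ : digits env₉ segments₁ ++ map (λ s → firstDigit (input s)) (reverse x) ++ digits env₉ segments₂ ≡ targetList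
      digits≡ = cong (ctrl₀ ∷_) (begin
        (replicate (length sr) (firstDigit hash) ++ []) ++ map (λ s → firstDigit (input s)) (reverse x) ++
          replicate (length pd) (firstDigit space) ++ firstDigit sep ∷ digits env₉ (firstColumns S₁ ++ upperSegments)
          ≡⟨ cong₂ _++_ (trans (Listₚ.++-identityʳ _) (replicate-map firstDigit hash sr≡)) (cong₂ _++_ (Listₚ.map-∘ (reverse x))
             (cong₂ (λ y z → y ++ firstDigit sep ∷ z) (replicate-map firstDigit space pd≡) (trans (digits-++ env₉ (firstColumns S₁) upperSegments)
             (cong₂ _++_ (first-columns S₁) (cong₂ (λ y z → replicate y (1 + 2 ^ b * (Kc + 2 ^ b * Kc)) ++ ctrl₁ ∷ z) md≡ (last-columns S₁)))))) ⟩
        map firstDigit hashes ++ map firstDigit inputs ++ map firstDigit spaces ++ map firstDigit (sep ∷ columnCodes S₁) ++ upperDigits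
          ≡⟨ cong (λ z → map firstDigit hashes ++ map firstDigit inputs ++ z) (regroup spaces _) ⟩
        map firstDigit hashes ++ map firstDigit inputs ++ map firstDigit (spaces ++ sep ∷ columnCodes S₁) ++ upperDigits
          ≡⟨ cong (map firstDigit hashes ++_) (regroup inputs _) ⟩
        map firstDigit hashes ++ map firstDigit (inputs ++ spaces ++ sep ∷ columnCodes S₁) ++ upperDigits
          ≡⟨ regroup hashes _ ⟩
        map firstDigit firstCodes ++ upperDigits ∎)
        where
        open ≡-Reasoning
        hashes inputs spaces upperDigits : List ℕ
        hashes = replicate (suc certBound) hash
        inputs = map input (reverse x)
        spaces = replicate (suc rest′) space
        upperDigits = replicate upper (1 + 2 ^ b * (Kc + 2 ^ b * Kc)) ++ ctrl₁ ∷ map finalDigit lastCodes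
        upperSegments : List (Segment 9)
        upperSegments = many 2F (1 + 2 ^ b * (Kc + 2 ^ b * Kc)) ∷ single ctrl₁ ∷ lastColumns S₁
        regroup : ∀ u v → map firstDigit u ++ map firstDigit v ++ upperDigits ≡ map firstDigit (u ++ v) ++ upperDigits
        regroup u v = trans (sym (Listₚ.++-assoc (map firstDigit u) (map firstDigit v) upperDigits))
          (cong (_++ upperDigits) (sym (Listₚ.map-++ firstDigit u v)))

      target≡ : ⟦ targetE ⟧ env₉ [] ≡ num target
      target≡ = trans (⟦targetE⟧ env₉ x x≡) (trans (cong (λ z → blocks z ++ num (finalDigit sep)) digits≡)
        (blocks-num targetList targetList< (finalDigit-pos sep≤)))

      env₁₀ : Env 10
      env₁₀ = ⟦ targetE ⟧ env₉ [] ∷ env₉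

      itemOf : ℕ → Letter → ℕ
      itemOf j t = X³ ^ j * item (2 + N₂) (tileAt t)

      open Correct env₁₀ itemOf
        (λ t r r′ → trans (⟦itemE⟧ {env₁₀} t r r′) (cong (λ z → num (X³ ^ length r * item (2 + z) (tileAt t))) n₂≡))
        W target w≡ target≡ target>0

      addGroup-ʳ++ : ∀ j ws as → addGroup j ws as ≡ map (itemOf j) ws ʳ++ as
      addGroup-ʳ++ j []       as = refl
      addGroup-ʳ++ j (t ∷ ws) as = addGroup-ʳ++ j ws (itemOf j t ∷ as)

      addGroup-items : ∀ j as → addGroup j letters as ≡ map (λ t → X³ ^ j * item (2 + N₂) t) ts ++ as
      addGroup-items j as = trans (cong (λ z → addGroup j z as) tw≡) (trans (addGroup-ʳ++ j tilesWord as)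
        (trans (cong (_ʳ++ as) (Listₚ.reverse-map (itemOf j) (map tileLetter (allFin (length ts)))))
        (trans (Listₚ.ʳ++-defn (reverse (map (itemOf j) (map tileLetter (allFin (length ts))))))
        (cong (_++ as) (trans (Listₚ.reverse-involutive _) (trans (sym (Listₚ.map-∘ (allFin (length ts))))
          (trans (Listₚ.map-cong (λ i → cong (λ t → X³ ^ j * item (2 + N₂) t) (tileAt-letter i)) (allFin (length ts)))
          (trans (Listₚ.map-∘ (allFin (length ts))) (cong (map (λ t → X³ ^ j * item (2 + N₂) t))
            (trans (Listₚ.map-tabulate id (lookup ts)) (Listₚ.tabulate-lookup ts)))))))))))

      upTo-items : ∀ m as → upTo m as ≡ items (2 + N₂) m ++ as
      upTo-items zero    as = refl
      upTo-items (suc m) as = trans (upTo-items m _) (trans (cong (items (2 + N₂) m ++_) (addGroup-items m as))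
        (trans (sym (Listₚ.++-assoc (items (2 + N₂) m) _ as)) (cong (_++ as) (sym (items-∷ʳ (2 + N₂) m)))))

      numbers≡ : upTo (length ms) [] ≡ numbers
      numbers≡ = trans (upTo-items (length ms) []) (trans (Listₚ.++-identityʳ _) (cong (items (2 + N₂)) ms≡))

      output≡ : ⟦ mainE ⟧ env₁₀ [] ≡ encTiles outputTiles
      output≡ = subst Output numbers≡ ⟦mainE⟧ sum-small
        where
        Output : List ℕ → Set
        Output as = (sum as + target) + (sum as + target) < 2 ^ W → ⟦ mainE ⟧ env₁₀ [] ≡
          encTiles (big (sum as + target) 0 ∷ big (sum as + target) (sum as + target) ∷ row₀ (sum as ∷ target + target ∷ as))

    output-correct : ⟦ program ⟧ (inject a≤γ′ x ∷ []) [] ≡ encTiles outputTiles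
    output-correct = Evaluation.output≡ _ _ _ _ _ _ _ _ _ (⟦literalE⟧ tilesWord _ [])
      (sized (con 1 ⊕ certP) 6F e₆ refl) (sized upperP 5F e₅ refl) (sized (con 1 ⊕ restP) 4F e₄ refl) (sized rowsP 3F e₃ refl)
      (sized columnsP₋₂ 2F e₂ refl) (sized cellsP 1F e₁ refl) (sized lengthP 0F e₀ refl) refl
      where
      sized : ∀ {m} (q : Poly) i (xs : Env m) → Vec.lookup xs i ≡ inject a≤γ′ x → length (⟦ unary (coeffs q) i ⟧ xs []) ≡ fn q n
      sized q i xs eq = trans (length-unary (coeffs q) i xs) (trans (cong (λ z → eval (coeffs q) (length z)) eq)
        (trans (cong (eval (coeffs q)) (Listₚ.length-map _ x)) (sym (exact q n))))
      e₀ : Env 1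
      e₀ = inject a≤γ′ x ∷ []
      e₁ : Env 2
      e₁ = ⟦ unary (coeffs lengthP) 0F ⟧ e₀ [] ∷ e₀
      e₂ : Env 3
      e₂ = ⟦ unary (coeffs cellsP) 1F ⟧ e₁ [] ∷ e₁
      e₃ : Env 4
      e₃ = ⟦ unary (coeffs columnsP₋₂) 2F ⟧ e₂ [] ∷ e₂
      e₄ : Env 5
      e₄ = ⟦ unary (coeffs rowsP) 3F ⟧ e₃ [] ∷ e₃
      e₅ : Env 6
      e₅ = ⟦ unary (coeffs (con 1 ⊕ restP)) 4F ⟧ e₄ [] ∷ e₄
      e₆ : Env 7
      e₆ = ⟦ unary (coeffs upperP) 5F ⟧ e₅ [] ∷ e₅

    module _ (nonempty : ∃[ t ] t ∈ ts) where

      sum>0 : 0 < totalNumbers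
      sum>0 = ≤-trans (s≤s z≤n) (sum-∈ (∈ₚ.∈-++⁺ˡ (∈ₚ.∈-map⁺ (item (2 + N₂)) (proj₂ nonempty))))

      output-tiling : IsTiling (suc (2 ^ W)) (half + half) outputTiles
      output-tiling = SubsetSum.tiles-tiling numbers-pos target>0 sum-small sum>0

      Subsum⇒TRANS : Subsum numbers target → TRANS-ST (encode outputTiles)
      Subsum⇒TRANS sub = outputTiles , suc (2 ^ W) , half + half , refl , s≤s z≤n ,
        ≤-trans target>0 (≤-trans (m≤n+m target totalNumbers) (m≤m+n half half)) , output-tiling ,
        SubsetSum.Subsum⇒subtiling numbers-pos target>0 sum-small sum>0 sub

      GEN⇒Subsum : GEN-ST (encode outputTiles) → Subsum numbers target
      GEN⇒Subsum (ts′ , n′ , m′ , eq , n>0 , m>0 , tiling , sub) = subtiling⇒Subsum numbers-pos target>0 sum>0 sum-small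
        n>0 m>0 (subst (IsTiling n′ m′) ts≡ tiling) (subst (AdmitsSubtilingWithRotations n′ m′) ts≡ sub)
        where
        ts≡ : ts′ ≡ outputTiles
        ts≡ = sym (encode-injective outputTiles ts′ eq)

-- NP-hardness

module Hardness {a c : ℕ} (M : TM (suc (a + c)) 0) (p pr : Polynomial) where
  open TM M using (k; γ; q; initial; runFor; HaltsWith) renaming (step to tmStep)
  open Guessing {a} {c} M hiding (target)

  opaque
    wangTiles : List WangTile
    wangTiles = wangs

    wangTiles≡ : wangTiles ≡ wangs
    wangTiles≡ = refl

    wangTiles-nonempty : ∃[ t ] t ∈ wangTiles
    wangTiles-nonempty = _ , wangs-complete (change skipGuess) z≤n

  colours : WangTile → ℕ
  colours t = west t + south t + north t + east t

  opaque
    -- Any bound on codes and colours would do, as it depends on the verifier but not on the input.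
    maxCode : ℕ
    maxCode = length (elems eSymbol) + sum (map colours wangTiles)

    codeV≤ : ∀ s → codeV s ≤ maxCode
    codeV≤ s = ≤-trans (<⇒≤ (Finₚ.toℕ<n (Enum.code eSymbol s))) (m≤m+n _ _)

    colours-bound : ∀ {t} → t ∈ wangTiles → west t ≤ maxCode × south t ≤ maxCode × north t ≤ maxCode × east t ≤ maxCode
    colours-bound {t} m = bound (≤-trans (m≤m+n _ _) (≤-trans (m≤m+n _ _) (m≤m+n _ _))) ,
      bound (≤-trans (m≤n+m _ (west t)) (≤-trans (m≤m+n _ _) (m≤m+n _ _))) ,
      bound (≤-trans (m≤n+m _ (west t + south t)) (m≤m+n _ _)) , bound (m≤n+m _ (west t + south t + north t))
      where
      bound : ∀ {x} → x ≤ colours t → x ≤ maxCode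
      bound le = ≤-trans le (≤-trans (sum-∈ (∈ₚ.∈-map⁺ colours m)) (m≤n+m _ (length (elems eSymbol))))

  opaque
    symbolCode : Symbol → ℕ
    symbolCode = codeV

    symbolCode≡ : ∀ s → symbolCode s ≡ codeV s
    symbolCode≡ s = refl

  symbolCode≤ : ∀ s → symbolCode s ≤ maxCode
  symbolCode≤ s = subst (_≤ maxCode) (sym (symbolCode≡ s)) (codeV≤ s)

  -- There are two stacks for each of the `suc k` tapes; the first one, with marks and input, is
  -- laid out separately and not counted here.
  module RO = ReductionOutput a (suc (twice k)) wangTiles maxCode colours-bound
    (symbolCode (ctrl guessing)) (symbolCode (ctrl accepted)) (symbolCode (cell hash)) (symbolCode (cell nothing)) (symbolCode sep)
    (λ s → symbolCode (cell (inputLetter s)))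
    (symbolCode≤ _) (symbolCode≤ _) (symbolCode≤ _) (symbolCode≤ _) (symbolCode≤ _) (λ s → symbolCode≤ _) p pr
  open RO public using (outputTiles; numbers; target; numbers-pos; target>0; sum-small; target-sum; certBound; rest′; rows; cells; columnCodes;
    lastColumnCodes; firstCodes; lastCodes; length-firstCodes; maxCode≤K; firstCodes≤)

  codes : List Symbol → List ℕ
  codes = map codeV

  module _ (x : Word a) where
    -- The number of rows also serves as the depth of the stacks, since no stack grows by more than
    -- one cell per row.
    L = rows x
    open GuessPhase {a} {c} M L
    open Depth L

    blankColumn : List (Cell γ)
    blankColumn = replicate L nothing

    others≡ : ∀ k → stacks (Vec.replicate k blankTape) ≡ replicate (twice k) blankColumn
    others≡ zero    = refl
    others≡ (suc k) = cong (λ z → blankColumn ∷ blankColumn ∷ z) (others≡ k)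

    codes-column : ∀ v ss → codes (column v ss) ≡ map (λ c → symbolCode (cell c)) v ++ symbolCode sep ∷ codes ss
    codes-column v ss = trans (Listₚ.map-++ codeV (map cell v) _) (cong₂ _++_
      (trans (sym (Listₚ.map-∘ v)) (Listₚ.map-cong (λ c → sym (symbolCode≡ (cell c))) v))
      (cong (_∷ codes ss) (sym (symbolCode≡ sep))))

    codes-blank : ∀ j → codes (columns (replicate j blankColumn)) ≡ columnCodes x j
    codes-blank zero    = refl
    codes-blank (suc j) = trans (codes-column blankColumn _)
      (cong₂ (λ y z → y ++ symbolCode sep ∷ z) (Listₚ.map-replicate (λ c → symbolCode (cell c)) L nothing) (codes-blank j))

    columnCodes-last : ∀ j → columnCodes x (suc j) ≡ lastColumnCodes x j ++ symbolCode sep ∷ []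
    columnCodes-last zero    = refl
    columnCodes-last (suc j) = trans (cong (λ z → replicate L (symbolCode (cell nothing)) ++ symbolCode sep ∷ z) (columnCodes-last j))
      (sym (Listₚ.++-assoc (replicate L (symbolCode (cell nothing))) _ _))

    xs = reverse x
    u = guesses (suc (certBound x)) xs

    length-u : length u + suc (rest′ x) ≡ L
    length-u = trans (cong (_+ suc (rest′ x)) (trans (Listₚ.length-++ (replicate (suc (certBound x)) hash))
        (cong₂ _+_ (Listₚ.length-replicate (suc (certBound x))) (trans (Listₚ.length-map inputLetter xs) (Listₚ.length-reverse x)))))
      (+-assoc (suc (certBound x)) (length x) (suc (rest′ x)))

    pad-u : pad L u ≡ u ++ replicate (suc (rest′ x)) nothing
    pad-u = cong (λ z → u ++ replicate z nothing) (trans (cong (_∸ length u) (sym length-u)) (ℕₚ.m+n∸m≡n (length u) (suc (rest′ x))))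

    first-codes : codes (row guessing (two u [])) ≡ symbolCode (ctrl guessing) ∷ firstCodes x
    first-codes = cong₂ _∷_ (sym (symbolCode≡ (ctrl guessing))) (trans (codes-column (pad L u) _) (trans
      (cong₂ (λ y z → map f y ++ symbolCode sep ∷ z) pad-u
        (trans (cong (λ z → codes (columns (blankColumn ∷ z))) (others≡ k)) (codes-blank (suc (twice k)))))
      (trans (cong (_++ symbolCode sep ∷ columnCodes x (suc (twice k))) letters≡)
        (trans (Listₚ.++-assoc (replicate (suc (certBound x)) (f hash)) _ _)
          (cong (replicate (suc (certBound x)) (f hash) ++_) (Listₚ.++-assoc (map (λ s → f (inputLetter s)) xs) _ _))))))
      where
      f : Cell γ → ℕ
      f c = symbolCode (cell c)
      letters≡ : map f (u ++ replicate (suc (rest′ x)) nothing) ≡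
        replicate (suc (certBound x)) (f hash) ++ map (λ s → f (inputLetter s)) xs ++ replicate (suc (rest′ x)) (f nothing)
      letters≡ = trans (Listₚ.map-++ f u _) (trans (cong₂ _++_
          (trans (Listₚ.map-++ f (replicate (suc (certBound x)) hash) _)
            (cong₂ _++_ (Listₚ.map-replicate f (suc (certBound x)) hash) (sym (Listₚ.map-∘ xs))))
          (Listₚ.map-replicate f (suc (rest′ x)) nothing))
        (Listₚ.++-assoc (replicate (suc (certBound x)) (f hash)) _ _))

    last-codes : codes (row accepted erased) ≡ symbolCode (ctrl accepted) ∷ lastCodes x ++ symbolCode sep ∷ []
    last-codes = cong₂ _∷_ (sym (symbolCode≡ (ctrl accepted)))
      (trans (codes-blank (suc (suc (twice k)))) (columnCodes-last (suc (twice k))))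

    room : suc (certBound x) + (length xs + suc (rest′ x)) ≤ L
    room = ≤-reflexive (cong (λ z → suc (certBound x) + (z + suc (rest′ x))) (Listₚ.length-reverse x))

    rows≡ : suc (certBound x) + (length xs + suc (rest′ x)) ≡ L
    rows≡ = cong (λ z → suc (certBound x) + (z + suc (rest′ x))) (Listₚ.length-reverse x)

    length-start : length (two u []) ≡ twice T
    length-start = cong (2 +_) length-others

    level-start : Level L (two u [])
    level-start = length-pad u (≤-trans (m≤m+n _ _) (≤-reflexive length-u)) ∷ length-pad {L = L} [] z≤n ∷
      level-stacks (Vec.replicate k blankTape) (room-blank {0} k z≤n)

    Accepting : Set
    Accepting = Steps guessing (two u []) L accepted erased

    Tableau : List WangTile → List ℕ → List ℕ → Set
    Tableau ts q q′ = Run ts 0 q (cells x) 0 q′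

    accepting⇒Subsum : Accepting → Subsum (numbers x) (target x)
    accepting⇒Subsum st = conclude (RO.Run⇒Subsum (suc (RO.N₂ x)) (cells x) (length-firstCodes x) tableau)
      where
      tableau : Tableau wangTiles (symbolCode (ctrl guessing) ∷ firstCodes x) (symbolCode (ctrl accepted) ∷ lastCodes x ++ symbolCode sep ∷ [])
      tableau = subst₂ (λ q q′ → Tableau wangTiles q q′) first-codes last-codes
        (subst (λ ts → Tableau ts (codes (row guessing (two u []))) (codes (row accepted erased))) (sym wangTiles≡) (steps⇒run {L} L length-start level-start st))
      conclude : ∃[ t ] Subsum (numbers x) t × t + RO.pending 0 (symbolCode (ctrl guessing) ∷ firstCodes x) ≡
        RO.quota (cells x) + RO.X³ ^ cells x * RO.pending 0 (symbolCode (ctrl accepted) ∷ lastCodes x ++ symbolCode sep ∷ []) →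
        Subsum (numbers x) (target x)
      conclude (t , sub , eq) = subst (Subsum (numbers x)) (+-cancelʳ-≡ _ t (target x) (trans eq (sym (target-sum x)))) sub

    Subsum⇒accepting : Subsum (numbers x) (target x) → Accepting
    Subsum⇒accepting sub = run⇒steps {L} L length-start level-start
      (subst (λ ts → Tableau ts (codes (row guessing (two u []))) (codes (row accepted erased))) wangTiles≡ (subst₂ (λ q q′ → Tableau wangTiles q q′) (sym first-codes) (sym last-codes)
        (RO.Subsum⇒Run (suc (RO.N₂ x)) (cells x) (length-firstCodes x) lastLength z≤n
          (maxCode≤K x (symbolCode≤ _) ∷ firstCodes≤ x) z≤n last≤ sub (target-sum x))))
      where
      lastLength : length (symbolCode (ctrl accepted) ∷ lastCodes x ++ symbolCode sep ∷ []) ≡ suc (suc (RO.N₂ x))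
      lastLength = cong suc (trans (cong length (sym (columnCodes-last (suc (twice k))))) (RO.length-columnCodes x (suc (suc (twice k)))))
      last≤ : All (_≤ RO.Kc) (symbolCode (ctrl accepted) ∷ lastCodes x ++ symbolCode sep ∷ [])
      last≤ = maxCode≤K x (symbolCode≤ _) ∷ subst (All (_≤ RO.Kc)) (columnCodes-last (suc (twice k))) (columns≤ (suc (suc (twice k))))
        where
        columns≤ : ∀ j → All (_≤ RO.Kc) (columnCodes x j)
        columns≤ zero    = []
        columns≤ (suc j) = Allₚ.++⁺ (Allₚ.replicate⁺ L (maxCode≤K x (symbolCode≤ _))) (maxCode≤K x (symbolCode≤ _) ∷ columns≤ j)

    accepting⇒certificate : Accepting → ∃[ y ] length y ≤ certBound x × HaltsWith true (runFor (rest′ x) (pair x y))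
    accepting⇒certificate st = restate′ (guessing-sound (certBound x) xs (rest′ x) room
        (subst (λ z → Steps guessing (two u []) z accepted erased) (sym rows≡) st))
      where
      restate′ : ∃[ y ] length y ≤ certBound x × HaltsWith true (runFor (rest′ x) (pair (reverse xs) y)) → _
      restate′ (y , ly , h) = y , ly , subst (λ z → HaltsWith true (runFor (rest′ x) (pair z y))) (Listₚ.reverse-involutive x) h

    certificate⇒accepting : ∀ {m} y → suc m ≡ rest′ x → length y ≤ certBound x → HaltsWith true (runFor m (pair x y)) → Accepting
    certificate⇒accepting {m} y eq ly h = subst (λ z → Steps guessing (two u []) z accepted erased) rows≡
      (guessing-complete (certBound x) xs (rest′ x) room y eq ly
        (subst (λ z → HaltsWith true (runFor m (pair z y))) (sym (Listₚ.reverse-involutive x)) h))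

iterate-+ : ∀ {A : Set} (f : A → A) x m n → iterate f x (m + n) ≡ iterate f (iterate f x m) n
iterate-+ f x zero    n = refl
iterate-+ f x (suc m) n = iterate-+ f (f x) m n

decided-yes : ∀ {A B C : Set} → (A × C) ⊎ (B × ¬ C) → C → A
decided-yes (inj₁ (a , _))  c = a
decided-yes (inj₂ (_ , ¬c)) c = contradiction c ¬c

decided-not-no : ∀ {A B C : Set} → (A × C) ⊎ (B × ¬ C) → ¬ B → C
decided-not-no (inj₁ (_ , c)) ¬b = c
decided-not-no (inj₂ (b , _)) ¬b = contradiction b ¬b

DecidesWithin : ∀ {b} → TM b 0 → Polynomial → Language b → Set
DecidesWithin M p V = ∀ x → (HaltsWith true (runFor (eval p (length x)) x) × V x) ⊎ (HaltsWith false (runFor (eval p (length x)) x) × ¬ V x)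
  where open TM M

module Reducibility {a c : ℕ} (L : Language a) (V : Language (suc (a + c))) (M : TM (suc (a + c)) 0) (p pr : Polynomial)
  (decider : DecidesWithin M p V)
  (certified : ∀ x → L x ⇔ (∃[ y ] length y ≤ eval pr (length x) × V (pair {a} {c} x y))) where

  open Hardness {a} {c} M p pr hiding (L)
  open TM M using (runFor; HaltsWith; initial) renaming (step to tmStep)

  halted-later : ∀ {v} m n z → m ≤ n → HaltsWith v (runFor m z) → HaltsWith v (runFor n z)
  halted-later {v} m n z le h with m≤n⇒∃[o]m+o≡n le
  ... | o , refl = trans (cong Config.control (iterate-+ tmStep (initial z) m o)) (stays o (runFor m z) h)
    where
    stays : ∀ o d → HaltsWith v d → HaltsWith v (iterate tmStep d o)
    stays zero    d h = h
    stays (suc o) (config (halted v) ts) refl = stays o (config (halted v) ts) refl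

  module _ (x : Word a) where
    enough : ∀ y → length y ≤ certBound x → eval p (length (pair {a} {c} x y)) ≤ eval p (length x + 1 + eval pr (length x))
    enough y ly = eval-mono p (≤-trans (≤-reflexive (trans (Listₚ.length-++ (map (λ s → suc (s ↑ˡ c)) x))
      (cong₂ (λ u v → u + suc v) (Listₚ.length-map (λ s → suc (s ↑ˡ c)) x) (Listₚ.length-map (λ s → suc (a ↑ʳ s)) y))))
      (≤-trans (+-monoʳ-≤ (length x) (s≤s ly)) (≤-reflexive (sym (+-assoc (length x) 1 (eval pr (length x)))))))

    accept : ∀ {y} → length y ≤ certBound x → V (pair x y) → HaltsWith true (runFor (eval p (length x + 1 + eval pr (length x))) (pair x y))
    accept {y} ly v = halted-later (eval p (length (pair {a} {c} x y))) (eval p (length x + 1 + eval pr (length x))) (pair x y) (enough y ly)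
      (decided-yes (decider (pair x y)) v)

    -- Were the pair rejected, the decider would have halted with `false` before the time `rest′ x`,
    -- and would still show this verdict.
    verify : ∀ {y} → length y ≤ certBound x → HaltsWith true (runFor (rest′ x) (pair x y)) → V (pair x y)
    verify {y} ly h = decided-not-no (decider (pair x y)) λ h′ → case trans (sym h)
      (halted-later (eval p (length (pair {a} {c} x y))) (rest′ x) (pair x y) (≤-trans (enough y ly) (n≤1+n _)) h′) of λ ()

    L⇒Subsum : L x → Subsum (numbers x) (target x)
    L⇒Subsum lx = let (y , ly , v) = Equivalence.to (certified x) lx in
      accepting⇒Subsum x (certificate⇒accepting x {eval p (length x + 1 + eval pr (length x))} y refl ly (accept ly v))

    Subsum⇒L : Subsum (numbers x) (target x) → L x
    Subsum⇒L sub = let (y , ly , h) = accepting⇒certificate x (Subsum⇒accepting x sub) in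
      Equivalence.from (certified x) (y , ly , verify ly h)

    L⇒TRANS : L x → TRANS-ST (encode (outputTiles x))
    L⇒TRANS lx = RO.Subsum⇒TRANS x wangTiles-nonempty (L⇒Subsum lx)

    GEN⇒L : GEN-ST (encode (outputTiles x)) → L x
    GEN⇒L gen = Subsum⇒L (RO.GEN⇒Subsum x wangTiles-nonempty gen)

  reduction : Word a → Word 3
  reduction x = encode (outputTiles x)

  reduction-polynomial : PolyTimeComputable reduction
  reduction-polynomial = Realise.toPolyTime RO.program RO.a≤γ′ RO.3≤γ reduction
    (λ x → trans (RO.output-correct x) (sym (RO.inject-encode (outputTiles x))))

NPHard-TRANS : NPHard TRANS-ST
NPHard-TRANS L (c , V , (M , p , decider) , pr , certified) =
  reduction , reduction-polynomial , λ x → mk⇔ (L⇒TRANS x) (λ t → GEN⇒L x (TRANS⇒GEN t))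
  where open Reducibility {c = c} L V M p pr decider certified

NPHard-GEN : NPHard GEN-ST
NPHard-GEN L (c , V , (M , p , decider) , pr , certified) =
  reduction , reduction-polynomial , λ x → mk⇔ (λ l → TRANS⇒GEN (L⇒TRANS x l)) (GEN⇒L x)
  where open Reducibility {c = c} L V M p pr decider certified

-- Programs over the words x # y, where y is a sequence of records. A record
-- is a sequence of k-tuples of bits, that is, a tuple of k binary numbers.

module Records (k : ℕ) where

  certificateLetters : ℕ
  certificateLetters = suc (2 ^ k)

  open Programs (suc certificateLetters) public

  -- Within a word x # y the mark is letter 0, the input has the letters 1 to 3, and the certificate
  -- those from 4 on. Computed numbers use 0 to 2 for bits and terminator, so input and computed
  -- words differ by a shift of letters.
  hash separator : Letter
  hash      = 0F
  separator = 4F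

  -- The numbers of a record run on parallel tracks: each is obtained by a letterwise projection,
  -- without any parsing.
  tuple : (Fin k → Bit) → Letter
  tuple v = 5 ↑ʳ Fin.funToFin v

  bitAt : Fin k → Letter → Bit
  bitAt f (suc (suc (suc (suc (suc i))))) = Fin.finToFun i f
  bitAt f _                               = 0b

  bitAt-tuple : ∀ f v → bitAt f (tuple v) ≡ v f
  bitAt-tuple f v = Finₚ.finToFun-funToFin v f

  fieldOf : Fin k → Word γ → ℕ
  fieldOf f u = val (map (bitAt f) u)

  fieldOf-bound : ∀ f u → fieldOf f u < 2 ^ length u
  fieldOf-bound f u = ≤-trans (val-bound (map (bitAt f) u)) (≤-reflexive (cong (2 ^_) (Listₚ.length-map (bitAt f) u)))

  Yes : Word γ → Set
  Yes []      = ⊥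
  Yes (_ ∷ _) = ⊤

  Decides : ∀ {n s} → Exp n s → Env n → Env s → Set → Set
  Decides e xs as A = Yes (⟦ e ⟧ xs as) ⇔ A

  yesE noE : ∀ {n s} → Exp n s
  yesE = cons zero nil
  noE  = nil

  -- The loop only serves to evaluate both expressions in the same context.

  opaque
    both : ∀ {n s} → Fin n → Exp n s → Exp n s → Exp n (2 + s) → Exp n s
    both i e e′ f = loop i (e ∷ e′ ∷ []) (λ _ → svar 0F ∷ svar 1F ∷ []) f

    ⟦both⟧ : ∀ {n s} i (e e′ : Exp n s) f xs as → ⟦ both i e e′ f ⟧ xs as ≡ ⟦ f ⟧ xs (⟦ e ⟧ xs as ∷ ⟦ e′ ⟧ xs as ∷ as)
    ⟦both⟧ {n} {s} i e e′ f xs as = scan (Vec.lookup xs i)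
      where
      body : Letter → Exps (suc n) (2 + s) 2
      body _ = svar 0F ∷ svar 1F ∷ []
      scan : ∀ w → ⟦ f ⟧ xs (⟦loop⟧ body xs as w (⟦ e ⟧ xs as ∷ ⟦ e′ ⟧ xs as ∷ []) Vec.++ as) ≡ ⟦ f ⟧ xs (⟦ e ⟧ xs as ∷ ⟦ e′ ⟧ xs as ∷ as)
      scan []      = refl
      scan (_ ∷ w) = scan w

  opaque
    andE orE : ∀ {n s} → Fin n → Exp n s → Exp n s → Exp n s
    andE i e e′ = both i e e′ (case 0F noE (λ _ → svar 2F))
    orE  i e e′ = both i e e′ (case 0F (svar 1F) (λ _ → yesE))

    notE : ∀ {n s} → Exp n s → Exp n s
    notE e = letS e (case 0F yesE (λ _ → noE))

    decides-and : ∀ {n s} i (e e′ : Exp n s) {xs as A B} → Decides e xs as A → Decides e′ xs as B → Decides (andE i e e′) xs as (A × B)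
    decides-and i e e′ {xs} {as} d d′ rewrite ⟦both⟧ i e e′ (case 0F noE (λ _ → svar 2F)) xs as with ⟦ e ⟧ xs as
    ... | []    = mk⇔ (λ ()) (λ (a , _) → Equivalence.from d a)
    ... | _ ∷ _ = mk⇔ (λ y → Equivalence.to d tt , Equivalence.to d′ y) (λ (_ , b) → Equivalence.from d′ b)

    decides-or : ∀ {n s} i (e e′ : Exp n s) {xs as A B} → Decides e xs as A → Decides e′ xs as B → Decides (orE i e e′) xs as (A ⊎ B)
    decides-or i e e′ {xs} {as} d d′ rewrite ⟦both⟧ i e e′ (case 0F (svar 1F) (λ _ → yesE)) xs as with ⟦ e ⟧ xs as
    ... | []    = mk⇔ (λ y → inj₂ (Equivalence.to d′ y)) [ (λ a → ⊥-elim (Equivalence.from d a)) , Equivalence.from d′ ]′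
    ... | _ ∷ _ = mk⇔ (λ _ → inj₁ (Equivalence.to d tt)) (λ _ → tt)

    decides-not : ∀ {n s} (e : Exp n s) {xs as A} → Decides e xs as A → Decides (notE e) xs as (¬ A)
    decides-not e {xs} {as} d with ⟦ e ⟧ xs as
    ... | []    = mk⇔ (λ _ a → Equivalence.from d a) (λ _ → tt)
    ... | _ ∷ _ = mk⇔ (λ ()) (λ ¬a → ¬a (Equivalence.to d tt))

  compareBit : Bit → Bit → Bool → Bool
  compareBit zero    zero    b = b
  compareBit zero    (suc _) b = true
  compareBit (suc _) zero    b = false
  compareBit (suc _) (suc _) b = b

  compare : ℕ → Bool → Word γ → Word γ → Bool
  compare zero    b p q = b
  compare (suc j) b p q = compare j (compareBit (headBit p) (headBit q) b) (tail p) (tail q)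

  -- The Boolean is the verdict on the digits already compared, which are less significant. It
  -- decides if the remaining digits tie, and so it turns their comparison into a weak or a strict
  -- one.
  Below : Bool → ℕ → ℕ → Set
  Below true  m n = m ≤ n
  Below false m n = m < n

  below-step : ∀ d e b m n → Below (compareBit d e b) m n ⇔ Below b (toℕ d + 2 * m) (toℕ e + 2 * n)
  below-step zero (suc zero) b m n = mk⇔ (into b) (out b)
    where
    into : ∀ b → m ≤ n → Below b (2 * m) (1 + 2 * n)
    into true  le = ≤-trans (*-monoʳ-≤ 2 le) (n≤1+n _)
    into false le = s≤s (*-monoʳ-≤ 2 le)
    half : 2 * m < 2 * suc n → m ≤ n
    half lt = s≤s⁻¹ (*-cancelˡ-< 2 m (suc n) lt)
    2+ : suc (suc (2 * n)) ≡ 2 * suc n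
    2+ = sym (*-suc 2 n)
    out : ∀ b → Below b (2 * m) (1 + 2 * n) → m ≤ n
    out true  le = half (≤-trans (s≤s le) (≤-reflexive 2+))
    out false lt = half (≤-trans lt (≤-trans (n≤1+n _) (≤-reflexive 2+)))
  below-step (suc zero) zero b m n = mk⇔ (into b) (out b)
    where
    into : ∀ b → m < n → Below b (1 + 2 * m) (2 * n)
    into true  lt = ≤-trans (n≤1+n _) (≤-trans (≤-reflexive (sym (*-suc 2 m))) (*-monoʳ-≤ 2 lt))
    into false lt = ≤-trans (≤-reflexive (sym (*-suc 2 m))) (*-monoʳ-≤ 2 lt)
    out : ∀ b → Below b (1 + 2 * m) (2 * n) → m < n
    out true  le = *-cancelˡ-< 2 m n le
    out false lt = *-cancelˡ-< 2 m n (<⇒≤ lt)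
  below-step zero zero true  m n = mk⇔ (*-monoʳ-≤ 2) (ℕₚ.*-cancelˡ-≤ 2)
  below-step zero zero false m n = mk⇔ (*-monoʳ-< 2) (*-cancelˡ-< 2 m n)
  below-step (suc zero) (suc zero) true  m n = mk⇔ (λ le → s≤s (*-monoʳ-≤ 2 le)) (λ le → ℕₚ.*-cancelˡ-≤ 2 (s≤s⁻¹ le))
  below-step (suc zero) (suc zero) false m n = mk⇔ (λ lt → s≤s (*-monoʳ-< 2 lt)) (λ lt → *-cancelˡ-< 2 m n (s≤s⁻¹ lt))

  compare-below : ∀ j b p q → length p ≤ j → length q ≤ j → compare j b p q ≡ true ⇔ Below b (value p) (value q)
  compare-below zero true  [] [] _ _ = mk⇔ (λ _ → z≤n) (λ _ → refl)
  compare-below zero false [] [] _ _ = mk⇔ (λ ()) (λ ())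
  compare-below (suc j) b p q lp lq = mk⇔
    (λ eq → subst₂ (Below b) (sym (value-step p)) (sym (value-step q))
      (Equivalence.to (below-step (headBit p) (headBit q) b _ _) (Equivalence.to ih eq)))
    (λ le → Equivalence.from ih (Equivalence.from (below-step (headBit p) (headBit q) b _ _)
      (subst₂ (Below b) (value-step p) (value-step q) le)))
    where
    shorter : ∀ (p : Word γ) → length p ≤ suc j → length (tail p) ≤ j
    shorter []      _        = z≤n
    shorter (_ ∷ p) (s≤s le) = le
    ih : compare j (compareBit (headBit p) (headBit q) b) (tail p) (tail q) ≡ true ⇔
      Below (compareBit (headBit p) (headBit q) b) (value (tail p)) (value (tail q))
    ih = compare-below j (compareBit (headBit p) (headBit q) b) (tail p) (tail q) (shorter p lp) (shorter q lq)

  bool : Bool → Word γ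
  bool true  = zero ∷ []
  bool false = []

  choose : ∀ {n s} → Bit → Bit → Exp n s → Exp n s
  choose zero    zero    e = e
  choose zero    (suc _) e = yesE
  choose (suc _) zero    e = noE
  choose (suc _) (suc _) e = e

  ⟦choose⟧ : ∀ {n s} d d′ (e : Exp n s) xs as b → ⟦ e ⟧ xs as ≡ bool b → ⟦ choose d d′ e ⟧ xs as ≡ bool (compareBit d d′ b)
  ⟦choose⟧ zero    zero    e xs as b eq = eq
  ⟦choose⟧ zero    (suc _) e xs as b eq = refl
  ⟦choose⟧ (suc _) zero    e xs as b eq = refl
  ⟦choose⟧ (suc _) (suc _) e xs as b eq = eq

  opaque
    leE : ∀ {n s} → Fin n → Exp n s → Exp n s → Exp n s
    leE i e e′ = loop i (e ∷ e′ ∷ yesE ∷ []) (λ _ → pop 0F ∷ pop 1F ∷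
      caseBit 0F (λ d → caseBit 2F (λ d′ → choose d d′ (svar 4F))) ∷ []) (svar 2F)

    decides-le : ∀ {n s} i (e e′ : Exp n s) {xs as u v} → ⟦ e ⟧ xs as ≡ num u → ⟦ e′ ⟧ xs as ≡ num v →
      length (⟦ e ⟧ xs as) ≤ length (Vec.lookup xs i) → length (⟦ e′ ⟧ xs as) ≤ length (Vec.lookup xs i) →
      Decides (leE i e e′) xs as (u ≤ v)
    decides-le {n} {s} i e e′ {xs} {as} {u} {v} eu ev lu lv =
      subst₂ (λ w A → Yes w ⇔ A) (sym (scan (Vec.lookup xs i) true (⟦ e ⟧ xs as) (⟦ e′ ⟧ xs as)))
        (cong₂ _≤_ (value-num eu) (value-num ev)) (mk⇔ (λ y → Equivalence.to cmp (yes-bool _ y)) (λ le → bool-yes (Equivalence.from cmp le)))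
      where
      body : Letter → Exps (suc n) (3 + s) 3
      body _ = pop 0F ∷ pop 1F ∷ caseBit 0F (λ d → caseBit 2F (λ d′ → choose d d′ (svar 4F))) ∷ []
      turn : ∀ w b p q → ⟦ body zero ⟧* (w ∷ xs) (p ∷ q ∷ bool b ∷ as) ≡ tail p ∷ tail q ∷ bool (compareBit (headBit p) (headBit q) b) ∷ []
      turn w b p q = cong₂ Vec._∷_ (⟦pop⟧ 0F (w ∷ xs) (p ∷ q ∷ bool b ∷ as)) (cong₂ Vec._∷_ (⟦pop⟧ 1F (w ∷ xs) (p ∷ q ∷ bool b ∷ as)) (cong (Vec._∷ [])
        (trans (⟦caseBit⟧ 0F (λ d → caseBit 2F (λ d′ → choose d d′ (svar 4F))) (w ∷ xs) (p ∷ q ∷ bool b ∷ as))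
        (trans (⟦caseBit⟧ 2F (λ d′ → choose (headBit p) d′ (svar 4F)) (w ∷ xs) (tail p ∷ p ∷ q ∷ bool b ∷ as))
        (⟦choose⟧ (headBit p) (headBit q) (svar 4F) (w ∷ xs) (tail q ∷ tail p ∷ p ∷ q ∷ bool b ∷ as) b refl)))))
      scan : ∀ w b p q → Vec.lookup (⟦loop⟧ body xs as w (p ∷ q ∷ bool b ∷ []) Vec.++ as) 2F ≡ bool (compare (length w) b p q)
      scan []      b p q = refl
      scan (_ ∷ w) b p q = trans (cong (λ z → Vec.lookup (⟦loop⟧ body xs as w z Vec.++ as) 2F) (turn w b p q))
        (scan w (compareBit (headBit p) (headBit q) b) (tail p) (tail q))
      value-num : ∀ {w : Word γ} {n} → w ≡ num n → value w ≡ n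
      value-num {n = n} refl = trans (cong val (bitOf-up (binary n))) (val-binary n)
      cmp : compare (length (Vec.lookup xs i)) true (⟦ e ⟧ xs as) (⟦ e′ ⟧ xs as) ≡ true ⇔ value (⟦ e ⟧ xs as) ≤ value (⟦ e′ ⟧ xs as)
      cmp = compare-below (length (Vec.lookup xs i)) true (⟦ e ⟧ xs as) (⟦ e′ ⟧ xs as) lu lv
      yes-bool : ∀ b → Yes (bool b) → b ≡ true
      yes-bool true _ = refl
      bool-yes : ∀ {b} → b ≡ true → Yes (bool b)
      bool-yes refl = tt

  sameE : ∀ {n s} → Letter → Letter → Exp n s → Exp n s
  sameE c d e with c Finₚ.≟ d
  ... | yes _ = e
  ... | no _  = noE

  opaque
    eqE : ∀ {n s} → Fin n → (Letter → Letter) → Exp n s → Exp n s → Exp n s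
    eqE i g e e′ = loop i (e ∷ e′ ∷ yesE ∷ []) (λ _ → pop 0F ∷ pop 1F ∷
      case 0F (case 1F (svar 2F) (λ _ → noE)) (λ c → case 2F noE (λ d → sameE c (g d) (svar 4F))) ∷ []) (svar 2F)

    -- The clock needs one round more than `e′` has letters, in order to notice letters of `e` in
    -- excess; no bound on `e` is required.
    decides-eq : ∀ {n s} i g (e e′ : Exp n s) {xs as} → length (⟦ e′ ⟧ xs as) < length (Vec.lookup xs i) →
      Decides (eqE i g e e′) xs as (⟦ e ⟧ xs as ≡ map g (⟦ e′ ⟧ xs as))
    decides-eq {n} {s} i g e e′ {xs} {as} lq =
      let iff = scan (Vec.lookup xs i) (⟦ e ⟧ xs as) (⟦ e′ ⟧ xs as) (zero ∷ []) lq in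
      mk⇔ (λ y → proj₂ (Equivalence.to iff y)) (λ eq → Equivalence.from iff (tt , eq))
      where
      body : Letter → Exps (suc n) (3 + s) 3
      body _ = pop 0F ∷ pop 1F ∷
        case 0F (case 1F (svar 2F) (λ _ → noE)) (λ c → case 2F noE (λ d → sameE c (g d) (svar 4F))) ∷ []
      result : Word γ → Word γ → Word γ → Word γ → Word γ
      result w p q r = Vec.lookup (⟦loop⟧ body xs as w (p ∷ q ∷ r ∷ []) Vec.++ as) 2F
      failed : ∀ w p q → ¬ Yes (result w p q [])
      failed (_ ∷ w) []      []      y = failed w [] [] y
      failed (_ ∷ w) []      (d ∷ q) y = failed w [] q y
      failed (_ ∷ w) (c ∷ p) []      y = failed w p [] y
      failed (_ ∷ w) (c ∷ p) (d ∷ q) y with c Finₚ.≟ g d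
      ... | yes _ = failed w p q y
      ... | no _  = failed w p q y
      exhausted : ∀ w r → result w [] [] r ≡ r
      exhausted []      r = refl
      exhausted (_ ∷ w) r = exhausted w r
      scan : ∀ w p q r → length q < length w → Yes (result w p q r) ⇔ (Yes r × p ≡ map g q)
      scan (_ ∷ w) []      []      r _ = mk⇔ (λ y → subst Yes (exhausted w r) y , refl) (λ (y , _) → subst Yes (sym (exhausted w r)) y)
      scan (_ ∷ w) []      (d ∷ q) r _ = mk⇔ (λ y → ⊥-elim (failed w [] q y)) λ { (_ , ()) }
      scan (_ ∷ w) (c ∷ p) []      r _ = mk⇔ (λ y → ⊥-elim (failed w p [] y)) λ { (_ , ()) }
      scan (_ ∷ w) (c ∷ p) (d ∷ q) r (s≤s lq) with c Finₚ.≟ g d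
      ... | yes refl = mk⇔ (λ y → let (yr , eq) = Equivalence.to (scan w p q r lq) y in yr , cong (c ∷_) eq)
                           (λ (yr , eq) → Equivalence.from (scan w p q r lq) (yr , Listₚ.∷-injectiveʳ eq))
      ... | no ne    = mk⇔ (λ y → ⊥-elim (failed w p q y))
                           (λ (yr , eq) → contradiction (Listₚ.∷-injectiveˡ eq) ne)

  opaque
    fieldE : ∀ {n s} → Fin n → Fin k → Exp n s → Exp n s
    fieldE i f e = canonical i (loop i (e ∷ nil ∷ [])
      (λ _ → pop 0F ∷ case 0F (svar 1F) (λ c → cons (up (bitAt f c)) (svar 2F)) ∷ []) (svar 1F))

    ⟦fieldE⟧ : ∀ {n s} i f (e : Exp n s) xs as → length (⟦ e ⟧ xs as) ≤ length (Vec.lookup xs i) →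
      ⟦ fieldE i f e ⟧ xs as ≡ num (fieldOf f (⟦ e ⟧ xs as))
    ⟦fieldE⟧ {n} {s} i f e xs as le = trans (⟦canonical⟧ i extract xs as (≤-trans (≤-reflexive (trans (cong length extracted)
        (trans (Listₚ.length-reverse (map up (map (bitAt f) u))) (trans (Listₚ.length-map up (map (bitAt f) u)) (Listₚ.length-map (bitAt f) u))))) le))
      (trans (cong (foldl (λ w c → normHead c w) []) extracted) (trans (norm-reverse (map (bitAt f) u))
        (cong (map up) (sym (binary-val (map (bitAt f) u))))))
      where
      u : Word γ
      u = ⟦ e ⟧ xs as
      body : Letter → Exps (suc n) (2 + s) 2
      body _ = pop 0F ∷ case 0F (svar 1F) (λ c → cons (up (bitAt f c)) (svar 2F)) ∷ []
      extract : Exp n s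
      extract = loop i (e ∷ nil ∷ []) body (svar 1F)
      scan : ∀ w u v → length u ≤ length w →
        Vec.lookup (⟦loop⟧ body xs as w (u ∷ v ∷ []) Vec.++ as) 1F ≡ map up (map (bitAt f) u) ʳ++ v
      scan []      []      v le       = refl
      scan (_ ∷ w) []      v le       = scan w [] v z≤n
      scan (_ ∷ w) (c ∷ u) v (s≤s le) = scan w u (up (bitAt f c) ∷ v) le
      extracted : ⟦ extract ⟧ xs as ≡ reverse (map up (map (bitAt f) u))
      extracted = scan (Vec.lookup xs i) u [] le

  -- The records of a word, each in reverse order and with the rest of the
  -- word after it

  records : Word γ → Word γ → List (Word γ × Word γ)
  records u []      = []
  records u (c ∷ w) with c Finₚ.≟ separator
  ... | yes _ = (u , w) ∷ records [] w
  ... | no _  = records (c ∷ u) w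

  records-bound : ∀ u y {u′ w} → (u′ , w) ∈ records u y → length u′ + length w < length u + length y
  records-bound u (c ∷ y) m with c Finₚ.≟ separator
  records-bound u (c ∷ y) (here refl) | yes _ = ≤-reflexive (sym (+-suc (length u) (length y)))
  records-bound u (c ∷ y) (there m)   | yes _ = ≤-trans (records-bound [] y m) (≤-trans (n≤1+n _) (m≤n+m _ (length u)))
  records-bound u (c ∷ y) m           | no _  = ≤-trans (records-bound (c ∷ u) y m) (≤-reflexive (sym (+-suc (length u) (length y))))

  atSeparator : ∀ {A : Set} → Letter → A → A → A
  atSeparator c x y with c Finₚ.≟ separator
  ... | yes _ = x
  ... | no _  = y

  recordBody : ∀ {n s} → Exp (suc n) (2 + s) → Letter → Exps (suc n) (2 + s) 2
  recordBody e c = atSeparator c nil (cons c (svar 0F)) ∷ atSeparator c e (svar 1F) ∷ []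

  opaque
    -- The tested expression finds the record in safe variable `0F` and the words after it in normal
    -- variable `0F`. A nested loop over the latter runs through the later records, hence through
    -- pairs.
    allE anyE : ∀ {n s} → Fin n → Exp (suc n) (2 + s) → Exp n s
    allE i e = loop i (nil ∷ yesE ∷ []) (recordBody (andE (suc i) (svar 1F) e)) (svar 1F)
    anyE i e = loop i (nil ∷ noE ∷ []) (recordBody (orE (suc i) (svar 1F) e)) (svar 1F)

    decides-all : ∀ {n s} i (e : Exp (suc n) (2 + s)) {xs as} {A : Word γ → Word γ → Set} →
      (∀ {u w} → (u , w) ∈ records [] (Vec.lookup xs i) → ∀ v → Decides e (w ∷ xs) (u ∷ v ∷ as) (A u w)) →
      Decides (allE i e) xs as (All (λ (u , w) → A u w) (records [] (Vec.lookup xs i)))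
    decides-all {n} {s} i e {xs} {as} {A} dec =
      let iff = scan (Vec.lookup xs i) [] (zero ∷ []) dec in
      mk⇔ (λ y → proj₂ (Equivalence.to iff y)) (λ all → Equivalence.from iff (tt , all))
      where
      body : Letter → Exps (suc n) (2 + s) 2
      body = recordBody (andE (suc i) (svar 1F) e)
      scan : ∀ y u r → (∀ {u′ w} → (u′ , w) ∈ records u y → ∀ v → Decides e (w ∷ xs) (u′ ∷ v ∷ as) (A u′ w)) →
        Yes (Vec.lookup (⟦loop⟧ body xs as y (u ∷ r ∷ []) Vec.++ as) 1F) ⇔ (Yes r × All (λ (u , w) → A u w) (records u y))
      scan []      u r dec = mk⇔ (λ yr → yr , []) proj₁
      scan (c ∷ y) u r dec with c Finₚ.≟ separator
      ... | no _  = scan y (c ∷ u) r dec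
      ... | yes _ = mk⇔
        (λ h → let (h₁ , all) = Equivalence.to ih h ; (yr , a) = Equivalence.to now h₁ in yr , a ∷ all)
        (λ { (yr , a ∷ all) → Equivalence.from ih (Equivalence.from now (yr , a) , all) })
        where
        now : Decides (andE (suc i) (svar 1F) e) (y ∷ xs) (u ∷ r ∷ as) (Yes r × A u y)
        now = decides-and (suc i) (svar 1F) e (mk⇔ id id) (dec (here refl) r)
        ok : Word γ
        ok = ⟦ andE (suc i) (svar 1F) e ⟧ (y ∷ xs) (u ∷ r ∷ as)
        ih : Yes (Vec.lookup (⟦loop⟧ body xs as y ([] ∷ ok ∷ []) Vec.++ as) 1F) ⇔ (Yes ok × All (λ (u , w) → A u w) (records [] y))
        ih = scan y [] (⟦ andE (suc i) (svar 1F) e ⟧ (y ∷ xs) (u ∷ r ∷ as)) (dec ∘ there)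

    decides-any : ∀ {n s} i (e : Exp (suc n) (2 + s)) {xs as} {A : Word γ → Word γ → Set} →
      (∀ {u w} → (u , w) ∈ records [] (Vec.lookup xs i) → ∀ v → Decides e (w ∷ xs) (u ∷ v ∷ as) (A u w)) →
      Decides (anyE i e) xs as (Any (λ (u , w) → A u w) (records [] (Vec.lookup xs i)))
    decides-any {n} {s} i e {xs} {as} {A} dec =
      let iff = scan (Vec.lookup xs i) [] [] dec in
      mk⇔ (λ y → [ (λ ()) , id ]′ (Equivalence.to iff y)) (λ any → Equivalence.from iff (inj₂ any))
      where
      body : Letter → Exps (suc n) (2 + s) 2
      body = recordBody (orE (suc i) (svar 1F) e)
      scan : ∀ y u r → (∀ {u′ w} → (u′ , w) ∈ records u y → ∀ v → Decides e (w ∷ xs) (u′ ∷ v ∷ as) (A u′ w)) →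
        Yes (Vec.lookup (⟦loop⟧ body xs as y (u ∷ r ∷ []) Vec.++ as) 1F) ⇔ (Yes r ⊎ Any (λ (u , w) → A u w) (records u y))
      scan []      u r dec = mk⇔ inj₁ [ id , (λ ()) ]′
      scan (c ∷ y) u r dec with c Finₚ.≟ separator
      ... | no _  = scan y (c ∷ u) r dec
      ... | yes _ = mk⇔
        (λ h → [ (λ h₁ → [ inj₁ , (λ a → inj₂ (here a)) ]′ (Equivalence.to now h₁)) , (λ any → inj₂ (there any)) ]′ (Equivalence.to ih h))
        [ (λ yr → Equivalence.from ih (inj₁ (Equivalence.from now (inj₁ yr))))
        , (λ { (here a) → Equivalence.from ih (inj₁ (Equivalence.from now (inj₂ a))) ; (there any) → Equivalence.from ih (inj₂ any) }) ]′
        where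
        now : Decides (orE (suc i) (svar 1F) e) (y ∷ xs) (u ∷ r ∷ as) (Yes r ⊎ A u y)
        now = decides-or (suc i) (svar 1F) e (mk⇔ id id) (dec (here refl) r)
        ok : Word γ
        ok = ⟦ orE (suc i) (svar 1F) e ⟧ (y ∷ xs) (u ∷ r ∷ as)
        ih : Yes (Vec.lookup (⟦loop⟧ body xs as y ([] ∷ ok ∷ []) Vec.++ as) 1F) ⇔ (Yes ok ⊎ Any (λ (u , w) → A u w) (records [] y))
        ih = scan y [] (⟦ orE (suc i) (svar 1F) e ⟧ (y ∷ xs) (u ∷ r ∷ as)) (dec ∘ there)

  before after : Letter → Word γ → Word γ
  before z []      = []
  before z (c ∷ w) with c Finₚ.≟ z
  ... | yes _ = []
  ... | no _  = c ∷ before z w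
  after z []      = []
  after z (c ∷ w) with c Finₚ.≟ z
  ... | yes _ = w
  ... | no _  = after z w

  isLetter : ∀ {A : Set} → Letter → Letter → A → A → A
  isLetter c z x y with c Finₚ.≟ z
  ... | yes _ = x
  ... | no _  = y

  opaque
    beforeE afterE : ∀ {n s} → Fin n → Letter → Exp n s
    beforeE i z = loop i (noE ∷ nil ∷ []) (λ c → isLetter c z yesE (svar 0F) ∷
      case 0F (isLetter c z (svar 1F) (cons c (svar 1F))) (λ _ → svar 2F) ∷ []) (svar 1F)
    afterE i z = revOnto i (loop i (noE ∷ nil ∷ []) (λ c → isLetter c z yesE (svar 0F) ∷
      case 0F (svar 1F) (λ _ → cons c (svar 2F)) ∷ []) (svar 1F)) nil

    ⟦beforeE⟧ : ∀ {n s} i z (xs : Env n) (as : Env s) → ⟦ beforeE i z ⟧ xs as ≡ reverse (before z (Vec.lookup xs i))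
    ⟦beforeE⟧ {n} {s} i z xs as = scan (Vec.lookup xs i) []
      where
      body : Letter → Exps (suc n) (2 + s) 2
      body c = isLetter c z yesE (svar 0F) ∷ case 0F (isLetter c z (svar 1F) (cons c (svar 1F))) (λ _ → svar 2F) ∷ []
      frozen : ∀ w u d v → Vec.lookup (⟦loop⟧ body xs as w ((d ∷ v) ∷ u ∷ []) Vec.++ as) 1F ≡ u
      frozen []      u d v = refl
      frozen (c ∷ w) u d v with c Finₚ.≟ z
      ... | yes _ = frozen w u zero []
      ... | no _  = frozen w u d v
      scan : ∀ w u → Vec.lookup (⟦loop⟧ body xs as w ([] ∷ u ∷ []) Vec.++ as) 1F ≡ before z w ʳ++ u
      scan []      u = refl
      scan (c ∷ w) u with c Finₚ.≟ z
      ... | yes _ = frozen w u zero []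
      ... | no _  = scan w (c ∷ u)

    ⟦afterE⟧ : ∀ {n s} i z (xs : Env n) (as : Env s) → ⟦ afterE i z ⟧ xs as ≡ after z (Vec.lookup xs i)
    ⟦afterE⟧ {n} {s} i z xs as = trans (⟦revOnto⟧ i inner nil xs as (≤-trans (≤-reflexive (trans (cong length inner≡) (Listₚ.length-reverse (after z (Vec.lookup xs i)))))
        (length-after (Vec.lookup xs i)))) (trans (cong (_ʳ++ []) inner≡) (Listₚ.reverse-involutive (after z (Vec.lookup xs i))))
      where
      body : Letter → Exps (suc n) (2 + s) 2
      body c = isLetter c z yesE (svar 0F) ∷ case 0F (svar 1F) (λ _ → cons c (svar 2F)) ∷ []
      inner : Exp n s
      inner = loop i (noE ∷ nil ∷ []) body (svar 1F)
      length-after : ∀ w → length (after z w) ≤ length w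
      length-after []      = z≤n
      length-after (c ∷ w) with c Finₚ.≟ z
      ... | yes _ = n≤1+n _
      ... | no _  = ≤-trans (length-after w) (n≤1+n _)
      found : ∀ w u d v → Vec.lookup (⟦loop⟧ body xs as w ((d ∷ v) ∷ u ∷ []) Vec.++ as) 1F ≡ w ʳ++ u
      found []      u d v = refl
      found (c ∷ w) u d v with c Finₚ.≟ z
      ... | yes _ = found w (c ∷ u) zero []
      ... | no _  = found w (c ∷ u) d v
      scan : ∀ w → Vec.lookup (⟦loop⟧ body xs as w ([] ∷ [] ∷ []) Vec.++ as) 1F ≡ reverse (after z w)
      scan []      = refl
      scan (c ∷ w) with c Finₚ.≟ z
      ... | yes _ = found w [] zero []
      ... | no _  = scan w
      inner≡ : ⟦ inner ⟧ xs as ≡ reverse (after z (Vec.lookup xs i))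
      inner≡ = scan (Vec.lookup xs i)

  records-first : ∀ u y {z} → z ∈ records [] (after separator y) → z ∈ records u y
  records-first u (c ∷ y) m with c Finₚ.≟ separator
  ... | yes _ = there m
  ... | no _  = records-first (c ∷ u) y m

  module _ (z : Letter) {y : Word γ} where

    before-++ : ∀ {x} → All (_≢ z) x → before z (x ++ z ∷ y) ≡ x
    before-++ {[]}    [] with z Finₚ.≟ z
    ... | yes _ = refl
    ... | no ne = contradiction refl ne
    before-++ {c ∷ x} (ne ∷ nes) with c Finₚ.≟ z
    ... | yes eq = contradiction eq ne
    ... | no _   = cong (c ∷_) (before-++ nes)

    after-++ : ∀ {x} → All (_≢ z) x → after z (x ++ z ∷ y) ≡ y
    after-++ {[]}    [] with z Finₚ.≟ z
    ... | yes _ = refl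
    ... | no ne = contradiction refl ne
    after-++ {c ∷ x} (ne ∷ nes) with c Finₚ.≟ z
    ... | yes eq = contradiction eq ne
    ... | no _   = after-++ nes

  records-++ : ∀ u {v w} → All (_≢ separator) v → records u (v ++ separator ∷ w) ≡ (v ʳ++ u , w) ∷ records [] w
  records-++ u {[]}    []         = refl
  records-++ u {c ∷ v} (ne ∷ nes) with c Finₚ.≟ separator
  ... | yes eq = contradiction eq ne
  ... | no _   = records-++ (c ∷ u) nes

  module _ {R : Word γ → Word γ → Set} where

    records-AllPairs : ∀ u y → All (λ (u , w) → All (λ (v , _) → R u v) (records [] w)) (records u y) →
      AllPairs (λ (u , _) (v , _) → R u v) (records u y)
    records-AllPairs u []      []         = []
    records-AllPairs u (c ∷ y) all with c Finₚ.≟ separator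
    records-AllPairs u (c ∷ y) (a ∷ all) | yes _ = a ∷ records-AllPairs [] y all
    records-AllPairs u (c ∷ y) all       | no _  = records-AllPairs (c ∷ u) y all

    records-All : ∀ u y → AllPairs (λ (u , _) (v , _) → R u v) (records u y) →
      All (λ (u , w) → All (λ (v , _) → R u v) (records [] w)) (records u y)
    records-All u []      []          = []
    records-All u (c ∷ y) pairs with c Finₚ.≟ separator
    records-All u (c ∷ y) (a ∷ pairs) | yes _ = a ∷ records-All [] y pairs
    records-All u (c ∷ y) pairs       | no _  = records-All (c ∷ u) y pairs

-- The fields of a record: dimensions of the rectangle and its left part (used
-- in the first record only), and shape and position of a tile in the given
-- tiling (false) and in its rearrangement (true).

data Field : Set where
  nF mF cutF : Field
  hF wF rF cF : Bool → Field

enum-Field : Enum Field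
enum-Field = enum-via (enum-⊎ (enum-Fin 3) (enum-Σ (enum-Fin 4) (λ _ → enum-Bool)))
  (λ { (inj₁ 0F) → nF ; (inj₁ 1F) → mF ; (inj₁ 2F) → cutF ; (inj₂ (0F , p)) → hF p ; (inj₂ (1F , p)) → wF p
     ; (inj₂ (2F , p)) → rF p ; (inj₂ (3F , p)) → cF p })
  (λ { nF → inj₁ 0F ; mF → inj₁ 1F ; cutF → inj₁ 2F ; (hF p) → inj₂ (0F , p) ; (wF p) → inj₂ (1F , p)
     ; (rF p) → inj₂ (2F , p) ; (cF p) → inj₂ (3F , p) })
  (λ { nF → refl ; mF → refl ; cutF → refl ; (hF p) → refl ; (wF p) → refl ; (rF p) → refl ; (cF p) → refl })

module Checking (rotations : Bool) (k : ℕ) (index : Field → Fin k) where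
  open Records k public

  data Term (v : ℕ) : Set where
    zero : Term v
    fld  : Field → Fin v → Term v
    plus : Field → Field → Fin v → Term v

  infix  5 _≤ᶠ_ _<ᶠ_
  infixr 4 _∧ᶠ_ _∨ᶠ_

  -- The conditions of the verifier are inequalities between fields. As syntax they get a meaning,
  -- `True`, and a program, `formulaE`, whose agreement is proved once for all of them.
  data Formula (v : ℕ) : Set where
    _≤ᶠ_ _<ᶠ_ : Term v → Term v → Formula v
    _∧ᶠ_ _∨ᶠ_ : Formula v → Formula v → Formula v
    falseᶠ    : Formula v

  get : Field → Word γ → ℕ
  get f u = fieldOf (index f) u

  termVal : ∀ {v} → Term v → Env v → ℕ
  termVal zero         us = 0
  termVal (fld f j)    us = get f (Vec.lookup us j)
  termVal (plus f g j) us = get f (Vec.lookup us j) + get g (Vec.lookup us j)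

  True : ∀ {v} → Formula v → Env v → Set
  True (t ≤ᶠ t′) us = termVal t us ≤ termVal t′ us
  True (t <ᶠ t′) us = termVal t us < termVal t′ us
  True (φ ∧ᶠ ψ)  us = True φ us × True ψ us
  True (φ ∨ᶠ ψ)  us = True φ us ⊎ True ψ us
  True falseᶠ    us = ⊥

  termE : ∀ {n s v} → Fin n → Vec (Exp n s) v → Term v → Exp n s
  termE i es zero         = nil
  termE i es (fld f j)    = fieldE i (index f) (Vec.lookup es j)
  termE i es (plus f g j) = sumE i (fieldE i (index f) (Vec.lookup es j)) (fieldE i (index g) (Vec.lookup es j))

  opaque
    formulaE : ∀ {n s v} → Fin n → Vec (Exp n s) v → Formula v → Exp n s
    formulaE i es (t ≤ᶠ t′) = leE i (termE i es t) (termE i es t′)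
    formulaE i es (t <ᶠ t′) = notE (leE i (termE i es t′) (termE i es t))
    formulaE i es (φ ∧ᶠ ψ)  = andE i (formulaE i es φ) (formulaE i es ψ)
    formulaE i es (φ ∨ᶠ ψ)  = orE i (formulaE i es φ) (formulaE i es ψ)
    formulaE i es falseᶠ    = noE

    decides-formula : ∀ {n s v} i (es : Vec (Exp n s) v) {xs as} us → (∀ j → ⟦ Vec.lookup es j ⟧ xs as ≡ Vec.lookup us j) →
      (∀ j → length (Vec.lookup us j) < length (Vec.lookup xs i)) → ∀ φ → Decides (formulaE i es φ) xs as (True φ us)
    decides-formula {n} {s} {v} i es {xs} {as} us eqs lens φ = go φ
      where
      ℓ : ℕ
      ℓ = length (Vec.lookup xs i)
      field≡ : ∀ f j → ⟦ fieldE i (index f) (Vec.lookup es j) ⟧ xs as ≡ num (get f (Vec.lookup us j))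
      field≡ f j = trans (⟦fieldE⟧ i (index f) (Vec.lookup es j) xs as
        (≤-trans (≤-reflexive (cong length (eqs j))) (<⇒≤ (lens j)))) (cong (λ z → num (get f z)) (eqs j))
      -- Records are strictly shorter than the clock, which leaves one bit for the carry.
      sum< : ∀ f g j → get f (Vec.lookup us j) + get g (Vec.lookup us j) < 2 ^ ℓ
      sum< f g j = <-≤-trans (+-mono-< (fieldOf-bound (index f) (Vec.lookup us j)) (fieldOf-bound (index g) (Vec.lookup us j)))
        (≤-trans (≤-reflexive (cong (2 ^ length (Vec.lookup us j) +_) (sym (+-identityʳ _)))) (ℕₚ.^-monoʳ-≤ 2 (lens j)))
      term≡ : ∀ t → ⟦ termE i es t ⟧ xs as ≡ num (termVal t us)
      term≡ zero         = refl
      term≡ (fld f j)    = field≡ f j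
      term≡ (plus f g j) = ⟦sumE⟧ i _ _ xs as {get f (Vec.lookup us j)} {get g (Vec.lookup us j)} (field≡ f j) (field≡ g j) (sum< f g j)
      term< : ∀ t → termVal t us < 2 ^ ℓ
      term< zero         = m^n>0 2 ℓ
      term< (fld f j)    = ≤-<-trans (m≤m+n _ _) (sum< f f j)
      term< (plus f g j) = sum< f g j
      term-lens : ∀ t → length (⟦ termE i es t ⟧ xs as) ≤ ℓ
      term-lens t = ≤-trans (≤-reflexive (trans (cong length (term≡ t)) (Listₚ.length-map up (binary (termVal t us)))))
        (length-binary ℓ (term< t))
      go : ∀ φ → Decides (formulaE i es φ) xs as (True φ us)
      go (t ≤ᶠ t′) = decides-le i (termE i es t) (termE i es t′) (term≡ t) (term≡ t′) (term-lens t) (term-lens t′)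
      go (t <ᶠ t′) = mk⇔ (λ y → ≰⇒> (Equivalence.to negated y)) (λ lt → Equivalence.from negated (<⇒≱ lt))
        where
        negated : Decides (notE (leE i (termE i es t′) (termE i es t))) xs as (¬ (termVal t′ us ≤ termVal t us))
        negated = decides-not (leE i (termE i es t′) (termE i es t))
          (decides-le i (termE i es t′) (termE i es t) (term≡ t′) (term≡ t) (term-lens t′) (term-lens t))
      go (φ ∧ᶠ ψ)  = decides-and i (formulaE i es φ) (formulaE i es ψ) (go φ) (go ψ)
      go (φ ∨ᶠ ψ)  = decides-or i (formulaE i es φ) (formulaE i es ψ) (go φ) (go ψ)
      go falseᶠ    = mk⇔ (λ ()) (λ ())

  tileOf : Bool → Word γ → Tile
  tileOf p u = (get (hF p) u by get (wF p) u) at get (rF p) u , get (cF p) u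

  topT sideT : ∀ {v} → Bool → Fin v → Term v
  topT p  = plus (rF p) (hF p)
  sideT p = plus (cF p) (wF p)

  headerF : Formula 1
  headerF = (zero <ᶠ fld nF 0F) ∧ᶠ (zero <ᶠ fld cutF 0F) ∧ᶠ (fld cutF 0F <ᶠ fld mF 0F)

  -- A record with top and side 0 brings 0 into the coordinates at which the coverings are tested.
  -- The header can play this part, as a void tile at the origin.
  originF : Formula 1
  originF = (topT false 0F ≤ᶠ zero) ∧ᶠ (sideT false 0F ≤ᶠ zero) ∧ᶠ (topT true 0F ≤ᶠ zero) ∧ᶠ (sideT true 0F ≤ᶠ zero)

  insideF : Bool → Formula 2
  insideF p = (zero <ᶠ fld (hF p) 1F) ∧ᶠ (zero <ᶠ fld (wF p) 1F) ∧ᶠ (topT p 1F ≤ᶠ fld nF 0F) ∧ᶠ (sideT p 1F ≤ᶠ fld mF 0F)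

  _≡ᶠ_ : ∀ {v} → Term v → Term v → Formula v
  t ≡ᶠ t′ = (t ≤ᶠ t′) ∧ᶠ (t′ ≤ᶠ t)

  turnedF : Bool → Formula 2
  turnedF true  = (fld (hF true) 1F ≡ᶠ fld (wF false) 1F) ∧ᶠ (fld (wF true) 1F ≡ᶠ fld (hF false) 1F)
  turnedF false = falseᶠ

  tileF : Formula 2
  tileF = insideF false ∧ᶠ insideF true ∧ᶠ
    (((fld (hF true) 1F ≡ᶠ fld (hF false) 1F) ∧ᶠ (fld (wF true) 1F ≡ᶠ fld (wF false) 1F)) ∨ᶠ turnedF rotations) ∧ᶠ
    ((sideT true 1F ≤ᶠ fld cutF 0F) ∨ᶠ (fld cutF 0F ≤ᶠ fld (cF true) 1F))

  apartF : Bool → Formula 2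
  apartF p = (topT p 0F ≤ᶠ fld (rF p) 1F) ∨ᶠ (topT p 1F ≤ᶠ fld (rF p) 0F) ∨ᶠ
             (sideT p 0F ≤ᶠ fld (cF p) 1F) ∨ᶠ (sideT p 1F ≤ᶠ fld (cF p) 0F)

  beyondF : Bool → Formula 3
  beyondF p = (fld nF 0F ≤ᶠ topT p 1F) ∨ᶠ (fld mF 0F ≤ᶠ sideT p 2F)

  coversF : Bool → Formula 3
  coversF p = (fld (rF p) 2F ≤ᶠ topT p 0F) ∧ᶠ (topT p 0F <ᶠ topT p 2F) ∧ᶠ (fld (cF p) 2F ≤ᶠ sideT p 1F) ∧ᶠ (sideT p 1F <ᶠ sideT p 2F)

  digit : Letter → Letter
  digit (suc 0F) = 0F
  digit (suc 1F) = 1F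
  digit (suc _)  = 2F
  digit 0F       = 0F

  -- In the following the normal variables are the records of the tiles, the
  -- header, the certificate, the reverse of the input and the whole word,
  -- preceded by the rests of the words being looped over.

  tilesE : ∀ {n s} → Fin n → Exp (suc n) (2 + s)
  tilesE i = prepend (suc i) (fieldE (suc i) (index (hF false)) (svar 0F)) (cons end
    (prepend (suc i) (fieldE (suc i) (index (wF false)) (svar 0F)) (cons end
    (prepend (suc i) (fieldE (suc i) (index (rF false)) (svar 0F)) (cons end
    (prepend (suc i) (fieldE (suc i) (index (cF false)) (svar 0F)) (cons end (svar 1F))))))))

  opaque
    encodedE : Exp 5 0
    encodedE = loop 0F (nil ∷ nil ∷ []) (recordBody (tilesE 4F)) (svar 1F)

  -- Each record goes in front of the previous ones, so a certificate lists the tiles in the reverse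
  -- of the order in the input.
  encTilesOf : Word γ → List (Word γ × Word γ) → Word γ
  encTilesOf o []             = o
  encTilesOf o ((u , _) ∷ rs) = encTilesOf (encTile (tileOf false u) ++ o) rs

  coveredE : Bool → Exp 7 4
  coveredE p = orE 6F (formulaE 6F (nvar 3F ∷ svar 2F ∷ svar 0F ∷ []) (beyondF p))
    (anyE 2F (formulaE 7F (svar 4F ∷ svar 2F ∷ svar 0F ∷ []) (coversF p)))

  checkE : Exp 5 0
  checkE =
    andE 4F (formulaE 4F (nvar 1F ∷ []) headerF) (
    andE 4F (anyE 2F (formulaE 5F (svar 0F ∷ []) originF)) (
    andE 4F (allE 0F (formulaE 5F (nvar 2F ∷ svar 0F ∷ []) tileF)) (
    andE 4F (allE 0F (allE 0F (formulaE 6F (svar 2F ∷ svar 0F ∷ []) (apartF false ∧ᶠ apartF true)))) (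
    andE 4F (allE 2F (allE 3F (andE 6F (coveredE false) (coveredE true))))
      (eqE 4F digit encodedE (revOnto 4F (nvar 3F) nil))))))

  verifier : Exp 1 0
  verifier = letN (beforeE 0F hash) (letN (afterE 1F hash) (letN (beforeE 0F separator) (letN (afterE 1F separator) checkE)))

  -- `rs` stands for the records of the tiles, and `ps` for these and the header, which only
  -- supplies additional coordinates for testing the coverings.
  record Valid (x : Word γ) (hdr : Word γ) (rs ps : List (Word γ × Word γ)) : Set where
    field
      header  : True headerF (hdr ∷ [])
      origin  : Any (λ (u , _) → True originF (u ∷ [])) ps
      tile    : All (λ (u , _) → True tileF (hdr ∷ u ∷ [])) rs
      apart   : All (λ (u , w) → All (λ (v , _) → True (apartF false ∧ᶠ apartF true) (u ∷ v ∷ [])) (records [] w)) rs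
      covered : All (λ (u , _) → All (λ (v , _) →
        (True (beyondF false) (hdr ∷ u ∷ v ∷ []) ⊎ Any (λ (t , _) → True (coversF false) (u ∷ v ∷ t ∷ [])) rs) ×
        (True (beyondF true) (hdr ∷ u ∷ v ∷ []) ⊎ Any (λ (t , _) → True (coversF true) (u ∷ v ∷ t ∷ [])) rs)) ps) ps
      input   : encTilesOf [] rs ≡ map digit x

  module _ (rest hdr y xr z : Word γ) (rest≤ : length rest ≤ length y) (hdr≤ : length hdr ≤ length y)
    (y< : length y < length z) (xr< : length xr < length z) where

    env : Env 5
    env = rest ∷ hdr ∷ y ∷ xr ∷ z ∷ []

    rs ps : List (Word γ × Word γ)
    rs = records [] rest
    ps = records [] y

    rs< : ∀ {u w} → (u , w) ∈ rs → length u < length z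
    rs< m = ≤-<-trans (≤-trans (m≤m+n _ _) (<⇒≤ (<-≤-trans (records-bound [] rest m) rest≤))) y<

    ps< : ∀ {u w} → (u , w) ∈ ps → length u < length z
    ps< m = ≤-<-trans (≤-trans (m≤m+n _ _) (<⇒≤ (records-bound [] y m))) y<

    hdr< : length hdr < length z
    hdr< = ≤-<-trans hdr≤ y<

    1-lens : ∀ {u : Word γ} → length u < length z → (j : Fin 1) → length (Vec.lookup (u ∷ []) j) < length z
    1-lens lu 0F = lu

    2-lens : ∀ {u v : Word γ} → length u < length z → length v < length z → (j : Fin 2) → length (Vec.lookup (u ∷ v ∷ []) j) < length z
    2-lens lu lv 0F = lu
    2-lens lu lv 1F = lv

    3-lens : ∀ {u v w : Word γ} → length u < length z → length v < length z → length w < length z →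
      (j : Fin 3) → length (Vec.lookup (u ∷ v ∷ w ∷ []) j) < length z
    3-lens lu lv lw 0F = lu
    3-lens lu lv lw 1F = lv
    3-lens lu lv lw 2F = lw

    opaque
      unfolding encodedE

      ⟦encodedE⟧ : ⟦ encodedE ⟧ env [] ≡ encTilesOf [] rs
      ⟦encodedE⟧ = scan rest [] [] rs<
        where
        scan : ∀ y u o → (∀ {u′ w} → (u′ , w) ∈ records u y → length u′ < length z) →
          Vec.lookup (⟦loop⟧ {s = 0} (recordBody (tilesE 4F)) env [] y (u ∷ o ∷ []) Vec.++ []) 1F ≡ encTilesOf o (records u y)
        scan []      u o lens = refl
        scan (c ∷ y) u o lens with c Finₚ.≟ separator
        ... | no _  = scan y (c ∷ u) o lens
        ... | yes _ = trans (cong (λ o → Vec.lookup (⟦loop⟧ {s = 0} (recordBody (tilesE 4F)) env [] y ([] ∷ o ∷ []) Vec.++ []) 1F) encoded)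
          (scan y [] (encTile (tileOf false u) ++ o) (lens ∘ there))
          where
          env′ : Env 6
          env′ = y ∷ env
          as′ : Env 2
          as′ = u ∷ o ∷ []
          u≤ : length u ≤ length z
          u≤ = <⇒≤ (lens (here refl))
          push-field : ∀ f e → ⟦ prepend 5F (fieldE 5F (index f) (svar 0F)) (cons end e) ⟧ env′ as′ ≡ num (get f u) ++ end ∷ ⟦ e ⟧ env′ as′
          push-field f e = trans (⟦prepend⟧ 5F (fieldE 5F (index f) (svar 0F)) (cons end e) env′ as′ (≤-trans (≤-reflexive
              (trans (cong length (⟦fieldE⟧ 5F (index f) (svar 0F) env′ as′ u≤)) (Listₚ.length-map up (binary (get f u)))))
              (length-binary _ (≤-trans (fieldOf-bound (index f) u) (ℕₚ.^-monoʳ-≤ 2 u≤)))))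
            (cong (_++ end ∷ ⟦ e ⟧ env′ as′) (⟦fieldE⟧ 5F (index f) (svar 0F) env′ as′ u≤))
          assoc : ∀ a b c d r → ((a ++ end ∷ []) ++ (b ++ end ∷ []) ++ (c ++ end ∷ []) ++ (d ++ end ∷ [])) ++ r ≡
            a ++ end ∷ b ++ end ∷ c ++ end ∷ d ++ end ∷ r
          assoc a b c d r = trans (Listₚ.++-assoc (a ++ end ∷ []) _ r) (trans (Listₚ.++-assoc a _ _) (cong (λ z → a ++ end ∷ z)
            (trans (Listₚ.++-assoc (b ++ end ∷ []) _ r) (trans (Listₚ.++-assoc b _ _) (cong (λ z → b ++ end ∷ z)
            (trans (Listₚ.++-assoc (c ++ end ∷ []) _ r) (trans (Listₚ.++-assoc c _ _) (cong (λ z → c ++ end ∷ z)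
            (Listₚ.++-assoc d _ r)))))))))
          encoded : ⟦ tilesE 4F ⟧ env′ as′ ≡ encTile (tileOf false u) ++ o
          encoded = trans (push-field (hF false) _) (trans (cong (λ e → num (get (hF false) u) ++ end ∷ e)
            (trans (push-field (wF false) _) (cong (λ e → num (get (wF false) u) ++ end ∷ e)
            (trans (push-field (rF false) _) (cong (λ e → num (get (rF false) u) ++ end ∷ e) (push-field (cF false) (svar 1F)))))))
            (sym (assoc (num (get (hF false) u)) (num (get (wF false) u)) (num (get (rF false) u)) (num (get (cF false) u)) o)))

    decides-covered : ∀ p {u w u′ w′ v v′} → (u , w) ∈ ps → (u′ , w′) ∈ ps →
      Decides (coveredE p) (w′ ∷ w ∷ env) (u′ ∷ v′ ∷ u ∷ v ∷ [])
        (True (beyondF p) (hdr ∷ u ∷ u′ ∷ []) ⊎ Any (λ (t , _) → True (coversF p) (u ∷ u′ ∷ t ∷ [])) rs)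
    decides-covered p {u} {w} {u′} {w′} m m′ = decides-or 6F _ _
      (decides-formula 6F (nvar 3F ∷ svar 2F ∷ svar 0F ∷ []) (hdr ∷ u ∷ u′ ∷ []) (λ { 0F → refl ; 1F → refl ; 2F → refl })
        (3-lens hdr< (ps< m) (ps< m′)) (beyondF p))
      (decides-any 2F _ λ {t} m″ _ → decides-formula 7F (svar 4F ∷ svar 2F ∷ svar 0F ∷ []) (u ∷ u′ ∷ t ∷ [])
        (λ { 0F → refl ; 1F → refl ; 2F → refl }) (3-lens (ps< m) (ps< m′) (rs< m″)) (coversF p))

    decides-check : Decides checkE env [] (Valid (reverse xr) hdr rs ps)
    decides-check = mk⇔
      (λ y → let (a , b , c , d , e , f) = Equivalence.to iff y in
        record { header = a ; origin = b ; tile = c ; apart = d ; covered = e ; input = f })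
      (λ v → let open Valid v in Equivalence.from iff (header , origin , tile , apart , covered , input))
      where
      x≡ : ⟦ revOnto 4F (nvar 3F) nil ⟧ env [] ≡ reverse xr
      x≡ = ⟦revOnto⟧ 4F (nvar 3F) nil env [] (<⇒≤ xr<)
      iff = decides-and 4F _ _ (decides-formula 4F (nvar 1F ∷ []) (hdr ∷ []) (λ { 0F → refl }) (1-lens hdr<) headerF)
        (decides-and 4F _ _ (decides-any 2F _ λ {u} m _ → decides-formula 5F (svar 0F ∷ []) (u ∷ []) (λ { 0F → refl }) (1-lens (ps< m)) originF)
        (decides-and 4F _ _ (decides-all 0F _ λ {u} m _ → decides-formula 5F (nvar 2F ∷ svar 0F ∷ []) (hdr ∷ u ∷ [])
          (λ { 0F → refl ; 1F → refl }) (2-lens hdr< (rs< m)) tileF)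
        (decides-and 4F _ _ (decides-all 0F _ λ {u} {w} m _ → decides-all 0F _ λ {v} m′ _ →
          decides-formula 6F (svar 2F ∷ svar 0F ∷ []) (u ∷ v ∷ []) (λ { 0F → refl ; 1F → refl })
            (2-lens (rs< m) (≤-<-trans (≤-trans (m≤m+n _ _) (≤-trans (<⇒≤ (records-bound [] w m′)) (≤-trans (m≤n+m _ (length u))
              (<⇒≤ (<-≤-trans (records-bound [] rest m) rest≤))))) y<)) (apartF false ∧ᶠ apartF true))
        (decides-and 4F _ _ (decides-all 2F _ λ {u} m _ → decides-all 3F _ λ {v} m′ _ →
          decides-and 6F (coveredE false) (coveredE true) (decides-covered false m m′) (decides-covered true m m′))
        (subst₂ (λ a b → Decides (eqE 4F digit encodedE (revOnto 4F (nvar 3F) nil)) env [] (a ≡ map digit b)) ⟦encodedE⟧ x≡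
          (decides-eq 4F digit encodedE (revOnto 4F (nvar 3F) nil) 
            (≤-<-trans (≤-reflexive (trans (cong length x≡) (Listₚ.length-reverse xr))) xr<)))))))

  decides-verifier : ∀ x y → All (_≢ hash) x →
    Decides verifier ((x ++ hash ∷ y) ∷ []) [] (Valid x (reverse (before separator y)) (records [] (after separator y)) (records [] y))
  decides-verifier x y noHash = subst₂ (λ w A → Yes w ⇔ A) (sym verifier≡) (cong (λ x → Valid x _ _ _) (Listₚ.reverse-involutive x))
    (decides-check (after separator y) (reverse (before separator y)) y (reverse x) z
      (after-≤ y) (≤-trans (≤-reflexive (Listₚ.length-reverse (before separator y))) (before-≤ y))
      (≤-trans (m≤n+m (suc (length y)) (length x)) (≤-reflexive (sym (Listₚ.length-++ x))))
      (≤-trans (s≤s (≤-trans (≤-reflexive (Listₚ.length-reverse x)) (m≤m+n (length x) (length y))))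
        (≤-trans (≤-reflexive (sym (+-suc (length x) (length y)))) (≤-reflexive (sym (Listₚ.length-++ x))))))
    where
    z : Word γ
    z = x ++ hash ∷ y
    after-≤ : ∀ w → length (after separator w) ≤ length w
    after-≤ []      = z≤n
    after-≤ (c ∷ w) with c Finₚ.≟ separator
    ... | yes _ = n≤1+n _
    ... | no _  = ≤-trans (after-≤ w) (n≤1+n _)
    before-≤ : ∀ w → length (before separator w) ≤ length w
    before-≤ []      = z≤n
    before-≤ (c ∷ w) with c Finₚ.≟ separator
    ... | yes _ = z≤n
    ... | no _  = s≤s (before-≤ w)
    letN≡ : ∀ {n} (e : Exp n 0) (e′ : Exp (suc n) 0) xs {v u} → ⟦ e ⟧ xs [] ≡ v → ⟦ e′ ⟧ (v ∷ xs) [] ≡ u → ⟦ letN e e′ ⟧ xs [] ≡ u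
    letN≡ e e′ xs refl eq = eq
    verifier≡ : ⟦ verifier ⟧ (z ∷ []) [] ≡ ⟦ checkE ⟧ (env (after separator y) (reverse (before separator y)) y (reverse x) z
      (after-≤ y) (≤-trans (≤-reflexive (Listₚ.length-reverse (before separator y))) (before-≤ y))
      (≤-trans (m≤n+m (suc (length y)) (length x)) (≤-reflexive (sym (Listₚ.length-++ x))))
      (≤-trans (s≤s (≤-trans (≤-reflexive (Listₚ.length-reverse x)) (m≤m+n (length x) (length y))))
        (≤-trans (≤-reflexive (sym (+-suc (length x) (length y)))) (≤-reflexive (sym (Listₚ.length-++ x)))))) []
    verifier≡ = letN≡ (beforeE 0F hash) (letN (afterE 1F hash) (letN (beforeE 0F separator) (letN (afterE 1F separator) checkE))) (z ∷ []) (trans (⟦beforeE⟧ 0F hash (z ∷ []) []) (cong reverse (before-++ hash noHash)))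
      (letN≡ (afterE 1F hash) (letN (beforeE 0F separator) (letN (afterE 1F separator) checkE)) (reverse x ∷ z ∷ []) (trans (⟦afterE⟧ 1F hash (reverse x ∷ z ∷ []) []) (after-++ hash noHash))
      (letN≡ (beforeE 0F separator) (letN (afterE 1F separator) checkE) (y ∷ reverse x ∷ z ∷ []) (⟦beforeE⟧ 0F separator (y ∷ reverse x ∷ z ∷ []) [])
      (letN≡ (afterE 1F separator) checkE (reverse (before separator y) ∷ y ∷ reverse x ∷ z ∷ [])
        (⟦afterE⟧ 1F separator (reverse (before separator y) ∷ y ∷ reverse x ∷ z ∷ []) []) refl)))

-- Certificates for subtilings

Copy : Bool → Shape → Shape → Set
Copy false = _≡_
Copy true  = RotatedCopy

Admits : Bool → ℕ → ℕ → List Tile → Set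
Admits false = AdmitsSubtiling
Admits true  = AdmitsSubtilingWithRotations

topOf sideOf : Tile → ℕ
topOf t  = Tile.row t + Tile.height t
sideOf t = Tile.col t + Tile.width t

Apart : Tile → Tile → Set
Apart s t = topOf s ≤ Tile.row t ⊎ topOf t ≤ Tile.row s ⊎ sideOf s ≤ Tile.col t ⊎ sideOf t ≤ Tile.col s

apart⇒disjoint : ∀ {s t} → Apart s t → Disjoint s t
apart⇒disjoint (inj₁ le)               = disjoint-rows le
apart⇒disjoint (inj₂ (inj₁ le))        = disjoint-sym (disjoint-rows le)
apart⇒disjoint (inj₂ (inj₂ (inj₁ le))) = disjoint-cols le
apart⇒disjoint (inj₂ (inj₂ (inj₂ le))) = disjoint-sym (disjoint-cols le)

disjoint⇒apart : ∀ {n m s t} → InRectangle n m s → InRectangle n m t → Disjoint s t → Apart s t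
disjoint⇒apart {s = s} {t} is it d with topOf s ≤? Tile.row t | topOf t ≤? Tile.row s | sideOf s ≤? Tile.col t | sideOf t ≤? Tile.col s
... | yes le | _      | _      | _      = inj₁ le
... | no _   | yes le | _      | _      = inj₂ (inj₁ le)
... | no _   | no _   | yes le | _      = inj₂ (inj₂ (inj₁ le))
... | no _   | no _   | no _   | yes le = inj₂ (inj₂ (inj₂ le))
-- The bottom-left cell of the intersection.
... | no a   | no b   | no c   | no e   = ⊥-elim (d (Tile.row s ⊔ Tile.row t) (Tile.col s ⊔ Tile.col t)
  ( ((m≤m⊔n _ _ , ⊔-lub (m<m+n (Tile.row s) (InRectangle.height>0 is)) (≰⇒> a)) ,
     (m≤m⊔n _ _ , ⊔-lub (m<m+n (Tile.col s) (InRectangle.width>0 is)) (≰⇒> c)))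
  , ((m≤n⊔m (Tile.row s) _ , ⊔-lub (≰⇒> b) (m<m+n (Tile.row t) (InRectangle.height>0 it))) ,
     (m≤n⊔m (Tile.col s) _ , ⊔-lub (≰⇒> e) (m<m+n (Tile.col t) (InRectangle.width>0 it))))))

greatest : ∀ {A : Set} (f : A → ℕ) r xs → Any (λ x → f x ≤ r) xs →
  ∃[ x ] x ∈ xs × f x ≤ r × (∀ {y} → y ∈ xs → f y ≤ r → f y ≤ f x)
greatest f r (x ∷ xs) any with Any.any? (λ y → f y ≤? r) xs
greatest f r (x ∷ xs) (here le)   | no none = x , here refl , le , λ where
  (here refl) _   → ≤-refl
  (there m)   le′ → contradiction (lose m le′) none
greatest f r (x ∷ xs) (there any) | no none = contradiction any none
... | yes any′ with greatest f r xs any′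
...   | z , m , le , max with f x ≤? f z | f x ≤? r
...     | yes x≤z | _       = z , there m , le , λ { (here refl) _ → x≤z ; (there m′) → max m′ }
...     | no x≰z  | yes x≤r = x , here refl , x≤r , λ where
  (here refl) _   → ≤-refl
  (there m′)  le′ → ≤-trans (max m′ le′) (<⇒≤ (≰⇒> x≰z))
...     | no _    | no x≰r  = z , there m , le , λ { (here refl) le′ → contradiction le′ x≰r ; (there m′) → max m′ }

-- A cell is covered by the tile covering the cell whose row is the greatest
-- top, and whose column is the greatest side, not beyond the given cell: a
-- tile ending in between would have a greater top or side. So polynomially
-- many cells suffice to check a covering.

corner-covering : ∀ {n m qs ts} → (∀ {t} → t ∈ ts → t ∈ qs) → Any (λ q → topOf q ≤ 0 × sideOf q ≤ 0) qs →
  (∀ {q q′} → q ∈ qs → q′ ∈ qs → n ≤ topOf q ⊎ m ≤ sideOf q′ ⊎ Any (Covers (topOf q) (sideOf q′)) ts) →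
  ∀ r c → r < n → c < m → Any (Covers r c) ts
corner-covering {n} {m} {qs} {ts} ts⊆qs origin corners r c r<n c<m
  with greatest topOf r qs (Any.map (λ (z , _) → ≤-trans z z≤n) origin) | greatest sideOf c qs (Any.map (λ (_ , z) → ≤-trans z z≤n) origin)
... | q , mq , le , max | q′ , mq′ , le′ , max′ = conclude (corners mq mq′)
  where
  conclude : n ≤ topOf q ⊎ m ≤ sideOf q′ ⊎ Any (Covers (topOf q) (sideOf q′)) ts → Any (Covers r c) ts
  conclude (inj₁ n≤)         = contradiction (≤-trans n≤ le) (<⇒≱ r<n)
  conclude (inj₂ (inj₁ m≤))  = contradiction (≤-trans m≤ le′) (<⇒≱ c<m)
  conclude (inj₂ (inj₂ any)) = let (t , mt , (r₁ , r₂) , (c₁ , c₂)) = find any in lose mt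
    ( (≤-trans r₁ le , ≰⇒> (λ t≤r → <⇒≱ r₂ (max (ts⊆qs mt) t≤r)))
    , (≤-trans c₁ le′ , ≰⇒> (λ t≤c → <⇒≱ c₂ (max′ (ts⊆qs mt) t≤c))))

allPairs-↭ : ∀ {A : Set} {R : A → A → Set} → (∀ {x y} → R x y → R y x) → ∀ {xs ys} → xs ↭ ys → AllPairs R xs → AllPairs R ys
allPairs-↭ sy Perm.refl         rs                     = rs
allPairs-↭ sy (Perm.prep x p)   (r ∷ rs)               = Permₚ.All-resp-↭ p r ∷ allPairs-↭ sy p rs
allPairs-↭ sy (Perm.swap x y p) ((r ∷ rx) ∷ ry ∷ rs)   = (sy r ∷ Permₚ.All-resp-↭ p ry) ∷ Permₚ.All-resp-↭ p rx ∷ allPairs-↭ sy p rs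
allPairs-↭ sy (Perm.trans p q)  rs                     = allPairs-↭ sy q (allPairs-↭ sy p rs)

tiling-↭ : ∀ {n m ts ss} → ts ↭ ss → IsTiling n m ts → IsTiling n m ss
tiling-↭ p tiling = record
  { inside   = Permₚ.All-resp-↭ p inside
  ; covering = λ r c r<n c<m → Permₚ.Any-resp-↭ p (covering r c r<n c<m)
  ; disjoint = allPairs-↭ disjoint-sym p disjoint
  }
  where open IsTiling tiling

Beside : ℕ → Tile → Set
Beside cut t = sideOf t ≤ cut ⊎ cut ≤ Tile.col t

split-by : ∀ {A : Set} {P Q : A → Set} {xs} → All (λ x → P x ⊎ Q x) xs → ∃[ ls ] ∃[ rs ] Split ls rs xs × All P ls × All Q rs
split-by []            = [] , [] , [] , [] , []
split-by (inj₁ p ∷ as) = let (_ , _ , s , l , r) = split-by as in _ , _ , inˡ s , p ∷ l , r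
split-by (inj₂ q ∷ as) = let (_ , _ , s , l , r) = split-by as in _ , _ , inʳ s , l , q ∷ r

module _ {A : Set} where

  split-All : ∀ {P : A → Set} {ls rs xs} → Split ls rs xs → All P xs → All P ls × All P rs
  split-All []      []       = [] , []
  split-All (inˡ s) (p ∷ ps) = let (l , r) = split-All s ps in p ∷ l , r
  split-All (inʳ s) (p ∷ ps) = let (l , r) = split-All s ps in l , p ∷ r

  split-AllPairs : ∀ {R : A → A → Set} {ls rs xs} → Split ls rs xs → AllPairs R xs → AllPairs R ls × AllPairs R rs
  split-AllPairs []      []       = [] , []
  split-AllPairs (inˡ s) (p ∷ ps) = let (l , r) = split-AllPairs s ps in proj₁ (split-All s p) ∷ l , r
  split-AllPairs (inʳ s) (p ∷ ps) = let (l , r) = split-AllPairs s ps in l , proj₂ (split-All s p) ∷ r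

  split-Any : ∀ {P : A → Set} {ls rs xs} → Split ls rs xs → Any P xs → Any P ls ⊎ Any P rs
  split-Any (inˡ s) (here p)    = inj₁ (here p)
  split-Any (inˡ s) (there any) = [ (λ l → inj₁ (there l)) , inj₂ ]′ (split-Any s any)
  split-Any (inʳ s) (here p)    = inj₂ (here p)
  split-Any (inʳ s) (there any) = [ inj₁ , (λ r → inj₂ (there r)) ]′ (split-Any s any)

  split⇒↭ : ∀ {ls rs xs : List A} → Split ls rs xs → xs ↭ ls ++ rs
  split⇒↭ []                     = Perm.refl
  split⇒↭ (inˡ s)                = Perm.prep _ (split⇒↭ s)
  split⇒↭ (inʳ {y} {ls} {rs} s) = Perm.trans (Perm.prep y (split⇒↭ s)) (Perm.↭-sym (Permₚ.shift y ls rs))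

shiftLeft : ℕ → Tile → Tile
shiftLeft d (s at r , c) = s at r , (c ∸ d)

-- A cell on one side of the line can only be covered by a tile of that side; hence the tiles of
-- either side cover it by themselves.
cut⇒juxtaposition : ∀ {n m cut ss} → 0 < cut → cut < m → IsTiling n m ss → All (Beside cut) ss → IsJuxtaposition n m ss
cut⇒juxtaposition {n} {m} {cut} {ss} cut>0 cut<m tiling beside with split-by beside | m≤n⇒∃[o]m+o≡n cut<m
... | ls , rs , s , ls≤ , rs≥ | o , refl = cut , suc o , sym (+-suc cut o) , cut>0 , s≤s z≤n , ls , map (shiftLeft cut) rs , leftTiling , rightTiling ,
  Perm.trans (split⇒↭ s) (Perm.↭-reflexive (cong (ls ++_) (sym (unshift rs≥))))
  where
  open IsTiling tiling
  unshift : ∀ {rs} → All (λ t → cut ≤ Tile.col t) rs → map (shiftRight cut) (map (shiftLeft cut) rs) ≡ rs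
  unshift []                         = refl
  unshift {(sh at r , _) ∷ _} (le ∷ les) = cong₂ _∷_ (cong (λ z → sh at r , z) (m+[n∸m]≡n le)) (unshift les)
  leftTiling : IsTiling n cut ls
  leftTiling = record
    { inside   = All.zipWith (λ (i , le) → record { InRectangle i ; side = le }) (proj₁ (split-All s inside) , ls≤)
    ; covering = λ r c r<n c<cut → [ id , (λ (any : Any (Covers r c) rs) → let (t , mt , _ , (le , _)) = find any in
        contradiction (≤-trans (All.lookup rs≥ mt) le) (<⇒≱ c<cut)) ]′ (split-Any s (covering r c r<n (<-trans c<cut cut<m)))
    ; disjoint = proj₁ (split-AllPairs s disjoint)
    }
  shifted : ∀ {t} → cut ≤ Tile.col t → Tile.col t ∸ cut + Tile.width t ≡ sideOf t ∸ cut
  shifted {t} le = sym (ℕₚ.+-∸-comm (Tile.width t) le)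
  covers-shifted : ∀ {r c t} → cut ≤ Tile.col t → Covers r (cut + c) t → Covers r c (shiftLeft cut t)
  covers-shifted {r} {c} {t} le (rows , (c₁ , c₂)) = rows ,
    (+-cancelˡ-≤ cut _ _ (≤-trans (≤-reflexive (m+[n∸m]≡n le)) c₁) ,
     +-cancelˡ-< cut _ _ (<-≤-trans c₂ (≤-reflexive (trans (cong (_+ Tile.width t) (sym (m+[n∸m]≡n le))) (+-assoc cut _ _)))))
  disjoint-shifted : ∀ {t t′} → cut ≤ Tile.col t → cut ≤ Tile.col t′ → Disjoint t t′ → Disjoint (shiftLeft cut t) (shiftLeft cut t′)
  disjoint-shifted {t} {t′} le le′ d r c (cov , cov′) = d r (cut + c) (back le cov , back le′ cov′)
    where
    back : ∀ {t} → cut ≤ Tile.col t → Covers r c (shiftLeft cut t) → Covers r (cut + c) t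
    back {t} le cov = subst (λ z → Covers r (cut + c) (Tile.shape t at Tile.row t , z)) (m+[n∸m]≡n le)
      (covers-shift {m = cut} {t = shiftLeft cut t} cov)
  rightTiling : IsTiling n (suc o) (map (shiftLeft cut) rs)
  rightTiling = record
    { inside   = Allₚ.map⁺ (All.zipWith (λ {t} (i , le) → record { InRectangle i ; side = ≤-trans (≤-reflexive (shifted {t} le))
        (≤-trans (ℕₚ.∸-monoˡ-≤ cut (InRectangle.side i)) (≤-reflexive (trans (cong (_∸ cut) (sym (+-suc cut o))) (ℕₚ.m+n∸m≡n cut (suc o))))) })
        (proj₂ (split-All s inside) , rs≥))
    ; covering = λ r c r<n c<o → [ (λ (any : Any (Covers r (cut + c)) ls) → let (t , mt , _ , (_ , lt)) = find any in
          contradiction (≤-trans (All.lookup ls≤ mt) (m≤m+n cut c)) (<⇒≱ lt))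
        , (λ (any : Any (Covers r (cut + c)) rs) → let (t , mt , cov) = find any in Anyₚ.map⁺ (lose mt (covers-shifted {t = t} (All.lookup rs≥ mt) cov))) ]′
        (split-Any s (covering r (cut + c) r<n (<-≤-trans (+-monoʳ-< cut c<o) (≤-reflexive (+-suc cut o)))))
    ; disjoint = AllPairsₚ.map⁺ (shiftPairs rs≥ (proj₂ (split-AllPairs s disjoint)))
    }
    where
    shiftPairs : ∀ {ts} → All (λ t → cut ≤ Tile.col t) ts → AllPairs Disjoint ts →
      AllPairs (λ t t′ → Disjoint (shiftLeft cut t) (shiftLeft cut t′)) ts
    shiftPairs []         []       = []
    shiftPairs (le ∷ les) (d ∷ ds) = All.zipWith (λ {t} (le′ , d) → disjoint-shifted le le′ d) (les , d) ∷ shiftPairs les ds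

juxtaposition⇒cut : ∀ {n m ss} → IsJuxtaposition n m ss → ∃[ cut ] 0 < cut × cut < m × All (Beside cut) ss
juxtaposition⇒cut (m′ , m″ , refl , m′>0 , m″>0 , as , bs , ta , tb , p) = m′ , m′>0 , m<m+n m′ m″>0 ,
  Permₚ.All-resp-↭ (Perm.↭-sym p) (Allₚ.++⁺ (All.map (λ i → inj₁ (InRectangle.side i)) (IsTiling.inside ta))
    (Allₚ.map⁺ (All.universal (λ t → inj₂ (m≤m+n m′ (Tile.col t))) bs)))

-- Listing every tile together with its new place presents the rearrangement as a bijection, which
-- leaves no permutation to be verified.
record Certified (rotations : Bool) (n m cut : ℕ) (zs : List (Tile × Tile)) : Set where
  field
    n>0        : 0 < n
    cut>0      : 0 < cut
    cut<m      : cut < m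
    given      : IsTiling n m (map proj₁ zs)
    rearranged : IsTiling n m (map proj₂ zs)
    copied     : All (λ (t , s) → Copy rotations (Tile.shape t) (Tile.shape s)) zs
    beside     : All (λ (_ , s) → Beside cut s) zs

certified-↭ : ∀ {rotations n m cut zs zs′} → zs ↭ zs′ → Certified rotations n m cut zs → Certified rotations n m cut zs′
certified-↭ p cert = record
  { Certified cert
  ; given      = tiling-↭ (Permₚ.map⁺ proj₁ p) given
  ; rearranged = tiling-↭ (Permₚ.map⁺ proj₂ p) rearranged
  ; copied     = Permₚ.All-resp-↭ p copied
  ; beside     = Permₚ.All-resp-↭ p beside
  }
  where open Certified cert

certified⇒admits : ∀ rotations {n m cut zs} → Certified rotations n m cut zs → Admits rotations n m (map proj₁ zs)
certified⇒admits rotations {n} {m} {cut} {zs} cert = admits rotations copied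
  where
  open Certified cert
  juxtaposed : IsJuxtaposition n m (map proj₂ zs)
  juxtaposed = cut⇒juxtaposition cut>0 cut<m rearranged (Allₚ.map⁺ beside)
  equal : ∀ {zs} → All (λ (t , s) → Tile.shape t ≡ Tile.shape s) zs → shapes (map proj₂ zs) ≡ shapes (map proj₁ zs)
  equal []         = refl
  equal (eq ∷ eqs) = cong₂ _∷_ (sym eq) (equal eqs)
  pointwise : ∀ {zs} → All (λ (t , s) → RotatedCopy (Tile.shape t) (Tile.shape s)) zs →
    Pointwise RotatedCopy (shapes (map proj₁ zs)) (shapes (map proj₂ zs))
  pointwise []       = []
  pointwise (r ∷ rs) = r ∷ pointwise rs
  admits : ∀ rotations → All (λ (t , s) → Copy rotations (Tile.shape t) (Tile.shape s)) zs → Admits rotations n m (map proj₁ zs)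
  admits false eqs = map proj₂ zs , (rearranged , Perm.↭-reflexive (equal eqs)) , juxtaposed
  admits true  rs  = map proj₂ zs , (rearranged , shapes (map proj₂ zs) , pointwise rs , Perm.refl) , juxtaposed

admits⇒certified : ∀ rotations {n m ts} → 0 < n → IsTiling n m ts → Admits rotations n m ts →
  ∃[ cut ] ∃[ zs ] map proj₁ zs ≡ ts × Certified rotations n m cut zs
admits⇒certified rotations {n} {m} {ts} n>0 tiling adm =
  let (ss , T′ , rearranged , pw , p , jux) = unify rotations adm
      -- The permutation of shapes lifts to one of placed tiles, which brings the rearrangement into
      -- the order of `ts`.
      (ss′ , eq , q) = Permₚ.↭-map-inv Tile.shape p
      (cut , cut>0 , cut<m , beside) = juxtaposition⇒cut jux
      (zs , eq₁ , eq₂ , copied) = pairing ts ss′ (subst (Pointwise (Copy rotations) (shapes ts)) eq pw)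
  in cut , zs , eq₁ , record
    { n>0 = n>0 ; cut>0 = cut>0 ; cut<m = cut<m
    ; given      = subst (IsTiling n m) (sym eq₁) tiling
    ; rearranged = subst (IsTiling n m) (sym eq₂) (tiling-↭ q rearranged)
    ; copied     = copied
    ; beside     = Allₚ.map⁻ (subst (All (Beside cut)) (sym eq₂) (Permₚ.All-resp-↭ q beside))
    }
  where
  unify : ∀ rotations → Admits rotations n m ts → ∃[ ss ] ∃[ T′ ] IsTiling n m ss ×
    Pointwise (Copy rotations) (shapes ts) T′ × shapes ss ↭ T′ × IsJuxtaposition n m ss
  unify false (ss , (tiling , p) , jux)           = ss , shapes ts , tiling , equal (shapes ts) , p , jux
    where
    equal : ∀ (T : List Shape) → Pointwise _≡_ T T
    equal []      = []
    equal (_ ∷ T) = refl ∷ equal T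
  unify true  (ss , (tiling , T′ , pw , p) , jux) = ss , T′ , tiling , pw , p , jux
  pairing : ∀ ts ss → Pointwise (Copy rotations) (shapes ts) (shapes ss) →
    ∃[ zs ] map proj₁ zs ≡ ts × map proj₂ zs ≡ ss × All (λ (t , s) → Copy rotations (Tile.shape t) (Tile.shape s)) zs
  pairing []       []       []       = [] , refl , refl , []
  pairing (t ∷ ts) (s ∷ ss) (r ∷ rs) = let (zs , eq₁ , eq₂ , as) = pairing ts ss rs in
    (t , s) ∷ zs , cong (t ∷_) eq₁ , cong (s ∷_) eq₂ , r ∷ as

∈-concatMap-length : ∀ {A B : Set} (f : A → List B) {x xs} → x ∈ xs → length (f x) ≤ length (concatMap f xs)
∈-concatMap-length f {xs = x ∷ xs} (here refl) = ≤-trans (m≤m+n _ _) (≤-reflexive (sym (Listₚ.length-++ (f x))))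
∈-concatMap-length f {xs = x ∷ xs} (there m)   =
  ≤-trans (∈-concatMap-length f m) (≤-trans (m≤n+m _ _) (≤-reflexive (sym (Listₚ.length-++ (f x)))))

length-concatMap : ∀ {A B : Set} (f : A → List B) → (∀ x → 0 < length (f x)) → ∀ xs → length xs ≤ length (concatMap f xs)
length-concatMap f pos []       = z≤n
length-concatMap f pos (x ∷ xs) = ≤-trans (+-mono-≤ (pos x) (length-concatMap f pos xs)) (≤-reflexive (sym (Listₚ.length-++ (f x))))

number-bound : ∀ n {ns} → n ∈ ns → n < 2 ^ length (concatMap encodeNumber ns)
number-bound n {ns} m = subst (_< 2 ^ length (concatMap encodeNumber ns)) (val-binary n) (<-≤-trans (val-bound (binary n)) (ℕₚ.^-monoʳ-≤ 2
  (≤-trans (≤-trans (≤-trans (≤-reflexive (sym (Listₚ.length-map inject₁ (binary n)))) (m≤m+n _ _))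
    (≤-reflexive (sym (Listₚ.length-++ (map inject₁ (binary n)))))) (∈-concatMap-length encodeNumber m))))

-- The tile at the top right corner shows each dimension to be at most a sum of two encoded numbers.
-- All numbers of a certificate therefore fit into one bit more than the length of the input.
tiling-bound : ∀ {n m ts} → 0 < n → 0 < m → IsTiling n m ts → n < 2 ^ suc (length (encode ts)) × m < 2 ^ suc (length (encode ts))
tiling-bound {suc n} {suc m} {ts} _ _ tiling =
  let (t , mt , (_ , r) , (_ , c)) = find (IsTiling.covering tiling n m ≤-refl ≤-refl) in
  sum< mt r (there (there (here refl))) (here refl) , sum< mt c (there (there (there (here refl)))) (there (here refl))
  where
  sum< : ∀ {x t u v} → t ∈ ts → x ≤ u + v → u ∈ Tile.height t ∷ Tile.width t ∷ Tile.row t ∷ Tile.col t ∷ [] →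
    v ∈ Tile.height t ∷ Tile.width t ∷ Tile.row t ∷ Tile.col t ∷ [] → x < 2 ^ suc (length (encode ts))
  sum< {t = t} mt le mu mv = ≤-<-trans le (<-≤-trans (+-mono-< (bound mu) (bound mv)) (≤-reflexive (cong (2 ^ length (encode ts) +_) (sym (+-identityʳ _)))))
    where
    bound : ∀ {u} → u ∈ Tile.height t ∷ Tile.width t ∷ Tile.row t ∷ Tile.col t ∷ [] → u < 2 ^ length (encode ts)
    bound {u} mu = <-≤-trans (number-bound u mu) (ℕₚ.^-monoʳ-≤ 2 (∈-concatMap-length encodeTile mt))

rotated-copy : ∀ {s s′} → RotatedCopy s s′ → s ≡ s′ ⊎ (Shape.height s′ ≡ Shape.width s × Shape.width s′ ≡ Shape.height s)
rotated-copy unturned = inj₁ refl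
rotated-copy turned   = inj₂ (refl , refl)

allPairs-apart : ∀ {n m ts} → All (InRectangle n m) ts → AllPairs Disjoint ts → AllPairs Apart ts
allPairs-apart []       []       = []
allPairs-apart (i ∷ is) (d ∷ ds) = All.zipWith (λ (i′ , d) → disjoint⇒apart i i′ d) (is , d) ∷ allPairs-apart is ds

-- Membership in NP

module Membership (rotations : Bool) (k : ℕ) (index : Field → Fin k) (fieldAt : Fin k → Field)
  (fieldAt-index : ∀ f → fieldAt (index f) ≡ f) where

  open Checking rotations k index hiding (env; rs; ps)

  tiles : Word γ × Word γ → Tile × Tile
  tiles (u , _) = tileOf false u , tileOf true u

  copy-true : ∀ p {hdr u} →
    True (((fld (hF true) 1F ≡ᶠ fld (hF false) 1F) ∧ᶠ (fld (wF true) 1F ≡ᶠ fld (wF false) 1F)) ∨ᶠ turnedF p) (hdr ∷ u ∷ []) ⇔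
    Copy p (Tile.shape (tileOf false u)) (Tile.shape (tileOf true u))
  copy-true p {hdr} {u} = mk⇔ (to p) (from p)
    where
    same : ∀ p {h w h′ w′} → h ≡ h′ → w ≡ w′ → Copy p (h by w) (h′ by w′)
    same false refl refl = refl
    same true  refl refl = unturned
    turn : ∀ {h w h′ w′} → h′ ≡ w → w′ ≡ h → RotatedCopy (h by w) (h′ by w′)
    turn refl refl = turned
    to : ∀ p → True (((fld (hF true) 1F ≡ᶠ fld (hF false) 1F) ∧ᶠ (fld (wF true) 1F ≡ᶠ fld (wF false) 1F)) ∨ᶠ turnedF p) (hdr ∷ u ∷ []) →
      Copy p (Tile.shape (tileOf false u)) (Tile.shape (tileOf true u))
    to p    (inj₁ ((a , b) , (c , d))) = same p (≤-antisym b a) (≤-antisym d c)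
    to true (inj₂ ((a , b) , (c , d))) = turn (≤-antisym a b) (≤-antisym c d)
    both-≤ : ∀ {x y : ℕ} → x ≡ y → x ≤ y × y ≤ x
    both-≤ eq = ≤-reflexive eq , ≤-reflexive (sym eq)
    from : ∀ p → Copy p (Tile.shape (tileOf false u)) (Tile.shape (tileOf true u)) →
      True (((fld (hF true) 1F ≡ᶠ fld (hF false) 1F) ∧ᶠ (fld (wF true) 1F ≡ᶠ fld (wF false) 1F)) ∨ᶠ turnedF p) (hdr ∷ u ∷ [])
    from false eq = inj₁ (both-≤ (sym (cong Shape.height eq)) , both-≤ (sym (cong Shape.width eq)))
    from true  r  = [ (λ eq → inj₁ (both-≤ (sym (cong Shape.height eq)) , both-≤ (sym (cong Shape.width eq))))
                    , (λ (e , e′) → inj₂ (both-≤ e , both-≤ e′)) ]′ (rotated-copy r)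

  valid⇒certified : ∀ {x hdr ps} body → (∀ {z} → z ∈ records [] body → z ∈ ps) → Valid x hdr (records [] body) ps →
    Certified rotations (get nF hdr) (get mF hdr) (get cutF hdr) (map tiles (records [] body))
  valid⇒certified {x} {hdr} {ps} body rs⊆ps valid = record
    { n>0 = proj₁ header ; cut>0 = proj₁ (proj₂ header) ; cut<m = proj₂ (proj₂ header)
    ; given      = subst (IsTiling n m) (Listₚ.map-∘ rs) (tiling false)
    ; rearranged = subst (IsTiling n m) (Listₚ.map-∘ rs) (tiling true)
    ; copied     = Allₚ.map⁺ (All.map (λ {(u , _)} (_ , _ , copy , _) → Equivalence.to (copy-true rotations {hdr} {u}) copy) tile)
    ; beside     = Allₚ.map⁺ (All.map (λ (_ , _ , _ , beside) → beside) tile)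
    }
    where
    open Valid valid
    n m : ℕ
    n = get nF hdr
    m = get mF hdr
    rs : List (Word γ × Word γ)
    rs = records [] body
    place : Bool → Word γ × Word γ → Tile
    place p (u , _) = tileOf p u
    inside : ∀ p {u} → True tileF (hdr ∷ u ∷ []) → InRectangle n m (tileOf p u)
    inside false ((h>0 , w>0 , top , side) , _)     = record { height>0 = h>0 ; width>0 = w>0 ; top = top ; side = side }
    inside true  (_ , (h>0 , w>0 , top , side) , _) = record { height>0 = h>0 ; width>0 = w>0 ; top = top ; side = side }
    atOrigin : ∀ p {u} → True originF (u ∷ []) → topOf (tileOf p u) ≤ 0 × sideOf (tileOf p u) ≤ 0
    atOrigin false (t , s , _) = t , s
    atOrigin true  (_ , _ , t) = t
    Covered : Bool → Tile → Tile → Set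
    Covered p q q′ = n ≤ topOf q ⊎ m ≤ sideOf q′ ⊎ Any (Covers (topOf q) (sideOf q′)) (map (place p) rs)
    cornered : ∀ p {u v} → True (beyondF p) (hdr ∷ u ∷ v ∷ []) ⊎ Any (λ (t , _) → True (coversF p) (u ∷ v ∷ t ∷ [])) rs →
      Covered p (tileOf p u) (tileOf p v)
    cornered p (inj₁ (inj₁ le)) = inj₁ le
    cornered p (inj₁ (inj₂ le)) = inj₂ (inj₁ le)
    cornered p (inj₂ any)       = inj₂ (inj₂ (Anyₚ.map⁺ (Any.map (λ (a , b , c , d) → (a , b) , (c , d)) any)))
    corner : ∀ p {q q′} → ∃[ z ] z ∈ ps × q ≡ place p z → ∃[ z ] z ∈ ps × q′ ≡ place p z → Covered p q q′
    corner false (z , mz , refl) (z′ , mz′ , refl) = cornered false {proj₁ z} {proj₁ z′} (proj₁ (All.lookup (All.lookup covered mz) mz′))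
    corner true  (z , mz , refl) (z′ , mz′ , refl) = cornered true {proj₁ z} {proj₁ z′} (proj₂ (All.lookup (All.lookup covered mz) mz′))
    among : ∀ p {t} → ∃[ z ] z ∈ rs × t ≡ place p z → t ∈ map (place p) ps
    among p (_ , mz , refl) = ∈ₚ.∈-map⁺ (place p) (rs⊆ps mz)
    separate : ∀ p {u v} → True (apartF false ∧ᶠ apartF true) (u ∷ v ∷ []) → Disjoint (tileOf p u) (tileOf p v)
    separate false (a , _) = apart⇒disjoint a
    separate true  (_ , a) = apart⇒disjoint a
    tiling : ∀ p → IsTiling n m (map (place p) rs)
    tiling p = record
      { inside   = Allₚ.map⁺ (All.map (λ {z} → inside p {proj₁ z}) tile)
      ; covering = corner-covering (λ mt → among p (∈ₚ.∈-map⁻ (place p) mt)) (Anyₚ.map⁺ (Any.map (λ {z} → atOrigin p {proj₁ z}) origin))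
          (λ mq mq′ → corner p (∈ₚ.∈-map⁻ (place p) mq) (∈ₚ.∈-map⁻ (place p) mq′))
      ; disjoint = AllPairsₚ.map⁺ (AllPairs.map (λ {a} {b} → separate p {proj₁ a} {proj₁ b})
          (records-AllPairs {λ u v → True (apartF false ∧ᶠ apartF true) (u ∷ v ∷ [])} [] body apart))
      }

  certified⇒valid : ∀ {x hdr w} body → Certified rotations (get nF hdr) (get mF hdr) (get cutF hdr) (map tiles (records [] body)) →
    (∀ p → tileOf p hdr ≡ (0 by 0) at 0 , 0) → encTilesOf [] (records [] body) ≡ map digit x →
    Valid x hdr (records [] body) ((hdr , w) ∷ records [] body)
  certified⇒valid {x} {hdr} {w} body cert zeros input = record
    { header  = n>0 , cut>0 , cut<m
    ; origin  = here (≤-reflexive (cong topOf (zeros false)) , ≤-reflexive (cong sideOf (zeros false)) ,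
        ≤-reflexive (cong topOf (zeros true)) , ≤-reflexive (cong sideOf (zeros true)))
    ; tile    = All.zipWith (λ {(u , _)} ((i , i′) , (copy , bes)) →
        bounds i , bounds i′ , Equivalence.from (copy-true rotations {hdr} {u}) copy , bes)
        (All.zipWith id (inside false , inside true) , All.zipWith id (Allₚ.map⁻ copied , Allₚ.map⁻ beside))
    ; apart   = records-All {λ u v → True (apartF false ∧ᶠ apartF true) (u ∷ v ∷ [])} [] body (AllPairs.zipWith id (apart false , apart true))
    ; covered = All.universal (λ (u , _) → All.universal (λ (v , _) → covered false u v , covered true u v) _) _
    ; input   = input
    }
    where
    open Certified cert
    n m : ℕ
    n = get nF hdr
    m = get mF hdr
    rs : List (Word γ × Word γ)
    rs = records [] body
    bounds : ∀ {t} → InRectangle n m t → 0 < Tile.height t × 0 < Tile.width t × topOf t ≤ n × sideOf t ≤ m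
    bounds i = InRectangle.height>0 i , InRectangle.width>0 i , InRectangle.top i , InRectangle.side i
    place : Bool → Word γ × Word γ → Tile
    place p (u , _) = tileOf p u
    tiling : ∀ p → IsTiling n m (map (place p) rs)
    tiling false = subst (IsTiling n m) (sym (Listₚ.map-∘ rs)) given
    tiling true  = subst (IsTiling n m) (sym (Listₚ.map-∘ rs)) rearranged
    inside : ∀ p → All (λ (u , _) → InRectangle n m (tileOf p u)) rs
    inside p = Allₚ.map⁻ (IsTiling.inside (tiling p))
    apart : ∀ p → AllPairs (λ (u , _) (v , _) → Apart (tileOf p u) (tileOf p v)) rs
    apart p = AllPairsₚ.map⁻ (allPairs-apart (IsTiling.inside (tiling p)) (IsTiling.disjoint (tiling p)))
    covered : ∀ p u v → True (beyondF p) (hdr ∷ u ∷ v ∷ []) ⊎ Any (λ (t , _) → True (coversF p) (u ∷ v ∷ t ∷ [])) rs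
    covered p u v = decide (n ≤? topOf (tileOf p u)) (m ≤? sideOf (tileOf p v))
      where
      decide : Dec (n ≤ topOf (tileOf p u)) → Dec (m ≤ sideOf (tileOf p v)) →
        True (beyondF p) (hdr ∷ u ∷ v ∷ []) ⊎ Any (λ (t , _) → True (coversF p) (u ∷ v ∷ t ∷ [])) rs
      decide (yes le) _        = inj₁ (inj₁ le)
      decide (no _)   (yes le) = inj₁ (inj₂ le)
      decide (no gt)  (no gt′) = inj₂ (Any.map (λ ((a , b) , (c , d)) → a , b , c , d)
        (Anyₚ.map⁻ (IsTiling.covering (tiling p) _ _ (≰⇒> gt) (≰⇒> gt′))))

  encTilesOf-tiles : ∀ o rs → encTilesOf o rs ≡ encTiles (reverse (map proj₁ (map tiles rs))) ++ o
  encTilesOf-tiles o []             = refl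
  encTilesOf-tiles o ((u , w) ∷ rs) = trans (encTilesOf-tiles (encTile (tileOf false u) ++ o) rs) (trans
    (sym (Listₚ.++-assoc (encTiles (reverse (map proj₁ (map tiles rs)))) _ o))
    (cong (_++ o) (sym (trans (cong encTiles (Listₚ.unfold-reverse (tileOf false u) (map proj₁ (map tiles rs))))
      (trans (Listₚ.concatMap-++ encTile (reverse (map proj₁ (map tiles rs))) _)
        (cong (encTiles (reverse (map proj₁ (map tiles rs))) ++_) (Listₚ.++-identityʳ _)))))))

  embed : Fin certificateLetters → Letter
  embed s = suc (3 ↑ʳ s)

  firstBit : List Bit → Bit
  firstBit []      = 0b
  firstBit (d ∷ _) = d

  otherBits : List Bit → List Bit
  otherBits []       = []
  otherBits (_ ∷ ds) = ds

  -- Transposition: the rows are the numbers, the columns become letters.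
  tupled : ℕ → (Fin k → List Bit) → Word certificateLetters
  tupled zero    b = []
  tupled (suc ℓ) b = suc (Fin.funToFin (λ i → firstBit (b i))) ∷ tupled ℓ (λ i → otherBits (b i))

  tupled-bits : ∀ ℓ b i → length (b i) ≡ ℓ → map (bitAt i) (map embed (tupled ℓ b)) ≡ b i
  tupled-bits zero    b i eq = sym (empty (b i) eq)
    where
    empty : ∀ (ds : List Bit) → length ds ≡ 0 → ds ≡ []
    empty [] _ = refl
  tupled-bits (suc ℓ) b i eq = trans (cong₂ _∷_ (bitAt-tuple i (λ i → firstBit (b i)))
      (tupled-bits ℓ (λ i → otherBits (b i)) i (length-other (b i) eq))) (uncons (b i) eq)
    where
    length-other : ∀ ds → length ds ≡ suc ℓ → length (otherBits ds) ≡ ℓ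
    length-other (_ ∷ _) eq = suc-injective eq
    uncons : ∀ ds → length ds ≡ suc ℓ → firstBit ds ∷ otherBits ds ≡ ds
    uncons (_ ∷ _) _ = refl

  tupled-letters : ∀ ℓ b → All (_≢ separator) (map embed (tupled ℓ b))
  tupled-letters zero    b = []
  tupled-letters (suc ℓ) b = (λ ()) ∷ tupled-letters ℓ (λ i → otherBits (b i))

  length-tupled : ∀ ℓ b → length (tupled ℓ b) ≡ ℓ
  length-tupled zero    b = refl
  length-tupled (suc ℓ) b = cong suc (length-tupled ℓ _)

  module _ (ℓ : ℕ) where

    entry : (Field → ℕ) → Word certificateLetters
    entry φ = tupled ℓ (λ i → bits ℓ (φ (fieldAt i)))

    get-entry : ∀ φ f → φ f < 2 ^ ℓ → get f (map embed (entry φ)) ≡ φ f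
    get-entry φ f lt = trans (cong val (tupled-bits ℓ (λ i → bits ℓ (φ (fieldAt i))) (index f) (length-bits ℓ (φ (fieldAt (index f))))))
      (trans (cong (λ g → val (bits ℓ (φ g))) (fieldAt-index f)) (val-bits ℓ (φ f) lt))

    -- Reversed in advance, because reading a record reverses it.
    block : (Field → ℕ) → Word certificateLetters
    block φ = reverse (entry φ) ++ 0F ∷ []

    certificate : List (Field → ℕ) → Word certificateLetters
    certificate = concatMap block

    map-certificate : ∀ φ φs → map embed (certificate (φ ∷ φs)) ≡ map embed (reverse (entry φ)) ++ separator ∷ map embed (certificate φs)
    map-certificate φ φs = trans (cong (map embed) (Listₚ.++-assoc (reverse (entry φ)) _ (certificate φs)))
      (Listₚ.map-++ embed (reverse (entry φ)) _)

    block-letters : ∀ φ → All (_≢ separator) (map embed (reverse (entry φ)))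
    block-letters φ = Permₚ.All-resp-↭ (Permₚ.map⁺ embed (Perm.↭-sym (Permₚ.↭-reverse (entry φ)))) (tupled-letters ℓ _)

    reverse-block : ∀ φ → reverse (map embed (reverse (entry φ))) ≡ map embed (entry φ)
    reverse-block φ = trans (cong reverse (Listₚ.reverse-map embed (entry φ))) (Listₚ.reverse-involutive _)

    records-certificate : ∀ φ φs → records [] (map embed (certificate (φ ∷ φs))) ≡
      (map embed (entry φ) , map embed (certificate φs)) ∷ records [] (map embed (certificate φs))
    records-certificate φ φs = trans (cong (records []) (map-certificate φ φs)) (trans (records-++ [] (block-letters φ))
      (cong (λ u → (u , map embed (certificate φs)) ∷ records [] (map embed (certificate φs))) (reverse-block φ)))

    tiles-certificate : ∀ φs → map tiles (records [] (map embed (certificate φs))) ≡ map (λ φ → tiles (map embed (entry φ) , [])) φs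
    tiles-certificate []       = refl
    tiles-certificate (φ ∷ φs) = trans (cong (map tiles) (records-certificate φ φs)) (cong (tiles (map embed (entry φ) , []) ∷_) (tiles-certificate φs))

    length-certificate : ∀ φs → length (certificate φs) ≡ length φs * suc ℓ
    length-certificate []       = refl
    length-certificate (φ ∷ φs) = trans (Listₚ.length-++ (block φ)) (cong₂ _+_
      (trans (Listₚ.length-++ (reverse (entry φ))) (trans (+-comm _ 1) (cong suc (trans (Listₚ.length-reverse (entry φ)) (length-tupled ℓ _)))))
      (length-certificate φs))

  headerFields : ℕ → ℕ → ℕ → Field → ℕ
  headerFields n m cut nF   = n
  headerFields n m cut mF   = m
  headerFields n m cut cutF = cut
  headerFields n m cut _    = 0

  tileFields : Tile × Tile → Field → ℕ
  tileFields (t , s) (hF p) = Tile.height (if p then s else t)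
  tileFields (t , s) (wF p) = Tile.width (if p then s else t)
  tileFields (t , s) (rF p) = Tile.row (if p then s else t)
  tileFields (t , s) (cF p) = Tile.col (if p then s else t)
  tileFields (t , s) _      = 0

  lettersOf : Word 3 → Word γ
  lettersOf = map (λ s → suc (s ↑ˡ certificateLetters))

  digits-input : ∀ x → map digit (lettersOf x) ≡ inject 3≤γ x
  digits-input x = trans (sym (Listₚ.map-∘ x)) (Listₚ.map-cong letter x)
    where
    letter : ∀ (s : Fin 3) → digit (suc (s ↑ˡ certificateLetters)) ≡ inject≤ s 3≤γ
    letter 0F = refl
    letter 1F = refl
    letter 2F = refl

  open Realise verifier using (Accepts; toP)

  accepts : ∀ x y → Accepts ≤-refl (pair x y) ⇔
    Valid (lettersOf x) (reverse (before separator (map embed y))) (records [] (after separator (map embed y))) (records [] (map embed y))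
  accepts x y = mk⇔ (λ (c , w , eq) → Equivalence.to decided (subst Yes (sym eq) tt)) (λ v → nonempty _ (Equivalence.from decided v))
    where
    inject-refl : inject ≤-refl (pair x y) ≡ pair x y
    inject-refl = trans (Listₚ.map-cong (λ s → Finₚ.inject≤-refl s ≤-refl) (pair x y)) (Listₚ.map-id (pair x y))
    Claim : Set
    Claim = Valid (lettersOf x) (reverse (before separator (map embed y))) (records [] (after separator (map embed y))) (records [] (map embed y))
    decided : Yes (⟦ verifier ⟧ (inject ≤-refl (pair x y) ∷ []) []) ⇔ Claim
    decided = subst (λ z → Yes (⟦ verifier ⟧ (z ∷ []) []) ⇔ Claim) (sym inject-refl)
      (decides-verifier (lettersOf x) (map embed y) (Allₚ.map⁺ (All.universal (λ _ ()) x)))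
    nonempty : ∀ w → Yes w → ∃[ c ] ∃[ v ] w ≡ c ∷ v
    nonempty (c ∷ v) _ = c , v , refl

  soundness : ∀ x y → Accepts ≤-refl (pair x y) → Problem (Admits rotations) x
  soundness x y acc = map proj₁ (reverse zs) , n , m , encoded , n>0 , <-trans cut>0 cut<m , given , certified⇒admits rotations cert
    where
    body hdr : Word γ
    body = after separator (map embed y)
    hdr  = reverse (before separator (map embed y))
    zs : List (Tile × Tile)
    zs = map tiles (records [] body)
    n m : ℕ
    n = get nF hdr
    m = get mF hdr
    valid : Valid (lettersOf x) hdr (records [] body) (records [] (map embed y))
    valid = Equivalence.to (accepts x y) acc
    cert : Certified rotations n m (get cutF hdr) (reverse zs)
    cert = certified-↭ (Perm.↭-sym (Permₚ.↭-reverse zs)) (valid⇒certified body (records-first [] (map embed y)) valid)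
    open Certified cert
    encoded : x ≡ encode (map proj₁ (reverse zs))
    encoded = Listₚ.map-injective (Finₚ.inject≤-injective 3≤γ 3≤γ _ _) (trans (sym (digits-input x)) (trans (sym (Valid.input valid))
      (trans (encTilesOf-tiles [] (records [] body)) (trans (Listₚ.++-identityʳ _)
        (trans (cong encTiles (sym (Listₚ.reverse-map proj₁ zs))) (sym (inject-encode (map proj₁ (reverse zs)))))))))

  -- With z the length of the input, the bound is (z + 1)(z + 2): a header and at most z tiles, each
  -- taking z + 1 letters and a separator.
  completeness : ∀ x → Problem (Admits rotations) x → ∃[ y ] length y ≤ eval (2 ∷ 3 ∷ 1 ∷ []) (length x) × Accepts ≤-refl (pair x y)
  completeness x (ts , n , m , refl , n>0′ , m>0 , tiling , adm) =
    let (cut , zs , eq , cert) = admits⇒certified rotations n>0′ tiling adm in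
    certify zs eq (certified-↭ (Perm.↭-sym (Permₚ.↭-reverse zs)) cert)
    where
    ℓ : ℕ
    ℓ = suc (length x)
    n< : n < 2 ^ ℓ
    n< = proj₁ (tiling-bound n>0′ m>0 tiling)
    m< : m < 2 ^ ℓ
    m< = proj₂ (tiling-bound n>0′ m>0 tiling)
    certify : ∀ {cut} zs → map proj₁ zs ≡ ts → Certified rotations n m cut (reverse zs) →
      ∃[ y ] length y ≤ eval (2 ∷ 3 ∷ 1 ∷ []) (length x) × Accepts ≤-refl (pair x y)
    certify {cut} zs eq cert = y , length-y , Equivalence.from (accepts x y) valid
      where
      open Certified cert
      φ₀ : Field → ℕ
      φ₀ = headerFields n m cut
      φs : List (Field → ℕ)
      φs = map tileFields (reverse zs)
      y : Word certificateLetters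
      y = certificate ℓ (φ₀ ∷ φs)
      hdr body : Word γ
      hdr  = map embed (entry ℓ φ₀)
      body = map embed (certificate ℓ φs)
      pos : 0 < 2 ^ ℓ
      pos = m^n>0 2 ℓ
      length-y : length y ≤ eval (2 ∷ 3 ∷ 1 ∷ []) (length x)
      length-y = ≤-trans (≤-reflexive (trans (length-certificate ℓ (φ₀ ∷ φs)) (cong (λ z → suc z * suc ℓ) length-φs)))
        (≤-trans (*-monoˡ-≤ (suc ℓ) (s≤s (length-concatMap encodeTile nonempty ts))) (≤-reflexive (lem (length x))))
        where
        length-φs : length φs ≡ length ts
        length-φs = trans (Listₚ.length-map tileFields (reverse zs)) (trans (Listₚ.length-reverse zs)
          (trans (sym (Listₚ.length-map proj₁ zs)) (cong length eq)))
        nonempty : ∀ t → 0 < length (encodeTile t)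
        nonempty t = ≤-trans (≤-trans (m≤n+m 1 _) (≤-reflexive (sym (Listₚ.length-++ (map inject₁ (binary (Tile.height t)))))))
          (∈-concatMap-length encodeNumber {xs = Tile.height t ∷ Tile.width t ∷ Tile.row t ∷ Tile.col t ∷ []} (here refl))
        lem : ∀ z → suc z * suc (suc z) ≡ 2 + z * (3 + z * (1 + z * 0))
        lem = solve-∀
      zeros : ∀ p → tileOf p hdr ≡ (0 by 0) at 0 , 0
      zeros p = tile≡ (get-entry ℓ φ₀ (hF p) pos) (get-entry ℓ φ₀ (wF p) pos) (get-entry ℓ φ₀ (rF p) pos) (get-entry ℓ φ₀ (cF p) pos)
        where
        tile≡ : ∀ {h w r c} → h ≡ 0 → w ≡ 0 → r ≡ 0 → c ≡ 0 → (h by w) at r , c ≡ (0 by 0) at 0 , 0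
        tile≡ refl refl refl refl = refl
      tile≡ : ∀ {h w r c} {t : Tile} → h ≡ Tile.height t → w ≡ Tile.width t → r ≡ Tile.row t → c ≡ Tile.col t → (h by w) at r , c ≡ t
      tile≡ refl refl refl refl = refl
      recovered : ∀ p z → InRectangle n m (if p then proj₂ z else proj₁ z) →
        tileOf p (map embed (entry ℓ (tileFields z))) ≡ (if p then proj₂ z else proj₁ z)
      recovered p z i = tile≡
        (get-entry ℓ (tileFields z) (hF p) (≤-<-trans (≤-trans (m≤n+m _ _) (InRectangle.top i)) n<))
        (get-entry ℓ (tileFields z) (wF p) (≤-<-trans (≤-trans (m≤n+m _ _) (InRectangle.side i)) m<))
        (get-entry ℓ (tileFields z) (rF p) (≤-<-trans (≤-trans (m≤m+n _ _) (InRectangle.top i)) n<))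
        (get-entry ℓ (tileFields z) (cF p) (≤-<-trans (≤-trans (m≤m+n _ _) (InRectangle.side i)) m<))
      zs≡ : map tiles (records [] body) ≡ reverse zs
      zs≡ = trans (tiles-certificate ℓ φs) (trans (sym (Listₚ.map-∘ (reverse zs)))
        (same (reverse zs) (Allₚ.map⁻ (IsTiling.inside given)) (Allₚ.map⁻ (IsTiling.inside rearranged))))
        where
        same : ∀ zs → All (λ z → InRectangle n m (proj₁ z)) zs → All (λ z → InRectangle n m (proj₂ z)) zs →
          map (λ z → tiles (map embed (entry ℓ (tileFields z)) , [])) zs ≡ zs
        same []       []       []         = refl
        same (z ∷ zs) (i ∷ is) (i′ ∷ is′) = cong₂ _∷_ (cong₂ _,_ (recovered false z i) (recovered true z i′)) (same zs is is′)
      input : encTilesOf [] (records [] body) ≡ map digit (lettersOf x)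
      input = trans (encTilesOf-tiles [] (records [] body)) (trans (Listₚ.++-identityʳ _) (trans
        (cong encTiles (trans (cong (λ zs → reverse (map proj₁ zs)) zs≡) (trans (cong reverse (Listₚ.reverse-map proj₁ zs))
          (trans (Listₚ.reverse-involutive _) eq)))) (trans (sym (inject-encode ts)) (sym (digits-input x)))))
      cert′ : Certified rotations (get nF hdr) (get mF hdr) (get cutF hdr) (map tiles (records [] body))
      cert′ = transport (sym (get-entry ℓ φ₀ nF n<)) (sym (get-entry ℓ φ₀ mF m<))
          (sym (get-entry ℓ φ₀ cutF (<-trans cut<m m<))) (sym zs≡) cert
        where
        transport : ∀ {n n′ m m′ c c′ zs zs′} → n ≡ n′ → m ≡ m′ → c ≡ c′ → zs ≡ zs′ → Certified rotations n m c zs → Certified rotations n′ m′ c′ zs′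
        transport refl refl refl refl cert = cert
      valid : Valid (lettersOf x) (reverse (before separator (map embed y))) (records [] (after separator (map embed y))) (records [] (map embed y))
      valid = transport
          (sym (trans (cong (λ z → reverse (before separator z)) (map-certificate ℓ φ₀ φs)) (trans (cong reverse (before-++ separator (block-letters ℓ φ₀))) (reverse-block ℓ φ₀))))
          (sym (trans (cong (after separator) (map-certificate ℓ φ₀ φs)) (after-++ separator (block-letters ℓ φ₀))))
          (sym (records-certificate ℓ φ₀ φs)) (certified⇒valid body cert′ zeros input)
        where
        transport : ∀ {h h′ r r′ ps ps′} → h ≡ h′ → r ≡ r′ → ps ≡ ps′ → Valid (lettersOf x) h (records [] r) ps → Valid (lettersOf x) h′ (records [] r′) ps′
        transport refl refl refl v = v

  membership : NP (Problem (Admits rotations))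
  membership = certificateLetters , Accepts ≤-refl , toP ≤-refl , 2 ∷ 3 ∷ 1 ∷ [] ,
    λ x → mk⇔ (completeness x) (λ (y , _ , acc) → soundness x y acc)

module Verification (rotations : Bool) =
  Membership rotations (length (elems enum-Field)) (Enum.code enum-Field) (Enum.decode enum-Field) (Enum.decode-code enum-Field)

theorem2p6 : NPComplete TRANS-ST × NPComplete GEN-ST
theorem2p6 = (Verification.membership false , NPHard-TRANS) , (Verification.membership true , NPHard-GEN)
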